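{- Let $p$ be a prime and let $\mathscr{L}$ be a finite set of primes. Let \[ \mathscr{B}_{\mathscr{L}}=\Big\{\prod_{\ell\in\mathscr{P}}\ell \;:\; \emptyset\neq\mathscr{P}\subseteq\mathscr{L},\ \mathscr{P}=\mathscr{L}\cap[\min\mathscr{P},\max\mathscr{P}]\Big\}, \] the set of products of nonempty sets of consecutive elements of $\mathscr{L}$, and let \[ f_{\mathscr{L}}=\prod_{b\in\mathscr{B}_{\mathscr{L}}}(X^p-b)\in\mathbb{Z}[X]. \] Then $f_{\mathscr{L}}$ is exceptional if and only if $|\mathscr{L}|\geq p$.
   Context: A monic polynomial $f\in\mathbb{Z}[X]$ is called exceptional if $f$ has no root in $\mathbb{Z}$ and, for all but at most finitely many primes $p$, the reduction $f \bmod p\in\mathbb{F}_p[X]$ has a root in $\mathbb{F}_p$. -}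

module Defs where

open import Data.Nat as ℕ using (ℕ; zero; suc; _≤_; _≤?_; _∸_)
open import Data.Integer as ℤ using (ℤ; +_)
open import Data.Integer.Divisibility using () renaming (_∣_ to _∣ℤ_)
open import Data.Nat.Primality using (Prime)
open import Data.List using (List; []; _∷_; _++_; replicate; map; concatMap; filter; deduplicate; foldr; [_])
open import Data.Nat.ListAction using (product)
open import Data.Bool using (if_then_else_)
open import Data.Product using (Σ; ∃; _×_; _,_)
open import Relation.Nullary using (¬_; ⌊_⌋)
open import Relation.Nullary.Decidable using (_×-dec_)
open import Relation.Binary.PropositionalEquality using (_≡_)

-- Polynomials in ℤ[X] as coefficient lists, lowest degree first.
Poly : Set
Poly = List ℤ

_+P_ : Poly → Poly → Poly
[] +P g = g
(a ∷ f) +P [] = a ∷ f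
(a ∷ f) +P (b ∷ g) = (a ℤ.+ b) ∷ (f +P g)

_*P_ : Poly → Poly → Poly
[] *P g = []
(a ∷ f) *P g = map (a ℤ.*_) g +P (+ 0 ∷ (f *P g))

oneP : Poly
oneP = + 1 ∷ []

eval : Poly → ℤ → ℤ
eval f x = foldr (λ a acc → a ℤ.+ x ℤ.* acc) (+ 0) f

Monic : Poly → Set
Monic f = Σ Poly λ g → Σ ℕ λ k → f ≡ g ++ (+ 1 ∷ replicate k (+ 0))

HasIntegerRoot : Poly → Set
HasIntegerRoot f = ∃ λ (x : ℤ) → eval f x ≡ + 0

HasRootMod : ℕ → Poly → Set
HasRootMod q f = ∃ λ (x : ℤ) → (+ q) ∣ℤ eval f x

Exceptional : Poly → Set
Exceptional f = Monic f × (¬ HasIntegerRoot f) ×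
  (∃ λ (N : ℕ) → ∀ (q : ℕ) → Prime q → N ≤ q → HasRootMod q f)

-- X^p - b  (for p ≥ 1)
XpMinus : ℕ → ℕ → Poly
XpMinus p b = ℤ.- (+ b) ∷ (replicate (p ∸ 1) (+ 0) ++ [ + 1 ])

segment : List ℕ → ℕ → ℕ → List ℕ
segment L a b = filter (λ x → (a ≤? x) ×-dec (x ≤? b)) L

-- B_L: products of the sets L ∩ [a,b] with a , b ∈ L, a ≤ b
-- (exactly the nonempty P ⊆ L with P = L ∩ [min P , max P]), as a set (duplicates removed)
B : List ℕ → List ℕ
B L = deduplicate ℕ._≟_
  (concatMap (λ a → concatMap (λ b →
     if ⌊ a ≤? b ⌋ then [ product (segment L a b) ] else []) L) L)

fL : ℕ → List ℕ → Poly
fL p L = foldr (λ b acc → XpMinus p b *P acc) oneP (B L)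

{-# OPTIONS --safe #-}
-- Suppose |L| ≥ p, and let q be a large prime.  Modulo q the p-th powers have index at most p in the units, so two of the
-- p + 1 products of initial segments of L agree up to p-th powers.  Their quotient is a product of consecutive elements
-- of L and a p-th power modulo q.
--
-- Suppose |L| < p, and let L = {l₁, …, l_n}, cᵢ = lᵢ l₁^(p-1) and b_a = l₁ ∏ cᵢ^aᵢ for a in the box [0,p)^(n-1).  If all
-- cᵢ are p-th powers modulo a large q, all elements of L lie in one class, and a root of f modulo q makes l₁^k a p-th
-- power for some 0 < k < p, hence l₁ too.  Therefore the numbers r_a(q) of roots of Xᵖ - b_a modulo q satisfy
-- Σ r_a(q) ≥ p^(n-1), with strict inequality when q splits completely in ℚ(ζ_p, cᵢ^(1/p)).  Every b_a has some prime to
-- a power prime to p, so Xᵖ - b_a can be replaced by an Eisenstein polynomial; counting short elements of its order by a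
-- pigeonhole argument shows that the Euler product of r_a is at most of the order of ζ near 1.  Comparing the product of
-- these with a power of ζ, Σ 1/q converges over the completely split q.  But in the order generated by ζ_p and the
-- cᵢ^(1/p) a prime ideal over any other q has index at least q², so Σ 1/(index) converges over all large q.  Now
-- sieve the d-parameter family of elements 1 + z! (T + w a), a in [0,Y)^d.  Few of them are units, because quotients of
-- two members are short, and each of the others lies in a prime ideal over some q > z of index O(Y^d); an ideal of index
-- N accounts for O(Y^d / N) members, which is too few in total.  This contradiction replaces Chebotarev's theorem.
module Submission where

open import Data.Empty using (⊥)
open import Data.Fin as Fin using (Fin; zero; suc)
import Data.Fin.Properties as Fin
open import Data.Integer as ℤ using (ℤ; 0ℤ; 1ℤ)
import Data.Integer.DivMod as ℤ
open import Data.Integer.Divisibility.Signed using (divides; ∣⇒∣ᵤ; ∣ᵤ⇒∣)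
import Data.Integer.Properties as ℤ
open import Data.List as List using (List; []; _∷_; length; upTo; filter)
open import Data.List.Membership.Propositional using (_∈_)
open import Data.List.Membership.Propositional.Properties
open import Data.List.Relation.Unary.Any as Any using (here; there)
open import Data.List.Relation.Unary.Unique.Propositional using (Unique)
import Data.List.Relation.Unary.Unique.Propositional.Properties as Unique
open import Data.Nat as ℕ using (ℕ; zero; suc; z≤n; s≤s; NonZero)
import Data.Nat.DivMod as ℕ
import Data.Nat.Divisibility as ℕ
open import Data.Nat.Primality using (Prime; prime?; prime⇒nonZero)
import Data.Nat.Properties as ℕ
open import Data.Nat.Tactic.RingSolver using () renaming (solve-∀ to ℕ-solve-∀)
open import Data.Product using (Σ; ∃; ∃₂; _×_; _,_; proj₁; proj₂)
open import Data.Sum as Sum using (_⊎_; inj₁; inj₂)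
open import Data.Vec as Vec using (Vec; []; _∷_)
import Data.Vec.Properties as Vec
open import Function using (_∘_; id)
open import Function.Bundles using (mk⇔)
open import Relation.Nullary using (¬_; Dec; yes; no; contradiction)
open import Relation.Nullary.Decidable using (decidable-stable; _×-dec_; ¬?)

-- The cᵢ are the quotients lᵢ / l₁ up to p-th powers, so the b_a run through l₁ ∏ (lᵢ / l₁)^aᵢ.
-- Each Xᵖ - b_a is irreducible and has one root modulo q on average, so Σ r_a(q) averages p^(n-1),
-- and an excess on the completely split q contradicts their positive density. Both halves must be
-- had without Dedekind zeta functions or rings of integers. For the first, an upper bound for each
-- Euler product is enough, because Σ r_a(q) ≥ p^(n-1) holds for every large q. The second needs
-- only the divergence of Σ 1/(index), which the sieve gives for every order that is a domain. Real
-- exponents are avoided: with `λ₂` the integral binary logarithm and ρ = 1 - 1/N, the weight ρ^(λ₂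
-- q) / q stands for q^(-s) and N for 1/(s - 1). Neither the degree nor a basis of ℚ(ζ_p, cᵢ^(1/p))
-- is computed. Its order is a polynomial ring modulo the annihilator of a sequence. That this has a
-- domain as quotient is obtained only up to double negation, and so are the alternative between
-- units and nonunits and the small tails of bounded series. This is harmless, as the goal is a
-- contradiction.

module Counting where

  -- Pigeonhole principles and boxes of natural vectors

  open import Data.Nat using (_+_; _*_; _^_; _≤_; _<_)
  open import Data.Nat.Properties
  open import Data.List using (_++_; map; cartesianProductWith)
  open import Data.List.Properties using (length-map; length-++; length-upTo)
  open import Data.List.Relation.Unary.All as All using (All; []; _∷_)
  import Data.List.Relation.Unary.All.Properties as All
  open import Data.List.Relation.Unary.AllPairs using ([]; _∷_)
  open import Data.Vec using (lookup; replicate)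
  open import Data.Vec.Properties using (lookup-replicate)
  open import Relation.Binary.Definitions using (DecidableEquality)
  open import Relation.Binary.PropositionalEquality using (_≡_; _≢_; refl; sym; trans; cong; cong₂; subst)

  private variable
    A B : Set

  unique⊆⇒length≤ : {xs ys : List A} → Unique xs → (∀ {x} → x ∈ xs → x ∈ ys) → length xs ≤ length ys
  unique⊆⇒length≤ {xs = []} _ _ = z≤n
  unique⊆⇒length≤ {xs = x ∷ xs} (x∉ ∷ u) sub with ∈-∃++ (sub (here refl))
  ... | as , bs , refl = ≤-trans (s≤s (unique⊆⇒length≤ u sub′))
          (≤-reflexive (sym (trans (length-++ as) (trans (+-suc _ _) (cong suc (sym (length-++ as)))))))
    where
    sub′ : ∀ {y} → y ∈ xs → y ∈ as ++ bs
    sub′ y∈ with ∈-++⁻ as (sub (there y∈))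
    ... | inj₁ p = ∈-++⁺ˡ p
    ... | inj₂ (here refl) = contradiction refl (All.lookup x∉ y∈)
    ... | inj₂ (there p) = ∈-++⁺ʳ as p

  unique-map : (f : A → B) {xs : List A} → Unique xs →
               (∀ {x y} → x ∈ xs → y ∈ xs → f x ≡ f y → x ≡ y) → Unique (map f xs)
  unique-map f {[]} [] inj = []
  unique-map f {x ∷ xs} (x∉ ∷ u) inj =
    All.map⁺ (All.tabulate λ y∈ e → All.lookup x∉ y∈ (inj (here refl) (there y∈) e)) ∷
    unique-map f u (λ a b → inj (there a) (there b))

  injection⇒length≤ : (f : A → B) {xs : List A} {ys : List B} → Unique xs →
    (∀ {x y} → x ∈ xs → y ∈ xs → f x ≡ f y → x ≡ y) → (∀ {x} → x ∈ xs → f x ∈ ys) →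
    length xs ≤ length ys
  injection⇒length≤ f {xs} u inj mem = subst (_≤ _) (length-map f xs)
    (unique⊆⇒length≤ (unique-map f u inj) λ m → let (x , x∈ , e) = ∈-map⁻ f m in subst (_∈ _) (sym e) (mem x∈))

  private
    injective-or-collision : DecidableEquality B → (f : A → B) (xs : List A) → Unique xs →
      Unique (map f xs) ⊎ ∃₂ λ x y → x ∈ xs × y ∈ xs × x ≢ y × f x ≡ f y
    injective-or-collision _≟_ f [] _ = inj₁ []
    injective-or-collision _≟_ f (x ∷ xs) (x∉ ∷ u) with injective-or-collision _≟_ f xs u
    ... | inj₂ (a , b , a∈ , b∈ , rest) = inj₂ (a , b , there a∈ , there b∈ , rest)
    ... | inj₁ v with All.all? (λ y → ¬? (f x ≟ y)) (map f xs)
    ...   | yes ok = inj₁ (ok ∷ v)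
    ...   | no bad = let (y , y∈ , e) = find xs bad in
                     inj₂ (x , y , here refl , there y∈ , All.lookup x∉ y∈ , e)
      where
      find : ∀ zs → ¬ All (λ y → f x ≢ y) (map f zs) → ∃ λ y → y ∈ zs × f x ≡ f y
      find [] n = contradiction [] n
      find (z ∷ zs) n with f x ≟ f z
      ... | yes e = z , here refl , e
      ... | no ne = let (y , y∈ , e) = find zs (λ a → n (ne ∷ a)) in y , there y∈ , e

  collision : DecidableEquality B → (f : A → B) {xs : List A} {ys : List B} → Unique xs →
    (∀ {x} → x ∈ xs → f x ∈ ys) → length ys < length xs →
    ∃₂ λ x y → x ∈ xs × y ∈ xs × x ≢ y × f x ≡ f y
  collision _≟_ f {xs} u mem lt with injective-or-collision _≟_ f xs u
  ... | inj₂ c = c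
  ... | inj₁ v = contradiction (subst (_≤ _) (length-map f xs)
          (unique⊆⇒length≤ v λ m → let (x , x∈ , e) = ∈-map⁻ f m in subst (_∈ _) (sym e) (mem x∈)))
          (<⇒≱ lt)

  module _ (P : A → Set) (P? : ∀ x → Dec (P x)) where
    length-filter-split : ∀ xs → length xs ≡ length (filter P? xs) + length (filter (λ x → ¬? (P? x)) xs)
    length-filter-split [] = refl
    length-filter-split (x ∷ xs) with P? x
    ... | yes _ = cong suc (length-filter-split xs)
    ... | no _ = trans (cong suc (length-filter-split xs)) (sym (+-suc _ _))

  filter-comm-length : {P Q : A → Set} (P? : ∀ x → Dec (P x)) (Q? : ∀ x → Dec (Q x)) →
    ∀ xs → length (filter P? (filter Q? xs)) ≤ length (filter P? xs)
  filter-comm-length P? Q? [] = z≤n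
  filter-comm-length P? Q? (x ∷ xs) with Q? x
  ... | no _ with P? x
  ...   | yes _ = m≤n⇒m≤1+n (filter-comm-length P? Q? xs)
  ...   | no _ = filter-comm-length P? Q? xs
  filter-comm-length P? Q? (x ∷ xs) | yes _ with P? x
  ... | yes _ = s≤s (filter-comm-length P? Q? xs)
  ... | no _ = filter-comm-length P? Q? xs

  -- Induction on the labels: deleting the fibre of one label removes at most k elements, and no
  -- other fibre grows.
  pigeonhole-fibres : (_≟_ : DecidableEquality B) (f : A → B) (k : ℕ) (xs : List A) (ys : List B) →
    (∀ {x} → x ∈ xs → f x ∈ ys) →
    (∀ y → length (filter (λ x → f x ≟ y) xs) ≤ k) → length xs ≤ k * length ys
  pigeonhole-fibres _≟_ f k [] [] mem fib = z≤n
  pigeonhole-fibres _≟_ f k (x ∷ xs) [] mem fib with mem (here refl)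
  ... | ()
  pigeonhole-fibres _≟_ f k xs (y ∷ ys) mem fib = begin
    length xs ≡⟨ length-filter-split _ (λ x → f x ≟ y) xs ⟩
    length (filter (λ x → f x ≟ y) xs) + length rest ≤⟨ +-mono-≤ (fib y)
       (pigeonhole-fibres _≟_ f k rest ys mem′ (λ z → ≤-trans (filter-comm-length _ _ xs) (fib z))) ⟩
    k + k * length ys ≡⟨ sym (*-suc k (length ys)) ⟩
    k * suc (length ys) ∎
    where
    open ≤-Reasoning
    rest = filter (λ x → ¬? (f x ≟ y)) xs
    mem′ : ∀ {x} → x ∈ rest → f x ∈ ys
    mem′ m with ∈-filter⁻ (λ x → ¬? (f x ≟ y)) m
    ... | x∈ , ne with mem x∈
    ...   | here e = contradiction e ne
    ...   | there p = p

  -- The sides may differ, because residues modulo several primes are labels in such a grid;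
  -- coefficient vectors use the cubes `box`.
  grid : ∀ {k} → Vec ℕ k → List (Vec ℕ k)
  grid [] = [] ∷ []
  grid (n ∷ ns) = cartesianProductWith _∷_ (upTo n) (grid ns)

  product : ∀ {k} → Vec ℕ k → ℕ
  product [] = 1
  product (n ∷ ns) = n * product ns

  private
    length-cartesianProductWith : {C : Set} (f : A → B → C) (xs : List A) (ys : List B) →
      length (cartesianProductWith f xs ys) ≡ length xs * length ys
    length-cartesianProductWith f [] ys = refl
    length-cartesianProductWith f (x ∷ xs) ys = trans (length-++ (map (f x) ys))
      (cong₂ _+_ (length-map (f x) ys) (length-cartesianProductWith f xs ys))

  length-grid : ∀ {k} (ns : Vec ℕ k) → length (grid ns) ≡ product ns
  length-grid [] = refl
  length-grid (n ∷ ns) = trans (length-cartesianProductWith _∷_ (upTo n) (grid ns))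
    (cong₂ _*_ (length-upTo n) (length-grid ns))

  product-replicate : ∀ k n → product (replicate k n) ≡ n ^ k
  product-replicate zero n = refl
  product-replicate (suc k) n = cong (n *_) (product-replicate k n)

  grid-unique : ∀ {k} (ns : Vec ℕ k) → Unique (grid ns)
  grid-unique [] = [] ∷ []
  grid-unique (n ∷ ns) = Unique.cartesianProductWith⁺ _∷_ (λ { refl → refl , refl }) (Unique.upTo⁺ n) (grid-unique ns)

  ∈-grid⁺ : ∀ {k} {ns v : Vec ℕ k} → (∀ i → lookup v i < lookup ns i) → v ∈ grid ns
  ∈-grid⁺ {ns = []} {[]} h = here refl
  ∈-grid⁺ {ns = n ∷ ns} {a ∷ v} h = ∈-cartesianProductWith⁺ _∷_ (∈-upTo⁺ (h zero)) (∈-grid⁺ {ns = ns} (λ i → h (suc i)))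

  ∈-grid⁻ : ∀ {k} {ns v : Vec ℕ k} → v ∈ grid ns → ∀ i → lookup v i < lookup ns i
  ∈-grid⁻ {ns = n ∷ ns} {v} m i with ∈-cartesianProductWith⁻ _∷_ (upTo n) (grid ns) m
  ∈-grid⁻ {ns = n ∷ ns} {_} m zero | a , v , a∈ , v∈ , refl = ∈-upTo⁻ a∈
  ∈-grid⁻ {ns = n ∷ ns} {_} m (suc i) | a , v , a∈ , v∈ , refl = ∈-grid⁻ {ns = ns} v∈ i

  box : (d n : ℕ) → List (Vec ℕ d)
  box d n = grid (replicate d n)

  length-box : ∀ d n → length (box d n) ≡ n ^ d
  length-box d n = trans (length-grid (replicate d n)) (product-replicate d n)

  ∈-box⁺ : ∀ {d n} {v : Vec ℕ d} → (∀ i → lookup v i < n) → v ∈ box d n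
  ∈-box⁺ {d} {n} h = ∈-grid⁺ {ns = replicate d n} λ i → subst (_ <_) (sym (lookup-replicate i n)) (h i)

  ∈-box⁻ : ∀ {d n} {v : Vec ℕ d} → v ∈ box d n → ∀ i → lookup v i < n
  ∈-box⁻ {d} {n} m i = subst (_ <_) (lookup-replicate i n) (∈-grid⁻ {ns = replicate d n} m i)

  ^-distribʳ-* : ∀ k m n → (m * n) ^ k ≡ m ^ k * n ^ k
  ^-distribʳ-* zero m n = refl
  ^-distribʳ-* (suc k) m n = trans (cong (m * n *_) (^-distribʳ-* k m n)) ([m*n]*[o*p]≡[m*o]*[n*p] m n (m ^ k) (n ^ k))

-- Nonnegative rationals, finite sums and products

module Q where

  import Data.Rational as ℚ
  import Data.Rational.Properties as ℚ
  open import Data.List using (_++_; map; concatMap)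
  open import Algebra using (CommutativeSemiring)
  import Algebra.Solver.Ring.NaturalCoefficients.Default as Solver
  open import Level using (0ℓ)
  open import Relation.Nullary using (recompute)
  open import Relation.Binary.PropositionalEquality hiding ([_])

  private variable
    A B : Set

  -- On nonnegative rationals multiplication is monotone without side conditions.
  record ℚ⁺ : Set where
    constructor mk
    field
      val : ℚ.ℚ
      .nonneg : ℚ.0ℚ ℚ.≤ val
  open ℚ⁺

  infix 4 _≤_
  infixl 6 _+_
  infixl 7 _*_

  private
    ext : {a b : ℚ⁺} → val a ≡ val b → a ≡ b
    ext refl = refl

    *-mono : ∀ {a b c d} → ℚ.0ℚ ℚ.≤ a → a ℚ.≤ b → ℚ.0ℚ ℚ.≤ c → c ℚ.≤ d → a ℚ.* c ℚ.≤ b ℚ.* d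
    *-mono {a} {b} {c} {d} 0≤a a≤b 0≤c c≤d = ℚ.≤-trans
      (ℚ.*-monoʳ-≤-nonNeg c {{ℚ.nonNegative 0≤c}} a≤b)
      (ℚ.*-monoˡ-≤-nonNeg b {{ℚ.nonNegative (ℚ.≤-trans 0≤a a≤b)}} c≤d)

    *-≥0 : ∀ a b → ℚ.0ℚ ℚ.≤ a → ℚ.0ℚ ℚ.≤ b → ℚ.0ℚ ℚ.≤ a ℚ.* b
    *-≥0 a b p q = subst (ℚ._≤ a ℚ.* b) (ℚ.*-zeroˡ ℚ.0ℚ) (*-mono (ℚ.≤-refl {ℚ.0ℚ}) p (ℚ.≤-refl {ℚ.0ℚ}) q)

    +-≥0 : ∀ a b → ℚ.0ℚ ℚ.≤ a → ℚ.0ℚ ℚ.≤ b → ℚ.0ℚ ℚ.≤ a ℚ.+ b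
    +-≥0 a b p q = subst (ℚ._≤ a ℚ.+ b) (ℚ.+-identityˡ ℚ.0ℚ) (ℚ.+-mono-≤ p q)

  abstract
    _≤_ : ℚ⁺ → ℚ⁺ → Set
    a ≤ b = val a ℚ.≤ val b

    _+_ _*_ : ℚ⁺ → ℚ⁺ → ℚ⁺
    mk a p + mk b q = mk (a ℚ.+ b) (+-≥0 a b p q)
    mk a p * mk b q = mk (a ℚ.* b) (*-≥0 a b p q)

    0# 1# : ℚ⁺
    0# = mk ℚ.0ℚ (ℚ.≤-refl {ℚ.0ℚ})
    1# = mk ℚ.1ℚ (ℚ.nonNegative⁻¹ ℚ.1ℚ)

    +-assoc : ∀ a b c → a + b + c ≡ a + (b + c)
    +-assoc a b c = ext (ℚ.+-assoc (val a) (val b) (val c))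

    +-comm : ∀ a b → a + b ≡ b + a
    +-comm a b = ext (ℚ.+-comm (val a) (val b))

    +-identityˡ : ∀ a → 0# + a ≡ a
    +-identityˡ a = ext (ℚ.+-identityˡ (val a))

    *-assoc : ∀ a b c → a * b * c ≡ a * (b * c)
    *-assoc a b c = ext (ℚ.*-assoc (val a) (val b) (val c))

    *-comm : ∀ a b → a * b ≡ b * a
    *-comm a b = ext (ℚ.*-comm (val a) (val b))

    *-identityˡ : ∀ a → 1# * a ≡ a
    *-identityˡ a = ext (ℚ.*-identityˡ (val a))

    *-zeroˡ : ∀ a → 0# * a ≡ 0#
    *-zeroˡ a = ext (ℚ.*-zeroˡ (val a))

    *-distribʳ-+ : ∀ a b c → (b + c) * a ≡ b * a + c * a
    *-distribʳ-+ a b c = ext (ℚ.*-distribʳ-+ (val a) (val b) (val c))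

    ≤-refl : ∀ {a} → a ≤ a
    ≤-refl {a} = ℚ.≤-refl {val a}

    ≤-trans : ∀ {a b c} → a ≤ b → b ≤ c → a ≤ c
    ≤-trans {a} {b} {c} = ℚ.≤-trans {val a} {val b} {val c}

    ≤-total : ∀ a b → a ≤ b ⊎ b ≤ a
    ≤-total a b = ℚ.≤-total (val a) (val b)

    _≤?_ : ∀ a b → Dec (a ≤ b)
    a ≤? b = val a ℚ.≤? val b

    0≤ : ∀ a → 0# ≤ a
    0≤ (mk a p) = recompute (ℚ.0ℚ ℚ.≤? a) p

    +-mono-≤ : ∀ {a b c d} → a ≤ b → c ≤ d → a + c ≤ b + d
    +-mono-≤ {a} {b} {c} {d} = ℚ.+-mono-≤ {val a} {val b} {val c} {val d}

    *-mono-≤ : ∀ {a b c d} → a ≤ b → c ≤ d → a * c ≤ b * d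
    *-mono-≤ {a} {b} {c} {d} p q = *-mono {val a} {val b} {val c} {val d} (0≤ a) p (0≤ c) q

    -- Positivity takes the form `1# ≤ c`: what is cancelled later is a positive integer or a
    -- product of factors 1 + x.
    *-cancelʳ-≤ : ∀ {a b} c → 1# ≤ c → a * c ≤ b * c → a ≤ b
    *-cancelʳ-≤ {a} {b} c 1≤c = ℚ.*-cancelʳ-≤-pos {val a} {val b} (val c)
      {{ℚ.positive (ℚ.<-≤-trans {ℚ.0ℚ} {ℚ.1ℚ} {val c} (ℚ.positive⁻¹ ℚ.1ℚ) 1≤c)}}

    +-cancelʳ-≤ : ∀ {a b} c → a + c ≤ b + c → a ≤ b
    +-cancelʳ-≤ {a} {b} c h = subst₂ ℚ._≤_ (lem (val a) (val c)) (lem (val b) (val c)) (ℚ.+-monoˡ-≤ (ℚ.- val c) {val a ℚ.+ val c} {val b ℚ.+ val c} h)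
      where
      lem : ∀ x y → x ℚ.+ y ℚ.+ ℚ.- y ≡ x
      lem x y = trans (ℚ.+-assoc x y (ℚ.- y)) (trans (cong (x ℚ.+_) (ℚ.+-inverseʳ y)) (ℚ.+-identityʳ x))

    1+a≰a : ∀ a → ¬ (1# + a ≤ a)
    1+a≰a a le = ℚ.<-irrefl {val a} refl (ℚ.<-≤-trans {val a} {ℚ.1ℚ ℚ.+ val a} {val a}
      (subst (ℚ._< ℚ.1ℚ ℚ.+ val a) (ℚ.+-identityˡ (val a)) (ℚ.+-monoˡ-< (val a) {ℚ.0ℚ} {ℚ.1ℚ} (ℚ.positive⁻¹ ℚ.1ℚ))) le)

    inverse : ∀ a → 1# ≤ a → ∃ λ b → a * b ≡ 1#
    inverse a 1≤a = mk (ℚ.1/ val a) (ℚ.<⇒≤ (ℚ.positive⁻¹ (ℚ.1/ val a) {{ℚ.1/pos⇒pos (val a)}})) , ext (ℚ.*-inverseʳ (val a))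
      where
      instance
        pos : ℚ.Positive (val a)
        pos = ℚ.positive (ℚ.<-≤-trans {ℚ.0ℚ} {ℚ.1ℚ} {val a} (ℚ.positive⁻¹ ℚ.1ℚ) 1≤a)
        nz : ℚ.NonZero (val a)
        nz = ℚ.pos⇒nonZero (val a)

  ℚ⁺-semiring : CommutativeSemiring 0ℓ 0ℓ
  ℚ⁺-semiring = record
    { Carrier = ℚ⁺ ; _≈_ = _≡_ ; _+_ = _+_ ; _*_ = _*_ ; 0# = 0# ; 1# = 1#
    ; isCommutativeSemiring = isCommutativeSemiringˡ record
      { +-isCommutativeMonoid = isCommutativeMonoidˡ record
        { isSemigroup = record { isMagma = record { isEquivalence = isEquivalence ; ∙-cong = cong₂ _+_ } ; assoc = +-assoc }
        ; identityˡ = +-identityˡ ; comm = +-comm }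
      ; *-isCommutativeMonoid = isCommutativeMonoidˡ record
        { isSemigroup = record { isMagma = record { isEquivalence = isEquivalence ; ∙-cong = cong₂ _*_ } ; assoc = *-assoc }
        ; identityˡ = *-identityˡ ; comm = *-comm }
      ; distribʳ = *-distribʳ-+ ; zeroˡ = *-zeroˡ } }
    where open import Algebra.Structures.Biased (_≡_ {A = ℚ⁺})

  open CommutativeSemiring ℚ⁺-semiring public using (+-identityʳ; *-identityʳ; distribˡ) renaming (zeroʳ to *-zeroʳ)
  open Solver ℚ⁺-semiring public using (solve; _:+_; _:*_; _:=_; con)

  ≤-reflexive : ∀ {a b} → a ≡ b → a ≤ b
  ≤-reflexive refl = ≤-refl

  module ≤-Reasoning where
    infix 1 begin_
    infixr 2 _≤⟨_⟩_ _≡⟨_⟩_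
    infix 3 _∎
    begin_ : ∀ {a b} → a ≤ b → a ≤ b
    begin p = p
    _≤⟨_⟩_ : ∀ a {b c} → a ≤ b → b ≤ c → a ≤ c
    _ ≤⟨ p ⟩ q = ≤-trans p q
    _≡⟨_⟩_ : ∀ a {b c} → a ≡ b → b ≤ c → a ≤ c
    _ ≡⟨ refl ⟩ q = q
    _∎ : ∀ a → a ≤ a
    _ ∎ = ≤-refl

  ≰⇒≥ : ∀ {a b} → ¬ (a ≤ b) → b ≤ a
  ≰⇒≥ {a} {b} n with ≤-total a b
  ... | inj₁ p = contradiction p n
  ... | inj₂ p = p

  a≤a+b : ∀ a b → a ≤ a + b
  a≤a+b a b = subst (_≤ a + b) (+-identityʳ a) (+-mono-≤ ≤-refl (0≤ b))

  b≤a+b : ∀ a b → b ≤ a + b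
  b≤a+b a b = subst (b ≤_) (+-comm b a) (a≤a+b b a)

  *-≥1 : ∀ {a b} → 1# ≤ a → 1# ≤ b → 1# ≤ a * b
  *-≥1 {a} {b} p q = subst (_≤ a * b) (*-identityˡ 1#) (*-mono-≤ p q)

  fromℕ : ℕ → ℚ⁺
  fromℕ zero = 0#
  fromℕ (suc n) = 1# + fromℕ n

  fromℕ-1 : fromℕ 1 ≡ 1#
  fromℕ-1 = +-identityʳ 1#

  fromℕ-+ : ∀ m n → fromℕ (m ℕ.+ n) ≡ fromℕ m + fromℕ n
  fromℕ-+ zero n = sym (+-identityˡ _)
  fromℕ-+ (suc m) n = trans (cong (1# +_) (fromℕ-+ m n)) (sym (+-assoc 1# (fromℕ m) (fromℕ n)))

  fromℕ-* : ∀ m n → fromℕ (m ℕ.* n) ≡ fromℕ m * fromℕ n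
  fromℕ-* zero n = sym (*-zeroˡ _)
  fromℕ-* (suc m) n = trans (fromℕ-+ n (m ℕ.* n)) (trans (cong (fromℕ n +_) (fromℕ-* m n))
    (solve 2 (λ a b → b :+ a :* b := (con 1 :+ a) :* b) refl (fromℕ m) (fromℕ n)))

  fromℕ-mono : ∀ {m n} → m ℕ.≤ n → fromℕ m ≤ fromℕ n
  fromℕ-mono z≤n = 0≤ _
  fromℕ-mono (s≤s p) = +-mono-≤ ≤-refl (fromℕ-mono p)

  1≤fromℕ : ∀ {n} → 1 ℕ.≤ n → 1# ≤ fromℕ n
  1≤fromℕ {suc n} _ = a≤a+b 1# _

  fromℕ-cancel : ∀ {m n} → fromℕ m ≤ fromℕ n → m ℕ.≤ n
  fromℕ-cancel {m} {n} le with m ℕ.≤? n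
  ... | yes p = p
  ... | no np = contradiction (≤-trans (fromℕ-mono (ℕ.≰⇒> np)) le) (1+a≰a _)

  -- The value 0 at `zero` lets `inv-*` and `inv≤1` hold without side conditions.
  inv : ℕ → ℚ⁺
  inv zero = 0#
  inv (suc n) = proj₁ (inverse (fromℕ (suc n)) (1≤fromℕ {suc n} (s≤s z≤n)))

  fromℕ*inv : ∀ {n} → 1 ℕ.≤ n → fromℕ n * inv n ≡ 1#
  fromℕ*inv {suc n} _ = proj₂ (inverse (fromℕ (suc n)) (1≤fromℕ {suc n} (s≤s z≤n)))

  inv*fromℕ : ∀ {n} → 1 ℕ.≤ n → inv n * fromℕ n ≡ 1#
  inv*fromℕ {n} p = trans (*-comm (inv n) (fromℕ n)) (fromℕ*inv p)

  ≤-from-*fromℕ : ∀ {a b n} → 1 ℕ.≤ n → a * fromℕ n ≤ b * fromℕ n → a ≤ b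
  ≤-from-*fromℕ {n = n} 1≤n = *-cancelʳ-≤ (fromℕ n) (1≤fromℕ 1≤n)

  inv-antitone : ∀ {m n} → 1 ℕ.≤ m → m ℕ.≤ n → inv n ≤ inv m
  inv-antitone {m} {n} 1≤m m≤n = ≤-from-*fromℕ 1≤m (≤-from-*fromℕ (ℕ.≤-trans 1≤m m≤n) (begin
      inv n * fromℕ m * fromℕ n ≡⟨ solve 3 (λ a b c → a :* b :* c := a :* c :* b) refl (inv n) (fromℕ m) (fromℕ n) ⟩
      inv n * fromℕ n * fromℕ m ≡⟨ cong (_* fromℕ m) (inv*fromℕ (ℕ.≤-trans 1≤m m≤n)) ⟩
      1# * fromℕ m ≤⟨ *-mono-≤ ≤-refl (fromℕ-mono m≤n) ⟩
      1# * fromℕ n ≡⟨ cong (_* fromℕ n) (sym (inv*fromℕ 1≤m)) ⟩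
      inv m * fromℕ m * fromℕ n ∎))
    where open ≤-Reasoning

  inv-1 : inv 1 ≡ 1#
  inv-1 = trans (sym (*-identityˡ _)) (trans (cong (_* inv 1) (sym fromℕ-1)) (fromℕ*inv {1} (s≤s z≤n)))

  inv≤1 : ∀ n → inv n ≤ 1#
  inv≤1 zero = 0≤ _
  inv≤1 (suc n) = ≤-trans (inv-antitone {1} {suc n} (s≤s z≤n) (s≤s z≤n)) (≤-reflexive inv-1)

  inv-* : ∀ m n → inv (m ℕ.* n) ≡ inv m * inv n
  inv-* zero n = sym (*-zeroˡ (inv n))
  inv-* (suc m) zero = trans (cong inv (ℕ.*-zeroʳ m)) (sym (*-zeroʳ (inv (suc m))))
  inv-* (suc m) (suc n) = trans (sym (*-identityʳ _))
      (trans (cong (inv (suc m ℕ.* suc n) *_) (sym (trans (cong₂ _*_ (fromℕ*inv {suc m} (s≤s z≤n)) (fromℕ*inv {suc n} (s≤s z≤n))) (*-identityˡ 1#))))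
      (trans (solve 5 (λ a b c d e → a :* ((b :* c) :* (d :* e)) := b :* d :* a :* (c :* e)) refl
          (inv (suc m ℕ.* suc n)) (fromℕ (suc m)) (inv (suc m)) (fromℕ (suc n)) (inv (suc n)))
      (trans (cong (λ x → x * inv (suc m ℕ.* suc n) * (inv (suc m) * inv (suc n))) (sym (fromℕ-* (suc m) (suc n))))
      (trans (cong (_* (inv (suc m) * inv (suc n))) (fromℕ*inv {suc m ℕ.* suc n} (s≤s z≤n))) (*-identityˡ _)))))

  infixr 8 _^_
  _^_ : ℚ⁺ → ℕ → ℚ⁺
  a ^ zero = 1#
  a ^ suc n = a * a ^ n

  ^-≥1 : ∀ {a} n → 1# ≤ a → 1# ≤ a ^ n
  ^-≥1 zero p = ≤-refl
  ^-≥1 (suc n) p = *-≥1 p (^-≥1 n p)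

  ^-mono : ∀ {a b} n → a ≤ b → a ^ n ≤ b ^ n
  ^-mono zero _ = ≤-refl
  ^-mono (suc n) p = *-mono-≤ p (^-mono n p)

  ^-+ : ∀ a m n → a ^ (m ℕ.+ n) ≡ a ^ m * a ^ n
  ^-+ a zero n = sym (*-identityˡ _)
  ^-+ a (suc m) n = trans (cong (a *_) (^-+ a m n)) (sym (*-assoc a (a ^ m) (a ^ n)))

  *-^ : ∀ a b n → (a * b) ^ n ≡ a ^ n * b ^ n
  *-^ a b zero = sym (*-identityˡ 1#)
  *-^ a b (suc n) = trans (cong (a * b *_) (*-^ a b n))
    (solve 4 (λ a b c d → a :* b :* (c :* d) := a :* c :* (b :* d)) refl a b (a ^ n) (b ^ n))

  ^-antitone : ∀ {a m n} → a ≤ 1# → m ℕ.≤ n → a ^ n ≤ a ^ m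
  ^-antitone {n = zero} q z≤n = ≤-refl
  ^-antitone {a} {n = suc n} q z≤n = subst (a * a ^ n ≤_) (*-identityˡ 1#) (*-mono-≤ q (^-antitone {n = n} q z≤n))
  ^-antitone {a} q (s≤s m≤n) = *-mono-≤ ≤-refl (^-antitone q m≤n)

  Σ[_] : (A → ℚ⁺) → List A → ℚ⁺
  Σ[ f ] [] = 0#
  Σ[ f ] (x ∷ xs) = f x + Σ[ f ] xs

  Π[_] : (A → ℚ⁺) → List A → ℚ⁺
  Π[ f ] [] = 1#
  Π[ f ] (x ∷ xs) = f x * Π[ f ] xs

  Σ-mono : {f g : A → ℚ⁺} (xs : List A) → (∀ {x} → x ∈ xs → f x ≤ g x) → Σ[ f ] xs ≤ Σ[ g ] xs
  Σ-mono [] h = ≤-refl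
  Σ-mono (x ∷ xs) h = +-mono-≤ (h (here refl)) (Σ-mono xs (h ∘ there))

  Σ-cong : {f g : A → ℚ⁺} (xs : List A) → (∀ x → f x ≡ g x) → Σ[ f ] xs ≡ Σ[ g ] xs
  Σ-cong [] h = refl
  Σ-cong (x ∷ xs) h = cong₂ _+_ (h x) (Σ-cong xs h)

  Σ-++ : (f : A → ℚ⁺) (xs ys : List A) → Σ[ f ] (xs ++ ys) ≡ Σ[ f ] xs + Σ[ f ] ys
  Σ-++ f [] ys = sym (+-identityˡ _)
  Σ-++ f (x ∷ xs) ys = trans (cong (f x +_) (Σ-++ f xs ys)) (sym (+-assoc (f x) _ _))

  Σ-map : (f : B → ℚ⁺) (g : A → B) (xs : List A) → Σ[ f ] (map g xs) ≡ Σ[ f ∘ g ] xs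
  Σ-map f g [] = refl
  Σ-map f g (x ∷ xs) = cong (f (g x) +_) (Σ-map f g xs)

  Σ-concatMap : (f : B → ℚ⁺) (g : A → List B) (xs : List A) → Σ[ f ] (concatMap g xs) ≡ Σ[ (λ x → Σ[ f ] (g x)) ] xs
  Σ-concatMap f g [] = refl
  Σ-concatMap f g (x ∷ xs) = trans (Σ-++ f (g x) (concatMap g xs)) (cong (Σ[ f ] (g x) +_) (Σ-concatMap f g xs))

  Σ-scale : (c : ℚ⁺) (f : A → ℚ⁺) (xs : List A) → Σ[ (λ x → c * f x) ] xs ≡ c * Σ[ f ] xs
  Σ-scale c f [] = sym (*-zeroʳ c)
  Σ-scale c f (x ∷ xs) = trans (cong (c * f x +_) (Σ-scale c f xs)) (sym (distribˡ c (f x) _))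

  Σ-+ : (f g : A → ℚ⁺) (xs : List A) → Σ[ (λ x → f x + g x) ] xs ≡ Σ[ f ] xs + Σ[ g ] xs
  Σ-+ f g [] = sym (+-identityʳ 0#)
  Σ-+ f g (x ∷ xs) = trans (cong (f x + g x +_) (Σ-+ f g xs))
    (solve 4 (λ a b c d → a :+ b :+ (c :+ d) := a :+ c :+ (b :+ d)) refl (f x) (g x) (Σ[ f ] xs) (Σ[ g ] xs))

  Σ-const : (c : ℚ⁺) (xs : List A) → Σ[ (λ _ → c) ] xs ≡ fromℕ (length xs) * c
  Σ-const c [] = sym (*-zeroˡ c)
  Σ-const c (x ∷ xs) = trans (cong (c +_) (Σ-const c xs))
    (solve 2 (λ c l → c :+ l :* c := (con 1 :+ l) :* c) refl c (fromℕ (length xs)))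

  Σ-swap : (f : A → B → ℚ⁺) (xs : List A) (ys : List B) →
    Σ[ (λ x → Σ[ f x ] ys) ] xs ≡ Σ[ (λ y → Σ[ (λ x → f x y) ] xs) ] ys
  Σ-swap f [] ys = sym (trans (Σ-const 0# ys) (*-zeroʳ _))
  Σ-swap f (x ∷ xs) ys = trans (cong (Σ[ f x ] ys +_) (Σ-swap f xs ys)) (sym (Σ-+ (f x) _ ys))

  Σ-∈ : {f : A → ℚ⁺} {xs : List A} {x : A} → x ∈ xs → f x ≤ Σ[ f ] xs
  Σ-∈ {f = f} {xs = x ∷ xs} (here refl) = a≤a+b (f x) _
  Σ-∈ {f = f} {xs = y ∷ xs} (there m) = ≤-trans (Σ-∈ m) (b≤a+b (f y) _)

  indicator : {P : Set} → Dec P → ℚ⁺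
  indicator (yes _) = 1#
  indicator (no _) = 0#

  indicator-true : {P : Set} (d : Dec P) → P → indicator d ≡ 1#
  indicator-true (yes _) _ = refl
  indicator-true (no n) p with () ← n p

  *indicator-≤ : {P : Set} {a b : ℚ⁺} (d : Dec P) → (P → a ≤ b) → a * indicator d ≤ b
  *indicator-≤ {a = a} (yes p) h = ≤-trans (≤-reflexive (*-identityʳ a)) (h p)
  *indicator-≤ {a = a} (no _) h = ≤-trans (≤-reflexive (*-zeroʳ a)) (0≤ _)

  Σ-filter : {P : A → Set} (P? : ∀ x → Dec (P x)) (f : A → ℚ⁺) (xs : List A) →
    Σ[ f ] (filter P? xs) ≡ Σ[ (λ x → indicator (P? x) * f x) ] xs
  Σ-filter P? f [] = refl
  Σ-filter P? f (x ∷ xs) with P? x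
  ... | yes _ = cong₂ _+_ (sym (*-identityˡ (f x))) (Σ-filter P? f xs)
  ... | no _ = trans (Σ-filter P? f xs) (trans (sym (+-identityˡ _)) (cong (_+ _) (sym (*-zeroˡ (f x)))))

  Π-≥1 : {f : A → ℚ⁺} (xs : List A) → (∀ x → 1# ≤ f x) → 1# ≤ Π[ f ] xs
  Π-≥1 [] h = ≤-refl
  Π-≥1 (x ∷ xs) h = *-≥1 (h x) (Π-≥1 xs h)

  Π-mono : {f g : A → ℚ⁺} (xs : List A) → (∀ {x} → x ∈ xs → f x ≤ g x) → Π[ f ] xs ≤ Π[ g ] xs
  Π-mono [] h = ≤-refl
  Π-mono (x ∷ xs) h = *-mono-≤ (h (here refl)) (Π-mono xs (h ∘ there))

  Π-* : (f g : A → ℚ⁺) (xs : List A) → Π[ (λ x → f x * g x) ] xs ≡ Π[ f ] xs * Π[ g ] xs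
  Π-* f g [] = sym (*-identityˡ 1#)
  Π-* f g (x ∷ xs) = trans (cong (f x * g x *_) (Π-* f g xs))
    (solve 4 (λ a b c d → a :* b :* (c :* d) := a :* c :* (b :* d)) refl (f x) (g x) (Π[ f ] xs) (Π[ g ] xs))

  1^ : ∀ k → 1# ^ k ≡ 1#
  1^ zero = refl
  1^ (suc k) = trans (*-identityˡ _) (1^ k)

  Π-^ : (f : A → ℚ⁺) (k : ℕ) (xs : List A) → Π[ (λ x → f x ^ k) ] xs ≡ Π[ f ] xs ^ k
  Π-^ f k [] = sym (1^ k)
  Π-^ f k (x ∷ xs) = trans (cong (f x ^ k *_) (Π-^ f k xs)) (sym (*-^ (f x) (Π[ f ] xs) k))

  Π-1 : (ys : List A) → Π[ (λ _ → 1#) ] ys ≡ 1#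
  Π-1 [] = refl
  Π-1 (y ∷ ys) = trans (*-identityˡ _) (Π-1 ys)

  Π-swap : (f : A → B → ℚ⁺) (xs : List A) (ys : List B) →
    Π[ (λ x → Π[ f x ] ys) ] xs ≡ Π[ (λ y → Π[ (λ x → f x y) ] xs) ] ys
  Π-swap f [] ys = sym (Π-1 ys)
  Π-swap f (x ∷ xs) ys = trans (cong (Π[ f x ] ys *_) (Π-swap f xs ys)) (sym (Π-* (f x) _ ys))

  1+Σ≤Π : {f : A → ℚ⁺} (xs : List A) → 1# + Σ[ f ] xs ≤ Π[ (λ x → 1# + f x) ] xs
  1+Σ≤Π [] = ≤-reflexive (+-identityʳ 1#)
  1+Σ≤Π {f = f} (x ∷ xs) = begin
    1# + (f x + Σ[ f ] xs) ≤⟨ a≤a+b _ (f x * Σ[ f ] xs) ⟩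
    1# + (f x + Σ[ f ] xs) + f x * Σ[ f ] xs
      ≡⟨ solve 2 (λ a b → con 1 :+ (a :+ b) :+ a :* b := (con 1 :+ a) :* (con 1 :+ b)) refl (f x) (Σ[ f ] xs) ⟩
    (1# + f x) * (1# + Σ[ f ] xs) ≤⟨ *-mono-≤ ≤-refl (1+Σ≤Π xs) ⟩
    (1# + f x) * Π[ (λ x → 1# + f x) ] xs ∎
    where open ≤-Reasoning

-- Orders with integer coordinates: sizes and indices

module Orders where

  open Counting
  open import Data.Integer using (+_; ∣_∣)
  open import Data.Vec using (lookup; tabulate)
  open import Data.Vec.Properties using (lookup∘tabulate; tabulate-cong)
  open import Data.List using (cartesianProduct)
  open import Data.List.Properties using (length-++; length-map)
  open import Data.List.Membership.Propositional.Properties using (∈-cartesianProduct⁻)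
  import Data.Maybe as Maybe
  open import Algebra using (CommutativeRing)
  import Algebra.Solver.Ring.AlmostCommutativeRing as ACR
  import Algebra.Solver.Ring
  import Algebra.Properties.AbelianGroup ℤ.+-0-abelianGroup as ℤ-Group
  open import Level using (0ℓ)
  open import Relation.Nullary.Decidable using (dec⇒maybe)
  open import Relation.Binary.PropositionalEquality as ≡ using (_≡_; _≢_; refl; cong; cong₂; subst)

  Σℤ : ∀ {k} → (Fin k → ℤ) → ℤ
  Σℤ {zero} f = 0ℤ
  Σℤ {suc k} f = f zero ℤ.+ Σℤ (f ∘ suc)

  ∣Σℤ∣≤ : ∀ {k} (f : Fin k → ℤ) b → (∀ i → ∣ f i ∣ ℕ.≤ b) → ∣ Σℤ f ∣ ℕ.≤ k ℕ.* b
  ∣Σℤ∣≤ {zero} f b h = z≤n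
  ∣Σℤ∣≤ {suc k} f b h = ℕ.≤-trans (ℤ.∣i+j∣≤∣i∣+∣j∣ (f zero) _) (ℕ.+-mono-≤ (h zero) (∣Σℤ∣≤ (f ∘ suc) b (h ∘ suc)))

  Σℤ-zero : ∀ {k} (f : Fin k → ℤ) → (∀ i → f i ≡ 0ℤ) → Σℤ f ≡ 0ℤ
  Σℤ-zero {zero} f h = refl
  Σℤ-zero {suc k} f h = cong₂ ℤ._+_ (h zero) (Σℤ-zero (f ∘ suc) (h ∘ suc))

  Σℤ-single : ∀ {k} (f : Fin k → ℤ) t → (∀ i → i ≢ t → f i ≡ 0ℤ) → Σℤ f ≡ f t
  Σℤ-single {suc k} f zero h = ≡.trans (cong₂ ℤ._+_ {x = f zero} refl (Σℤ-zero (f ∘ suc) (λ i → h (suc i) λ ()))) (ℤ.+-identityʳ _)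
  Σℤ-single {suc k} f (suc t) h = ≡.trans (cong₂ ℤ._+_ (h zero λ ()) (Σℤ-single (f ∘ suc) t (λ i ne → h (suc i) (ne ∘ Fin.suc-injective)))) (ℤ.+-identityˡ _)

  upper-bound : ∀ {k} (f : Fin k → ℕ) → ∃ λ b → ∀ i → f i ℕ.≤ b
  upper-bound {zero} f = 0 , λ ()
  upper-bound {suc k} f with upper-bound (f ∘ suc)
  ... | b , h = f zero ℕ.+ b , λ { zero → ℕ.m≤m+n _ b ; (suc i) → ℕ.≤-trans (h i) (ℕ.m≤n+m b _) }

  -- An order is seen through d jointly injective integer functionals `π` and not through a ℤ-basis.
  -- Dual elements `e` exist only up to a common factor, hence the diagonal value `M`: they span a
  -- sublattice that contains M x for every x (`w-π`).
  record Order : Set₁ where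
    field
      𝓐 : CommutativeRing 0ℓ 0ℓ
    open CommutativeRing 𝓐 public hiding (zero) renaming (refl to ≈-refl)
    field
      ι : ℤ → Carrier
      ι-+ : ∀ a b → ι (a ℤ.+ b) ≈ ι a + ι b
      ι-* : ∀ a b → ι (a ℤ.* b) ≈ ι a * ι b
      ι-neg : ∀ a → ι (ℤ.- a) ≈ - ι a
      ι-0 : ι 0ℤ ≈ 0#
      ι-1 : ι 1ℤ ≈ 1#
      d : ℕ
      π : Carrier → Fin d → ℤ
      π-cong : ∀ {x y} → x ≈ y → ∀ s → π x s ≡ π y s
      π-+ : ∀ x y s → π (x + y) s ≡ π x s ℤ.+ π y s
      π-ι* : ∀ c x s → π (ι c * x) s ≡ c ℤ.* π x s
      π-injective : ∀ {x} → (∀ s → π x s ≡ 0ℤ) → x ≈ 0#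
      e : Fin d → Carrier
      M : ℕ
      1≤M : 1 ℕ.≤ M
      π-e-diag : ∀ s → π (e s) s ≡ + M
      π-e-off : ∀ s t → s ≢ t → π (e s) t ≡ 0ℤ
      domain : ∀ {x y} → x * y ≈ 0# → ¬ (x ≈ 0#) → y ≈ 0#

    R : ACR.AlmostCommutativeRing 0ℓ 0ℓ
    R = ACR.fromCommutativeRing 𝓐

    private
      ℤ-raw = CommutativeRing.rawRing ℤ.+-*-commutativeRing

    ι-morphism : ℤ-raw ACR.-Raw-AlmostCommutative⟶ R
    ι-morphism = record { ⟦_⟧ = ι ; +-homo = ι-+ ; *-homo = ι-* ; -‿homo = ι-neg ; 0-homo = ι-0 ; 1-homo = ι-1 }

    ι-cong : ∀ {a b} → a ≡ b → ι a ≈ ι b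
    ι-cong refl = ≈-refl

    open Algebra.Solver.Ring ℤ-raw R ι-morphism (λ a b → Maybe.map ι-cong (dec⇒maybe (a ℤ.≟ b))) public
      using (solve; _:+_; _:*_; _:=_; _:-_; :-_; con)

    -‿≈0 : ∀ {x y} → x - y ≈ 0# → x ≈ y
    -‿≈0 {x} {y} h = trans (solve 2 (λ x y → x := (x :- y) :+ y) ≈-refl x y)
      (trans (+-congʳ h) (+-identityˡ y))

    ≈⇒-≈0 : ∀ {x y} → x ≈ y → x - y ≈ 0#
    ≈⇒-≈0 {x} {y} h = trans (+-congʳ h) (-‿inverseʳ y)

    cancelˡ : ∀ {x y z} → ¬ (x ≈ 0#) → x * y ≈ x * z → y ≈ z
    cancelˡ {x} {y} {z} n h = -‿≈0 (domain
      (trans (solve 3 (λ x y z → x :* (y :- z) := x :* y :- x :* z) ≈-refl x y z) (≈⇒-≈0 h)) n)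

    π-0 : ∀ s → π 0# s ≡ 0ℤ
    π-0 s = ≡.trans (π-cong (sym (trans (*-congʳ ι-0) (zeroˡ 0#))) s) (≡.trans (π-ι* 0ℤ 0# s) (ℤ.*-zeroˡ (π 0# s)))

    π-ι : ∀ c s → π (ι c) s ≡ c ℤ.* π 1# s
    π-ι c s = ≡.trans (π-cong (sym (*-identityʳ (ι c))) s) (π-ι* c 1# s)

    π-sub : ∀ x y s → π (x - y) s ≡ π x s ℤ.- π y s
    π-sub x y s = ≡.trans (π-+ x (- y) s) (cong₂ ℤ._+_ {x = π x s} refl (≡.trans
      (π-cong (trans (solve 1 (λ y → :- y := con (ℤ.- 1ℤ) :* y) ≈-refl y) ≈-refl) s)
      (≡.trans (π-ι* (ℤ.- 1ℤ) y s) (ℤ.-1*i≡-i (π y s)))))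

    π-faithful : ∀ {x y} → (∀ s → π x s ≡ π y s) → x ≈ y
    π-faithful {x} {y} h = -‿≈0 (π-injective λ s → ≡.trans (π-sub x y s)
      (≡.trans (cong (ℤ._- π y s) (h s)) (ℤ.+-inverseʳ (π y s))))

    lin : ∀ {k} → (Fin k → ℤ) → (Fin k → Carrier) → Carrier
    lin {zero} a x = 0#
    lin {suc k} a x = ι (a zero) * x zero + lin (a ∘ suc) (x ∘ suc)

    lin-* : ∀ {k} (a : Fin k → ℤ) (x : Fin k → Carrier) y → lin a x * y ≈ lin a (λ s → x s * y)
    lin-* {zero} a x y = zeroˡ y
    lin-* {suc k} a x y = trans (distribʳ y _ _) (+-cong (*-assoc _ _ _) (lin-* (a ∘ suc) (x ∘ suc) y))

    π-lin : ∀ {k} (a : Fin k → ℤ) (x : Fin k → Carrier) s → π (lin a x) s ≡ Σℤ λ t → a t ℤ.* π (x t) s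
    π-lin {zero} a x s = π-0 s
    π-lin {suc k} a x s = ≡.trans (π-+ _ _ s) (cong₂ ℤ._+_ (π-ι* (a zero) (x zero) s) (π-lin (a ∘ suc) (x ∘ suc) s))

    w : (Fin d → ℤ) → Carrier
    w a = lin a e

    π-w : ∀ a s → π (w a) s ≡ a s ℤ.* + M
    π-w a s = ≡.trans (π-lin a e s) (≡.trans
      (Σℤ-single _ s λ t t≢s → ≡.trans (cong (a t ℤ.*_) (π-e-off t s t≢s)) (ℤ.*-zeroʳ (a t)))
      (cong (a s ℤ.*_) (π-e-diag s)))

    w-π : ∀ x → ι (+ M) * x ≈ w (π x)
    w-π x = π-faithful λ s → ≡.trans (π-ι* (+ M) x s) (≡.trans (ℤ.*-comm (+ M) (π x s)) (≡.sym (π-w (π x) s)))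

    M≢0 : ℤ.NonZero (+ M)
    M≢0 = ℕ.>-nonZero 1≤M

    w-injective : ∀ {a b} → w a ≈ w b → ∀ s → a s ≡ b s
    w-injective {a} {b} h s = ℤ.*-cancelʳ-≡ (a s) (b s) (+ M) {{M≢0}}
      (≡.trans (≡.sym (π-w a s)) (≡.trans (π-cong h s) (π-w b s)))

    w-sub : ∀ a b → w a - w b ≈ w (λ s → a s ℤ.- b s)
    w-sub a b = π-faithful λ s → ≡.trans (π-sub (w a) (w b) s) (≡.trans (cong₂ ℤ._-_ (π-w a s) (π-w b s))
      (≡.trans (lem (a s) (b s) (+ M)) (≡.sym (π-w _ s))))
      where
      open import Data.Integer.Tactic.RingSolver using (solve-∀)
      lem : ∀ a b m → a ℤ.* m ℤ.- b ℤ.* m ≡ (a ℤ.- b) ℤ.* m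
      lem = solve-∀

    Bounded : Carrier → ℕ → Set
    Bounded x b = ∀ s → ∣ π x s ∣ ℕ.≤ b

    bounded-exists : ∀ x → ∃ (Bounded x)
    bounded-exists x = upper-bound (λ s → ∣ π x s ∣)

    bounded-≤ : ∀ {x b c} → b ℕ.≤ c → Bounded x b → Bounded x c
    bounded-≤ p h s = ℕ.≤-trans (h s) p

    bounded-cong : ∀ {x y b} → x ≈ y → Bounded x b → Bounded y b
    bounded-cong e h s = subst (λ z → ∣ z ∣ ℕ.≤ _) (π-cong e s) (h s)

    bounded-+ : ∀ {x y b c} → Bounded x b → Bounded y c → Bounded (x + y) (b ℕ.+ c)
    bounded-+ {x} {y} p q s = ℕ.≤-trans (ℕ.≤-reflexive (cong ∣_∣ (π-+ x y s)))
      (ℕ.≤-trans (ℤ.∣i+j∣≤∣i∣+∣j∣ (π x s) (π y s)) (ℕ.+-mono-≤ (p s) (q s)))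

    bounded-ι* : ∀ c {x b} → Bounded x b → Bounded (ι c * x) (∣ c ∣ ℕ.* b)
    bounded-ι* c {x} p s = ℕ.≤-trans (ℕ.≤-reflexive (≡.trans (cong ∣_∣ (π-ι* c x s)) (ℤ.abs-* c (π x s)))) (ℕ.*-monoʳ-≤ ∣ c ∣ (p s))

    bounded-w : ∀ {a b} → (∀ s → ∣ a s ∣ ℕ.≤ b) → Bounded (w a) (b ℕ.* M)
    bounded-w {a} p s = ℕ.≤-trans (ℕ.≤-reflexive (≡.trans (cong ∣_∣ (π-w a s)) (ℤ.abs-* (a s) (+ M)))) (ℕ.*-monoˡ-≤ M (p s))

    bounded-/ι : ∀ c {x b} → 1 ℕ.≤ ∣ c ∣ → Bounded (ι c * x) b → Bounded x b
    bounded-/ι c {x} 1≤c p s = ℕ.≤-trans (ℕ.≤-trans (ℕ.≤-reflexive (≡.sym (ℕ.*-identityˡ _))) (ℕ.*-monoˡ-≤ _ 1≤c))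
      (ℕ.≤-trans (ℕ.≤-reflexive (≡.sym (≡.trans (cong ∣_∣ (π-ι* c x s)) (ℤ.abs-* c (π x s))))) (p s))

    private
      bounded-left : ∀ {x y b c} → Bounded x b → (∀ s → Bounded (e s * y) c) → Bounded (x * y) (d ℕ.* (b ℕ.* c))
      bounded-left {x} {y} {b} {c} p q = bounded-/ι (+ M) 1≤M (bounded-cong
        (sym (trans (sym (*-assoc _ _ _)) (trans (*-congʳ (w-π x)) (lin-* (π x) e y))))
        λ s → ℕ.≤-trans (ℕ.≤-reflexive (cong ∣_∣ (π-lin (π x) (λ t → e t * y) s)))
          (∣Σℤ∣≤ _ (b ℕ.* c) λ t → ℕ.≤-trans (ℕ.≤-reflexive (ℤ.abs-* (π x t) (π (e t * y) s))) (ℕ.*-mono-≤ (p t) (q t s))))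

      structure-bound : ∃ λ c → ∀ s t → Bounded (e s * e t) c
      structure-bound = proj₁ bs , λ s t r → ℕ.≤-trans (proj₂ (f s t) r) (ℕ.≤-trans (proj₂ (g s) t) (proj₂ bs s))
        where
        f = λ s t → bounded-exists (e s * e t)
        g = λ s → upper-bound (λ t → proj₁ (f s t))
        bs = upper-bound (λ s → proj₁ (g s))

    -- Each factor of a product is expanded in the `e s` after multiplication by M, which costs a
    -- factor d; what remains is a bound for the coordinates of the products e s e t. Dividing by M
    -- afterwards only shrinks coordinates.
    K : ℕ
    K = d ℕ.* (d ℕ.* proj₁ structure-bound)

    bounded-* : ∀ {x y b c} → Bounded x b → Bounded y c → Bounded (x * y) (K ℕ.* b ℕ.* c)
    bounded-* {x} {y} {b} {c} p q = bounded-≤ {x * y} (ℕ.≤-reflexive (lem d b c (proj₁ structure-bound)))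
      (bounded-left {x} {y} p λ s → bounded-cong (*-comm y (e s))
        (bounded-left {y} {e s} q λ t → proj₂ structure-bound t s))
      where
      lem : ∀ d b c k → d ℕ.* (b ℕ.* (d ℕ.* (c ℕ.* k))) ≡ d ℕ.* (d ℕ.* k) ℕ.* b ℕ.* c
      lem = ℕ-solve-∀

    private
      offset : ∀ i b → ∣ i ∣ ℕ.≤ b → + ∣ i ℤ.+ + b ∣ ≡ i ℤ.+ + b
      offset i b p = ℤ.0≤i⇒+∣i∣≡i (ℤ.≤-trans (ℤ.≤-reflexive (≡.sym (ℤ.+-inverseˡ (+ b))))
        (ℤ.+-monoˡ-≤ (+ b) (ℤ.≤-trans (ℤ.neg-mono-≤ (ℤ.+≤+ p)) (neg-abs i))))
        where
        neg-abs : ∀ i → ℤ.- + ∣ i ∣ ℤ.≤ i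
        neg-abs (+ n) = ℤ.≤-trans (ℤ.neg-≤-pos {n} {0}) (ℤ.+≤+ z≤n)
        neg-abs ℤ.-[1+ n ] = ℤ.≤-refl

      code : ℕ → Carrier → Vec ℕ d
      code b x = tabulate λ s → ∣ π x s ℤ.+ + b ∣

      code-∈ : ∀ {b x} → Bounded x b → code b x ∈ box d (suc (2 ℕ.* b))
      code-∈ {b} {x} p = ∈-box⁺ λ s → s≤s (subst (ℕ._≤ _) (≡.sym (lookup∘tabulate _ s))
        (ℕ.≤-trans (ℤ.∣i+j∣≤∣i∣+∣j∣ (π x s) (+ b)) (ℕ.≤-trans (ℕ.+-monoˡ-≤ b (p s))
          (ℕ.≤-reflexive (cong (b ℕ.+_) (≡.sym (ℕ.+-identityʳ b)))))))

      code-injective : ∀ {b x y} → Bounded x b → Bounded y b → code b x ≡ code b y → x ≈ y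
      code-injective {b} {x} {y} p q h = π-faithful λ s → ℤ-Group.∙-cancelʳ (+ b) (π x s) (π y s) (
        ≡.trans (≡.sym (offset (π x s) b (p s))) (≡.trans (cong +_ (≡.trans (≡.sym (lookup∘tabulate _ s))
          (≡.trans (cong (λ v → lookup v s) h) (lookup∘tabulate _ s)))) (offset (π y s) b (q s))))

    count-bounded : ∀ {I : Set} {is : List I} (f : I → Carrier) b → Unique is →
      (∀ {i} → i ∈ is → Bounded (f i) b) → (∀ {i j} → i ∈ is → j ∈ is → f i ≈ f j → i ≡ j) →
      length is ℕ.≤ suc (2 ℕ.* b) ℕ.^ d
    count-bounded f b u bd inj = ℕ.≤-trans
      (injection⇒length≤ (code b ∘ f) u (λ p q h → inj p q (code-injective (bd p) (bd q) h)) (λ p → code-∈ (bd p)))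
      (ℕ.≤-reflexive (length-box d _))

    private
      common-bound : ∀ {I : Set} (is : List I) (f : I → Carrier) → ∃ λ b → ∀ {i} → i ∈ is → Bounded (f i) b
      common-bound [] f = 0 , λ ()
      common-bound (i ∷ is) f with bounded-exists (f i) | common-bound is f
      ... | b , p | c , q = b ℕ.+ c , λ
        { (here refl) → bounded-≤ {f i} (ℕ.m≤m+n b c) p ; (there {y} m) → bounded-≤ (ℕ.m≤n+m c b) (q m) }

      length-cartesianProduct : ∀ {A B : Set} (xs : List A) (ys : List B) → length (cartesianProduct xs ys) ≡ length xs ℕ.* length ys
      length-cartesianProduct [] ys = refl
      length-cartesianProduct (x ∷ xs) ys = ≡.trans (length-++ (List.map (x ,_) ys))
        (cong₂ ℕ._+_ (length-map (x ,_) ys) (length-cartesianProduct xs ys))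

    vec : Vec ℕ d → Fin d → ℤ
    vec a s = + lookup a s

    vec-injective : ∀ {a b} → (∀ s → vec a s ≡ vec b s) → a ≡ b
    vec-injective {a} {b} h = ≡.trans (≡.sym (Vec.tabulate∘lookup a)) (≡.trans (tabulate-cong λ s → ℤ.+-injective (h s)) (Vec.tabulate∘lookup b))

    -- The index of an ideal is at most that of a principal ideal γR inside it; the elements
    -- βᵢ + γ w(a) with a in a large box are distinct and all lie in a slightly larger box.
    index-bound : ∀ {I : Set} {is : List I} (β : I → Carrier) {γ b} → Unique is → ¬ (γ ≈ 0#) → Bounded γ b →
      (∀ {i j} → i ∈ is → j ∈ is → ∀ z → β i ≈ β j + γ * z → i ≡ j) →
      length is ℕ.≤ suc (2 ℕ.* K ℕ.* M ℕ.* b) ℕ.^ d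
    index-bound {I} {is} β {γ} {b} u γ≉0 bγ inj = ℕ.*-cancelʳ-≤ (length is) _ (Y ℕ.^ d) {{ℕ.m^n≢0 Y d}} (begin
      length is ℕ.* Y ℕ.^ d ≡⟨ cong (length is ℕ.*_) (≡.sym (length-box d Y)) ⟩
      length is ℕ.* length (box d Y) ≡⟨ ≡.sym (length-cartesianProduct is (box d Y)) ⟩
      length (cartesianProduct is (box d Y)) ≤⟨ count-bounded f B (Unique.cartesianProduct⁺ u (grid-unique (Vec.replicate d Y))) bdd inj′ ⟩
      suc (2 ℕ.* B) ℕ.^ d ≡⟨ cong (ℕ._^ d) (lem r K M b) ⟩
      (suc (2 ℕ.* K ℕ.* M ℕ.* b) ℕ.* Y) ℕ.^ d ≡⟨ ^-distribʳ-* d (suc (2 ℕ.* K ℕ.* M ℕ.* b)) Y ⟩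
      suc (2 ℕ.* K ℕ.* M ℕ.* b) ℕ.^ d ℕ.* Y ℕ.^ d ∎)
      where
      open ℕ.≤-Reasoning
      r = proj₁ (common-bound is β)
      -- This side makes 2 B + 1 an exact multiple of Y, so Y^d cancels and the size of the β leaves
      -- no trace in the bound.
      Y = suc (2 ℕ.* r)
      B = r ℕ.+ K ℕ.* b ℕ.* (Y ℕ.* M)
      lem : ∀ r K M b → suc (2 ℕ.* (r ℕ.+ K ℕ.* b ℕ.* (suc (2 ℕ.* r) ℕ.* M))) ≡ suc (2 ℕ.* K ℕ.* M ℕ.* b) ℕ.* suc (2 ℕ.* r)
      lem = ℕ-solve-∀
      f : I × Vec ℕ d → Carrier
      f (i , a) = β i + γ * w (vec a)
      bdd : ∀ {x} → x ∈ cartesianProduct is (box d Y) → Bounded (f x) B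
      bdd {i , a} m with ∈-cartesianProduct⁻ is (box d Y) m
      ... | i∈ , a∈ = bounded-+ {β i} {γ * w (vec a)} (proj₂ (common-bound is β) i∈)
        (bounded-* {γ} bγ (bounded-w λ s → ℕ.<⇒≤ (∈-box⁻ a∈ s)))
      inj′ : ∀ {x y} → x ∈ cartesianProduct is (box d Y) → y ∈ cartesianProduct is (box d Y) → f x ≈ f y → x ≡ y
      inj′ {i , a} {j , a′} m m′ h with ∈-cartesianProduct⁻ is (box d Y) m | ∈-cartesianProduct⁻ is (box d Y) m′
      ... | i∈ , _ | j∈ , _ with inj i∈ j∈ (w (vec a′) - w (vec a))
              (trans (solve 4 (λ b g w w′ → b := (b :+ g :* w) :- g :* w) ≈-refl (β i) γ (w (vec a)) 0#)
              (trans (+-congʳ h)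
              (solve 4 (λ b g w w′ → (b :+ g :* w′) :- g :* w := b :+ g :* (w′ :- w)) ≈-refl (β j) γ (w (vec a)) (w (vec a′)))))
      ...   | refl = cong (i ,_) (vec-injective (w-injective (cancelˡ γ≉0
              (trans (solve 2 (λ b x → x := (b :+ x) :- b) ≈-refl (β i) (γ * w (vec a)))
              (trans (+-congʳ h) (solve 2 (λ b x → (b :+ x) :- b := x) ≈-refl (β i) (γ * w (vec a′))))))))

-- Binary logarithms and the product of the 1 + 1/q²

module Estimates where

  open Q
  open import Data.List using (_++_)
  import Data.List.Relation.Unary.All as All
  open import Data.List.Relation.Unary.AllPairs using ([]; _∷_)
  open import Relation.Binary.PropositionalEquality hiding ([_])

  private variable
    A : Set

  power-bracket : ∀ {b} → 2 ℕ.≤ b → ∀ {n} → 1 ℕ.≤ n → ∃ λ k → b ℕ.^ k ℕ.≤ n × n ℕ.< b ℕ.^ suc k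
  power-bracket {b} 2≤b {suc zero} _ = 0 , ℕ.≤-refl , ℕ.≤-trans 2≤b (ℕ.≤-reflexive (sym (ℕ.*-identityʳ b)))
  power-bracket {b} 2≤b {suc (suc n)} _ with power-bracket 2≤b {suc n} (s≤s z≤n)
  ... | k , lo , hi with suc (suc n) ℕ.<? b ℕ.^ suc k
  ...   | yes lt = k , ℕ.m≤n⇒m≤1+n lo , lt
  ...   | no ge = suc k , ℕ.≮⇒≥ ge , ℕ.≤-<-trans hi (ℕ.^-monoʳ-< b 2≤b (ℕ.n<1+n (suc k)))

  -- The integral part of the binary logarithm, with value 0 at 0. The powers `ρ ^ λ₂ q` replace the
  -- real powers q^(1-s).
  λ₂ : ℕ → ℕ
  λ₂ zero = 0
  λ₂ (suc n) = proj₁ (power-bracket {2} ℕ.≤-refl {suc n} (s≤s z≤n))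

  2^λ₂≤ : ∀ {n} → 1 ℕ.≤ n → 2 ℕ.^ λ₂ n ℕ.≤ n
  2^λ₂≤ {suc n} _ = proj₁ (proj₂ (power-bracket {2} ℕ.≤-refl {suc n} (s≤s z≤n)))

  <2^1+λ₂ : ∀ n → n ℕ.< 2 ℕ.^ suc (λ₂ n)
  <2^1+λ₂ zero = s≤s z≤n
  <2^1+λ₂ (suc n) = proj₂ (proj₂ (power-bracket {2} ℕ.≤-refl {suc n} (s≤s z≤n)))

  ^-cancelʳ-≤ : ∀ b {m n} → 2 ℕ.≤ b → b ℕ.^ m ℕ.< b ℕ.^ suc n → m ℕ.≤ n
  ^-cancelʳ-≤ b {m} {n} 2≤b lt with m ℕ.≤? n
  ... | yes p = p
  ... | no np = contradiction (ℕ.^-monoʳ-≤ b {{ℕ.>-nonZero (ℕ.<⇒≤ 2≤b)}} (ℕ.≰⇒> np)) (ℕ.<⇒≱ lt)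

  -- For n ≥ 2 the logarithm is at least 1, so 1 + λ₂ n ≤ 2 λ₂ n. As `λ₂` is not additive, a product
  -- of primes is only confined between 2 and 4 raised to the sum of the logarithms.
  ≤4^λ₂ : ∀ {n} → 2 ℕ.≤ n → n ℕ.≤ 4 ℕ.^ λ₂ n
  ≤4^λ₂ {n} 2≤n = ℕ.≤-trans (ℕ.<⇒≤ (<2^1+λ₂ n)) (ℕ.≤-trans (ℕ.^-monoʳ-≤ 2 (ℕ.+-monoˡ-≤ (λ₂ n) pos))
     (ℕ.≤-reflexive (trans (ℕ.^-distribˡ-+-* 2 (λ₂ n) (λ₂ n)) (sq (λ₂ n)))))
    where
    pos : 1 ℕ.≤ λ₂ n
    pos with λ₂ n | <2^1+λ₂ n
    ... | zero | lt = contradiction 2≤n (ℕ.<⇒≱ lt)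
    ... | suc _ | _ = s≤s z≤n
    sq : ∀ k → 2 ℕ.^ k ℕ.* 2 ℕ.^ k ≡ 4 ℕ.^ k
    sq zero = refl
    sq (suc k) = trans (lem (2 ℕ.^ k)) (cong (4 ℕ.*_) (sq k))
      where
      lem : ∀ x → 2 ℕ.* x ℕ.* (2 ℕ.* x) ≡ 4 ℕ.* (x ℕ.* x)
      lem = ℕ-solve-∀

  λ₂≤ : ∀ {n} → 1 ℕ.≤ n → λ₂ n ℕ.≤ n
  λ₂≤ {n} 1≤n = ℕ.≤-trans (lt (λ₂ n)) (2^λ₂≤ 1≤n)
    where
    lt : ∀ k → k ℕ.≤ 2 ℕ.^ k
    lt zero = z≤n
    lt (suc k) = ℕ.≤-trans (ℕ.+-mono-≤ (ℕ.m^n>0 2 k) (lt k)) (ℕ.≤-reflexive (cong (2 ℕ.^ k ℕ.+_) (sym (ℕ.+-identityʳ _))))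

  Σ-⊆ : {f : A → ℚ⁺} {xs ys : List A} → Unique xs → (∀ {x} → x ∈ xs → x ∈ ys) → Σ[ f ] xs ≤ Σ[ f ] ys
  Σ-⊆ {xs = []} _ _ = 0≤ _
  Σ-⊆ {f = f} {x ∷ xs} (x∉ ∷ u) sub with ∈-∃++ (sub (here refl))
  ... | as , bs , refl = begin
      f x + Σ[ f ] xs ≤⟨ +-mono-≤ ≤-refl (Σ-⊆ u sub′) ⟩
      f x + Σ[ f ] (as ++ bs) ≡⟨ cong (f x +_) (Σ-++ f as bs) ⟩
      f x + (Σ[ f ] as + Σ[ f ] bs) ≡⟨ solve 3 (λ a b c → a :+ (b :+ c) := b :+ (a :+ c)) refl (f x) (Σ[ f ] as) (Σ[ f ] bs) ⟩
      Σ[ f ] as + (f x + Σ[ f ] bs) ≡⟨ sym (Σ-++ f as (x ∷ bs)) ⟩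
      Σ[ f ] (as ++ x ∷ bs) ∎
    where
    open ≤-Reasoning
    sub′ : ∀ {y} → y ∈ xs → y ∈ as ++ bs
    sub′ y∈ with ∈-++⁻ as (sub (there y∈))
    ... | inj₁ p = ∈-++⁺ˡ p
    ... | inj₂ (here refl) = contradiction refl (All.lookup x∉ y∈)
    ... | inj₂ (there p) = ∈-++⁺ʳ as p

  Π-++ : (f : A → ℚ⁺) (xs ys : List A) → Π[ f ] (xs ++ ys) ≡ Π[ f ] xs * Π[ f ] ys
  Π-++ f [] ys = sym (*-identityˡ _)
  Π-++ f (x ∷ xs) ys = trans (cong (f x *_) (Π-++ f xs ys)) (sym (*-assoc (f x) _ _))

  Π-⊆ : {f : A → ℚ⁺} {xs ys : List A} → (∀ x → 1# ≤ f x) → Unique xs → (∀ {x} → x ∈ xs → x ∈ ys) → Π[ f ] xs ≤ Π[ f ] ys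
  Π-⊆ {xs = []} {ys} h _ _ = Π-≥1 ys h
  Π-⊆ {f = f} {x ∷ xs} h (x∉ ∷ u) sub with ∈-∃++ (sub (here refl))
  ... | as , bs , refl = begin
      f x * Π[ f ] xs ≤⟨ *-mono-≤ ≤-refl (Π-⊆ h u sub′) ⟩
      f x * Π[ f ] (as ++ bs) ≡⟨ cong (f x *_) (Π-++ f as bs) ⟩
      f x * (Π[ f ] as * Π[ f ] bs) ≡⟨ solve 3 (λ a b c → a :* (b :* c) := b :* (a :* c)) refl (f x) (Π[ f ] as) (Π[ f ] bs) ⟩
      Π[ f ] as * (f x * Π[ f ] bs) ≡⟨ sym (Π-++ f as (x ∷ bs)) ⟩
      Π[ f ] (as ++ x ∷ bs) ∎
    where
    open ≤-Reasoning
    sub′ : ∀ {y} → y ∈ xs → y ∈ as ++ bs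
    sub′ y∈ with ∈-++⁻ as (sub (there y∈))
    ... | inj₁ p = ∈-++⁺ˡ p
    ... | inj₂ (here refl) = contradiction refl (All.lookup x∉ y∈)
    ... | inj₂ (there p) = ∈-++⁺ʳ as p

  countdown : ℕ → List ℕ
  countdown zero = []
  countdown (suc n) = suc (suc n) ∷ countdown n

  ∈-countdown : ∀ n {q} → 2 ℕ.≤ q → q ℕ.≤ suc n → q ∈ countdown n
  ∈-countdown zero 2≤q q≤ = contradiction (ℕ.≤-trans 2≤q q≤) (λ { (s≤s ()) })
  ∈-countdown (suc n) {q} 2≤q q≤ with q ℕ.≟ suc (suc n)
  ... | yes refl = here refl
  ... | no ne = there (∈-countdown n 2≤q (ℕ.≤-pred (ℕ.≤∧≢⇒< q≤ ne)))

  list-bound : (f : A → ℕ) (xs : List A) → ∃ λ b → ∀ {x} → x ∈ xs → f x ℕ.≤ b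
  list-bound f [] = 0 , λ ()
  list-bound f (x ∷ xs) with list-bound f xs
  ... | b , h = f x ℕ.+ b , λ { (here refl) → ℕ.m≤m+n _ b ; (there m) → ℕ.≤-trans (h m) (ℕ.m≤n+m b _) }

  fromℕ-*inv : ∀ {m n} a b → 1 ℕ.≤ m → 1 ℕ.≤ n → a ℕ.* n ℕ.≤ b ℕ.* m → fromℕ a * inv m ≤ fromℕ b * inv n
  fromℕ-*inv {m} {n} a b 1≤m 1≤n h = ≤-from-*fromℕ {n = m} 1≤m (≤-from-*fromℕ {n = n} 1≤n (begin
      fromℕ a * inv m * fromℕ m * fromℕ n ≡⟨ cong (_* fromℕ n) (trans (*-assoc (fromℕ a) (inv m) (fromℕ m)) (trans (cong (fromℕ a *_) (inv*fromℕ 1≤m)) (*-identityʳ _))) ⟩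
      fromℕ a * fromℕ n ≡⟨ sym (fromℕ-* a n) ⟩
      fromℕ (a ℕ.* n) ≤⟨ fromℕ-mono h ⟩
      fromℕ (b ℕ.* m) ≡⟨ fromℕ-* b m ⟩
      fromℕ b * fromℕ m ≡⟨ cong (_* fromℕ m) (sym (trans (*-assoc (fromℕ b) (inv n) (fromℕ n)) (trans (cong (fromℕ b *_) (inv*fromℕ 1≤n)) (*-identityʳ _)))) ⟩
      fromℕ b * inv n * fromℕ n * fromℕ m ≡⟨ solve 4 (λ a b c d → a :* b :* c :* d := a :* b :* d :* c) refl (fromℕ b) (inv n) (fromℕ n) (fromℕ m) ⟩
      fromℕ b * inv n * fromℕ m * fromℕ n ∎))
    where open ≤-Reasoning

  inv-square : ℕ → ℚ⁺
  inv-square q = inv (q ℕ.* q)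

  -- The product telescopes against ∏ k²/((k-1)(k+1)).
  Π-1+inv-square : ∀ n → Π[ (λ q → 1# + inv-square q) ] (countdown n) ≤ fromℕ (2 ℕ.* suc n) * inv (suc (suc n))
  Π-1+inv-square zero = ≤-reflexive (sym (fromℕ*inv {2} (s≤s z≤n)))
  Π-1+inv-square (suc n) = begin
      (1# + inv (y ℕ.* y)) * Π[ (λ q → 1# + inv-square q) ] (countdown n) ≤⟨ *-mono-≤ ≤-refl (Π-1+inv-square n) ⟩
      (1# + inv (y ℕ.* y)) * (fromℕ (2 ℕ.* suc n) * inv y)
        ≡⟨ cong (λ z → (z + inv (y ℕ.* y)) * (fromℕ (2 ℕ.* suc n) * inv y)) (sym (fromℕ*inv {y ℕ.* y} (s≤s z≤n))) ⟩
      (fromℕ (y ℕ.* y) * inv (y ℕ.* y) + inv (y ℕ.* y)) * (fromℕ (2 ℕ.* suc n) * inv y)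
        ≡⟨ solve 4 (λ a b c d → (a :* b :+ b) :* (c :* d) := (con 1 :+ a) :* c :* (b :* d)) refl (fromℕ (y ℕ.* y)) (inv (y ℕ.* y)) (fromℕ (2 ℕ.* suc n)) (inv y) ⟩
      fromℕ (suc (y ℕ.* y)) * fromℕ (2 ℕ.* suc n) * (inv (y ℕ.* y) * inv y)
        ≡⟨ sym (cong₂ _*_ (fromℕ-* (suc (y ℕ.* y)) (2 ℕ.* suc n)) (inv-* (y ℕ.* y) y)) ⟩
      fromℕ (suc (y ℕ.* y) ℕ.* (2 ℕ.* suc n)) * inv (y ℕ.* y ℕ.* y)
        ≤⟨ fromℕ-*inv {y ℕ.* y ℕ.* y} {suc y} (suc (y ℕ.* y) ℕ.* (2 ℕ.* suc n)) (2 ℕ.* y) (s≤s z≤n) (s≤s z≤n)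
            (subst ((suc (y ℕ.* y) ℕ.* (2 ℕ.* suc n)) ℕ.* suc y ℕ.≤_) (lem n) (ℕ.m≤m+n _ 2)) ⟩
      fromℕ (2 ℕ.* y) * inv (suc y) ∎
    where
    open ≤-Reasoning
    y = suc (suc n)
    lem : ∀ n → (suc (suc (suc n) ℕ.* suc (suc n)) ℕ.* (2 ℕ.* suc n)) ℕ.* suc (suc (suc n)) ℕ.+ 2
      ≡ 2 ℕ.* suc (suc n) ℕ.* (suc (suc n) ℕ.* suc (suc n) ℕ.* suc (suc n))
    lem = ℕ-solve-∀

  Π-1+inv-square≤2 : ∀ {qs} → Unique qs → (∀ {q} → q ∈ qs → 2 ℕ.≤ q) → Π[ (λ q → 1# + inv-square q) ] qs ≤ fromℕ 2
  Π-1+inv-square≤2 {qs} u h = begin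
      Π[ (λ q → 1# + inv-square q) ] qs ≤⟨ Π-⊆ (λ q → a≤a+b 1# _) u (λ m → ∈-countdown n (h m) (ℕ.m≤n⇒m≤1+n (proj₂ (list-bound (λ q → q) qs) m))) ⟩
      Π[ (λ q → 1# + inv-square q) ] (countdown n) ≤⟨ Π-1+inv-square n ⟩
      fromℕ (2 ℕ.* suc n) * inv (suc (suc n)) ≤⟨ fromℕ-*inv {suc (suc n)} {1} (2 ℕ.* suc n) 2 (s≤s z≤n) (s≤s z≤n) (ℕ.≤-trans (ℕ.≤-reflexive (ℕ.*-identityʳ _)) (ℕ.*-monoʳ-≤ 2 (ℕ.n≤1+n (suc n)))) ⟩
      fromℕ 2 * inv 1 ≤⟨ *-mono-≤ ≤-refl (inv≤1 1) ⟩
      fromℕ 2 * 1# ≡⟨ *-identityʳ _ ⟩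
      fromℕ 2 ∎
    where
    open ≤-Reasoning
    n = proj₁ (list-bound (λ q → q) qs)

-- Congruences modulo a prime

module Congruences where

  open import Data.Nat.Coprimality using (Coprime; coprime-Bézout; prime⇒coprime)
  import Data.Nat.Coprimality as Coprime
  open import Data.Nat.GCD using (module Bézout)
  open import Data.Nat.Primality using (euclidsLemma; prime⇒nonTrivial; prime⇒irreducible; ¬prime[1])
  open import Data.Integer using (+_; _+_; _*_; _-_; -_; _^_)
  open import Data.Integer.Divisibility.Signed as Signed using (_∣_)
  open import Data.Integer.Tactic.RingSolver using (solve-∀)
  open import Relation.Binary.PropositionalEquality using (_≡_; _≢_; refl; sym; trans; cong; subst)

  infix 4 _∣ᶻ_ _∣ᶻ?_

  _∣ᶻ_ : ℕ → ℤ → Set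
  q ∣ᶻ a = (+ q) ∣ a

  _∣ᶻ?_ : ∀ q a → Dec (q ∣ᶻ a)
  q ∣ᶻ? a = (+ q) Signed.∣? a

  private variable
    q : ℕ
    a b c x y : ℤ

  prime≥2 : Prime q → 2 ℕ.≤ q
  prime≥2 {q} pq = ℕ.nonTrivial⇒n>1 q {{prime⇒nonTrivial pq}}

  prime≥1 : Prime q → 1 ℕ.≤ q
  prime≥1 pq = ℕ.<⇒≤ (prime≥2 pq)

  ∣ᶻ-≡ : a ≡ b → q ∣ᶻ a → q ∣ᶻ b
  ∣ᶻ-≡ refl h = h

  ∣ᶻ-+ : q ∣ᶻ a → q ∣ᶻ b → q ∣ᶻ a + b
  ∣ᶻ-+ = Signed.∣m∣n⇒∣m+n

  ∣ᶻ-- : q ∣ᶻ a → q ∣ᶻ b → q ∣ᶻ a - b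
  ∣ᶻ-- = Signed.∣m∣n⇒∣m-n

  ∣ᶻ-*ˡ : ∀ a → q ∣ᶻ b → q ∣ᶻ a * b
  ∣ᶻ-*ˡ a = Signed.∣n⇒∣m*n a

  ∣ᶻ-*ʳ : ∀ b → q ∣ᶻ a → q ∣ᶻ a * b
  ∣ᶻ-*ʳ b = Signed.∣m⇒∣m*n b

  ∣ᶻ-refl : q ∣ᶻ + q
  ∣ᶻ-refl = Signed.∣-refl

  ∣ᶻ-0 : q ∣ᶻ 0ℤ
  ∣ᶻ-0 = divides 0ℤ refl

  ∣ᶻ-self- : ∀ a → q ∣ᶻ a - a
  ∣ᶻ-self- a = ∣ᶻ-≡ (sym (ℤ.+-inverseʳ a)) ∣ᶻ-0

  ∣ᶻ-sym : ∀ a b → q ∣ᶻ a - b → q ∣ᶻ b - a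
  ∣ᶻ-sym a b h = ∣ᶻ-≡ (lem a b) (∣ᶻ-*ˡ (- 1ℤ) h)
    where
    lem : ∀ a b → (- 1ℤ) * (a - b) ≡ b - a
    lem = solve-∀

  ∣ᶻ-trans : ∀ a b c → q ∣ᶻ a - b → q ∣ᶻ b - c → q ∣ᶻ a - c
  ∣ᶻ-trans a b c h k = ∣ᶻ-≡ (lem a b c) (∣ᶻ-+ h k)
    where
    lem : ∀ a b c → (a - b) + (b - c) ≡ a - c
    lem = solve-∀

  ∣ᶻ-cong-* : ∀ a b x y → q ∣ᶻ a - b → q ∣ᶻ x - y → q ∣ᶻ a * x - b * y
  ∣ᶻ-cong-* a b x y h k = ∣ᶻ-≡ (lem a b x y) (∣ᶻ-+ (∣ᶻ-*ˡ a k) (∣ᶻ-*ˡ y h))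
    where
    lem : ∀ a b x y → a * (x - y) + y * (a - b) ≡ a * x - b * y
    lem = solve-∀

  ∣ᶻ-cong-^ : ∀ a b n → q ∣ᶻ a - b → q ∣ᶻ a ^ n - b ^ n
  ∣ᶻ-cong-^ a b zero h = ∣ᶻ-0
  ∣ᶻ-cong-^ a b (suc n) h = ∣ᶻ-cong-* a b (a ^ n) (b ^ n) h (∣ᶻ-cong-^ a b n h)

  ∣ᶻ-cong : ∀ a b → q ∣ᶻ a - b → q ∣ᶻ b → q ∣ᶻ a
  ∣ᶻ-cong a b h k = ∣ᶻ-≡ (lem a b) (∣ᶻ-+ h k)
    where
    lem : ∀ a b → (a - b) + b ≡ a
    lem = solve-∀

  euclid : Prime q → ∀ a b → q ∣ᶻ a * b → (q ∣ᶻ a) ⊎ (q ∣ᶻ b)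
  euclid pq a b h with euclidsLemma ℤ.∣ a ∣ ℤ.∣ b ∣ pq (subst (_ ℕ.∣_) (ℤ.abs-* a b) (∣⇒∣ᵤ h))
  ... | inj₁ x = inj₁ (∣ᵤ⇒∣ x)
  ... | inj₂ x = inj₂ (∣ᵤ⇒∣ x)

  euclidˡ : Prime q → ¬ (q ∣ᶻ a) → q ∣ᶻ a * b → q ∣ᶻ b
  euclidˡ {a = a} {b} pq n h with euclid pq a b h
  ... | inj₁ p = contradiction p n
  ... | inj₂ p = p

  ∤-* : Prime q → ¬ (q ∣ᶻ a) → ¬ (q ∣ᶻ b) → ¬ (q ∣ᶻ a * b)
  ∤-* pq na nb h = nb (euclidˡ pq na h)

  ∤1 : Prime q → ¬ (q ∣ᶻ 1ℤ)
  ∤1 pq h = ℕ.<⇒≱ (prime≥2 pq) (ℕ.∣⇒≤ (∣⇒∣ᵤ h))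

  ∤-^ : Prime q → ∀ n → ¬ (q ∣ᶻ a) → ¬ (q ∣ᶻ a ^ n)
  ∤-^ pq zero na = ∤1 pq
  ∤-^ pq (suc n) na = ∤-* pq na (∤-^ pq n na)

  ∤-small : ∀ {n} → 1 ℕ.≤ n → n ℕ.< q → ¬ (q ∣ᶻ + n)
  ∤-small {n = suc n} _ n<q h = ℕ.<⇒≱ n<q (ℕ.∣⇒≤ (∣⇒∣ᵤ h))

  ∣ᶻ-difference⇒≡ : ∀ {m n} → m ℕ.< q → n ℕ.< q → q ∣ᶻ + m - + n → m ≡ n
  ∣ᶻ-difference⇒≡ {q} {m} {n} m< n< h = ℤ.+-injective (trans (lem (+ m) (+ n)) (trans (cong (_+ + n) zero′) (ℤ.+-identityˡ (+ n))))
    where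
    lem : ∀ a b → a ≡ (a - b) + b
    lem = solve-∀
    small : ℤ.∣ + m - + n ∣ ℕ.< q
    small = ℕ.≤-<-trans (ℕ.≤-reflexive (cong ℤ.∣_∣ (ℤ.m-n≡m⊖n m n))) (ℕ.≤-<-trans (ℤ.∣m⊝n∣≤m⊔n m n) (ℕ.⊔-lub m< n<))
    zero′ : + m - + n ≡ 0ℤ
    zero′ with ℤ.∣ + m - + n ∣ in eq
    ... | zero = ℤ.∣i∣≡0⇒i≡0 eq
    ... | suc k = contradiction (ℕ.∣⇒≤ (subst (q ℕ.∣_) eq (∣⇒∣ᵤ h))) (ℕ.<⇒≱ (subst (ℕ._< q) eq small))

  prime∤prime : ∀ {r} → Prime q → Prime r → q ≢ r → ¬ (q ∣ᶻ + r)
  prime∤prime pq pr ne h with prime⇒irreducible pr (∣⇒∣ᵤ h)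
  ... | inj₁ refl = ¬prime[1] pq
  ... | inj₂ e = ne e

  residue : ℕ → ℤ → ℕ
  residue zero a = 0
  residue (suc q) a = a ℤ.%ℕ suc q

  residue-< : 1 ℕ.≤ q → ∀ a → residue q a ℕ.< q
  residue-< {suc q} _ a = ℤ.n%ℕd<d a (suc q)

  residue-≡ : 1 ℕ.≤ q → ∀ a → q ∣ᶻ a - + residue q a
  residue-≡ {suc q} _ a = divides (a ℤ./ℕ suc q) (trans (cong (_- + (a ℤ.%ℕ suc q)) (ℤ.a≡a%ℕn+[a/ℕn]*n a (suc q)))
    (lem (+ (a ℤ.%ℕ suc q)) (a ℤ./ℕ suc q) (+ suc q)))
    where
    lem : ∀ r d q → (r + d * q) - r ≡ d * q
    lem = solve-∀

  residue-injective : ∀ a b → 1 ℕ.≤ q → residue q a ≡ residue q b → q ∣ᶻ a - b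
  residue-injective {q} a b 1≤q h = ∣ᶻ-trans a (+ residue q a) b (residue-≡ 1≤q a)
    (subst (λ r → q ∣ᶻ + r - b) (sym h) (∣ᶻ-sym b (+ residue q b) (residue-≡ 1≤q b)))

  coprime-bezout : ∀ {m n} → Coprime m n → ∃ λ u → ∃ λ v → u * + m + v * + n ≡ 1ℤ
  coprime-bezout {m} {n} cop with coprime-Bézout cop
  ... | Bézout.+- x y eq = + x , - (+ y) , trans (cong (λ z → z + (- (+ y)) * + n)
          (trans (sym (ℤ.pos-* x m)) (trans (cong +_ (sym eq)) (trans (ℤ.pos-+ 1 (y ℕ.* n)) (cong (λ z → 1ℤ + z) (ℤ.pos-* y n))))))
          (lem (+ y) (+ n))
    where
    lem : ∀ y n → (1ℤ + y * n) + (- y) * n ≡ 1ℤ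
    lem = solve-∀
  ... | Bézout.-+ x y eq = - (+ x) , + y , trans (cong (λ z → (- (+ x)) * + m + z)
          (trans (sym (ℤ.pos-* y n)) (trans (cong +_ (sym eq)) (trans (ℤ.pos-+ 1 (x ℕ.* m)) (cong (λ z → 1ℤ + z) (ℤ.pos-* x m))))))
          (lem (+ x) (+ m))
    where
    lem : ∀ x m → (- x) * m + (1ℤ + x * m) ≡ 1ℤ
    lem = solve-∀

  inverse-mod : Prime q → ¬ (q ∣ᶻ a) → ∃ λ b → q ∣ᶻ a * b - 1ℤ
  inverse-mod {q} {a} pq na with residue q a in eq | residue-< (prime≥1 pq) a | residue-≡ (prime≥1 pq) a
  ... | zero | _ | h = contradiction (∣ᶻ-≡ (ℤ.+-identityʳ a) h) na
  ... | suc r | r< | h with coprime-bezout (prime⇒coprime pq r<)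
  ...   | u , v , e = v , ∣ᶻ-≡ (lem a v (+ suc r) (+ q) u e) (∣ᶻ-- (∣ᶻ-*ˡ v h) (∣ᶻ-*ˡ u ∣ᶻ-refl))
    where
    lem : ∀ a v r q u → u * q + v * r ≡ 1ℤ → v * (a - r) - u * q ≡ a * v - 1ℤ
    lem a v r q u e = trans (lem′ a v r q u) (cong (λ z → a * v - z) e)
      where
      lem′ : ∀ a v r q u → v * (a - r) - u * q ≡ a * v - (u * q + v * r)
      lem′ = solve-∀

-- Degree-one primes and the Chinese remainder theorem

module Evaluations where

  open Counting hiding (product)
  open Orders
  open Congruences
  open import Data.Integer using (+_)
  open import Data.Integer.Tactic.RingSolver using () renaming (solve-∀ to ℤ-solve-∀)
  open import Data.List.Properties using (length-upTo)
  open import Data.List.Membership.Propositional.Properties using (∈-upTo⁻)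
  open import Data.List.Relation.Unary.All as All using (All; []; _∷_)
  open import Data.List.Relation.Unary.AllPairs using ([]; _∷_)
  open import Relation.Binary.PropositionalEquality as ≡ using (_≡_; _≢_; refl; cong; cong₂; subst)

  %-/-injective : ∀ q .{{_ : NonZero q}} {i j} → i ℕ.% q ≡ j ℕ.% q → i ℕ./ q ≡ j ℕ./ q → i ≡ j
  %-/-injective q {i} {j} e f = ≡.trans (ℕ.m≡m%n+[m/n]*n i q) (≡.trans (cong₂ (λ a b → a ℕ.+ b ℕ.* q) e f) (≡.sym (ℕ.m≡m%n+[m/n]*n j q)))

  -- `ev t` substitutes t for X in a representative. Compatibility with `≈` is not among the fields:
  -- substitution descends to the ring only modulo q, and only for t that are roots modulo q.
  -- `Valid q t` records this.
  record Evaluation (O : Order) : Set where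
    open Order O
    field
      ev : ℕ → Carrier → ℤ
      ev-+ : ∀ t x y → ev t (x + y) ≡ ev t x ℤ.+ ev t y
      ev-* : ∀ t x y → ev t (x * y) ≡ ev t x ℤ.* ev t y
      ev-neg : ∀ t x → ev t (- x) ≡ ℤ.- ev t x
      ev-ι : ∀ t c → ev t (ι c) ≡ c
      X : Carrier
      ev-X : ∀ t → ev t X ≡ + t

  module ResidueSystems (O : Order) (E : Evaluation O) where
    open Order O
    open Evaluation E

    Valid : ℕ → ℕ → Set
    Valid q t = ∀ x → x ≈ 0# → q ∣ᶻ ev t x

    -- For valid and distinct t this is the index of the intersection of the ideals (q, X - t), each
    -- of index q.
    ∏^ : (ℕ → List ℕ) → List ℕ → ℕ
    ∏^ T [] = 1
    ∏^ T (q ∷ qs) = q ℕ.^ length (T q) ℕ.* ∏^ T qs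

    Agree : ℕ → List ℕ → Carrier → Carrier → Set
    Agree q ts x y = ∀ {t} → t ∈ ts → q ∣ᶻ ev t x ℤ.- ev t y

    -- Newton interpolation: the base-q digits of i are the coefficients of 1, X - t, (X - t)(X -
    -- t′), and so on. Evaluation at t reads off the lowest digit; at another point s the factor s -
    -- t is a unit modulo q, so the remaining digits follow by induction.
    local-system : ∀ {q} → Prime q → ∀ ts → Unique ts → (∀ {t} → t ∈ ts → t ℕ.< q) →
      ∃ λ (β : ℕ → Carrier) → ∀ {i j} → i ℕ.< q ℕ.^ length ts → j ℕ.< q ℕ.^ length ts → Agree q ts (β i) (β j) → i ≡ j
    local-system pq [] _ _ = (λ _ → 0#) , λ i< j< _ → ≡.trans (ℕ.n<1⇒n≡0 i<) (≡.sym (ℕ.n<1⇒n≡0 j<))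
    local-system {q} pq (t ∷ ts) (t∉ ∷ u) bd with local-system pq ts u (λ m → bd (there m))
    ... | β , β-inj = β′ , inj
      where
      instance
        nz : NonZero q
        nz = prime⇒nonZero pq
      β′ : ℕ → Carrier
      β′ i = ι (+ (i ℕ.% q)) + (X - ι (+ t)) * β (i ℕ./ q)
      ev-β′ : ∀ s i → ev s (β′ i) ≡ + (i ℕ.% q) ℤ.+ (+ s ℤ.- + t) ℤ.* ev s (β (i ℕ./ q))
      ev-β′ s i = ≡.trans (ev-+ s _ _) (cong₂ ℤ._+_ (ev-ι s _) (≡.trans (ev-* s _ _)
        (cong (ℤ._* ev s (β (i ℕ./ q))) (≡.trans (ev-+ s X _) (cong₂ ℤ._+_ (ev-X s) (≡.trans (ev-neg s _) (cong ℤ.-_ (ev-ι s _))))))))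
      inj : ∀ {i j} → i ℕ.< q ℕ.^ suc (length ts) → j ℕ.< q ℕ.^ suc (length ts) → Agree q (t ∷ ts) (β′ i) (β′ j) → i ≡ j
      inj {i} {j} i< j< ag = %-/-injective q mod (β-inj (ℕ.m<n*o⇒m/o<n (sw i<)) (ℕ.m<n*o⇒m/o<n (sw j<)) ag′)
        where
        sw : ∀ {i} → i ℕ.< q ℕ.* q ℕ.^ length ts → i ℕ.< q ℕ.^ length ts ℕ.* q
        sw {i} = subst (i ℕ.<_) (ℕ.*-comm q (q ℕ.^ length ts))
        lem₁ : ∀ a b t x y → (a ℤ.+ (t ℤ.- t) ℤ.* x) ℤ.- (b ℤ.+ (t ℤ.- t) ℤ.* y) ≡ a ℤ.- b
        lem₁ = ℤ-solve-∀
        lem₂ : ∀ a s t x y → (a ℤ.+ (s ℤ.- t) ℤ.* x) ℤ.- (a ℤ.+ (s ℤ.- t) ℤ.* y) ≡ (s ℤ.- t) ℤ.* (x ℤ.- y)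
        lem₂ = ℤ-solve-∀
        mod : i ℕ.% q ≡ j ℕ.% q
        mod = ∣ᶻ-difference⇒≡ (ℕ.m%n<n i q) (ℕ.m%n<n j q)
          (∣ᶻ-≡ (≡.trans (cong₂ ℤ._-_ (ev-β′ t i) (ev-β′ t j)) (lem₁ (+ (i ℕ.% q)) (+ (j ℕ.% q)) (+ t) _ _)) (ag (here refl)))
        ag′ : Agree q ts (β (i ℕ./ q)) (β (j ℕ./ q))
        ag′ {s} s∈ = euclidˡ pq (λ h → All.lookup t∉ s∈ (≡.sym (∣ᶻ-difference⇒≡ (bd (there s∈)) (bd (here refl)) h)))
          (∣ᶻ-≡ (≡.trans (cong₂ ℤ._-_ (ev-β′ s i) (≡.trans (ev-β′ s j) (cong (λ r → + r ℤ.+ (+ s ℤ.- + t) ℤ.* ev s (β (j ℕ./ q))) (≡.sym mod))))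
             (lem₂ (+ (i ℕ.% q)) (+ s) (+ t) _ _)) (ag (there s∈)))

    -- Chinese remainder theorem: the systems for different primes combine.
    global-system : ∀ (T : ℕ → List ℕ) qs → Unique qs → All Prime qs →
      (∀ {q} → q ∈ qs → Unique (T q) × (∀ {t} → t ∈ T q → t ℕ.< q)) →
      ∃ λ (β : ℕ → Carrier) → ∀ {i j} → i ℕ.< ∏^ T qs → j ℕ.< ∏^ T qs →
        (∀ {q} → q ∈ qs → Agree q (T q) (β i) (β j)) → i ≡ j
    global-system T [] _ _ _ = (λ _ → 0#) , λ i< j< _ → ≡.trans (ℕ.n<1⇒n≡0 i<) (≡.sym (ℕ.n<1⇒n≡0 j<))
    global-system T (q ∷ qs) (q∉ ∷ u) (pq ∷ pqs) hT
      with local-system pq (T q) (proj₁ (hT (here refl))) (proj₂ (hT (here refl)))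
         | global-system T qs u pqs (λ m → hT (there m))
    ... | α , α-inj | β , β-inj = γ , inj
      where
      Q = q ℕ.^ length (T q)
      instance
        nz : NonZero Q
        nz = ℕ.m^n≢0 q (length (T q)) {{prime⇒nonZero pq}}
      P : ℕ
      P = List.foldr ℕ._*_ 1 qs
      P-∣ : ∀ {r} rs → r ∈ rs → r ∣ᶻ + List.foldr ℕ._*_ 1 rs
      P-∣ (r ∷ rs) (here refl) = ∣ᶻ-≡ (≡.sym (ℤ.pos-* r _)) (∣ᶻ-*ʳ _ ∣ᶻ-refl)
      P-∣ (r ∷ rs) (there m) = ∣ᶻ-≡ (≡.sym (ℤ.pos-* r _)) (∣ᶻ-*ˡ (+ r) (P-∣ rs m))
      P-∤ : ∀ {rs} → All Prime rs → All (q ≢_) rs → ¬ (q ∣ᶻ + List.foldr ℕ._*_ 1 rs)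
      P-∤ [] [] = ∤1 pq
      P-∤ {r ∷ rs} (p ∷ ps) (n ∷ ns) h = ∤-* pq (prime∤prime pq p n) (P-∤ ps ns) (∣ᶻ-≡ (ℤ.pos-* r _) h)
      γ : ℕ → Carrier
      γ i = ι (+ P) * α (i ℕ.% Q) + ι (+ q) * β (i ℕ./ Q)
      ev-γ : ∀ t i → ev t (γ i) ≡ + P ℤ.* ev t (α (i ℕ.% Q)) ℤ.+ + q ℤ.* ev t (β (i ℕ./ Q))
      ev-γ t i = ≡.trans (ev-+ t _ _) (cong₂ ℤ._+_ (≡.trans (ev-* t _ _) (cong (ℤ._* ev t (α (i ℕ.% Q))) (ev-ι t _)))
        (≡.trans (ev-* t _ _) (cong (ℤ._* ev t (β (i ℕ./ Q))) (ev-ι t _))))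
      lem : ∀ P q a b x y → (P ℤ.* a ℤ.+ q ℤ.* x) ℤ.- (P ℤ.* b ℤ.+ q ℤ.* y) ≡ P ℤ.* (a ℤ.- b) ℤ.+ q ℤ.* (x ℤ.- y)
      lem = ℤ-solve-∀
      lem₂ : ∀ a b → (a ℤ.+ b) ℤ.- b ≡ a
      lem₂ = ℤ-solve-∀
      lem₃ : ∀ a b → (a ℤ.+ b) ℤ.- a ≡ b
      lem₃ = ℤ-solve-∀
      difference : ∀ t i j → ev t (γ i) ℤ.- ev t (γ j) ≡
        + P ℤ.* (ev t (α (i ℕ.% Q)) ℤ.- ev t (α (j ℕ.% Q))) ℤ.+ + q ℤ.* (ev t (β (i ℕ./ Q)) ℤ.- ev t (β (j ℕ./ Q)))
      difference t i j = ≡.trans (cong₂ ℤ._-_ (ev-γ t i) (ev-γ t j)) (lem (+ P) (+ q) _ _ _ _)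
      inj : ∀ {i j} → i ℕ.< ∏^ T (q ∷ qs) → j ℕ.< ∏^ T (q ∷ qs) → (∀ {r} → r ∈ q ∷ qs → Agree r (T r) (γ i) (γ j)) → i ≡ j
      inj {i} {j} i< j< ag = %-/-injective Q
        (α-inj (ℕ.m%n<n i Q) (ℕ.m%n<n j Q) λ {t} t∈ → euclidˡ pq (P-∤ pqs q∉)
          (∣ᶻ-≡ (lem₂ (+ P ℤ.* _) (+ q ℤ.* _)) (∣ᶻ-- (∣ᶻ-≡ (difference t i j) (ag (here refl) t∈)) (∣ᶻ-*ʳ _ ∣ᶻ-refl))))
        (β-inj (ℕ.m<n*o⇒m/o<n (sw i<)) (ℕ.m<n*o⇒m/o<n (sw j<)) λ {r} r∈ {t} t∈ →
          euclidˡ (All.lookup pqs r∈) (prime∤prime (All.lookup pqs r∈) pq (λ { refl → All.lookup q∉ r∈ refl }))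
          (∣ᶻ-≡ (lem₃ (+ P ℤ.* _) (+ q ℤ.* _)) (∣ᶻ-- (∣ᶻ-≡ (difference t i j) (ag (there r∈) t∈)) (∣ᶻ-*ʳ _ (P-∣ qs r∈)))))
        where
        sw : ∀ {i} → i ℕ.< Q ℕ.* ∏^ T qs → i ℕ.< ∏^ T qs ℕ.* Q
        sw {i} = subst (i ℕ.<_) (ℕ.*-comm Q (∏^ T qs))

    -- γ lies in all the ideals (q, X - t), so elements that are distinct modulo their intersection
    -- are distinct modulo γ, and the index of γR is bounded by the size of γ. A short element
    -- therefore lies in few degree-one primes.
    ∏^-bound : ∀ (T : ℕ → List ℕ) qs → Unique qs → All Prime qs →
      (∀ {q} → q ∈ qs → Unique (T q) × (∀ {t} → t ∈ T q → t ℕ.< q × Valid q t)) →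
      ∀ {γ b} → ¬ (γ ≈ 0#) → Bounded γ b → (∀ {q} → q ∈ qs → ∀ {t} → t ∈ T q → q ∣ᶻ ev t γ) →
      ∏^ T qs ℕ.≤ suc (2 ℕ.* K ℕ.* M ℕ.* b) ℕ.^ d
    ∏^-bound T qs u pqs hT {γ} γ≉0 bγ van with global-system T qs u pqs (λ m → proj₁ (hT m) , λ t∈ → proj₁ (proj₂ (hT m) t∈))
    ... | β , inj = subst (ℕ._≤ _) (length-upTo (∏^ T qs)) (index-bound {is = upTo (∏^ T qs)} β (Unique.upTo⁺ _) γ≉0 bγ λ {i} {j} i∈ j∈ z h →
        inj (∈-upTo⁻ i∈) (∈-upTo⁻ j∈) λ {q} q∈ {t} t∈ →
          ∣ᶻ-≡ (lem (ev t (β i)) (ev t (β j)) (ev t γ) (ev t z)) (∣ᶻ-+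
            (∣ᶻ-≡ (≡.trans (ev-+ t (β i) _) (cong₂ ℤ._+_ {x = ev t (β i)} refl (≡.trans (ev-neg t _)
                (cong ℤ.-_ (≡.trans (ev-+ t _ _) (cong₂ ℤ._+_ {x = ev t (β j)} refl (ev-* t γ z)))))))
              (proj₂ (proj₂ (hT q∈) t∈) _ (≈⇒-≈0 h)))
            (∣ᶻ-*ʳ (ev t z) (van q∈ t∈))))
      where
      lem : ∀ a b g z → (a ℤ.+ ℤ.- (b ℤ.+ g ℤ.* z)) ℤ.+ g ℤ.* z ≡ a ℤ.- b
      lem = ℤ-solve-∀

-- Upper bound for the Euler product of the degree-one primes

module EulerProducts where

  open Counting using (box; length-box; grid-unique; ∈-box⁺; ∈-box⁻; collision; grid; length-grid; ∈-grid⁺; ^-distribʳ-*)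
  open Q
  open Orders
  open Estimates
  open Congruences using (_∣ᶻ_; _∣ᶻ?_; residue; residue-<; residue-injective; prime≥2; prime≥1; ∣ᶻ-≡)
  open Evaluations
  open import Data.Integer.Tactic.RingSolver using () renaming (solve-∀ to ℤ-solve-∀)
  open import Data.Vec using (lookup)
  open import Data.List using (_++_; map; concatMap)
  open import Data.List.Relation.Unary.All as All using (All; []; _∷_)
  open import Data.List.Properties using (length-filter)
  open import Relation.Binary.PropositionalEquality hiding ([_])

  -- A choice encodes a product of degree-one primes (q, t) with at most one t above each q, and
  -- `mass` is its norm. These are the terms in the expansion of the Euler product, see `Σ-choices`.
  choices : (ℕ → List ℕ) → List ℕ → List (List (ℕ × ℕ))
  choices rt [] = [] ∷ []
  choices rt (q ∷ qs) = choices rt qs ++ concatMap (λ t → map ((q , t) ∷_) (choices rt qs)) (rt q)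

  Σ-choices : ∀ rt (f : ℕ × ℕ → ℚ⁺) qs → Σ[ (λ pt → Π[ f ] pt) ] (choices rt qs) ≡ Π[ (λ q → 1# + Σ[ (λ t → f (q , t)) ] (rt q)) ] qs
  Σ-choices rt f [] = +-identityʳ 1#
  Σ-choices rt f (q ∷ qs) = begin
      Σ[ Π[ f ] ] (choices rt qs ++ concatMap (λ t → map ((q , t) ∷_) (choices rt qs)) (rt q))
        ≡⟨ Σ-++ Π[ f ] (choices rt qs) _ ⟩
      S + Σ[ Π[ f ] ] (concatMap (λ t → map ((q , t) ∷_) (choices rt qs)) (rt q))
        ≡⟨ cong (S +_) (trans (Σ-concatMap Π[ f ] _ (rt q)) (trans (Σ-cong (rt q) λ t → trans (Σ-map Π[ f ] ((q , t) ∷_) (choices rt qs))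
             (trans (Σ-scale (f (q , t)) Π[ f ] (choices rt qs)) (*-comm _ S))) (Σ-scale S _ (rt q)))) ⟩
      S + S * Σ[ (λ t → f (q , t)) ] (rt q)
        ≡⟨ solve 2 (λ s u → s :+ s :* u := (con 1 :+ u) :* s) refl S (Σ[ (λ t → f (q , t)) ] (rt q)) ⟩
      (1# + Σ[ (λ t → f (q , t)) ] (rt q)) * S ≡⟨ cong ((1# + Σ[ (λ t → f (q , t)) ] (rt q)) *_) (Σ-choices rt f qs) ⟩
      (1# + Σ[ (λ t → f (q , t)) ] (rt q)) * Π[ (λ q → 1# + Σ[ (λ t → f (q , t)) ] (rt q)) ] qs ∎
    where
    open ≡-Reasoning
    S = Σ[ Π[ f ] ] (choices rt qs)

  choices⁻ : ∀ rt qs {pt} → pt ∈ choices rt qs → All (λ (q , t) → q ∈ qs × t ∈ rt q) pt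
  choices⁻ rt [] (here refl) = []
  choices⁻ rt (q ∷ qs) m with ∈-++⁻ (choices rt qs) m
  ... | inj₁ m = All.map (λ (a , b) → there a , b) (choices⁻ rt qs m)
  ... | inj₂ m with ∈-concatMap⁻′ {xs = rt q} m
    where
    ∈-concatMap⁻′ : ∀ {A B : Set} {f : A → List B} {xs y} → y ∈ concatMap f xs → ∃ λ x → x ∈ xs × y ∈ f x
    ∈-concatMap⁻′ {f = f} {x ∷ xs} m with ∈-++⁻ (f x) m
    ... | inj₁ p = x , here refl , p
    ... | inj₂ p = let (z , z∈ , p′) = ∈-concatMap⁻′ {f = f} {xs} p in z , there z∈ , p′
  ...   | t , t∈ , m′ with ∈-map⁻ ((q , t) ∷_) m′
  ...     | pt , pt∈ , refl = (here refl , t∈) ∷ All.map (λ (a , b) → there a , b) (choices⁻ rt qs pt∈)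

  mass : List (ℕ × ℕ) → ℕ
  mass [] = 1
  mass ((q , t) ∷ pt) = q ℕ.* mass pt

  fromℕ-mass² : ∀ pt → fromℕ (mass pt ℕ.* mass pt) ≡ Π[ (λ (q , t) → fromℕ (q ℕ.* q)) ] pt
  fromℕ-mass² [] = fromℕ-1
  fromℕ-mass² ((q , t) ∷ pt) = trans (cong fromℕ (ℕ.[m*n]*[o*p]≡[m*o]*[n*p] q (mass pt) q (mass pt)))
    (trans (fromℕ-* (q ℕ.* q) _) (cong (fromℕ (q ℕ.* q) *_) (fromℕ-mass² pt)))

  mass≥1 : ∀ {pt} → All (λ (q , t) → 1 ℕ.≤ q) pt → 1 ℕ.≤ mass pt
  mass≥1 [] = ℕ.≤-refl
  mass≥1 (p ∷ ps) = ℕ.*-mono-≤ p (mass≥1 ps)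

  module _ (ρ : ℚ⁺) where
    -- A rational substitute for q^(-s), with s > 1 governed by ρ < 1.
    ζ-weight : ℕ → ℚ⁺
    ζ-weight q = ρ ^ λ₂ q * inv q

    height : List (ℕ × ℕ) → ℕ
    height [] = 0
    height ((q , t) ∷ pt) = λ₂ q ℕ.+ height pt

    Π-weight : ∀ pt → Π[ (λ (q , t) → ζ-weight q) ] pt ≡ ρ ^ height pt * inv (mass pt)
    Π-weight [] = sym (trans (*-identityˡ _) inv-1)
    Π-weight ((q , t) ∷ pt) = trans (cong (ζ-weight q *_) (Π-weight pt))
      (trans (solve 4 (λ a b c d → a :* b :* (c :* d) := a :* c :* (b :* d)) refl (ρ ^ λ₂ q) (inv q) (ρ ^ height pt) (inv (mass pt)))
        (sym (cong₂ _*_ (^-+ ρ (λ₂ q) (height pt)) (inv-* q (mass pt)))))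

    mass≤4^height : ∀ {pt} → All (λ (q , t) → 2 ℕ.≤ q) pt → mass pt ℕ.≤ 4 ℕ.^ height pt
    mass≤4^height [] = ℕ.≤-refl
    mass≤4^height {(q , t) ∷ pt} (p ∷ ps) = ℕ.≤-trans (ℕ.*-mono-≤ (≤4^λ₂ p) (mass≤4^height ps))
      (ℕ.≤-reflexive (sym (ℕ.^-distribˡ-+-* 4 (λ₂ q) (height pt))))

  -- Equality holds at τ = 1, which dictates the factor 1 + 1/q²; for larger τ the power q^(2τ) wins
  -- by far.
  root-count-bound : ∀ q τ → 2 ℕ.≤ q → (1 ℕ.+ q ℕ.* q ℕ.* τ) ℕ.* (q ℕ.* q) ℕ.≤ (q ℕ.* q ℕ.+ 1) ℕ.* (q ℕ.^ τ ℕ.* q ℕ.^ τ)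
  root-count-bound q zero _ = ℕ.≤-trans (ℕ.≤-reflexive (lem (q ℕ.* q))) (ℕ.≤-trans (ℕ.m≤m+n (q ℕ.* q) 1) (ℕ.≤-reflexive (sym (ℕ.*-identityʳ (q ℕ.* q ℕ.+ 1)))))
    where
    lem : ∀ s → (1 ℕ.+ s ℕ.* 0) ℕ.* s ≡ s
    lem = ℕ-solve-∀
  root-count-bound q (suc zero) _ = ℕ.≤-reflexive (lem q)
    where
    lem : ∀ q → (1 ℕ.+ q ℕ.* q ℕ.* 1) ℕ.* (q ℕ.* q) ≡ (q ℕ.* q ℕ.+ 1) ℕ.* ((q ℕ.* 1) ℕ.* (q ℕ.* 1))
    lem = ℕ-solve-∀
  root-count-bound q (suc (suc k)) 2≤q = begin
      (1 ℕ.+ q ℕ.* q ℕ.* suc (suc k)) ℕ.* (q ℕ.* q) ≤⟨ ℕ.*-monoˡ-≤ (q ℕ.* q) (ℕ.+-monoˡ-≤ _ (ℕ.*-mono-≤ 1≤q 1≤q)) ⟩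
      (q ℕ.* q ℕ.+ q ℕ.* q ℕ.* suc (suc k)) ℕ.* (q ℕ.* q) ≡⟨ cong (ℕ._* (q ℕ.* q)) (sym (ℕ.*-suc (q ℕ.* q) (2 ℕ.+ k))) ⟩
      (q ℕ.* q ℕ.* (3 ℕ.+ k)) ℕ.* (q ℕ.* q) ≤⟨ ℕ.*-mono-≤ (ℕ.*-monoʳ-≤ (q ℕ.* q) (four k)) (ℕ.m≤m+n (q ℕ.* q) 1) ⟩
      (q ℕ.* q ℕ.* (q ℕ.^ suc k ℕ.* q ℕ.^ suc k)) ℕ.* (q ℕ.* q ℕ.+ 1) ≡⟨ lem q (q ℕ.^ suc k) ⟩
      (q ℕ.* q ℕ.+ 1) ℕ.* ((q ℕ.* q ℕ.^ suc k) ℕ.* (q ℕ.* q ℕ.^ suc k)) ∎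
    where
    open ℕ.≤-Reasoning
    1≤q = ℕ.<⇒≤ 2≤q
    lem : ∀ q x → (q ℕ.* q ℕ.* (x ℕ.* x)) ℕ.* (q ℕ.* q ℕ.+ 1) ≡ (q ℕ.* q ℕ.+ 1) ℕ.* ((q ℕ.* x) ℕ.* (q ℕ.* x))
    lem = ℕ-solve-∀
    four : ∀ k → 3 ℕ.+ k ℕ.≤ q ℕ.^ suc k ℕ.* q ℕ.^ suc k
    four zero = ℕ.≤-trans (ℕ.n≤1+n 3) (ℕ.*-mono-≤ (ℕ.≤-trans 2≤q (ℕ.≤-reflexive (sym (ℕ.*-identityʳ q)))) (ℕ.≤-trans 2≤q (ℕ.≤-reflexive (sym (ℕ.*-identityʳ q)))))
    four (suc k) = begin
      4 ℕ.+ k ≤⟨ ℕ.+-monoˡ-≤ (3 ℕ.+ k) {1} {3 ℕ.+ k} (s≤s z≤n) ⟩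
      (3 ℕ.+ k) ℕ.+ (3 ℕ.+ k) ≡⟨ cong ((3 ℕ.+ k) ℕ.+_) (sym (ℕ.+-identityʳ (3 ℕ.+ k))) ⟩
      2 ℕ.* (3 ℕ.+ k) ≤⟨ ℕ.*-mono-≤ 2≤q (four k) ⟩
      q ℕ.* (x ℕ.* x) ≤⟨ ℕ.*-monoʳ-≤ q (ℕ.≤-trans (ℕ.≤-reflexive (sym (ℕ.*-identityˡ _))) (ℕ.*-monoˡ-≤ (x ℕ.* x) 1≤q)) ⟩
      q ℕ.* (q ℕ.* (x ℕ.* x)) ≡⟨ lem′ q x ⟩
      (q ℕ.* x) ℕ.* (q ℕ.* x) ∎
      where
      x = q ℕ.^ suc k
      lem′ : ∀ q x → q ℕ.* (q ℕ.* (x ℕ.* x)) ≡ (q ℕ.* x) ℕ.* (q ℕ.* x)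
      lem′ = ℕ-solve-∀

  module UpperBound (O : Order) (E : Evaluation O) (1≤d : 1 ℕ.≤ Order.d O) where
    open Order O using (Carrier; d; M; K; Bounded; bounded-w; bounded-cong; bounded-≤; w; w-injective; w-sub; vec; vec-injective) renaming (_≈_ to _≈ᴼ_; _-_ to _-ᴼ_; 0# to 0ᴼ)
    module O = Order O
    open Evaluation E
    open ResidueSystems O E

    RootLists : (ℕ → List ℕ) → List ℕ → Set
    RootLists rt qs = ∀ {q} → q ∈ qs → Unique (rt q) × (∀ {t} → t ∈ rt q → t ℕ.< q × Valid q t)

    ev-sub : ∀ t x y → ev t (x -ᴼ y) ≡ ev t x ℤ.- ev t y
    ev-sub t x y = trans (ev-+ t x _) (cong (λ z → ev t x ℤ.+ z) (ev-neg t y))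

    -- Signed coefficient vectors are stored with offset Y, as natural vectors in a box of side 2 Y
    -- + 1.
    shift : ℕ → Vec ℕ d → Fin d → ℤ
    shift Y c s = ℤ.+ lookup c s ℤ.- ℤ.+ Y

    -- Thue's argument: the Y^d vectors of the box have only `mass pt` residue labels at the places
    -- of pt, so two labels agree, and the difference is a nonzero short element of the product
    -- ideal.
    short : ∀ Y (pt : List (ℕ × ℕ)) → All (λ (q , t) → 1 ℕ.≤ q × Valid q t) pt → mass pt ℕ.< Y ℕ.^ d →
      ∃ λ c → c ∈ box d (suc (2 ℕ.* Y)) × ¬ (w (shift Y c) ≈ᴼ 0ᴼ) × All (λ (q , t) → q ∣ᶻ ev t (w (shift Y c))) pt
    short Y pt ok lt with collision (Vec.≡-dec ℕ._≟_) label {box d Y} {grid (Vec.map proj₁ (Vec.fromList pt))} (grid-unique (Vec.replicate d Y))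
        (λ {a} _ → ∈-grid⁺ {ns = Vec.map proj₁ (Vec.fromList pt)} (label-< ok a))
        (subst₂ ℕ._<_ (sym (trans (length-grid (Vec.map proj₁ (Vec.fromList pt))) (product-mass pt))) (sym (length-box d Y)) lt)
      where
      residues : Vec ℕ d → ℕ × ℕ → ℕ
      residues a (q , t) = residue q (ev t (w (vec a)))
      label : Vec ℕ d → Vec ℕ (length pt)
      label a = Vec.map (residues a) (Vec.fromList pt)
      label-< : ∀ {pt} → All (λ (q , t) → 1 ℕ.≤ q × Valid q t) pt → ∀ a i →
        lookup (Vec.map (residues a) (Vec.fromList pt)) i ℕ.< lookup (Vec.map proj₁ (Vec.fromList pt)) i
      label-< ((p , _) ∷ ps) a Fin.zero = residue-< p _
      label-< (p ∷ ps) a (Fin.suc i) = label-< ps a i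
      product-mass : ∀ pt → Counting.product (Vec.map proj₁ (Vec.fromList pt)) ≡ mass pt
      product-mass [] = refl
      product-mass ((q , t) ∷ pt) = cong (q ℕ.*_) (product-mass pt)
    ... | a , a′ , a∈ , a′∈ , a≢ , e = c , ∈-box⁺ c< , nonzero , vanish ok e
      where
      c : Vec ℕ d
      c = Vec.tabulate λ s → lookup a s ℕ.+ Y ℕ.∸ lookup a′ s
      c-≡ : ∀ s → shift Y c s ≡ vec a s ℤ.- vec a′ s
      c-≡ s = trans (cong (λ z → ℤ.+ z ℤ.- ℤ.+ Y) (Vec.lookup∘tabulate _ s))
        (trans (cong (ℤ._- ℤ.+ Y) (trans (sym (ℤ.⊖-≥ (ℕ.≤-trans (ℕ.<⇒≤ (∈-box⁻ a′∈ s)) (ℕ.m≤n+m Y _))))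
          (trans (sym (ℤ.m-n≡m⊖n (lookup a s ℕ.+ Y) (lookup a′ s))) (cong (ℤ._- vec a′ s) (ℤ.pos-+ (lookup a s) Y)))))
        (lem (vec a s) (ℤ.+ Y) (vec a′ s)))
        where
        lem : ∀ a y b → a ℤ.+ y ℤ.- b ℤ.- y ≡ a ℤ.- b
        lem = ℤ-solve-∀
      c< : ∀ s → lookup c s ℕ.< suc (2 ℕ.* Y)
      c< s = s≤s (subst (ℕ._≤ 2 ℕ.* Y) (sym (Vec.lookup∘tabulate _ s)) (ℕ.≤-trans (ℕ.m∸n≤m _ (lookup a′ s))
        (ℕ.≤-trans (ℕ.+-monoˡ-≤ Y (ℕ.<⇒≤ (∈-box⁻ a∈ s))) (ℕ.≤-reflexive (cong (Y ℕ.+_) (sym (ℕ.+-identityʳ Y)))))))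
      w-c : w (shift Y c) ≈ᴼ w (vec a) -ᴼ w (vec a′)
      w-c = O.trans (O.π-faithful λ s → trans (O.π-w _ s) (trans (cong (ℤ._* ℤ.+ M) (c-≡ s)) (sym (O.π-w _ s)))) (O.sym (w-sub (vec a) (vec a′)))
      nonzero : ¬ (w (shift Y c) ≈ᴼ 0ᴼ)
      nonzero h = a≢ (vec-injective (w-injective (O.-‿≈0 (O.trans (O.sym w-c) h))))
      vanish : ∀ {pt} → All (λ (q , t) → 1 ℕ.≤ q × Valid q t) pt →
        Vec.map (λ (q , t) → residue q (ev t (w (vec a)))) (Vec.fromList pt) ≡ Vec.map (λ (q , t) → residue q (ev t (w (vec a′)))) (Vec.fromList pt) →
        All (λ (q , t) → q ∣ᶻ ev t (w (shift Y c))) pt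
      vanish [] _ = []
      vanish {(q , t) ∷ pt} ((p , v) ∷ ps) e =
        ∣ᶻ-≡ (lem (ev t (w (shift Y c))) _) (Congruences.∣ᶻ-+ (∣ᶻ-≡ (trans (ev-sub t _ _) (cong (λ z → ev t (w (shift Y c)) ℤ.- z) (ev-sub t _ _))) (v _ (O.≈⇒-≈0 w-c)))
          (residue-injective _ _ p (Vec.∷-injectiveˡ e))) ∷
        vanish ps (Vec.∷-injectiveʳ e)
        where
        lem : ∀ a b → (a ℤ.- b) ℤ.+ b ≡ a
        lem = ℤ-solve-∀

    -- 3^d compares the number of short elements with Y^d, the 2 bounds the product of the 1 + 1/q²,
    -- and c₁² is the square of the index bound for a short element.
    constant : ℕ
    constant = 3 ℕ.^ d ℕ.* 2 ℕ.* (c₁ ℕ.* c₁)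
      where c₁ = suc (2 ℕ.* K ℕ.* M ℕ.* M) ℕ.^ d

    -- A d-th power, so that the thresholds base^(k+1) are exactly the Y^d with Y = 4^(k+1); and at
    -- least 4, so that mass ≥ base^k forces height ≥ k.
    base : ℕ
    base = 4 ℕ.^ d

    base≥4 : 4 ℕ.≤ base
    base≥4 = ℕ.≤-trans (ℕ.≤-reflexive (sym (ℕ.^-identityʳ 4))) (ℕ.^-monoʳ-≤ 4 1≤d)

    module _ (rt : ℕ → List ℕ) (qs : List ℕ) (u : Unique qs) (pqs : All Prime qs) (ok : RootLists rt qs) where

      hit : Carrier → ℕ × ℕ → ℚ⁺
      hit γ (q , t) = fromℕ (q ℕ.* q) * indicator (q ∣ᶻ? ev t γ)

      -- The ideals containing γ are weighted by the square of their norm. The largest of them then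
      -- dominates: the sum is at most the squared index of γ times the product of the 1 + 1/q², and
      -- the number of divisors of γ costs only a constant.
      count-multiples : ∀ {γ b} → ¬ (γ ≈ᴼ 0ᴼ) → Bounded γ b →
        Σ[ (λ pt → Π[ hit γ ] pt) ] (choices rt qs) ≤ fromℕ 2 * fromℕ ((suc (2 ℕ.* K ℕ.* M ℕ.* b) ℕ.^ d) ℕ.* (suc (2 ℕ.* K ℕ.* M ℕ.* b) ℕ.^ d))
      count-multiples {γ} {b} γ≉0 bγ = begin
        Σ[ (λ pt → Π[ hit γ ] pt) ] (choices rt qs) ≡⟨ Σ-choices rt (hit γ) qs ⟩
        Π[ (λ q → 1# + Σ[ (λ t → hit γ (q , t)) ] (rt q)) ] qs ≤⟨ Π-mono qs factor ⟩
        Π[ (λ q → (1# + inv-square q) * fromℕ (q ℕ.^ τ q ℕ.* q ℕ.^ τ q)) ] qs ≡⟨ Π-* _ _ qs ⟩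
        Π[ (λ q → 1# + inv-square q) ] qs * Π[ (λ q → fromℕ (q ℕ.^ τ q ℕ.* q ℕ.^ τ q)) ] qs
          ≤⟨ *-mono-≤ (Π-1+inv-square≤2 u (λ m → prime≥2 (All.lookup pqs m))) (≤-trans (≤-reflexive (square qs)) (fromℕ-mono (ℕ.*-mono-≤ index index))) ⟩
        fromℕ 2 * fromℕ (suc (2 ℕ.* K ℕ.* M ℕ.* b) ℕ.^ d ℕ.* suc (2 ℕ.* K ℕ.* M ℕ.* b) ℕ.^ d) ∎
        where
        open ≤-Reasoning
        T : ℕ → List ℕ
        T q = filter (λ t → q ∣ᶻ? ev t γ) (rt q)
        τ : ℕ → ℕ
        τ q = length (T q)
        index : ∏^ T qs ℕ.≤ suc (2 ℕ.* K ℕ.* M ℕ.* b) ℕ.^ d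
        index = ∏^-bound T qs u pqs
          (λ {q} m → Unique.filter⁺ (λ t → q ∣ᶻ? ev t γ) (proj₁ (ok m)) , λ t∈ → proj₂ (ok m) (proj₁ (∈-filter⁻ (λ t → q ∣ᶻ? ev t γ) t∈)))
          γ≉0 bγ (λ {q} _ t∈ → proj₂ (∈-filter⁻ (λ t → q ∣ᶻ? ev t γ) {xs = rt q} t∈))
        square : ∀ qs → Π[ (λ q → fromℕ (q ℕ.^ τ q ℕ.* q ℕ.^ τ q)) ] qs ≡ fromℕ (∏^ T qs ℕ.* ∏^ T qs)
        square [] = sym fromℕ-1
        square (q ∷ qs) = trans (cong (fromℕ (q ℕ.^ τ q ℕ.* q ℕ.^ τ q) *_) (square qs)) (trans (sym (fromℕ-* (q ℕ.^ τ q ℕ.* q ℕ.^ τ q) (∏^ T qs ℕ.* ∏^ T qs)))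
          (cong fromℕ (ℕ.[m*n]*[o*p]≡[m*o]*[n*p] (q ℕ.^ τ q) (q ℕ.^ τ q) (∏^ T qs) (∏^ T qs))))
        factor : ∀ {q} → q ∈ qs → 1# + Σ[ (λ t → hit γ (q , t)) ] (rt q) ≤ (1# + inv-square q) * fromℕ (q ℕ.^ τ q ℕ.* q ℕ.^ τ q)
        factor {q} q∈ = begin
          1# + Σ[ (λ t → hit γ (q , t)) ] (rt q) ≡⟨ cong (1# +_) (trans (Σ-scale (fromℕ (q ℕ.* q)) (λ t → indicator (q ∣ᶻ? ev t γ)) (rt q)) (cong (fromℕ (q ℕ.* q) *_) count)) ⟩
          1# + fromℕ (q ℕ.* q) * fromℕ (τ q) ≡⟨ cong (1# +_) (sym (fromℕ-* (q ℕ.* q) (τ q))) ⟩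
          fromℕ (suc (q ℕ.* q ℕ.* τ q)) ≤⟨ ≤-from-*fromℕ {n = q ℕ.* q} 1≤q² (≤-trans (≤-reflexive (sym (fromℕ-* (suc (q ℕ.* q ℕ.* τ q)) (q ℕ.* q))))
              (≤-trans (fromℕ-mono (root-count-bound q (τ q) 2≤q)) (≤-reflexive rhs))) ⟩
          (1# + inv-square q) * fromℕ (q ℕ.^ τ q ℕ.* q ℕ.^ τ q) ∎
          where
          2≤q = prime≥2 (All.lookup pqs q∈)
          1≤q² : 1 ℕ.≤ q ℕ.* q
          1≤q² = ℕ.*-mono-≤ (ℕ.<⇒≤ 2≤q) (ℕ.<⇒≤ 2≤q)
          count : Σ[ (λ t → indicator (q ∣ᶻ? ev t γ)) ] (rt q) ≡ fromℕ (τ q)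
          count = trans (Σ-cong (rt q) λ t → sym (*-identityʳ _)) (trans (sym (Σ-filter (λ t → q ∣ᶻ? ev t γ) (λ _ → 1#) (rt q))) (trans (Σ-const 1# (T q)) (*-identityʳ _)))
          Z = q ℕ.^ τ q ℕ.* q ℕ.^ τ q
          rhs : fromℕ ((q ℕ.* q ℕ.+ 1) ℕ.* Z) ≡ (1# + inv-square q) * fromℕ Z * fromℕ (q ℕ.* q)
          rhs = trans (fromℕ-* (q ℕ.* q ℕ.+ 1) Z) (trans (cong (_* fromℕ Z) (trans (fromℕ-+ (q ℕ.* q) 1) (cong (fromℕ (q ℕ.* q) +_) (trans fromℕ-1 (sym (inv*fromℕ 1≤q²))))))
            (solve 3 (λ s i z → (s :+ i :* s) :* z := (con 1 :+ i) :* z :* s) refl (fromℕ (q ℕ.* q)) (inv-square q) (fromℕ Z)))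

      in-range : ∀ X Z pt → Dec (X ℕ.≤ mass pt × mass pt ℕ.< Z)
      in-range X Z pt = (X ℕ.≤? mass pt) ×-dec (mass pt ℕ.<? Z)

      choices-ok : ∀ {pt} → pt ∈ choices rt qs → All (λ (q , t) → Prime q × Valid q t) pt
      choices-ok m = All.map (λ (a , b) → All.lookup pqs a , proj₂ (proj₂ (ok a) b)) (choices⁻ rt qs m)

      -- By `short` each ideal with norm in the range contains one of the nonzero short elements and
      -- contributes at least X² to its weighted sum. Exchanging the sums bounds the count by the
      -- number of short elements times the bound of `count-multiples`.
      count-range : ∀ X Y → Σ[ (λ pt → indicator (in-range X (Y ℕ.^ d) pt)) ] (choices rt qs) * fromℕ (X ℕ.* X) ≤
        fromℕ (suc (2 ℕ.* Y) ℕ.^ d) * (fromℕ 2 * fromℕ (suc (2 ℕ.* K ℕ.* M ℕ.* (Y ℕ.* M)) ℕ.^ d ℕ.* suc (2 ℕ.* K ℕ.* M ℕ.* (Y ℕ.* M)) ℕ.^ d))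
      count-range X Y = begin
        Σ[ ind ] (choices rt qs) * fromℕ (X ℕ.* X) ≡⟨ trans (*-comm _ _) (sym (Σ-scale (fromℕ (X ℕ.* X)) ind (choices rt qs))) ⟩
        Σ[ (λ pt → fromℕ (X ℕ.* X) * ind pt) ] (choices rt qs) ≤⟨ Σ-mono (choices rt qs) pointwise ⟩
        Σ[ (λ pt → Σ[ (λ c → Π[ hit (w (shift Y c)) ] pt) ] D) ] (choices rt qs) ≡⟨ Σ-swap _ (choices rt qs) D ⟩
        Σ[ (λ c → Σ[ (λ pt → Π[ hit (w (shift Y c)) ] pt) ] (choices rt qs)) ] D ≤⟨ Σ-mono D (λ {c} c∈ → count-multiples (λ h → proj₂ (∈-filter⁻ nonzero? {xs = box d (suc (2 ℕ.* Y))} c∈) (zero-shift h))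
            (bounded-w (bd (proj₁ (∈-filter⁻ nonzero? {xs = box d (suc (2 ℕ.* Y))} c∈))))) ⟩
        Σ[ (λ _ → R) ] D ≡⟨ Σ-const R D ⟩
        fromℕ (length D) * R ≤⟨ *-mono-≤ (fromℕ-mono (ℕ.≤-trans (length-filter nonzero? (box d (suc (2 ℕ.* Y)))) (ℕ.≤-reflexive (length-box d (suc (2 ℕ.* Y)))))) ≤-refl ⟩
        fromℕ (suc (2 ℕ.* Y) ℕ.^ d) * R ∎
        where
        open ≤-Reasoning
        ind = λ pt → indicator (in-range X (Y ℕ.^ d) pt)
        B = suc (2 ℕ.* K ℕ.* M ℕ.* (Y ℕ.* M)) ℕ.^ d
        R = fromℕ 2 * fromℕ (B ℕ.* B)
        nonzero? : ∀ c → Dec (c ≢ Vec.replicate d Y)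
        nonzero? c = ¬? (Vec.≡-dec ℕ._≟_ c (Vec.replicate d Y))
        D = filter nonzero? (box d (suc (2 ℕ.* Y)))
        zero-shift : ∀ {c} → w (shift Y c) ≈ᴼ 0ᴼ → c ≡ Vec.replicate d Y
        zero-shift {c} h = vec-injective λ s → trans (lem (vec c s) (ℤ.+ Y)) (trans (cong (ℤ._+ ℤ.+ Y) (w-injective {shift Y c} {λ _ → 0ℤ} (O.trans h
          (O.sym (O.π-injective λ s → trans (O.π-w _ s) (ℤ.*-zeroˡ (ℤ.+ M))))) s)) (trans (ℤ.+-identityˡ (ℤ.+ Y)) (cong ℤ.+_ (sym (Vec.lookup-replicate s Y)))))
          where
          lem : ∀ a b → a ≡ (a ℤ.- b) ℤ.+ b
          lem = ℤ-solve-∀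
        bd : ∀ {c} → c ∈ box d (suc (2 ℕ.* Y)) → ∀ s → ℤ.∣ shift Y c s ∣ ℕ.≤ Y
        bd {c} c∈ s = ℕ.≤-trans (ℕ.≤-reflexive (cong ℤ.∣_∣ (ℤ.m-n≡m⊖n (lookup c s) Y))) (abs-⊖ (lookup c s) Y (ℕ.≤-pred (∈-box⁻ c∈ s)))
          where
          abs-⊖ : ∀ m n → m ℕ.≤ 2 ℕ.* n → ℤ.∣ m ℤ.⊖ n ∣ ℕ.≤ n
          abs-⊖ m n le with ℕ.≤-total m n
          ... | inj₁ p = ℕ.≤-trans (ℕ.≤-reflexive (ℤ.∣⊖∣-≤ p)) (ℕ.m∸n≤m n m)
          ... | inj₂ p = ℕ.≤-trans (ℕ.≤-reflexive (trans (cong ℤ.∣_∣ (ℤ.⊖-≥ p)) refl)) (ℕ.≤-trans (ℕ.∸-monoˡ-≤ n le) (ℕ.≤-reflexive (trans (ℕ.m+n∸m≡n n (n ℕ.+ 0)) (ℕ.+-identityʳ n))))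
        pointwise : ∀ {pt} → pt ∈ choices rt qs → fromℕ (X ℕ.* X) * ind pt ≤ Σ[ (λ c → Π[ hit (w (shift Y c)) ] pt) ] D
        pointwise {pt} m = *indicator-≤ (in-range X (Y ℕ.^ d) pt) λ (lo , hi) →
          covered lo (short Y pt (All.map (λ (p , v) → prime≥1 p , v) (choices-ok m)) hi)
          where
          covered : X ℕ.≤ mass pt →
            (∃ λ c → c ∈ box d (suc (2 ℕ.* Y)) × ¬ (w (shift Y c) ≈ᴼ 0ᴼ) × All (λ (q , t) → q ∣ᶻ ev t (w (shift Y c))) pt) →
            fromℕ (X ℕ.* X) ≤ Σ[ (λ c → Π[ hit (w (shift Y c)) ] pt) ] D
          covered lo (c , c∈ , nz , van) = begin
            fromℕ (X ℕ.* X) ≤⟨ fromℕ-mono (ℕ.*-mono-≤ lo lo) ⟩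
            fromℕ (mass pt ℕ.* mass pt) ≡⟨ fromℕ-mass² pt ⟩
            Π[ (λ (q , t) → fromℕ (q ℕ.* q)) ] pt ≤⟨ Π-mono pt (λ {x} x∈ → ≤-reflexive (sym (trans (cong (fromℕ (proj₁ x ℕ.* proj₁ x) *_)
                  (indicator-true (proj₁ x ∣ᶻ? ev (proj₂ x) (w (shift Y c))) (All.lookup van x∈))) (*-identityʳ _)))) ⟩
            Π[ hit (w (shift Y c)) ] pt ≤⟨ Σ-∈ {f = λ c → Π[ hit (w (shift Y c)) ] pt} (∈-filter⁺ nonzero? c∈ (λ e → nz (shift-replicate e))) ⟩
            Σ[ (λ c → Π[ hit (w (shift Y c)) ] pt) ] D ∎
            where
            shift-replicate : ∀ {c} → c ≡ Vec.replicate d Y → w (shift Y c) ≈ᴼ 0ᴼ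
            shift-replicate e = O.π-injective λ s → trans (O.π-w _ s)
               (trans (cong (ℤ._* ℤ.+ M) (trans (cong (λ z → ℤ.+ z ℤ.- ℤ.+ Y) (trans (cong (λ v → lookup v s) e) (Vec.lookup-replicate s Y))) (ℤ.+-inverseʳ (ℤ.+ Y)))) (ℤ.*-zeroˡ (ℤ.+ M)))

      -- For X = x = base^k and Y = 4^(k+1) the bound of `count-range` is O(x³). Dividing by x²
      -- gives O(x) ideals with norm of order x, uniformly in `qs`.
      count-level : ∀ k → Σ[ (λ pt → indicator (in-range (base ℕ.^ k) (base ℕ.^ suc k) pt)) ] (choices rt qs) * inv (base ℕ.^ k)
        ≤ fromℕ (constant ℕ.* (base ℕ.* base ℕ.* base))
      count-level k = ≤-from-*fromℕ {n = x} 1≤x (≤-trans (≤-reflexive (trans (*-assoc S (inv x) (fromℕ x)) (trans (cong (S *_) (inv*fromℕ 1≤x)) (*-identityʳ S))))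
        (≤-from-*fromℕ {n = x ℕ.* x} (ℕ.*-mono-≤ 1≤x 1≤x) (begin
          S * fromℕ (x ℕ.* x) ≡⟨ cong (λ z → Σ[ (λ pt → indicator (in-range x z pt)) ] (choices rt qs) * fromℕ (x ℕ.* x)) (sym Y^d) ⟩
          Σ[ (λ pt → indicator (in-range x (Y ℕ.^ d) pt)) ] (choices rt qs) * fromℕ (x ℕ.* x) ≤⟨ count-range x Y ⟩
          fromℕ (suc (2 ℕ.* Y) ℕ.^ d) * (fromℕ 2 * fromℕ (suc (2 ℕ.* K ℕ.* M ℕ.* (Y ℕ.* M)) ℕ.^ d ℕ.* suc (2 ℕ.* K ℕ.* M ℕ.* (Y ℕ.* M)) ℕ.^ d))
            ≡⟨ trans (cong (fromℕ (suc (2 ℕ.* Y) ℕ.^ d) *_) (sym (fromℕ-* 2 (B ℕ.* B)))) (sym (fromℕ-* (suc (2 ℕ.* Y) ℕ.^ d) (2 ℕ.* (B ℕ.* B)))) ⟩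
          fromℕ (suc (2 ℕ.* Y) ℕ.^ d ℕ.* (2 ℕ.* (B ℕ.* B))) ≤⟨ fromℕ-mono final ⟩
          fromℕ (constant ℕ.* (base ℕ.* base ℕ.* base) ℕ.* x ℕ.* (x ℕ.* x)) ≡⟨ trans (fromℕ-* (constant ℕ.* (base ℕ.* base ℕ.* base) ℕ.* x) (x ℕ.* x)) (cong (_* fromℕ (x ℕ.* x)) (fromℕ-* (constant ℕ.* (base ℕ.* base ℕ.* base)) x)) ⟩
          fromℕ (constant ℕ.* (base ℕ.* base ℕ.* base)) * fromℕ x * fromℕ (x ℕ.* x) ∎)))
        where
        open ≤-Reasoning
        x = base ℕ.^ k
        1≤x : 1 ℕ.≤ x
        1≤x = ℕ.m^n>0 base {{ℕ.>-nonZero (ℕ.≤-trans (s≤s z≤n) base≥4)}} k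
        Y = 4 ℕ.^ suc k
        S = Σ[ (λ pt → indicator (in-range x (base ℕ.^ suc k) pt)) ] (choices rt qs)
        Y^d : Y ℕ.^ d ≡ base ℕ.* x
        Y^d = trans (ℕ.^-*-assoc 4 (suc k) d) (trans (cong (4 ℕ.^_) (ℕ.*-comm (suc k) d)) (sym (ℕ.^-*-assoc 4 d (suc k))))
        c₁ = suc (2 ℕ.* K ℕ.* M ℕ.* M) ℕ.^ d
        B = suc (2 ℕ.* K ℕ.* M ℕ.* (Y ℕ.* M)) ℕ.^ d
        1≤Y : 1 ℕ.≤ Y
        1≤Y = ℕ.m^n>0 4 (suc k)
        B≤ : B ℕ.≤ c₁ ℕ.* (base ℕ.* x)
        B≤ = ℕ.≤-trans (ℕ.^-monoˡ-≤ d (ℕ.≤-trans (ℕ.+-monoˡ-≤ (2 ℕ.* K ℕ.* M ℕ.* (Y ℕ.* M)) 1≤Y) (ℕ.≤-reflexive (lem K M Y))))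
          (ℕ.≤-reflexive (trans (^-distribʳ-* d (suc (2 ℕ.* K ℕ.* M ℕ.* M)) Y) (cong (c₁ ℕ.*_) Y^d)))
          where
          lem : ∀ K M Y → Y ℕ.+ 2 ℕ.* K ℕ.* M ℕ.* (Y ℕ.* M) ≡ suc (2 ℕ.* K ℕ.* M ℕ.* M) ℕ.* Y
          lem = ℕ-solve-∀
        A≤ : suc (2 ℕ.* Y) ℕ.^ d ℕ.≤ 3 ℕ.^ d ℕ.* (base ℕ.* x)
        A≤ = ℕ.≤-trans (ℕ.^-monoˡ-≤ d (ℕ.+-monoˡ-≤ (2 ℕ.* Y) 1≤Y)) (ℕ.≤-reflexive (trans (^-distribʳ-* d 3 Y) (cong (3 ℕ.^ d ℕ.*_) Y^d)))
        final : suc (2 ℕ.* Y) ℕ.^ d ℕ.* (2 ℕ.* (B ℕ.* B)) ℕ.≤ constant ℕ.* (base ℕ.* base ℕ.* base) ℕ.* x ℕ.* (x ℕ.* x)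
        final = ℕ.≤-trans (ℕ.*-mono-≤ A≤ (ℕ.*-monoʳ-≤ 2 (ℕ.*-mono-≤ B≤ B≤))) (ℕ.≤-reflexive (lem (3 ℕ.^ d) base x c₁))
          where
          lem : ∀ a b x c → a ℕ.* (b ℕ.* x) ℕ.* (2 ℕ.* (c ℕ.* (b ℕ.* x) ℕ.* (c ℕ.* (b ℕ.* x))))
            ≡ a ℕ.* 2 ℕ.* (c ℕ.* c) ℕ.* (b ℕ.* b ℕ.* b) ℕ.* x ℕ.* (x ℕ.* x)
          lem = ℕ-solve-∀

      -- Split the choices by the k with base^k ≤ mass < base^(k+1). Their height is at least k, so
      -- each weighs at most ρ^k / base^k; by `count-level` the whole level contributes O(ρ^k), and
      -- the geometric series is at most N.
      upper-bound-at : ∀ (ρ : ℚ⁺) (N : ℕ) → ρ ≤ 1# → (∀ n → Σ[ (λ k → ρ ^ k) ] (upTo n) ≤ fromℕ N) →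
        Π[ (λ q → 1# + fromℕ (length (rt q)) * ζ-weight ρ q) ] qs ≤ fromℕ (constant ℕ.* (base ℕ.* base ℕ.* base)) * fromℕ N
      upper-bound-at ρ N ρ≤1 geometric = begin
        Π[ (λ q → 1# + fromℕ (length (rt q)) * ζ-weight ρ q) ] qs ≤⟨ Π-mono qs (λ {q} _ → ≤-reflexive (cong (1# +_) (sym (Σ-const (ζ-weight ρ q) (rt q))))) ⟩
        Π[ (λ q → 1# + Σ[ (λ t → ζ-weight ρ q) ] (rt q)) ] qs ≡⟨ sym (Σ-choices rt (λ (q , t) → ζ-weight ρ q) qs) ⟩
        Σ[ (λ pt → Π[ (λ (q , t) → ζ-weight ρ q) ] pt) ] (choices rt qs) ≤⟨ Σ-mono (choices rt qs) level ⟩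
        Σ[ (λ pt → Σ[ (λ k → ind k pt * (inv (base ℕ.^ k) * ρ ^ k)) ] (upTo kmax)) ] (choices rt qs) ≡⟨ Σ-swap _ (choices rt qs) (upTo kmax) ⟩
        Σ[ (λ k → Σ[ (λ pt → ind k pt * (inv (base ℕ.^ k) * ρ ^ k)) ] (choices rt qs)) ] (upTo kmax) ≤⟨ Σ-mono (upTo kmax) (λ {k} _ → per-level k) ⟩
        Σ[ (λ k → C * ρ ^ k) ] (upTo kmax) ≡⟨ Σ-scale C (λ k → ρ ^ k) (upTo kmax) ⟩
        C * Σ[ (λ k → ρ ^ k) ] (upTo kmax) ≤⟨ *-mono-≤ ≤-refl (geometric kmax) ⟩
        C * fromℕ N ∎
        where
        open ≤-Reasoning
        C = fromℕ (constant ℕ.* (base ℕ.* base ℕ.* base))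
        kmax = suc (proj₁ (list-bound mass (choices rt qs)))
        ind : ℕ → List (ℕ × ℕ) → ℚ⁺
        ind k pt = indicator (in-range (base ℕ.^ k) (base ℕ.^ suc k) pt)
        per-level : ∀ k → Σ[ (λ pt → ind k pt * (inv (base ℕ.^ k) * ρ ^ k)) ] (choices rt qs) ≤ C * ρ ^ k
        per-level k = begin
          Σ[ (λ pt → ind k pt * (inv (base ℕ.^ k) * ρ ^ k)) ] (choices rt qs) ≡⟨ trans (Σ-cong (choices rt qs) λ pt → *-comm (ind k pt) _) (Σ-scale _ (ind k) (choices rt qs)) ⟩
          inv (base ℕ.^ k) * ρ ^ k * Σ[ ind k ] (choices rt qs) ≡⟨ solve 3 (λ a b c → a :* b :* c := c :* a :* b) refl (inv (base ℕ.^ k)) (ρ ^ k) (Σ[ ind k ] (choices rt qs)) ⟩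
          Σ[ ind k ] (choices rt qs) * inv (base ℕ.^ k) * ρ ^ k ≤⟨ *-mono-≤ (count-level k) ≤-refl ⟩
          C * ρ ^ k ∎
        level : ∀ {pt} → pt ∈ choices rt qs → Π[ (λ (q , t) → ζ-weight ρ q) ] pt ≤ Σ[ (λ k → ind k pt * (inv (base ℕ.^ k) * ρ ^ k)) ] (upTo kmax)
        level {pt} m = found (power-bracket {base} (ℕ.≤-trans (s≤s (s≤s z≤n)) base≥4) 1≤m)
          where
          2≤ : All (λ (q , t) → 2 ℕ.≤ q) pt
          2≤ = All.map (λ (p , _) → prime≥2 p) (choices-ok m)
          1≤m : 1 ℕ.≤ mass pt
          1≤m = mass≥1 (All.map ℕ.<⇒≤ 2≤)
          found : (∃ λ k → base ℕ.^ k ℕ.≤ mass pt × mass pt ℕ.< base ℕ.^ suc k) → _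
          found (k , lo , hi) = begin
            Π[ (λ (q , t) → ζ-weight ρ q) ] pt ≡⟨ Π-weight ρ pt ⟩
            ρ ^ height ρ pt * inv (mass pt) ≤⟨ *-mono-≤ (^-antitone ρ≤1 k≤height) (inv-antitone 1≤b lo) ⟩
            ρ ^ k * inv (base ℕ.^ k) ≡⟨ trans (*-comm _ _) (trans (sym (*-identityˡ _)) (cong (_* (inv (base ℕ.^ k) * ρ ^ k)) (sym (indicator-true (in-range (base ℕ.^ k) (base ℕ.^ suc k) pt) (lo , hi))))) ⟩
            ind k pt * (inv (base ℕ.^ k) * ρ ^ k) ≤⟨ Σ-∈ {f = λ k → ind k pt * (inv (base ℕ.^ k) * ρ ^ k)} (∈-upTo⁺ (s≤s (ℕ.≤-trans (k≤ k) (ℕ.≤-trans lo (proj₂ (list-bound mass (choices rt qs)) m))))) ⟩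
            Σ[ (λ k → ind k pt * (inv (base ℕ.^ k) * ρ ^ k)) ] (upTo kmax) ∎
            where
            1≤b : 1 ℕ.≤ base ℕ.^ k
            1≤b = ℕ.m^n>0 base {{ℕ.>-nonZero (ℕ.≤-trans (s≤s z≤n) base≥4)}} k
            k≤ : ∀ k → k ℕ.≤ base ℕ.^ k
            k≤ zero = z≤n
            k≤ (suc k) = ℕ.≤-trans (ℕ.+-mono-≤ (ℕ.m^n>0 base {{ℕ.>-nonZero (ℕ.≤-trans (s≤s z≤n) base≥4)}} k) (k≤ k))
              (ℕ.≤-trans (ℕ.≤-reflexive (cong (base ℕ.^ k ℕ.+_) (sym (ℕ.+-identityʳ _)))) (ℕ.*-monoˡ-≤ (base ℕ.^ k) (ℕ.≤-trans (s≤s (s≤s z≤n)) base≥4)))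
            k≤height : k ℕ.≤ height ρ pt
            k≤height = ^-cancelʳ-≤ 4 (s≤s (s≤s z≤n)) (ℕ.≤-<-trans (ℕ.≤-trans (ℕ.^-monoˡ-≤ k base≥4) (ℕ.≤-trans lo (mass≤4^height ρ 2≤)))
              (ℕ.^-monoʳ-< 4 (s≤s (s≤s z≤n)) (ℕ.n<1+n (height ρ pt))))

-- Rings of polynomials acting on sequences

module SequenceOperators where

  open Orders
  open import Data.Integer using (+_; -1ℤ; _+_; _*_; -_)
  open import Data.Integer.Tactic.RingSolver using (solve-∀)
  open import Data.Vec using (updateAt)
  open import Algebra using (CommutativeRing)
  open import Relation.Binary.Structures using (IsEquivalence)
  open import Level using (0ℓ)
  open import Relation.Binary.PropositionalEquality

  -- Polynomials remain unreduced syntax. Equality in the ring is equality of the actions on a fixed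
  -- sequence, while substitution is defined by recursion on the syntax.
  data Op (n : ℕ) : Set where
    con : ℤ → Op n
    var : Fin n → Op n
    _⊕_ _⊗_ : Op n → Op n → Op n

  infixl 6 _⊕_
  infixl 7 _⊗_
  infix 4 _≐_

  Seq : ℕ → Set
  Seq n = Vec ℕ n → ℤ

  _≐_ : ∀ {n} → Seq n → Seq n → Set
  g ≐ h = ∀ a → g a ≡ h a

  bump : ∀ {n} → Fin n → Vec ℕ n → Vec ℕ n
  bump i a = updateAt a i suc

  -- Polynomials in n variables act on sequences indexed by ℕⁿ; the variables act as shifts.
  act : ∀ {n} → Op n → Seq n → Seq n
  act (con c) g a = c * g a
  act (var i) g a = g (bump i a)
  act (e ⊕ f) g a = act e g a + act f g a
  act (e ⊗ f) g = act e (act f g)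

  private variable
    n : ℕ
    g h : Seq n

  act-cong : ∀ (e : Op n) → g ≐ h → act e g ≐ act e h
  act-cong (con c) p a = cong (c *_) (p a)
  act-cong (var i) p a = p (bump i a)
  act-cong (e ⊕ f) p a = cong₂ _+_ (act-cong e p a) (act-cong f p a)
  act-cong (e ⊗ f) p = act-cong e (act-cong f p)

  act-+ : ∀ (e : Op n) g h → act e (λ a → g a + h a) ≐ λ a → act e g a + act e h a
  act-+ (con c) g h a = ℤ.*-distribˡ-+ c (g a) (h a)
  act-+ (var i) g h a = refl
  act-+ (e ⊕ f) g h a = trans (cong₂ _+_ (act-+ e g h a) (act-+ f g h a)) (lem (act e g a) (act e h a) (act f g a) (act f h a))
    where
    lem : ∀ x y z w → (x + y) + (z + w) ≡ (x + z) + (y + w)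
    lem = solve-∀
  act-+ (e ⊗ f) g h a = trans (act-cong e (act-+ f g h) a) (act-+ e (act f g) (act f h) a)

  act-scale : ∀ (e : Op n) c g → act e (λ a → c * g a) ≐ λ a → c * act e g a
  act-scale (con d) c g a = lem d c (g a)
    where
    lem : ∀ d c x → d * (c * x) ≡ c * (d * x)
    lem = solve-∀
  act-scale (var i) c g a = refl
  act-scale (e ⊕ f) c g a = trans (cong₂ _+_ (act-scale e c g a) (act-scale f c g a)) (sym (ℤ.*-distribˡ-+ c _ _))
  act-scale (e ⊗ f) c g a = trans (act-cong e (act-scale f c g) a) (act-scale e c (act f g) a)

  bump-comm : ∀ (i j : Fin n) a → bump i (bump j a) ≡ bump j (bump i a)
  bump-comm zero zero (x ∷ a) = refl
  bump-comm zero (suc j) (x ∷ a) = refl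
  bump-comm (suc i) zero (x ∷ a) = refl
  bump-comm (suc i) (suc j) (x ∷ a) = cong (x ∷_) (bump-comm i j a)

  act-var : ∀ i (f : Op n) g → act f (act (var i) g) ≐ act (var i) (act f g)
  act-var i (con c) g a = refl
  act-var i (var j) g a = cong g (bump-comm i j a)
  act-var i (e ⊕ f) g a = cong₂ _+_ (act-var i e g a) (act-var i f g a)
  act-var i (e ⊗ f) g a = trans (act-cong e (act-var i f g) a) (act-var i e (act f g) a)

  act-comm : ∀ (e f : Op n) g → act e (act f g) ≐ act f (act e g)
  act-comm (con c) f g a = sym (act-scale f c g a)
  act-comm (var i) f g a = sym (act-var i f g a)
  act-comm (e ⊕ e′) f g a = trans (cong₂ _+_ (act-comm e f g a) (act-comm e′ f g a)) (sym (act-+ f (act e g) (act e′ g) a))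
  act-comm (e ⊗ e′) f g a = trans (act-cong e (act-comm e′ f g) a) (act-comm e f (act e′ g) a)

  act-0 : ∀ (e : Op n) → g ≐ (λ _ → 0ℤ) → act e g ≐ λ _ → 0ℤ
  act-0 e p a = trans (act-cong e p a) (trans (act-scale e 0ℤ (λ _ → 0ℤ) a) (ℤ.*-zeroˡ (act e (λ _ → 0ℤ) a)))

  negate : Op n → Op n
  negate e = con -1ℤ ⊗ e

  value : (Fin n → ℤ) → Op n → ℤ
  value v (con c) = c
  value v (var i) = v i
  value v (e ⊕ f) = value v e + value v f
  value v (e ⊗ f) = value v e * value v f

  _^ᴼ_ : Op n → ℕ → Op n
  e ^ᴼ zero = con 1ℤ
  e ^ᴼ suc m = e ⊗ e ^ᴼ m

  -- The quotient of the polynomial ring by the annihilator of ρ.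
  module _ (ρ : Seq n) where
    _∼_ : Op n → Op n → Set
    e ∼ f = act e ρ ≐ act f ρ

    Op-ring : CommutativeRing 0ℓ 0ℓ
    Op-ring = record
      { Carrier = Op n ; _≈_ = _∼_ ; _+_ = _⊕_ ; _*_ = _⊗_ ; -_ = negate ; 0# = con 0ℤ ; 1# = con 1ℤ
      ; isCommutativeRing = record
        { isRing = record
          { +-isAbelianGroup = record
            { isGroup = record
              { isMonoid = record
                { isSemigroup = record
                  { isMagma = record { isEquivalence = equiv ; ∙-cong = λ p q a → cong₂ _+_ (p a) (q a) }
                  ; assoc = λ e f k a → ℤ.+-assoc (act e ρ a) _ _ }
                ; identity = (λ e a → trans (cong (_+ act e ρ a) (ℤ.*-zeroˡ (ρ a))) (ℤ.+-identityˡ _))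
                           , (λ e a → trans (cong (λ z → act e ρ a + z) (ℤ.*-zeroˡ (ρ a))) (ℤ.+-identityʳ _)) }
              ; inverse = (λ e a → trans (lemˡ (act e ρ a)) (sym (ℤ.*-zeroˡ (ρ a)))) , (λ e a → trans (lemʳ (act e ρ a)) (sym (ℤ.*-zeroˡ (ρ a))))
              ; ⁻¹-cong = λ p a → cong (-1ℤ *_) (p a) }
            ; comm = λ e f a → ℤ.+-comm (act e ρ a) _ }
          ; *-cong = λ {e} {e′} {f} {f′} p q a → trans (act-cong e q a) (trans (act-comm e f′ ρ a) (trans (act-cong f′ p a) (act-comm f′ e′ ρ a)))
          ; *-assoc = λ e f k a → refl
          ; *-identity = (λ e a → ℤ.*-identityˡ _) , (λ e a → trans (act-cong e (λ b → ℤ.*-identityˡ (ρ b)) a) refl)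
          ; distrib = (λ e f k a → act-+ e (act f ρ) (act k ρ) a) , (λ e f k a → refl) }
        ; *-comm = λ e f → act-comm e f ρ } }
      where
      lemˡ : ∀ x → -1ℤ * x + x ≡ 0ℤ
      lemˡ = solve-∀
      lemʳ : ∀ x → x + -1ℤ * x ≡ 0ℤ
      lemʳ = solve-∀
      equiv : IsEquivalence _∼_
      equiv = record { refl = λ a → refl ; sym = λ p a → sym (p a) ; trans = λ p q a → trans (p a) (q a) }

    -- The coordinates of e are d entries of the sequence `act e ρ`. In the applications `separates`
    -- holds because linear recurrences determine all other entries.
    record Frame : Set where
      field
        d : ℕ
        point : Fin d → Vec ℕ n
        separates : ∀ e → (∀ s → act e ρ (point s) ≡ 0ℤ) → ∀ a → act e ρ a ≡ 0ℤ
        basis : Fin d → Op n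
        M : ℕ
        1≤M : 1 ℕ.≤ M
        diagonal : ∀ s → act (basis s) ρ (point s) ≡ + M
        off-diagonal : ∀ s t → s ≢ t → act (basis s) ρ (point t) ≡ 0ℤ
        no-zero-divisors : ∀ e f → (∀ a → act (e ⊗ f) ρ a ≡ 0ℤ) → ¬ (∀ a → act e ρ a ≡ 0ℤ) → ∀ a → act f ρ a ≡ 0ℤ

    toOrder : Frame → Order
    toOrder F = record
      { 𝓐 = Op-ring
      ; ι = con
      ; ι-+ = λ a b v → ℤ.*-distribʳ-+ (ρ v) a b
      ; ι-* = λ a b v → ℤ.*-assoc a b (ρ v)
      ; ι-neg = λ a v → lem a (ρ v)
      ; ι-0 = λ v → refl
      ; ι-1 = λ v → refl
      ; d = d
      ; π = λ e s → act e ρ (point s)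
      ; π-cong = λ p s → p (point s)
      ; π-+ = λ e f s → refl
      ; π-ι* = λ c e s → refl
      ; π-injective = λ {e} h a → trans (separates e h a) (sym (ℤ.*-zeroˡ (ρ a)))
      ; e = basis
      ; M = M
      ; 1≤M = 1≤M
      ; π-e-diag = diagonal
      ; π-e-off = off-diagonal
      ; domain = λ {e} {f} p n a → trans (no-zero-divisors e f (λ b → trans (p b) (ℤ.*-zeroˡ (ρ b)))
          (λ z → n λ b → trans (z b) (sym (ℤ.*-zeroˡ (ρ b)))) a) (sym (ℤ.*-zeroˡ (ρ a)))
      }
      where
      open Frame F
      lem : ∀ a x → (- a) * x ≡ -1ℤ * (a * x)
      lem = solve-∀

-- The ring generated by one p-th root

module PureRoots where

  open Orders
  open Congruences
  open Evaluations using (Evaluation)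
  open SequenceOperators
  open import Data.Integer using (+_; _+_; _*_; -_; _-_; _^_)
  open import Data.Integer.Tactic.RingSolver using (solve-∀)
  open import Data.Fin using (toℕ)
  open import Relation.Binary.Definitions using (tri<; tri≈; tri>)
  open import Relation.Binary.PropositionalEquality

  X : Op 1
  X = var zero

  act-X^ : ∀ m (g : Seq 1) k → act (X ^ᴼ m) g (k ∷ []) ≡ g (m ℕ.+ k ∷ [])
  act-X^ zero g k = ℤ.*-identityˡ _
  act-X^ (suc m) g k = trans (act-X^ m g (suc k)) (cong (λ z → g (z ∷ [])) (ℕ.+-suc m k))

  ^-pos : ∀ a n → (+ a) ^ n ≡ + (a ℕ.^ n)
  ^-pos a zero = refl
  ^-pos a (suc n) = trans (cong (+ a *_) (^-pos a n)) (sym (ℤ.pos-* a (a ℕ.^ n)))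

  -- The ring ℤ[X]/(X^p - b), where b = l u is divisible exactly once by the prime l.
  module Eisenstein (p : ℕ) (2≤p : 2 ℕ.≤ p) (l u : ℕ) (pl : Prime l) (l∤u : ¬ (l ∣ᶻ + u)) where

    instance
      p≢0 : NonZero p
      p≢0 = ℕ.>-nonZero (ℕ.<⇒≤ 2≤p)

    b : ℕ
    b = l ℕ.* u

    1≤u : 1 ℕ.≤ u
    1≤u = ℕ.n≢0⇒n>0 λ { refl → l∤u ∣ᶻ-0 }

    1≤b : 1 ℕ.≤ b
    1≤b = ℕ.*-mono-≤ (prime≥1 pl) 1≤u

    δ : ℕ → ℤ
    δ zero = 1ℤ
    δ (suc _) = 0ℤ

    -- The coefficient of 1 in X^k after reduction modulo X^p - b. Its annihilator is the ideal
    -- generated by X^p - b.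
    r : ℕ → ℤ
    r k = δ (k ℕ.% p) * (+ b) ^ (k ℕ./ p)

    ρ : Seq 1
    ρ (k ∷ []) = r k

    r-shift : ∀ k → r (p ℕ.+ k) ≡ + b * r k
    r-shift k = trans (cong₂ (λ i j → δ i * (+ b) ^ j) (trans (cong (ℕ._% p) (ℕ.+-comm p k)) (ℕ.[m+n]%n≡m%n k p))
      (trans (ℕ.m/n≡1+[m∸n]/n {p ℕ.+ k} {p} (ℕ.m≤m+n p k)) (cong (λ z → suc (z ℕ./ p)) (ℕ.m+n∸m≡n p k))))
      (lem (δ (k ℕ.% p)) (+ b) ((+ b) ^ (k ℕ./ p)))
      where
      lem : ∀ d b x → d * (b * x) ≡ b * (d * x)
      lem = solve-∀

    r-0 : r 0 ≡ 1ℤ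
    r-0 = cong₂ (λ i j → δ i * (+ b) ^ j) (ℕ.m<n⇒m%n≡m {n = p} {m = 0} (ℕ.<⇒≤ 2≤p)) (ℕ.m<n⇒m/n≡0 {m = 0} {n = p} (ℕ.<⇒≤ 2≤p))

    r-small : ∀ k → 1 ℕ.≤ k → k ℕ.< p → r k ≡ 0ℤ
    r-small (suc k) _ k<p = trans (cong (λ i → δ i * (+ b) ^ (suc k ℕ./ p)) (ℕ.m<n⇒m%n≡m {n = p} {m = suc k} k<p)) (ℤ.*-zeroˡ ((+ b) ^ (suc k ℕ./ p)))

    r-p : r p ≡ + b
    r-p = trans (cong r (sym (ℕ.+-identityʳ p))) (trans (r-shift 0) (trans (cong (+ b *_) r-0) (ℤ.*-identityʳ (+ b))))

    Recurrent : Seq 1 → Set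
    Recurrent g = ∀ k → g (p ℕ.+ k ∷ []) ≡ + b * g (k ∷ [])

    act-recurrent : ∀ e {g} → Recurrent g → Recurrent (act e g)
    act-recurrent e {g} rec k = trans (sym (act-X^ p (act e g) k)) (trans (act-comm (X ^ᴼ p) e g (k ∷ []))
      (trans (act-cong {g = act (X ^ᴼ p) g} {h = λ a → + b * g a} e (λ { (j ∷ []) → trans (act-X^ p g j) (rec j) }) (k ∷ [])) (act-scale e (+ b) g (k ∷ []))))

    ρ-recurrent : Recurrent ρ
    ρ-recurrent = r-shift

    recurrent-multiple : ∀ {g} → Recurrent g → ∀ m k → g (m ℕ.* p ℕ.+ k ∷ []) ≡ (+ b) ^ m * g (k ∷ [])
    recurrent-multiple rec zero k = sym (ℤ.*-identityˡ _)
    recurrent-multiple {g} rec (suc m) k = trans (cong (λ z → g (z ∷ [])) (ℕ.+-assoc p (m ℕ.* p) k))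
      (trans (rec (m ℕ.* p ℕ.+ k)) (trans (cong (+ b *_) (recurrent-multiple {g} rec m k)) (sym (ℤ.*-assoc (+ b) ((+ b) ^ m) _))))

    act-X^p* : ∀ {g} → Recurrent g → ∀ m → act (X ^ᴼ (m ℕ.* p)) g ≐ λ a → (+ b) ^ m * g a
    act-X^p* {g} rec m (k ∷ []) = trans (act-X^ (m ℕ.* p) g k) (recurrent-multiple {g} rec m k)

    separates : ∀ e → (∀ (s : Fin p) → act e ρ (toℕ s ∷ []) ≡ 0ℤ) → ∀ a → act e ρ a ≡ 0ℤ
    separates e h (k ∷ []) = trans (cong (λ z → act e ρ (z ∷ [])) (trans (ℕ.m≡m%n+[m/n]*n k p) (ℕ.+-comm (k ℕ.% p) _)))
      (trans (recurrent-multiple {act e ρ} (act-recurrent e ρ-recurrent) (k ℕ./ p) (k ℕ.% p))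
      (trans (cong ((+ b) ^ (k ℕ./ p) *_) (trans (cong (λ z → act e ρ (z ∷ [])) (sym (Fin.toℕ-fromℕ< (ℕ.m%n<n k p)))) (h (Fin.fromℕ< (ℕ.m%n<n k p))))) (ℤ.*-zeroʳ ((+ b) ^ (k ℕ./ p)))))

    -- X^(p-k) is dual to X^k up to the factor X^p = b, so `M` is b; at position 0 the scalar b
    -- replaces 1 to give the same diagonal.
    basis : Fin p → Op 1
    basis s with toℕ s
    ... | zero = con (+ b)
    ... | suc k = X ^ᴼ (p ℕ.∸ suc k)

    basis-diagonal : ∀ s → act (basis s) ρ (toℕ s ∷ []) ≡ + b
    basis-diagonal s with toℕ s | Fin.toℕ<n s
    ... | zero | _ = trans (cong (+ b *_) r-0) (ℤ.*-identityʳ (+ b))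
    ... | suc k | k< = trans (act-X^ (p ℕ.∸ suc k) ρ (suc k)) (trans (cong r (ℕ.m∸n+n≡m (ℕ.<⇒≤ k<))) r-p)

    basis-off : ∀ s t → s ≢ t → act (basis s) ρ (toℕ t ∷ []) ≡ 0ℤ
    basis-off s t s≢t with toℕ s in es | Fin.toℕ<n s | toℕ t in et | Fin.toℕ<n t
    ... | zero | _ | zero | _ = contradiction (Fin.toℕ-injective (trans es (sym et))) s≢t
    ... | zero | _ | suc j | j< = trans (cong (+ b *_) (r-small (suc j) (s≤s z≤n) j<)) (ℤ.*-zeroʳ (+ b))
    ... | suc k | k< | j | j< with ℕ.<-cmp (suc k) j
    ...   | tri≈ _ eq _ = contradiction (Fin.toℕ-injective (trans es (trans eq (sym et)))) s≢t
    ...   | tri> _ _ j<k = trans (act-X^ (p ℕ.∸ suc k) ρ j) (r-small (p ℕ.∸ suc k ℕ.+ j) (ℕ.≤-trans (ℕ.m<n⇒0<n∸m k<) (ℕ.m≤m+n _ j))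
              (ℕ.<-≤-trans (ℕ.+-monoʳ-< (p ℕ.∸ suc k) j<k) (ℕ.≤-reflexive (ℕ.m∸n+n≡m (ℕ.<⇒≤ k<)))))
    ...   | tri< k<j _ _ = trans (act-X^ (p ℕ.∸ suc k) ρ j) (trans (cong r eq)
              (trans (r-shift (j ℕ.∸ suc k)) (trans (cong (+ b *_) (r-small (j ℕ.∸ suc k) (ℕ.m<n⇒0<n∸m k<j) (ℕ.≤-<-trans (ℕ.m∸n≤m j (suc k)) j<))) (ℤ.*-zeroʳ (+ b)))))
      where
      eq : p ℕ.∸ suc k ℕ.+ j ≡ p ℕ.+ (j ℕ.∸ suc k)
      eq = trans (cong (p ℕ.∸ suc k ℕ.+_) (sym (ℕ.m+[n∸m]≡n (ℕ.<⇒≤ k<j))))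
        (trans (sym (ℕ.+-assoc (p ℕ.∸ suc k) (suc k) (j ℕ.∸ suc k))) (cong (ℕ._+ (j ℕ.∸ suc k)) (ℕ.m∸n+n≡m (ℕ.<⇒≤ k<))))

    constant : Op 1 → ℤ
    constant = value (λ _ → 0ℤ)

    -- The polynomial (e - e(0)) / X, computed on the syntax.
    tail : Op 1 → Op 1
    tail (con c) = con 0ℤ
    tail (var i) = con 1ℤ
    tail (e ⊕ f) = tail e ⊕ tail f
    tail (e ⊗ f) = con (constant e) ⊗ tail f ⊕ tail e ⊗ f

    act-decompose : ∀ e g → act e g ≐ λ a → constant e * g a + act X (act (tail e) g) a
    act-decompose (con c) g (k ∷ []) = sym (trans (cong (λ z → c * g (k ∷ []) + z) (ℤ.*-zeroˡ (g (suc k ∷ [])))) (ℤ.+-identityʳ (c * g (k ∷ []))))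
    act-decompose (var zero) g (k ∷ []) = sym (trans (cong₂ _+_ (ℤ.*-zeroˡ (g (k ∷ []))) (ℤ.*-identityˡ (g (suc k ∷ [])))) (ℤ.+-identityˡ (g (suc k ∷ []))))
    act-decompose (e ⊕ f) g a = trans (cong₂ _+_ (act-decompose e g a) (act-decompose f g a)) (lem (constant e) (constant f) (g a) _ _)
      where
      lem : ∀ c d x y z → (c * x + y) + (d * x + z) ≡ (c + d) * x + (y + z)
      lem = solve-∀
    act-decompose (e ⊗ f) g a = trans (act-decompose e (act f g) a) (trans (cong (λ z → constant e * z + act X (act (tail e) (act f g)) a) (act-decompose f g a))
      (lem (constant e) (constant f) (g a) (act X (act (tail f) g) a) _))
      where
      lem : ∀ c d x y z → c * (d * x + y) + z ≡ c * d * x + (c * y + z)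
      lem = solve-∀

    -- u e(0) is a multiple of u l = b = X^p, hence of X. The factor u, prime to l, appears because
    -- X is a uniformizer only locally at l.
    pull-X : ∀ e → l ∣ᶻ constant e → ∃ λ e′ → act (con (+ u) ⊗ e) ρ ≐ act (X ⊗ e′) ρ
    pull-X e (divides k eq) = e′ , λ
      { (j ∷ []) → trans (cong (+ u *_) (act-decompose e ρ (j ∷ []))) (trans (cong (λ c → + u * (c * r j + act (tail e) ρ (suc j ∷ []))) eq)
        (trans (lem (+ u) k (+ l) (r j) (act (tail e) ρ (suc j ∷ [])))
        (cong (λ z → k * z + + u * act (tail e) ρ (suc j ∷ [])) (trans (cong (_* r j) (sym (ℤ.pos-* l u))) (trans (sym (r-shift j)) (sym (trans (act-X^ (ℕ.pred p) ρ (suc j))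
          (cong r (trans (ℕ.+-suc (ℕ.pred p) j) (cong (ℕ._+ j) (ℕ.suc-pred p)))))))))))
      }
      where
      e′ = con k ⊗ X ^ᴼ ℕ.pred p ⊕ con (+ u) ⊗ tail e
      lem : ∀ u k l r y → u * (k * l * r + y) ≡ k * (l * u * r) + u * y
      lem = solve-∀

    strip : ∀ m e → (∃₂ λ j e′ → act (con ((+ u) ^ j) ⊗ e) ρ ≐ act (X ^ᴼ j ⊗ e′) ρ × ¬ (l ∣ᶻ constant e′))
                  ⊎ (∃ λ e′ → act (con ((+ u) ^ m) ⊗ e) ρ ≐ act (X ^ᴼ m ⊗ e′) ρ)
    strip zero e = inj₂ (e , λ a → refl)
    strip (suc m) e with strip m e
    ... | inj₁ done = inj₁ done
    ... | inj₂ (e′ , h) with l ∣ᶻ? constant e′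
    ...   | no nd = inj₁ (m , e′ , h , nd)
    ...   | yes dv with pull-X e′ dv
    ...     | e″ , h′ = inj₂ (e″ , λ a → trans (ℤ.*-assoc (+ u) ((+ u) ^ m) _) (trans (cong (+ u *_) (h a))
              (trans (sym (act-scale (X ^ᴼ m) (+ u) (act e′ ρ) a)) (trans (act-cong (X ^ᴼ m) h′ a) (act-comm (X ^ᴼ m) X (act e″ ρ) a)))))

    l^∤ : ∀ k x → l ℕ.^ k ∣ᶻ (+ u) ^ (k ℕ.* p) * x → l ℕ.^ k ∣ᶻ x
    l^∤ zero x _ = divides x (sym (ℤ.*-identityʳ x))
    l^∤ (suc k) x h = peel (suc k) (suc k ℕ.* p) x h
      where
      peel : ∀ k m x → l ℕ.^ k ∣ᶻ (+ u) ^ m * x → l ℕ.^ k ∣ᶻ x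
      peel zero m x h = divides x (sym (ℤ.*-identityʳ x))
      peel (suc k) m x (divides c eq) with euclidˡ {b = x} pl (∤-^ pl m l∤u) (divides (c * + (l ℕ.^ k)) (trans eq (trans (cong (c *_) (ℤ.pos-* l (l ℕ.^ k))) (lem c (+ l) (+ (l ℕ.^ k))))))
        where
        lem : ∀ c l x → c * (l * x) ≡ c * x * l
        lem = solve-∀
      ... | divides y refl with peel k m y (divides c (ℤ.*-cancelʳ-≡ _ _ (+ l) {{ℕ.>-nonZero (prime≥1 pl)}} (trans (ℤ.*-assoc ((+ u) ^ m) y (+ l)) (trans eq (trans (cong (c *_) (ℤ.pos-* l (l ℕ.^ k))) (lem c (+ l) (+ (l ℕ.^ k))))))))
        where
        lem : ∀ c l x → c * (l * x) ≡ c * x * l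
        lem = solve-∀
      ...   | divides z refl = divides z (trans (lem z (+ l) (+ (l ℕ.^ k))) (cong (z *_) (sym (ℤ.pos-* l (l ℕ.^ k)))))
        where
        lem : ∀ z l x → z * x * l ≡ z * (l * x)
        lem = solve-∀

    -- Repeated division by X terminates: X^(pk) contributes the factor l^k.
    strip-nonzero : ∀ e a → act e ρ a ≢ 0ℤ → ∃₂ λ j e′ → act (con ((+ u) ^ j) ⊗ e) ρ ≐ act (X ^ᴼ j ⊗ e′) ρ × ¬ (l ∣ᶻ constant e′)
    strip-nonzero e a nz with strip (ℤ.∣ act e ρ a ∣ ℕ.* p) e
    ... | inj₁ done = done
    ... | inj₂ (e′ , h) = contradiction dvd (∤-big ℤ.∣ act e ρ a ∣ refl)
      where
      k = ℤ.∣ act e ρ a ∣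
      dvd : l ℕ.^ k ∣ᶻ act e ρ a
      dvd = l^∤ k (act e ρ a) (∣ᶻ-≡ (sym (trans (h a) (trans (act-X^p* {act e′ ρ} (act-recurrent e′ ρ-recurrent) k a)
        (cong (_* act e′ ρ a) (trans (^-pos b k) (cong +_ (Counting.^-distribʳ-* k l u)))))))
        (∣ᶻ-*ʳ (act e′ ρ a) (∣ᶻ-≡ (sym (ℤ.pos-* (l ℕ.^ k) (u ℕ.^ k))) (∣ᶻ-*ʳ (+ (u ℕ.^ k)) ∣ᶻ-refl))))
      k<l^k : ∀ k → k ℕ.< l ℕ.^ k
      k<l^k zero = s≤s z≤n
      k<l^k (suc k) = ℕ.≤-trans (ℕ.+-mono-≤ (ℕ.≤-trans (s≤s z≤n) (k<l^k k)) (k<l^k k)) (ℕ.≤-trans (ℕ.≤-reflexive (cong (l ℕ.^ k ℕ.+_) (sym (ℕ.+-identityʳ _)))) (ℕ.*-monoˡ-≤ (l ℕ.^ k) (prime≥2 pl)))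
      ∤-big : ∀ m → ℤ.∣ act e ρ a ∣ ≡ m → ¬ (l ℕ.^ k ∣ᶻ act e ρ a)
      ∤-big zero eq _ = nz (ℤ.∣i∣≡0⇒i≡0 eq)
      ∤-big (suc m) eq h = ℕ.<⇒≱ (k<l^k k) (subst (l ℕ.^ k ℕ.≤_) (sym eq) (ℕ.∣⇒≤ (subst (l ℕ.^ k ℕ.∣_) eq (∣⇒∣ᵤ h))))

    ∣-positive : ∀ e {g} → (∀ k → l ∣ᶻ g (suc k ∷ [])) → ∀ k → l ∣ᶻ act e g (suc k ∷ [])
    ∣-positive (con c) h k = ∣ᶻ-*ˡ c (h k)
    ∣-positive (var zero) h k = h (suc k)
    ∣-positive (e ⊕ f) h k = ∣ᶻ-+ (∣-positive e h k) (∣-positive f h k)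
    ∣-positive (e ⊗ f) h k = ∣-positive e (∣-positive f h) k

    r-positive : ∀ k → l ∣ᶻ r (suc k)
    r-positive k with suc k ℕ.<? p
    ... | yes lt = ∣ᶻ-≡ (sym (r-small (suc k) (s≤s z≤n) lt)) ∣ᶻ-0
    ... | no ge = ∣ᶻ-≡ (sym (trans (cong r (sym (ℕ.m+[n∸m]≡n (ℕ.≮⇒≥ ge)))) (r-shift (suc k ℕ.∸ p))))
          (∣ᶻ-*ʳ (r (suc k ℕ.∸ p)) (∣ᶻ-≡ (sym (ℤ.pos-* l u)) (∣ᶻ-*ʳ (+ u) ∣ᶻ-refl)))

    -- The map X ↦ 0 to the field of l elements is well defined: modulo l the sequence vanishes at
    -- all positive indices, so entry 0 of `act e ρ` is e(0).
    constant-∣ : ∀ e → (∀ a → act e ρ a ≡ 0ℤ) → l ∣ᶻ constant e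
    constant-∣ e h = ∣ᶻ-≡ (lem (constant e) (act (tail e) ρ (1 ∷ [])))
      (∣ᶻ-- (∣ᶻ-≡ (trans (sym (h (0 ∷ []))) (trans (act-decompose e ρ (0 ∷ [])) (cong (λ z → constant e * z + act (tail e) ρ (1 ∷ [])) r-0))) ∣ᶻ-0)
        (∣-positive (tail e) r-positive 0))
      where
      lem : ∀ c x → (c * 1ℤ + x) - x ≡ c
      lem = solve-∀

    cancel-nonzero : ∀ {c x} → c ≢ 0ℤ → c * x ≡ 0ℤ → x ≡ 0ℤ
    cancel-nonzero {c} nz h with ℤ.i*j≡0⇒i≡0∨j≡0 c h
    ... | inj₁ z = contradiction z nz
    ... | inj₂ z = z

    cancel-X : ∀ m e → (∀ a → act (X ^ᴼ m ⊗ e) ρ a ≡ 0ℤ) → ∀ a → act e ρ a ≡ 0ℤ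
    cancel-X m e h a = cancel-nonzero {(+ b) ^ m} (λ z → ℕ.<⇒≢ 1≤b (sym (ℤ.+-injective (ℤ.i^n≡0⇒i≡0 (+ b) m z))))
      (trans (sym (act-X^p* {act e ρ} (act-recurrent e ρ-recurrent) m a)) (trans (reorder a) (act-0 (X ^ᴼ (m ℕ.* ℕ.pred p)) h a)))
      where
      reorder : act (X ^ᴼ (m ℕ.* p)) (act e ρ) ≐ act (X ^ᴼ (m ℕ.* ℕ.pred p)) (act (X ^ᴼ m) (act e ρ))
      reorder (k ∷ []) = trans (act-X^ (m ℕ.* p) (act e ρ) k) (sym (trans (act-X^ (m ℕ.* ℕ.pred p) (act (X ^ᴼ m) (act e ρ)) k) (trans (act-X^ m (act e ρ) (m ℕ.* ℕ.pred p ℕ.+ k))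
        (cong (λ z → act e ρ (z ∷ [])) (trans (sym (ℕ.+-assoc m (m ℕ.* ℕ.pred p) k)) (cong (ℕ._+ k) (trans (sym (ℕ.*-suc m (ℕ.pred p))) (cong (m ℕ.*_) (ℕ.suc-pred p)))))))))

    -- Up to a power of u, a nonzero element is a power of X times an element whose constant term is
    -- prime to l. Such elements are closed under multiplication and X can be cancelled, so the
    -- product is nonzero: Eisenstein's criterion read as an X-adic valuation.
    no-zero-divisors : ∀ e f → (∀ a → act (e ⊗ f) ρ a ≡ 0ℤ) → ¬ (∀ a → act e ρ a ≡ 0ℤ) → ∀ a → act f ρ a ≡ 0ℤ
    no-zero-divisors e f ef e≉0 a with act f ρ a ℤ.≟ 0ℤ
    ... | yes z = z
    ... | no nz = contradiction (λ a′ → e≡0 a′ (act e ρ a′ ℤ.≟ 0ℤ)) e≉0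
      where
      e≡0 : ∀ a′ → Dec (act e ρ a′ ≡ 0ℤ) → act e ρ a′ ≡ 0ℤ
      e≡0 a′ (yes z) = z
      e≡0 a′ (no nz′) with strip-nonzero e a′ nz′ | strip-nonzero f a nz
      ... | i , e′ , he , ne | j , f′ , hf , nf = contradiction (constant-∣ (e′ ⊗ f′) (cancel-X i (e′ ⊗ f′) (cancel-X j (X ^ᴼ i ⊗ (e′ ⊗ f′)) product≡0))) (∤-* pl ne nf)
        where
        product≡0 : ∀ c → act (X ^ᴼ j ⊗ (X ^ᴼ i ⊗ (e′ ⊗ f′))) ρ c ≡ 0ℤ
        product≡0 c = begin
          act (X ^ᴼ j) (act (X ^ᴼ i) (act e′ (act f′ ρ))) c ≡⟨ act-comm (X ^ᴼ j) (X ^ᴼ i ⊗ e′) (act f′ ρ) c ⟩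
          act (X ^ᴼ i ⊗ e′) (act (X ^ᴼ j) (act f′ ρ)) c ≡⟨ act-cong (X ^ᴼ i ⊗ e′) (λ v → sym (hf v)) c ⟩
          act (X ^ᴼ i ⊗ e′) (λ v → (+ u) ^ j * act f ρ v) c ≡⟨ act-scale (X ^ᴼ i ⊗ e′) ((+ u) ^ j) (act f ρ) c ⟩
          (+ u) ^ j * act (X ^ᴼ i ⊗ e′) (act f ρ) c ≡⟨ cong ((+ u) ^ j *_) (trans (act-comm (X ^ᴼ i ⊗ e′) f ρ c) (trans (act-cong f (λ v → sym (he v)) c) (act-scale f ((+ u) ^ i) (act e ρ) c))) ⟩
          (+ u) ^ j * ((+ u) ^ i * act f (act e ρ) c) ≡⟨ cong (λ z → (+ u) ^ j * ((+ u) ^ i * z)) (trans (act-comm f e ρ c) (ef c)) ⟩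
          (+ u) ^ j * ((+ u) ^ i * 0ℤ) ≡⟨ trans (cong ((+ u) ^ j *_) (ℤ.*-zeroʳ ((+ u) ^ i))) (ℤ.*-zeroʳ ((+ u) ^ j)) ⟩
          0ℤ ∎
          where open ≡-Reasoning

    order : Order
    order = toOrder ρ record
      { d = p ; point = λ s → toℕ s ∷ [] ; separates = separates ; basis = basis ; M = b ; 1≤M = 1≤b
      ; diagonal = basis-diagonal ; off-diagonal = basis-off ; no-zero-divisors = no-zero-divisors }

    evaluation : Evaluation order
    evaluation = record
      { ev = λ t → value (λ _ → + t) ; ev-+ = λ _ _ _ → refl ; ev-* = λ _ _ _ → refl
      ; ev-neg = λ t e → ℤ.-1*i≡-i (value (λ _ → + t) e) ; ev-ι = λ _ _ → refl ; X = X ; ev-X = λ _ → refl }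

    module _ (t : ℕ) where
      ev : Op 1 → ℤ
      ev = value (λ _ → + t)

      -- Horner form of the sum of the t^(m-1-i) g(i). For m = p it is entry 0 of g after the action
      -- of (X^p - t^p) / (X - t).
      φ : ℕ → Seq 1 → ℤ
      φ zero g = 0ℤ
      φ (suc m) g = + t * φ m g + g (m ∷ [])

      φ-shift : ∀ m g → φ m (act X g) + (+ t) ^ m * g (0 ∷ []) ≡ + t * φ m g + g (m ∷ [])
      φ-shift zero g = lem (+ t) (g (0 ∷ []))
        where
        lem : ∀ t x → 0ℤ + 1ℤ * x ≡ t * 0ℤ + x
        lem = solve-∀
      φ-shift (suc m) g = trans (lem (+ t) (φ m (act X g)) (g (suc m ∷ [])) ((+ t) ^ m) (g (0 ∷ []))) (cong (λ z → + t * z + g (suc m ∷ [])) (φ-shift m g))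
        where
        lem : ∀ t f x y z → t * f + x + t * y * z ≡ t * (f + y * z) + x
        lem = solve-∀

      φ-+ : ∀ m g h → φ m (λ a → g a + h a) ≡ φ m g + φ m h
      φ-+ zero g h = refl
      φ-+ (suc m) g h = trans (cong (λ z → + t * z + (g (m ∷ []) + h (m ∷ []))) (φ-+ m g h)) (lem (+ t) (φ m g) (φ m h) _ _)
        where
        lem : ∀ t a b x y → t * (a + b) + (x + y) ≡ t * a + x + (t * b + y)
        lem = solve-∀

      φ-scale : ∀ m c g → φ m (λ a → c * g a) ≡ c * φ m g
      φ-scale zero c g = sym (ℤ.*-zeroʳ c)
      φ-scale (suc m) c g = trans (cong (λ z → + t * z + c * g (m ∷ [])) (φ-scale m c g)) (lem (+ t) c (φ m g) _)
        where
        lem : ∀ t c a x → t * (c * a) + c * x ≡ c * (t * a + x)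
        lem = solve-∀

      φ-cong0 : ∀ m {g} → (∀ a → g a ≡ 0ℤ) → φ m g ≡ 0ℤ
      φ-cong0 zero h = refl
      φ-cong0 (suc m) h = trans (cong₂ (λ x y → + t * x + y) (φ-cong0 m h) (h (m ∷ []))) (trans (ℤ.+-identityʳ _) (ℤ.*-zeroʳ (+ t)))

      -- Modulo q, the functional φ is an eigenvector of the transposed action of X, with eigenvalue t.
      Eigenvector : ℕ → Op 1 → Set
      Eigenvector q e = ∀ g → Recurrent g → q ∣ᶻ φ p (act e g) - ev e * φ p g

      eigenvector-con : ∀ {q} c → Eigenvector q (con c)
      eigenvector-con {q} c g rec = ∣ᶻ-≡ (cong (λ x → x - c * φ p g) (sym (φ-scale p c g))) (∣ᶻ-self- {q} (c * φ p g))

      eigenvector-X : ∀ {q} → q ∣ᶻ (+ t) ^ p - + b → Eigenvector q X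
      eigenvector-X {q} root g rec = ∣ᶻ-≡ (lem (φ p (act X g)) ((+ t) ^ p) (g (0 ∷ [])) (+ t) (φ p g) (g (p ∷ [])) (+ b) (φ-shift p g)
          (trans (cong (λ z → g (z ∷ [])) (sym (ℕ.+-identityʳ p))) (rec 0)))
        (∣ᶻ-*ˡ {q} (- g (0 ∷ [])) root)
        where
        lem : ∀ A T x t f y b → A + T * x ≡ t * f + y → y ≡ b * x → - x * (T - b) ≡ A - t * f
        lem A T x t f y b e1 e2 = trans (s₁ x T b) (trans (cong (λ z → z - T * x) (sym e2)) (trans (s₂ y T x t f)
            (trans (cong (λ z → z - T * x - t * f) (sym e1)) (s₃ A T x t f))))
          where
          s₁ : ∀ x T b → - x * (T - b) ≡ b * x - T * x
          s₁ = solve-∀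
          s₂ : ∀ y T x t f → y - T * x ≡ t * f + y - T * x - t * f
          s₂ = solve-∀
          s₃ : ∀ A T x t f → A + T * x - T * x - t * f ≡ A - t * f
          s₃ = solve-∀

      eigenvector-⊕ : ∀ {q e f} → Eigenvector q e → Eigenvector q f → Eigenvector q (e ⊕ f)
      eigenvector-⊕ {q} {e} {f} he hf g rec = ∣ᶻ-≡ (trans (lem (φ p (act e g)) (φ p (act f g)) (ev e) (ev f) (φ p g)) (cong (λ x → x - (ev e + ev f) * φ p g) (sym (φ-+ p (act e g) (act f g)))))
          (∣ᶻ-+ (he g rec) (hf g rec))
        where
        lem : ∀ x y a b z → (x - a * z) + (y - b * z) ≡ (x + y) - (a + b) * z
        lem = solve-∀

      eigenvector-⊗ : ∀ {q e f} → Eigenvector q e → Eigenvector q f → Eigenvector q (e ⊗ f)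
      eigenvector-⊗ {q} {e} {f} he hf g rec = ∣ᶻ-≡ (lem (φ p (act e (act f g))) (ev e) (φ p (act f g)) (ev f) (φ p g))
          (∣ᶻ-+ (he (act f g) (act-recurrent f {g} rec)) (∣ᶻ-*ˡ (ev e) (hf g rec)))
        where
        lem : ∀ x a y b z → (x - a * y) + a * (y - b * z) ≡ x - a * b * z
        lem = solve-∀

      φ-act : ∀ {q} → q ∣ᶻ (+ t) ^ p - + b → ∀ e → Eigenvector q e
      φ-act root (con c) = eigenvector-con c
      φ-act root (var zero) = eigenvector-X root
      φ-act root (e ⊕ f) = eigenvector-⊕ {e = e} {f} (φ-act root e) (φ-act root f)
      φ-act root (e ⊗ f) = eigenvector-⊗ {e = e} {f} (φ-act root e) (φ-act root f)

      φ-ρ : ∀ m → m ℕ.< p → φ (suc m) ρ ≡ (+ t) ^ m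
      φ-ρ zero _ = trans (cong (_+ r 0) (ℤ.*-zeroʳ (+ t))) (trans (ℤ.+-identityˡ (r 0)) r-0)
      φ-ρ (suc m) m< = trans (cong₂ (λ x y → + t * x + y) (φ-ρ m (ℕ.<⇒≤ m<)) (r-small (suc m) (s≤s z≤n) m<)) (ℤ.+-identityʳ _)

      -- By `φ-act`, e acts on φ through the scalar `ev e` modulo q. If e is zero in the ring then
      -- `ev e` kills φ p ρ = t^(p-1), which is a unit since q does not divide b.
      valid : ∀ {q} → Prime q → ¬ (q ∣ᶻ + b) → q ∣ᶻ (+ t) ^ p - + b → ∀ e → (∀ a → act e ρ a ≡ 0ℤ * ρ a) → q ∣ᶻ ev e
      valid {q} pq q∤b root e h = euclidˡ {b = ev e} pq (∤-^ pq (ℕ.pred p) q∤t)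
        (∣ᶻ-≡ (trans (cong₂ (λ x y → x - (x - ev e * y)) (φ-cong0 p {act e ρ} λ a → trans (h a) (ℤ.*-zeroˡ (ρ a))) φρ) (lem (ev e) ((+ t) ^ ℕ.pred p)))
          (∣ᶻ-- (∣ᶻ-≡ (sym (φ-cong0 p {act e ρ} λ a → trans (h a) (ℤ.*-zeroˡ (ρ a)))) ∣ᶻ-0) (φ-act root e ρ ρ-recurrent)))
        where
        lem : ∀ v x → 0ℤ - (0ℤ - v * x) ≡ x * v
        lem = solve-∀
        φρ : φ p ρ ≡ (+ t) ^ ℕ.pred p
        φρ = trans (cong (λ m → φ m ρ) (sym (ℕ.suc-pred p))) (φ-ρ (ℕ.pred p) (ℕ.≤-reflexive (ℕ.suc-pred p)))
        q∤t : ¬ (q ∣ᶻ + t)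
        q∤t q∣t = q∤b (∣ᶻ-≡ (lem₂ ((+ t) ^ p) (+ b)) (∣ᶻ-- (∣ᶻ-≡ (cong (λ m → (+ t) ^ m) (ℕ.suc-pred p)) (∣ᶻ-*ʳ ((+ t) ^ ℕ.pred p) q∣t)) root))
          where
          lem₂ : ∀ x b → x - (x - b) ≡ b
          lem₂ = solve-∀

-- The order of a p-th root of unity and several radicals

module RadicalRings where

  open Counting using (box; ∈-box⁺)
  open Orders using (Σℤ; Σℤ-single)
  open SequenceOperators
  open import Data.Nat.Induction using (<-rec)
  open import Data.Integer using (+_; -1ℤ; _+_; _*_; -_; _-_; _^_)
  open import Data.Integer.Tactic.RingSolver using (solve-∀)
  open import Data.Fin using (punchIn; punchOut)
  open import Data.Vec using (lookup; updateAt)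
  open import Data.List.Relation.Unary.Any using (index)
  open import Data.List.Relation.Unary.Any.Properties using (lookup-index)
  open import Relation.Binary.PropositionalEquality

  ¬¬-∀Fin : ∀ {k} {P : Fin k → Set} → (∀ s → ¬ ¬ P s) → ¬ ¬ (∀ s → P s)
  ¬¬-∀Fin {zero} h n = n λ ()
  ¬¬-∀Fin {suc k} h n = h zero λ p → ¬¬-∀Fin (h ∘ suc) λ f → n λ { zero → p ; (suc s) → f s }

  private variable
    n : ℕ

  common-multiple : ∀ {k} (m : Fin k → ℤ) → (∀ s → m s ≢ 0ℤ) →
    ∃ λ M → 1 ℕ.≤ M × ∃ λ (c : Fin k → ℤ) → ∀ s → c s * m s ≡ + M
  common-multiple {zero} m h = 1 , ℕ.≤-refl , (λ ()) , λ ()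
  common-multiple {suc k} m h with common-multiple (m ∘ suc) (h ∘ suc) | unit (m zero)
    where
    unit : ∀ x → ∃ λ c → c * x ≡ + ℤ.∣ x ∣
    unit (+ x) = 1ℤ , ℤ.*-identityˡ _
    unit ℤ.-[1+ x ] = -1ℤ , ℤ.-1*i≡-i ℤ.-[1+ x ]
  ... | M , 1≤M , c , e | σ , eσ = ℤ.∣ m zero ∣ ℕ.* M , ℕ.*-mono-≤ (ℕ.n≢0⇒n>0 (h zero ∘ ℤ.∣i∣≡0⇒i≡0)) 1≤M ,
      (λ { zero → + M * σ ; (suc s) → + ℤ.∣ m zero ∣ * c s }) ,
      λ { zero → trans (ℤ.*-assoc (+ M) σ (m zero)) (trans (cong (+ M *_) eσ) (trans (sym (ℤ.pos-* M ℤ.∣ m zero ∣)) (cong +_ (ℕ.*-comm M ℤ.∣ m zero ∣))))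
        ; (suc s) → trans (ℤ.*-assoc (+ ℤ.∣ m zero ∣) (c s) (m (suc s))) (trans (cong (+ ℤ.∣ m zero ∣ *_) (e s)) (sym (ℤ.pos-* ℤ.∣ m zero ∣ M))) }

  sumᴼ : ∀ {k} → (Fin k → Op n) → Op n
  sumᴼ {k = zero} f = con 0ℤ
  sumᴼ {k = suc k} f = f zero ⊕ sumᴼ (f ∘ suc)

  act-sum : ∀ {k} (f : Fin k → Op n) g a → act (sumᴼ f) g a ≡ Σℤ λ s → act (f s) g a
  act-sum {k = zero} f g a = ℤ.*-zeroˡ (g a)
  act-sum {k = suc k} f g a = cong (λ z → act (f zero) g a + z) (act-sum (f ∘ suc) g a)

  Separates : ∀ {k} → Seq n → (Fin k → Vec ℕ n) → Set
  Separates ρ pt = ∀ e → (∀ s → act e ρ (pt s) ≡ 0ℤ) → ∀ a → act e ρ a ≡ 0ℤ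

  Null : Seq n → Set
  Null g = ∀ a → g a ≡ 0ℤ

  DualBasis : ∀ {k} → Seq n → (Fin k → Vec ℕ n) → Set
  DualBasis {n} {k} ρ pt = ∃₂ λ (M : ℕ) (b : Fin k → Op n) → 1 ℕ.≤ M ×
    (∀ s → act (b s) ρ (pt s) ≡ + M) × (∀ s t → s ≢ t → act (b s) ρ (pt t) ≡ 0ℤ)

  separates-act : ∀ {k} {ρ : Seq n} {pt : Fin k → Vec ℕ n} α → Separates ρ pt → Separates (act α ρ) pt
  separates-act α sep e h = sep (e ⊗ α) h

  -- No proper subset of the coordinates separates, so for each coordinate some element is supported on it alone.
  dual-basis : ∀ {k} (ρ : Seq n) (pt : Fin (suc k) → Vec ℕ n) → Separates ρ pt →
    (∀ (pt′ : Fin k → Vec ℕ n) → ¬ Separates ρ pt′) → ¬ ¬ DualBasis ρ pt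
  dual-basis {k = k} ρ pt sep minimal absurd = ¬¬-∀Fin supported λ f →
      let (M , 1≤M , c , e) = common-multiple (λ s → act (proj₁ (f s)) ρ (pt s)) (λ s → proj₁ (proj₂ (f s))) in
      absurd (M , (λ s → con (c s) ⊗ proj₁ (f s)) , 1≤M , e ,
        λ s t s≢t → trans (cong (c s *_) (proj₂ (proj₂ (f s)) t (s≢t ∘ sym))) (ℤ.*-zeroʳ (c s)))
    where
    supported : ∀ s → ¬ ¬ (∃ λ e → act e ρ (pt s) ≢ 0ℤ × ∀ t → t ≢ s → act e ρ (pt t) ≡ 0ℤ)
    supported s none = minimal (pt ∘ punchIn s) λ e h → sep e λ t → vanish e h t (t Fin.≟ s)
      where
      vanish : ∀ e → (∀ t → act e ρ (pt (punchIn s t)) ≡ 0ℤ) → ∀ t → Dec (t ≡ s) → act e ρ (pt t) ≡ 0ℤ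
      others : ∀ e → (∀ t → act e ρ (pt (punchIn s t)) ≡ 0ℤ) → ∀ t → t ≢ s → act e ρ (pt t) ≡ 0ℤ
      others e h t t≢s = trans (cong (act e ρ ∘ pt) (sym (Fin.punchIn-punchOut (t≢s ∘ sym)))) (h (punchOut (t≢s ∘ sym)))
      vanish e h t (no t≢s) = others e h t t≢s
      vanish e h t (yes refl) with act e ρ (pt s) ℤ.≟ 0ℤ
      ... | yes z = z
      ... | no nz = contradiction (e , nz , others e h) none

  cancel-+ : ∀ {M x} → 1 ℕ.≤ M → + M * x ≡ 0ℤ → x ≡ 0ℤ
  cancel-+ {M} 1≤M h with ℤ.i*j≡0⇒i≡0∨j≡0 (+ M) h
  ... | inj₁ z = contradiction (ℤ.+-injective z) (ℕ.<⇒≢ 1≤M ∘ sym)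
  ... | inj₂ z = z

  -- Minimality also makes the quotient a domain: every nonzero e divides a nonzero integer.
  frame : ∀ {k} (ρ : Seq n) (pt : Fin (suc k) → Vec ℕ n) → Separates ρ pt →
    (∀ α → ¬ Null (act α ρ) → ∀ (pt′ : Fin k → Vec ℕ n) → ¬ Separates (act α ρ) pt′) →
    DualBasis ρ pt → Frame ρ
  frame {k = k} ρ pt sep minimal (M , b , 1≤M , diag , off) = record
    { d = suc k ; point = pt ; separates = sep ; basis = b ; M = M ; 1≤M = 1≤M ; diagonal = diag ; off-diagonal = off
    ; no-zero-divisors = no-zero-divisors }
    where
    no-zero-divisors : ∀ e f → (∀ a → act (e ⊗ f) ρ a ≡ 0ℤ) → ¬ (∀ a → act e ρ a ≡ 0ℤ) → ∀ a → act f ρ a ≡ 0ℤ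
    no-zero-divisors e f ef e≉0 a with act f ρ a ℤ.≟ 0ℤ
    ... | yes z = z
    ... | no nz = contradiction (λ (M′ , b′ , 1≤M′ , diag′ , off′) → nz (cancel-+ 1≤M′ (killed M′ b′ diag′ off′)))
                    (dual-basis (act e ρ) pt (separates-act e sep) (minimal e e≉0))
      where
      killed : ∀ M′ (b′ : Fin (suc k) → Op _) → (∀ s → act (b′ s) (act e ρ) (pt s) ≡ + M′) → (∀ s t → s ≢ t → act (b′ s) (act e ρ) (pt t) ≡ 0ℤ) →
        + M′ * act f ρ a ≡ 0ℤ
      killed M′ b′ diag′ off′ = begin
        + M′ * act f ρ a ≡⟨ sym (act-scale f (+ M′) ρ a) ⟩
        act f (λ v → + M′ * ρ v) a ≡⟨ act-cong f M′ρ a ⟩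
        act f (act τ (act e ρ)) a ≡⟨ act-comm f (τ ⊗ e) ρ a ⟩
        act τ (act e (act f ρ)) a ≡⟨ act-0 τ ef a ⟩
        0ℤ ∎
        where
        open ≡-Reasoning
        -- τ e and M′ have the same entries at all points, so they agree in the quotient. As e f
        -- vanishes, so does M′ f.
        τ = sumᴼ (λ s → con (ρ (pt s)) ⊗ b′ s)
        value-at : ∀ t → act τ (act e ρ) (pt t) ≡ ρ (pt t) * + M′
        value-at t = trans (act-sum (λ s → con (ρ (pt s)) ⊗ b′ s) (act e ρ) (pt t)) (trans (Σℤ-single (λ s → ρ (pt s) * act (b′ s) (act e ρ) (pt t)) t λ s s≢t → trans (cong (ρ (pt s) *_) (off′ s t s≢t)) (ℤ.*-zeroʳ (ρ (pt s))))
          (cong (ρ (pt t) *_) (diag′ t)))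
        M′ρ : (λ v → + M′ * ρ v) ≐ act τ (act e ρ)
        M′ρ v = trans (lem (+ M′ * ρ v) (act τ (act e ρ) v)) (trans (cong (_+ act τ (act e ρ) v)
            (sep (con (+ M′) ⊕ negate (τ ⊗ e)) (λ t → trans (cong (λ z → + M′ * ρ (pt t) + -1ℤ * z) (value-at t)) (lem₂ (+ M′) (ρ (pt t)))) v)) (ℤ.+-identityˡ _))
          where
          lem : ∀ x y → x ≡ (x + -1ℤ * y) + y
          lem = solve-∀
          lem₂ : ∀ m r → m * r + -1ℤ * (r * m) ≡ 0ℤ
          lem₂ = solve-∀

  -- Descent on k. If some nonzero `act α ρ` is separated by fewer points, it replaces ρ, which
  -- enlarges the annihilator. If there is none, k is minimal for all nonzero multiples of ρ and
  -- `frame` gives a domain. The case distinction is not decided, hence the double negation. The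
  -- ring of ρ itself need not be a domain, since the radicals may be dependent.
  domain-quotient : ∀ k (ρ : Seq n) (pt : Fin k → Vec ℕ n) → Separates ρ pt → ¬ Null ρ → ¬ ¬ (∃ λ e → ¬ Null (act e ρ) × Frame (act e ρ))
  domain-quotient zero ρ pt sep nz absurd = nz λ a → trans (sym (ℤ.*-identityˡ (ρ a))) (sep (con 1ℤ) (λ ()) a)
  domain-quotient (suc k) ρ pt sep nz absurd =
    dual-basis (act (con 1ℤ) ρ) pt (separates-act {ρ = ρ} (con 1ℤ) sep) (minimal (con 1ℤ) nz′) λ db →
    absurd (con 1ℤ , nz′ , frame (act (con 1ℤ) ρ) pt (separates-act {ρ = ρ} (con 1ℤ) sep) (λ α → minimal (α ⊗ con 1ℤ)) db)
    where
    nz′ : ¬ Null (act (con 1ℤ) ρ)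
    nz′ z = nz λ a → trans (sym (ℤ.*-identityˡ (ρ a))) (z a)
    minimal : ∀ α → ¬ Null (act α ρ) → ∀ (pt′ : Fin k → Vec ℕ _) → ¬ Separates (act α ρ) pt′
    minimal α n pt′ s = domain-quotient k (act α ρ) pt′ s n λ (e , n′ , F) → absurd (e ⊗ α , n′ , F)

  -- The sequence attached to ℤ[ζ, c₁^(1/p), …, c_m^(1/p)]; the first index belongs to ζ.
  module Radical (p : ℕ) (2≤p : 2 ℕ.≤ p) {m : ℕ} (c : Vec ℤ m) where
    instance
      p≢0 : NonZero p
      p≢0 = ℕ.>-nonZero (ℕ.<⇒≤ 2≤p)

    δ : ℕ → ℤ
    δ zero = 1ℤ
    δ (suc _) = 0ℤ

    -- A difference of two p-periodic delta sequences: every sum over a full period telescopes to 0,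
    -- so 1 + X + ... + X^(p-1) annihilates it and X acts as a p-th root of unity.
    s : ℕ → ℤ
    s k = δ (suc k ℕ.% p) - δ (k ℕ.% p)

    -- A solution of the recurrences g(a + p) = c g(a), one for each coordinate, with value 1 at the
    -- origin.
    radical : ∀ {m} → Vec ℤ m → Seq m
    radical [] [] = 1ℤ
    radical (c ∷ cs) (a ∷ as) = c ^ (a ℕ./ p) * radical cs as

    ρ : Seq (suc m)
    ρ (k ∷ a) = s k * radical c a

    Recurrent : ∀ {n} → Vec ℤ n → Seq n → Set
    Recurrent C g = ∀ i a → g (updateAt a i (p ℕ.+_)) ≡ lookup C i * g a

    %-shift : ∀ k → (p ℕ.+ k) ℕ.% p ≡ k ℕ.% p
    %-shift k = trans (cong (ℕ._% p) (ℕ.+-comm p k)) (ℕ.[m+n]%n≡m%n k p)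

    radical-recurrent : ∀ {m} (c : Vec ℤ m) → Recurrent c (radical c)
    radical-recurrent (c ∷ cs) zero (a ∷ as) = trans (cong (λ k → c ^ k * radical cs as)
      (trans (ℕ.m/n≡1+[m∸n]/n {p ℕ.+ a} {p} (ℕ.m≤m+n p a)) (cong (λ z → suc (z ℕ./ p)) (ℕ.m+n∸m≡n p a)))) (ℤ.*-assoc c _ _)
    radical-recurrent (c ∷ cs) (suc i) (a ∷ as) = trans (cong (c ^ (a ℕ./ p) *_) (radical-recurrent cs i as)) (lem (c ^ (a ℕ./ p)) (lookup cs i) (radical cs as))
      where
      lem : ∀ x y z → x * (y * z) ≡ y * (x * z)
      lem = solve-∀

    ρ-recurrent : Recurrent (1ℤ ∷ c) ρ
    ρ-recurrent zero (k ∷ a) = trans (cong (_* radical c a) (cong₂ (λ i j → δ i - δ j) (trans (cong (ℕ._% p) (sym (ℕ.+-suc p k))) (%-shift (suc k))) (%-shift k)))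
      (sym (ℤ.*-identityˡ _))
    ρ-recurrent (suc i) (k ∷ a) = trans (cong (s k *_) (radical-recurrent c i a)) (lem (s k) (lookup c i) (radical c a))
      where
      lem : ∀ x y z → x * (y * z) ≡ y * (x * z)
      lem = solve-∀

    act-var^ : ∀ {n} (i : Fin n) j g a → act (var i ^ᴼ j) g a ≡ g (updateAt a i (j ℕ.+_))
    act-var^ i zero g a = trans (ℤ.*-identityˡ _) (cong g (sym (Vec.updateAt-id i a)))
    act-var^ i (suc j) g a = trans (act-var^ i j g (bump i a)) (cong g (trans (Vec.updateAt-updateAt i a) (Vec.updateAt-cong i (λ x → ℕ.+-suc j x) a)))

    act-recurrent : ∀ {n} (C : Vec ℤ n) e {g} → Recurrent C g → Recurrent C (act e g)
    act-recurrent C e {g} rec i a = trans (sym (act-var^ i p (act e g) a)) (trans (act-comm (var i ^ᴼ p) e g a)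
      (trans (act-cong {g = act (var i ^ᴼ p) g} {h = λ a → lookup C i * g a} e (λ b → trans (act-var^ i p g b) (rec i b)) a) (act-scale e (lookup C i) g a)))

    recurrent-null : ∀ {n} (C : Vec ℤ n) {g} → Recurrent C g → (∀ {a} → a ∈ box n p → g a ≡ 0ℤ) → Null g
    recurrent-null {zero} [] rec h [] = h (∈-box⁺ {n = p} {v = []} λ ())
    recurrent-null {suc n} (c ∷ C) {g} rec h (k ∷ a) = <-rec (λ k → ∀ a → g (k ∷ a) ≡ 0ℤ) step k a
      where
      step : ∀ k → (∀ {j} → j ℕ.< k → ∀ a → g (j ∷ a) ≡ 0ℤ) → ∀ a → g (k ∷ a) ≡ 0ℤ
      step k rec′ a with k ℕ.<? p
      ... | yes k<p = recurrent-null C {λ a → g (k ∷ a)} (λ i a → rec (suc i) (k ∷ a))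
                        (λ {a} a∈ → h (∈-box⁺ λ { zero → k<p ; (suc i) → Counting.∈-box⁻ a∈ i })) a
      ... | no k≮p = trans (cong (λ j → g (j ∷ a)) (sym (ℕ.m+[n∸m]≡n (ℕ.≮⇒≥ k≮p)))) (trans (rec zero (k ℕ.∸ p ∷ a))
                       (trans (cong (c *_) (rec′ (ℕ.∸-monoʳ-< (ℕ.<⇒≤ 2≤p) (ℕ.≮⇒≥ k≮p)) a)) (ℤ.*-zeroʳ c)))

    pts : Fin (List.length (box (suc m) p)) → Vec ℕ (suc m)
    pts = List.lookup (box (suc m) p)

    separates : Separates ρ pts
    separates e h = recurrent-null (1ℤ ∷ c) (act-recurrent (1ℤ ∷ c) e ρ-recurrent) λ {a} a∈ → trans (cong (act e ρ) (lookup-index a∈)) (h (index a∈))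

    radical-1 : ∀ {m} (c : Vec ℤ m) → radical c (Vec.replicate m 0) ≡ 1ℤ
    radical-1 [] = refl
    radical-1 (c ∷ cs) = trans (cong₂ (λ k z → c ^ k * z) (ℕ.m<n⇒m/n≡0 {m = 0} {n = p} (ℕ.<⇒≤ 2≤p)) (radical-1 cs)) refl

    ρ-nonnull : ¬ Null ρ
    ρ-nonnull h with () ← trans (sym (trans (cong₂ (λ x y → x * y) (cong₂ (λ i j → δ i - δ j) (ℕ.m<n⇒m%n≡m {n = p} {m = 1} 2≤p) (ℕ.m<n⇒m%n≡m {n = p} {m = 0} (ℕ.<⇒≤ 2≤p))) (radical-1 c)) refl))
                                (h (0 ∷ Vec.replicate m 0))

    -- 1 + X + ... + X^(j-1) in the first variable; at j = p, for prime p, the p-th cyclotomic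
    -- polynomial.
    Φ : ∀ {n} → ℕ → Op (suc n)
    Φ zero = con 0ℤ
    Φ (suc j) = Φ j ⊕ var zero ^ᴼ j

    Φ-telescopes : ∀ j k a → act (Φ j) ρ (k ∷ a) ≡ (δ ((j ℕ.+ k) ℕ.% p) - δ (k ℕ.% p)) * radical c a
    Φ-telescopes zero k a = trans (ℤ.*-zeroˡ (ρ (k ∷ a))) (sym (trans (cong (_* radical c a) (ℤ.+-inverseʳ (δ (k ℕ.% p)))) (ℤ.*-zeroˡ (radical c a))))
    Φ-telescopes (suc j) k a = trans (cong₂ _+_ (Φ-telescopes j k a) (act-var^ zero j ρ (k ∷ a)))
      (lem (δ ((j ℕ.+ k) ℕ.% p)) (δ (k ℕ.% p)) (δ (suc (j ℕ.+ k) ℕ.% p)) (radical c a))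
      where
      lem : ∀ x y z r → (x - y) * r + (z - x) * r ≡ (z - y) * r
      lem = solve-∀

    Φ-null : Null (act (Φ p) ρ)
    Φ-null (k ∷ a) = trans (Φ-telescopes p k a) (trans (cong (λ i → (δ i - δ (k ℕ.% p)) * radical c a) (%-shift k))
      (trans (cong (_* radical c a) (ℤ.+-inverseʳ (δ (k ℕ.% p)))) (ℤ.*-zeroˡ (radical c a))))

    exists-quotient : ¬ ¬ (∃ λ e → ¬ Null (act e ρ) × Frame (act e ρ))
    exists-quotient = domain-quotient _ ρ pts separates ρ-nonnull

    Φ-relation : ∀ e → Null (act (Φ p) (act e ρ))
    Φ-relation e a = trans (act-comm (Φ p) e ρ a) (act-0 e Φ-null a)

    root-relation : ∀ e i → act (var (suc i) ^ᴼ p) (act e ρ) ≐ λ a → lookup c i * act e ρ a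
    root-relation e i a = trans (act-var^ (suc i) p (act e ρ) a) (act-recurrent (1ℤ ∷ c) e ρ-recurrent (suc i) a)

-- Ideals, indices and units in an order

module Ideals where

  open Counting
  open Orders
  open Congruences
  open Evaluations using (%-/-injective)
  open import Data.Nat.Primality.Factorisation using (factorise; PrimeFactorisation)
  open import Data.Integer using (+_)
  open import Data.Integer.Tactic.RingSolver using () renaming (solve-∀ to ℤ-solve-∀)
  open import Data.Vec using (lookup)
  open import Data.List using (foldr)
  open import Data.List.Properties using (length-upTo)
  open import Data.List.Membership.Propositional.Properties using (∈-upTo⁻)
  open import Data.List.Relation.Unary.All as All using (All; []; _∷_)
  open import Data.List.Relation.Unary.AllPairs as AllPairs using (AllPairs; []; _∷_)
  open import Relation.Binary.PropositionalEquality as ≡ using (_≡_; _≢_; refl; cong; subst)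

  ¬¬-All : {A : Set} {P : A → Set} {xs : List A} → All (λ x → ¬ ¬ P x) xs → ¬ ¬ All P xs
  ¬¬-All [] n = n []
  ¬¬-All (p ∷ ps) n = p λ x → ¬¬-All ps λ xs → n (x ∷ xs)

  ¬¬-AllPairs : {A : Set} {R : A → A → Set} {xs : List A} → AllPairs (λ x y → ¬ ¬ R x y) xs → ¬ ¬ AllPairs R xs
  ¬¬-AllPairs [] n = n []
  ¬¬-AllPairs (p ∷ ps) n = ¬¬-All p λ x → ¬¬-AllPairs ps λ xs → n (x ∷ xs)

  maximum : ∀ {k} (f : Fin k → ℕ) → ∃ λ t → (∀ s → f s ℕ.≤ t) × (t ≡ 0 ⊎ ∃ λ s → f s ≡ t)
  maximum {zero} f = 0 , (λ ()) , inj₁ refl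
  maximum {suc k} f with maximum (f ∘ suc)
  ... | t , bd , att with ℕ.≤-total (f zero) t
  ...   | inj₁ le = t , (λ { zero → le ; (suc s) → bd s }) , Sum.map₂ (λ (s , e) → suc s , e) att
  ...   | inj₂ ge = f zero , (λ { zero → ℕ.≤-refl ; (suc s) → ℕ.≤-trans (bd s) ge }) , inj₂ (zero , refl)

  module PrimeIdeals (O : Order) (1≉0 : ¬ (Order._≈_ O (Order.1# O) (Order.0# O))) where
    open Order O

    ι-nat : ∀ m n → ι (+ (m ℕ.* n)) ≈ ι (+ m) * ι (+ n)
    ι-nat m n = trans (ι-cong (ℤ.pos-* m n)) (ι-* (+ m) (+ n))

    ι≉0 : ∀ {a} → a ≢ 0ℤ → ¬ (ι a ≈ 0#)
    ι≉0 {a} nz h = 1≉0 (π-injective λ s → cancel (≡.trans (≡.sym (π-ι a s)) (≡.trans (π-cong h s) (π-0 s))))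
      where
      cancel : ∀ {x} → a ℤ.* x ≡ 0ℤ → x ≡ 0ℤ
      cancel {x} e with ℤ.i*j≡0⇒i≡0∨j≡0 a e
      ... | inj₁ z = contradiction z nz
      ... | inj₂ z = z

    N₁ : ℕ
    N₁ = proj₁ (bounded-exists 1#)

    bounded-ι : ∀ a → Bounded (ι a) (ℤ.∣ a ∣ ℕ.* N₁)
    bounded-ι a = bounded-cong (*-identityʳ (ι a)) (bounded-ι* a (proj₂ (bounded-exists 1#)))

    c : ℕ
    c = suc (2 ℕ.* K ℕ.* M)

    index-bound′ : ∀ {n} (β : ℕ → Carrier) {γ b} → ¬ (γ ≈ 0#) → Bounded γ b →
      (∀ {i j} → i ℕ.< n → j ℕ.< n → ∀ z → β i ≈ β j + γ * z → i ≡ j) → n ℕ.≤ suc (c ℕ.* b) ℕ.^ d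
    index-bound′ {n} β {γ} {b} γ≉0 bγ inj = ℕ.≤-trans (subst (ℕ._≤ _) (length-upTo n)
        (index-bound {is = upTo n} β (Unique.upTo⁺ n) γ≉0 bγ λ i∈ j∈ → inj (∈-upTo⁻ i∈) (∈-upTo⁻ j∈)))
      (ℕ.^-monoˡ-≤ d (s≤s (ℕ.*-monoˡ-≤ b (ℕ.n≤1+n (2 ℕ.* K ℕ.* M)))))

    -- Among more integers than the index of γR can be, two are congruent modulo γ, and their
    -- difference is the required multiple.
    divides-integer : ∀ {γ} → ¬ (γ ≈ 0#) → ¬ ¬ (∃₂ λ δ a → a ≢ 0ℤ × γ * δ ≈ ι a)
    divides-integer {γ} γ≉0 none = ℕ.<-irrefl refl (index-bound′ {suc (suc (c ℕ.* b) ℕ.^ d)} (λ i → ι (+ i)) γ≉0 bγ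
      λ {i} {j} _ _ z h → decidable-stable (i ℕ.≟ j) λ i≢j → none (z , + i ℤ.- + j , (λ e → i≢j (ℤ.+-injective (ℤ.i-j≡0⇒i≡j (+ i) (+ j) e))) ,
        trans (solve 2 (λ g i → g := (i :+ g) :- i) ≈-refl (γ * z) (ι (+ j))) (trans (+-congʳ (sym h)) (sym (trans (ι-+ _ _) (+-congˡ (ι-neg _)))))))
      where
      b = proj₁ (bounded-exists γ)
      bγ = proj₂ (bounded-exists γ)

    Unit : Carrier → Set
    Unit γ = ∃ λ u → γ * u ≈ 1#

    Invertible : ℕ → Carrier → Set
    Invertible q γ = ∃₂ λ u v → γ * u ≈ 1# + ι (+ q) * v

    -- γ divides a nonzero integer a. Inverses of γ modulo the prime factors of a combine to an
    -- inverse modulo a, and since a is itself a multiple of γ this becomes an inverse in the ring.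
    -- So a nonunit fails to be invertible modulo some prime.
    unit-or-prime : ∀ {γ} → ¬ (γ ≈ 0#) → ¬ ¬ (Unit γ ⊎ ∃ λ q → Prime q × ¬ Invertible q γ)
    unit-or-prime {γ} γ≉0 none = divides-integer γ≉0 λ (δ , a , a≢0 , h) →
      let f = factorise ℤ.∣ a ∣ {{ℤ.≢-nonZero a≢0}}
          open PrimeFactorisation f
      in ¬¬-All (All.tabulate λ {q} q∈ ni → none (inj₂ (q , All.lookup factorsPrime q∈ , ni))) λ inv →
         let (u , v , e) = product-invertible factors inv
             (w , e′) = associate a
         in none (inj₁ (u - δ * ι w * v , trans
           (solve 5 (λ g u d w v → g :* (u :- d :* w :* v) := g :* u :- g :* d :* w :* v) ≈-refl γ u δ (ι w) v)
           (trans (+-cong e (-‿cong (*-congʳ (trans (*-congʳ h) (trans (sym (ι-* a w)) (ι-cong (≡.trans e′ (cong +_ isFactorisation))))))))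
             (trans (+-assoc _ _ _) (trans (+-congˡ (-‿inverseʳ _)) (+-identityʳ 1#))))))
      where
      associate : ∀ a → ∃ λ w → a ℤ.* w ≡ + ℤ.∣ a ∣
      associate (+ n) = 1ℤ , ℤ.*-identityʳ (+ n)
      associate ℤ.-[1+ n ] = ℤ.- 1ℤ , ≡.trans (ℤ.*-comm ℤ.-[1+ n ] (ℤ.- 1ℤ)) (ℤ.-1*i≡-i ℤ.-[1+ n ])
      product-invertible : ∀ qs → All (λ q → Invertible q γ) qs → Invertible (foldr ℕ._*_ 1 qs) γ
      product-invertible [] [] = 0# , - 1# , trans (zeroʳ γ) (sym (trans (+-congˡ (*-congʳ ι-1)) (trans (+-congˡ (*-identityˡ _)) (-‿inverseʳ 1#))))
      product-invertible (q ∷ qs) ((u , v , e) ∷ ps) with product-invertible qs ps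
      ... | u′ , v′ , e′ = u + u′ - u * u′ * γ , - (v * v′) ,
        trans (solve 3 (λ g u u′ → g :* (u :+ u′ :- u :* u′ :* g) := g :* u :+ g :* u′ :- (g :* u) :* (g :* u′)) ≈-refl γ u u′)
        (trans (+-cong (+-cong e e′) (-‿cong (*-cong e e′)))
        (trans (+-cong (+-cong (+-congʳ (sym ι-1)) (+-congʳ (sym ι-1))) (-‿cong (*-cong (+-congʳ (sym ι-1)) (+-congʳ (sym ι-1)))))
        (trans (solve 4 (λ q v p v′ → (con 1ℤ :+ q :* v) :+ (con 1ℤ :+ p :* v′) :- (con 1ℤ :+ q :* v) :* (con 1ℤ :+ p :* v′) := con 1ℤ :+ (q :* p) :* (:- (v :* v′)))
            ≈-refl (ι (+ q)) v (ι (+ foldr ℕ._*_ 1 qs)) v′)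
          (+-cong ι-1 (*-congʳ (sym (ι-nat q (foldr ℕ._*_ 1 qs))))))))

    record IsIdeal (I : Carrier → Set) : Set where
      field
        ≈-closed : ∀ {x y} → x ≈ y → I x → I y
        +-closed : ∀ {x y} → I x → I y → I (x + y)
        *-closed : ∀ x {y} → I y → I (x * y)

    module _ {I : Carrier → Set} (ideal : IsIdeal I) where
      open IsIdeal ideal

      integer-in-ideal : ∀ {q} → Prime q → I (ι (+ q)) → ¬ I 1# → ∀ a → I (ι a) → q ∣ᶻ a
      integer-in-ideal {q} pq q∈I proper a a∈I = decidable-stable (q ∣ᶻ? a) λ q∤a → proper (one (inverse-mod pq q∤a))
        where
        one : (∃ λ b → q ∣ᶻ a ℤ.* b ℤ.- 1ℤ) → I 1#
        one (b , divides k e) = ≈-closed (trans (solve 4 (λ a b k q → b :* a :+ (:- k) :* q := a :* b :- k :* q) ≈-refl (ι a) (ι b) (ι k) (ι (+ q)))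
            (trans (+-cong (sym (ι-* a b)) (-‿cong (sym (ι-* k (+ q))))) (trans (+-congˡ (-‿cong (ι-cong (≡.sym e))))
            (trans (trans (+-congˡ (sym (ι-neg _))) (trans (sym (ι-+ _ _)) (ι-cong (lem (a ℤ.* b))))) ι-1))))
          (+-closed (*-closed (ι b) a∈I) (*-closed (- ι k) q∈I))
          where
          lem : ∀ x → x ℤ.+ ℤ.- (x ℤ.- 1ℤ) ≡ 1ℤ
          lem = ℤ-solve-∀

      private
        difference-∈ : ∀ {x y ξ z} → I ξ → x ≈ y + ξ * z → I (x - y)
        difference-∈ {x} {y} {ξ} {z} ξ∈ h = ≈-closed (trans (solve 3 (λ y ξ z → z :* ξ := (y :+ ξ :* z) :- y) ≈-refl y ξ z) (+-congʳ (sym h))) (*-closed z ξ∈)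

      index≥q : ∀ {q} → Prime q → I (ι (+ q)) → ¬ I 1# → ∀ {ξ b} → I ξ → ¬ (ξ ≈ 0#) → Bounded ξ b → q ℕ.≤ suc (c ℕ.* b) ℕ.^ d
      index≥q {q} pq q∈I proper {ξ} ξ∈I ξ≉0 bξ = index-bound′ (λ i → ι (+ i)) ξ≉0 bξ λ {i} {j} i< j< z h →
        ∣ᶻ-difference⇒≡ i< j< (integer-in-ideal pq q∈I proper (+ i ℤ.- + j)
          (≈-closed (sym (trans (ι-+ _ _) (+-congˡ (ι-neg _)))) (difference-∈ ξ∈I h)))

      -- Modulo I the elements 1 and x are independent over the field of q elements: a relation
      -- between them with a nonzero coefficient of x would make x congruent to an integer. So the
      -- q² elements a + b x are distinct modulo I.
      index≥q² : ∀ {q} → Prime q → I (ι (+ q)) → ¬ I 1# → ∀ x → (∀ a → ¬ I (x - ι a)) →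
        ∀ {ξ b} → I ξ → ¬ (ξ ≈ 0#) → Bounded ξ b → q ℕ.* q ℕ.≤ suc (c ℕ.* b) ℕ.^ d
      index≥q² {q} pq q∈I proper x nonint {ξ} ξ∈I ξ≉0 bξ = index-bound′ β ξ≉0 bξ λ {i} {j} i< j< z h →
        let h′ = ≈-closed (rearrange i j) (difference-∈ ξ∈I h)
            /≡ = quotients i j (ℕ.m<n*o⇒m/o<n i<) (ℕ.m<n*o⇒m/o<n j<) h′
        in %-/-injective q (remainders i j /≡ h′) /≡
        where
        instance
          nz : NonZero q
          nz = prime⇒nonZero pq
        β : ℕ → Carrier
        β i = ι (+ (i ℕ.% q)) + ι (+ (i ℕ./ q)) * x
        D : ℕ → ℕ → Carrier
        D m n = ι (+ m ℤ.- + n)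
        D≈ : ∀ m n → D m n ≈ ι (+ m) - ι (+ n)
        D≈ m n = trans (ι-+ _ _) (+-congˡ (ι-neg _))
        rearrange : ∀ i j → β i - β j ≈ D (i ℕ.% q) (j ℕ.% q) + D (i ℕ./ q) (j ℕ./ q) * x
        rearrange i j = trans (solve 5 (λ a b c d x → (a :+ b :* x) :- (c :+ d :* x) := (a :- c) :+ (b :- d) :* x) ≈-refl
          (ι (+ (i ℕ.% q))) (ι (+ (i ℕ./ q))) (ι (+ (j ℕ.% q))) (ι (+ (j ℕ./ q))) x) (sym (+-cong (D≈ _ _) (*-congʳ (D≈ _ _))))
        quotients : ∀ i j → i ℕ./ q ℕ.< q → j ℕ./ q ℕ.< q → I (D (i ℕ.% q) (j ℕ.% q) + D (i ℕ./ q) (j ℕ./ q) * x) → i ℕ./ q ≡ j ℕ./ q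
        quotients i j i< j< h = ∣ᶻ-difference⇒≡ i< j< (decidable-stable (q ∣ᶻ? _) λ q∤ → solveFor (inverse-mod pq q∤))
          where
          a = + (i ℕ./ q) ℤ.- + (j ℕ./ q)
          r = D (i ℕ.% q) (j ℕ.% q)
          solveFor : ¬ (∃ λ b → q ∣ᶻ a ℤ.* b ℤ.- 1ℤ)
          solveFor (b , divides k e) = nonint (ℤ.- b ℤ.* (+ (i ℕ.% q) ℤ.- + (j ℕ.% q))) (≈-closed
            (trans (solve 5 (λ b r a x kq → b :* (r :+ a :* x) :+ (:- x) :* kq := (a :* b :- kq) :* x :- (:- b) :* r) ≈-refl (ι b) r (ι a) x (ι (k ℤ.* + q)))
             (+-cong (trans (*-congʳ (trans (+-cong (sym (ι-* a b)) (-‿cong (ι-cong (≡.sym e)))) (trans (+-congˡ (sym (ι-neg _))) (trans (sym (ι-+ _ _)) (trans (ι-cong (lem (a ℤ.* b))) ι-1))))) (*-identityˡ x))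
               (-‿cong (trans (*-congʳ (sym (ι-neg b))) (sym (ι-* _ _))))))
            (+-closed (*-closed (ι b) h) (*-closed (- x) (≈-closed (sym (ι-* k (+ q))) (*-closed (ι k) q∈I)))))
            where
            lem : ∀ x → x ℤ.+ ℤ.- (x ℤ.- 1ℤ) ≡ 1ℤ
            lem = ℤ-solve-∀
        remainders : ∀ i j → i ℕ./ q ≡ j ℕ./ q → I (D (i ℕ.% q) (j ℕ.% q) + D (i ℕ./ q) (j ℕ./ q) * x) → i ℕ.% q ≡ j ℕ.% q
        remainders i j e h = ∣ᶻ-difference⇒≡ (ℕ.m%n<n i q) (ℕ.m%n<n j q) (integer-in-ideal pq q∈I proper _ (≈-closed
          (trans (+-congˡ (trans (*-congʳ (trans (ι-cong (≡.trans (cong (λ z → + z ℤ.- + (j ℕ./ q)) e) (ℤ.+-inverseʳ (+ (j ℕ./ q))))) ι-0)) (zeroˡ x))) (+-identityʳ _)) h))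

    -- That x, y and q generate the unit ideal, written as invertibility of x modulo (y, q), a form
    -- that multiplies well in x.
    Comaximal : ℕ → Carrier → Carrier → Set
    Comaximal q x y = ∃ λ u → ∃₂ λ v s → x * u ≈ 1# + y * v + ι (+ q) * s

    -- If γ₀, …, γ_r are pairwise comaximal nonunits modulo q then 1, γ₀, γ₀γ₁, … are independent modulo q.
    horner : ℕ → List Carrier → ℕ → Carrier
    horner q [] i = 0#
    horner zero (γ ∷ γs) i = 0#
    horner (suc q) (γ ∷ γs) i = ι (+ (i ℕ.% suc q)) + γ * horner (suc q) γs (i ℕ./ suc q)

    -- δ is the product of the γ already split off. It is invertible modulo each remaining γ and q,
    -- so a congruence multiplied by δ still determines the lowest digit: a nonzero difference of
    -- digits would make γ invertible modulo q.
    horner-injective : ∀ {q} → Prime q → ∀ γs δ → All (λ γ → ¬ Invertible q γ) γs → AllPairs (Comaximal q) γs → All (Comaximal q δ) γs →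
      ∀ {i j} → i ℕ.< q ℕ.^ length γs → j ℕ.< q ℕ.^ length γs → ∀ z → δ * (horner q γs i - horner q γs j) ≈ ι (+ q) * z → i ≡ j
    horner-injective pq [] δ _ _ _ i< j< z h = ≡.trans (ℕ.n<1⇒n≡0 i<) (≡.sym (ℕ.n<1⇒n≡0 j<))
    horner-injective {suc q′} pq (γ ∷ γs) δ (ni ∷ nis) (cm ∷ cms) ((u , v , s , e) ∷ es) {i} {j} i< j< z h =
      %-/-injective q rem (horner-injective pq γs (δ * γ) nis cms (All.zipWith (λ {x} (p , r) → combine {x} p r) (es , cm))
        (ℕ.m<n*o⇒m/o<n (sw i<)) (ℕ.m<n*o⇒m/o<n (sw j<)) z (trans (sym step) h))
      where
      q = suc q′
      H = horner q γs
      a = + (i ℕ.% q) ℤ.- + (j ℕ.% q)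
      sw : ∀ {i} → i ℕ.< q ℕ.* q ℕ.^ length γs → i ℕ.< q ℕ.^ length γs ℕ.* q
      sw {i} = subst (i ℕ.<_) (ℕ.*-comm q (q ℕ.^ length γs))
      D = H (i ℕ./ q) - H (j ℕ./ q)
      expand : δ * (horner q (γ ∷ γs) i - horner q (γ ∷ γs) j) ≈ δ * (ι a + γ * D)
      expand = *-congˡ (trans (solve 5 (λ a b g x y → (a :+ g :* x) :- (b :+ g :* y) := (a :- b) :+ g :* (x :- y)) ≈-refl
        (ι (+ (i ℕ.% q))) (ι (+ (j ℕ.% q))) γ (H (i ℕ./ q)) (H (j ℕ./ q))) (+-congʳ (sym (trans (ι-+ _ _) (+-congˡ (ι-neg _))))))
      rem : i ℕ.% q ≡ j ℕ.% q
      rem = ∣ᶻ-difference⇒≡ (ℕ.m%n<n i q) (ℕ.m%n<n j q) (decidable-stable (q ∣ᶻ? a) λ q∤a → ni (invert (inverse-mod pq q∤a)))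
        where
        invert : (∃ λ b → q ∣ᶻ a ℤ.* b ℤ.- 1ℤ) → Invertible q γ
        invert (b , divides k eb) = - (ι b * (ι a * v + D * (δ * u))) , ι k + ι b * (ι a * s - z * u) , (begin
          γ * - (ι b * (ι a * v + D * (δ * u)))
            ≈⟨ solve 9 (λ g b a v D δ u s q → g :* (:- (b :* (a :* v :+ D :* (δ :* u)))) :=
                 b :* a :+ q :* (b :* (a :* s)) :- b :* (δ :* (a :+ g :* D)) :* u :+ b :* a :* ((δ :* u) :- (con 1ℤ :+ g :* v :+ q :* s)))
                 ≈-refl γ (ι b) (ι a) v D δ u s (ι (+ q)) ⟩
          ι b * ι a + ι (+ q) * (ι b * (ι a * s)) - ι b * (δ * (ι a + γ * D)) * u + ι b * ι a * ((δ * u) - (ι 1ℤ + γ * v + ι (+ q) * s))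
            ≈⟨ +-cong (+-congˡ (-‿cong (*-congʳ (*-congˡ (trans (sym expand) h))))) (trans (*-congˡ (≈⇒-≈0 (trans e (+-congʳ (+-congʳ (sym ι-1)))))) (zeroʳ _)) ⟩
          ι b * ι a + ι (+ q) * (ι b * (ι a * s)) - ι b * (ι (+ q) * z) * u + 0#
            ≈⟨ trans (+-identityʳ _) (+-congʳ (+-congʳ ba)) ⟩
          1# + ι k * ι (+ q) + ι (+ q) * (ι b * (ι a * s)) - ι b * (ι (+ q) * z) * u
            ≈⟨ solve 8 (λ o k q b a s z u → o :+ k :* q :+ q :* (b :* (a :* s)) :- b :* (q :* z) :* u := o :+ q :* (k :+ b :* (a :* s :- z :* u))) ≈-refl
                 1# (ι k) (ι (+ q)) (ι b) (ι a) s z u ⟩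
          1# + ι (+ q) * (ι k + ι b * (ι a * s - z * u)) ∎)
          where
          open import Relation.Binary.Reasoning.Setoid setoid
          lem : ∀ x → x ≡ 1ℤ ℤ.+ (x ℤ.- 1ℤ)
          lem = ℤ-solve-∀
          ba : ι b * ι a ≈ 1# + ι k * ι (+ q)
          ba = trans (*-comm _ _) (trans (sym (ι-* a b)) (trans (ι-cong (≡.trans (lem (a ℤ.* b)) (cong (λ x → 1ℤ ℤ.+ x) eb))) (trans (ι-+ _ _) (+-cong ι-1 (ι-* _ _)))))
      step : δ * (horner q (γ ∷ γs) i - horner q (γ ∷ γs) j) ≈ δ * γ * D
      step = trans expand (trans (*-congˡ (trans (+-congʳ (trans (ι-cong (≡.trans (cong (λ z → + z ℤ.- + (j ℕ.% q)) rem) (ℤ.+-inverseʳ (+ (j ℕ.% q))))) ι-0)) (+-identityˡ _))) (sym (*-assoc _ _ _)))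
      combine : ∀ {y} → Comaximal q δ y → Comaximal q γ y → Comaximal q (δ * γ) y
      combine {y} (u , v , s , e) (u′ , v′ , s′ , e′) = u * u′ , v + v′ + y * v * v′ + v * ι (+ q) * s′ + v′ * ι (+ q) * s , s + s′ + ι (+ q) * s * s′ ,
        trans (solve 4 (λ a b c d → a :* b :* (c :* d) := (a :* c) :* (b :* d)) ≈-refl δ γ u u′)
        (trans (*-cong (trans e (+-congʳ (+-congʳ (sym ι-1)))) (trans e′ (+-congʳ (+-congʳ (sym ι-1)))))
        (trans (solve 6 (λ y v q s v′ s′ → (con 1ℤ :+ y :* v :+ q :* s) :* (con 1ℤ :+ y :* v′ :+ q :* s′) :=
           con 1ℤ :+ y :* (v :+ v′ :+ y :* v :* v′ :+ v :* q :* s′ :+ v′ :* q :* s) :+ q :* (s :+ s′ :+ q :* s :* s′)) ≈-refl y v (ι (+ q)) s v′ s′)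
         (+-congʳ (+-congʳ ι-1))))

    -- `horner` yields q^r distinct classes modulo q for r elements, but R/q has at most (1 + c
    -- N₁)^d q^d classes, and the first factor is less than q.
    few-comaximal : ∀ {q} → Prime q → ∀ γs → All (λ γ → ¬ Invertible q γ) γs → AllPairs (Comaximal q) γs →
      suc (c ℕ.* N₁) ℕ.^ d ℕ.< q → length γs ℕ.≤ d
    few-comaximal {q} pq γs nis cms q-large = ℕ.≮⇒≥ λ long → ℕ.<⇒≱ q-large (ℕ.*-cancelʳ-≤ q (suc (c ℕ.* N₁) ℕ.^ d) (q ℕ.^ d) {{ℕ.m^n≢0 q d {{prime⇒nonZero pq}}}} (begin
        q ℕ.^ suc d ≤⟨ ℕ.^-monoʳ-≤ q {{prime⇒nonZero pq}} long ⟩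
        q ℕ.^ length γs ≤⟨ index-bound′ (horner q γs) (ι≉0 (λ e → ℕ.<⇒≢ (prime≥1 pq) (≡.sym (ℤ.+-injective e)))) (bounded-ι (+ q)) (λ {i} {j} i< j< z h →
            horner-injective pq γs 1# nis cms (All.tabulate λ {y} _ → 1# , 0# , 0# , trans (*-identityˡ 1#) (sym (trans (+-cong (trans (+-congˡ (zeroʳ y)) (+-identityʳ 1#)) (zeroʳ _)) (+-identityʳ 1#))))
              i< j< z (trans (*-identityˡ _) (trans (+-congʳ h) (solve 2 (λ a b → (a :+ b) :- a := b) ≈-refl (horner q γs j) (ι (+ q) * z))))) ⟩
        suc (c ℕ.* (q ℕ.* N₁)) ℕ.^ d ≤⟨ ℕ.^-monoˡ-≤ d (ℕ.≤-trans (ℕ.+-monoˡ-≤ (c ℕ.* (q ℕ.* N₁)) (prime≥1 pq)) (ℕ.≤-reflexive (lem c q N₁))) ⟩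
        (suc (c ℕ.* N₁) ℕ.* q) ℕ.^ d ≡⟨ ^-distribʳ-* d (suc (c ℕ.* N₁)) q ⟩
        suc (c ℕ.* N₁) ℕ.^ d ℕ.* q ℕ.^ d ∎))
      where
      open ℕ.≤-Reasoning
      lem : ∀ c q n → q ℕ.+ c ℕ.* (q ℕ.* n) ≡ suc (c ℕ.* n) ℕ.* q
      lem = ℕ-solve-∀

-- A sieve on a box of elements of an order

module Sieving where

  open Counting
  open Q using (ℚ⁺; Σ[_]; fromℕ; inv)
  open Orders
  open Estimates using (list-bound)
  open Congruences
  open Ideals
  open import Data.Nat using (_!)
  import Data.Nat.Combinatorics.Base
  open import Data.Integer using (+_)
  open import Data.Integer.Tactic.RingSolver using () renaming (solve-∀ to ℤ-solve-∀)
  open import Data.Vec using (lookup)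
  open import Data.List using (_++_; map)
  open import Data.List.Properties using (length-map)
  open import Data.List.Relation.Unary.All as All using (All; []; _∷_)
  import Data.List.Relation.Unary.All.Properties as All
  open import Data.List.Relation.Unary.AllPairs as AllPairs using (AllPairs; []; _∷_)
  import Data.List.Relation.Unary.AllPairs.Properties as AllPairs
  open import Relation.Binary.PropositionalEquality as ≡ using (_≡_; _≢_; refl; cong; cong₂; subst)

  -- If no tail were small, (C + 1) k disjoint finite blocks, each of sum at least 1/k, could be
  -- concatenated to a sum of at least C + 1.
  small-tail : (G : ℕ → Set) (f : ℕ → ℚ⁺) (C : ℕ) → (∀ qs → Unique qs → All G qs → Σ[ f ] qs Q.≤ fromℕ C) →
    ∀ k → 1 ℕ.≤ k → ∀ z₁ → ¬ ¬ (∃ λ z → z₁ ℕ.≤ z × (∀ qs → Unique qs → All (λ q → G q × z ℕ.< q) qs → Σ[ f ] qs Q.≤ inv k))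
  small-tail G f C bounded k 1≤k z₁ absurd = accumulate (suc C ℕ.* k) z₁ ℕ.≤-refl λ (qs , u , gs , big) →
    ℕ.<-irrefl refl (Q.fromℕ-cancel {suc C} {C} (Q.≤-trans (Q.≤-reflexive (value (suc C))) (Q.≤-trans big (bounded qs u (All.map proj₁ gs)))))
    where
    value : ∀ m → fromℕ m ≡ fromℕ (m ℕ.* k) Q.* inv k
    value m = ≡.sym (≡.trans (cong (Q._* inv k) (Q.fromℕ-* m k)) (≡.trans (Q.*-assoc (fromℕ m) (fromℕ k) (inv k)) (≡.trans (cong (fromℕ m Q.*_) (Q.fromℕ*inv 1≤k)) (Q.*-identityʳ _))))
    accumulate : ∀ j z → z₁ ℕ.≤ z → ¬ ¬ (∃ λ qs → Unique qs × All (λ q → G q × z ℕ.< q) qs × fromℕ j Q.* inv k Q.≤ Σ[ f ] qs)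
    accumulate zero z _ n = n ([] , [] , [] , Q.≤-reflexive (Q.*-zeroˡ (inv k)))
    accumulate (suc j) z z₁≤z n = absurd (z , z₁≤z , λ qs u gs → decidable-stable (_ Q.≤? _) λ not-small →
      let (m , m-max) = list-bound (λ q → q) qs in
      accumulate j (z ℕ.+ m) (ℕ.≤-trans z₁≤z (ℕ.m≤m+n z m)) λ (rs , v , hs , big) →
        n (qs ++ rs , Unique.++⁺ u v (λ (q∈ , q∈′) → ℕ.<⇒≱ (proj₂ (All.lookup hs q∈′)) (ℕ.≤-trans (m-max q∈) (ℕ.m≤n+m m z))) ,
           All.++⁺ gs (All.map (λ (g , lt) → g , ℕ.≤-<-trans (ℕ.m≤m+n z m) lt) hs) ,
           Q.≤-trans (Q.≤-reflexive (≡.trans (Q.*-comm (fromℕ (suc j)) (inv k)) (≡.trans (Q.distribˡ (inv k) Q.1# (fromℕ j)) (cong₂ Q._+_ (Q.*-identityʳ (inv k)) (Q.*-comm (inv k) (fromℕ j))))))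
             (Q.≤-trans (Q.+-mono-≤ (Q.≰⇒≥ not-small) big) (Q.≤-reflexive (≡.sym (Q.Σ-++ f qs rs))))))

  root-bracket : ∀ c d {E} → 1 ℕ.≤ c → 1 ℕ.≤ d → 1 ℕ.< E → ∃ λ s → suc (c ℕ.* s) ℕ.^ d ℕ.< E × E ℕ.≤ suc (c ℕ.* suc s) ℕ.^ d
  root-bracket c d {E} 1≤c 1≤d 1<E with search E
    where
    search : ∀ n → (∃ λ s → suc (c ℕ.* s) ℕ.^ d ℕ.< E × E ℕ.≤ suc (c ℕ.* suc s) ℕ.^ d) ⊎ suc (c ℕ.* n) ℕ.^ d ℕ.< E
    search zero = inj₂ (ℕ.≤-<-trans (ℕ.≤-reflexive (≡.trans (cong (λ z → suc z ℕ.^ d) (ℕ.*-zeroʳ c)) (ℕ.^-zeroˡ d))) 1<E)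
    search (suc n) with search n
    ... | inj₁ found = inj₁ found
    ... | inj₂ lt with suc (c ℕ.* suc n) ℕ.^ d ℕ.<? E
    ...   | yes lt′ = inj₂ lt′
    ...   | no ge = inj₁ (n , lt , ℕ.≮⇒≥ ge)
  ... | inj₁ found = found
  ... | inj₂ lt = contradiction lt (ℕ.≤⇒≯ (ℕ.≤-trans (ℕ.≤-trans (ℕ.≤-trans (ℕ.≤-reflexive (≡.sym (ℕ.*-identityˡ E))) (ℕ.*-monoˡ-≤ E 1≤c)) (ℕ.n≤1+n (c ℕ.* E)))
          (ℕ.≤-trans (ℕ.≤-reflexive (≡.sym (ℕ.^-identityʳ _))) (ℕ.^-monoʳ-≤ (suc (c ℕ.* E)) 1≤d))))

  prime-∤! : ∀ {q} → Prime q → ∀ n → n ℕ.< q → ¬ (q ∣ᶻ + (n !))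
  prime-∤! pq zero _ = ∤1 pq
  prime-∤! pq (suc n) lt h = ∤-* pq (∤-small (s≤s z≤n) lt) (prime-∤! pq n (ℕ.<⇒≤ lt)) (∣ᶻ-≡ (ℤ.pos-* (suc n) (n !)) h)

  ∣! : ∀ {q} n → 1 ℕ.≤ q → q ℕ.≤ n → q ℕ.∣ n !
  ∣! {suc q} n _ q≤n = ℕ.∣-trans (ℕ.m∣m*n (q !)) (ℕ.m≤n⇒m!∣n! q≤n)

  1≤! : ∀ n → 1 ℕ.≤ n !
  1≤! zero = ℕ.≤-refl
  1≤! (suc n) = ℕ.*-mono-≤ {1} {suc n} (s≤s z≤n) (1≤! n)

  same-block : ∀ s .{{_ : NonZero s}} a b → a ℕ./ s ≡ b ℕ./ s → ℤ.∣ + a ℤ.- + b ∣ ℕ.≤ s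
  same-block s a b e = ℕ.≤-trans (ℕ.≤-reflexive (cong ℤ.∣_∣ (≡.trans (cong₂ ℤ._-_ (split a) (≡.trans (split b) (cong (λ k → + (b ℕ.% s) ℤ.+ + (k ℕ.* s)) (≡.sym e))))
      (≡.trans (lem (+ (a ℕ.% s)) (+ (b ℕ.% s)) (+ (a ℕ./ s ℕ.* s))) (ℤ.m-n≡m⊖n (a ℕ.% s) (b ℕ.% s))))))
    (ℕ.≤-trans (ℤ.∣m⊝n∣≤m⊔n (a ℕ.% s) (b ℕ.% s)) (ℕ.⊔-lub (ℕ.<⇒≤ (ℕ.m%n<n a s)) (ℕ.<⇒≤ (ℕ.m%n<n b s))))
    where
    split : ∀ a → + a ≡ + (a ℕ.% s) ℤ.+ + (a ℕ./ s ℕ.* s)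
    split a = ≡.trans (cong +_ (ℕ.m≡m%n+[m/n]*n a s)) (ℤ.pos-+ (a ℕ.% s) _)
    lem : ∀ x y k → (x ℤ.+ k) ℤ.- (y ℤ.+ k) ≡ x ℤ.- y
    lem = ℤ-solve-∀

  module Divergence (O : Order) (1≉0 : ¬ (Order._≈_ O (Order.1# O) (Order.0# O))) where
    open Order O
    open PrimeIdeals O 1≉0

    1≤d : 1 ℕ.≤ d
    1≤d = ℕ.n≢0⇒n>0 λ d≡0 → 1≉0 (π-injective λ s → contradiction (subst Fin d≡0 s) λ ())

    -- The elements 1 + Z(T + w a), with Z = z! and T a large multiple of Y.
    module Sieve (z Y : ℕ) (1≤Y : 1 ℕ.≤ Y) where
      Z T G : ℕ
      Z = z !
      -- G then exceeds Z Y M, which keeps `γ a` nonzero, and also 2 K Z Y M, which lets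
      -- `bounded-quotient` absorb the product term.
      T = suc (2 ℕ.* K) ℕ.* (Y ℕ.* M)
      G = suc (Z ℕ.* T)

      γ : Vec ℕ d → Carrier
      γ a = ι (+ G) + ι (+ Z) * w (vec a)

      Z·Y·M≤G : Z ℕ.* (Y ℕ.* M) ℕ.< G
      Z·Y·M≤G = s≤s (ℕ.*-monoʳ-≤ Z (ℕ.m≤m+n (Y ℕ.* M) _))

      bounded-γ : ∀ {a} → a ∈ box d Y → Bounded (γ a) (G ℕ.* N₁ ℕ.+ Z ℕ.* (Y ℕ.* M))
      bounded-γ a∈ = bounded-+ {ι (+ G)} (bounded-ι (+ G)) (bounded-ι* (+ Z) (bounded-w λ s → ℕ.<⇒≤ (∈-box⁻ a∈ s)))

      γ≉0 : ∀ {a} → a ∈ box d Y → ¬ (γ a ≈ 0#)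
      γ≉0 {a} a∈ h = 1≉0 (π-injective λ s → ℤ.∣i∣≡0⇒i≡0 (ℕ.n<1⇒n≡0 (ℕ.*-cancelˡ-< G _ 1 (ℕ.≤-<-trans (small s) (ℕ.<-≤-trans Z·Y·M≤G (ℕ.≤-reflexive (≡.sym (ℕ.*-identityʳ G))))))))
        where
        small : ∀ s → G ℕ.* ℤ.∣ π 1# s ∣ ℕ.≤ Z ℕ.* (Y ℕ.* M)
        small s = subst (ℕ._≤ Z ℕ.* (Y ℕ.* M)) (≡.trans (cong ℤ.∣_∣ (≡.trans (π-cong (sym eq) s) (π-ι (+ G) s))) (ℤ.abs-* (+ G) (π 1# s)))
          (subst (λ k → ℤ.∣ π (ι (ℤ.- + Z) * w (vec a)) s ∣ ℕ.≤ k ℕ.* (Y ℕ.* M)) (ℤ.∣-i∣≡∣i∣ (+ Z)) (bounded-ι* (ℤ.- + Z) {w (vec a)} (bounded-w λ s → ℕ.<⇒≤ (∈-box⁻ a∈ s)) s))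
          where
          eq : ι (+ G) ≈ ι (ℤ.- + Z) * w (vec a)
          eq = trans (solve 3 (λ g z w → g := (g :+ z :* w) :+ (:- z) :* w) ≈-refl (ι (+ G)) (ι (+ Z)) (w (vec a)))
            (trans (+-cong h (*-congʳ (sym (ι-neg _)))) (+-identityˡ _))

      Z≢0 : + Z ≢ 0ℤ
      Z≢0 e = ℕ.<⇒≢ (1≤! z) (≡.sym (ℤ.+-injective e))

      γ-injective : ∀ {a b} → γ a ≈ γ b → a ≡ b
      γ-injective {a} {b} h = vec-injective (w-injective (cancelˡ (ι≉0 Z≢0) (trans (solve 2 (λ g x → x := (g :+ x) :- g) ≈-refl (ι (+ G)) (ι (+ Z) * w (vec a)))
        (trans (+-congʳ h) (solve 2 (λ g x → (g :+ x) :- g := x) ≈-refl (ι (+ G)) (ι (+ Z) * w (vec b)))))))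

      -- Independent of z and Y, so that units are negligible in a large box.
      units : ℕ
      units = suc (2 ℕ.* (2 ℕ.* suc N₁)) ℕ.^ d

      -- The γ a all point in nearly the same direction, so the quotient of two of them is small when it is integral.
      bounded-quotient : ∀ {a b x} → a ∈ box d Y → b ∈ box d Y → x * γ b ≈ γ a → Bounded x (2 ℕ.* suc N₁)
      bounded-quotient {a} {b} {x} a∈ b∈ h with maximum (λ s → ℤ.∣ π x s ∣)
      ... | t , t-max , attained = λ s → ℕ.≤-trans (t-max s) (t-small attained)
        where
        estimate : ∀ s → G ℕ.* ℤ.∣ π x s ∣ ℕ.≤ (G ℕ.* N₁ ℕ.+ Z ℕ.* (Y ℕ.* M)) ℕ.+ Z ℕ.* (K ℕ.* (Y ℕ.* M) ℕ.* t)
        estimate s = subst (ℕ._≤ _) (≡.trans (cong ℤ.∣_∣ (≡.trans (π-cong (sym eq) s) (π-ι* (+ G) x s))) (ℤ.abs-* (+ G) (π x s)))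
          (bounded-+ {γ a} (bounded-γ a∈)
            (subst (λ k → Bounded (ι (ℤ.- + Z) * (w (vec b) * x)) (k ℕ.* _)) (ℤ.∣-i∣≡∣i∣ (+ Z)) (bounded-ι* (ℤ.- + Z) (bounded-* {w (vec b)} {x} (bounded-w λ s → ℕ.<⇒≤ (∈-box⁻ b∈ s)) t-max))) s)
          where
          eq : ι (+ G) * x ≈ γ a + ι (ℤ.- + Z) * (w (vec b) * x)
          eq = trans (solve 4 (λ g z w x → g :* x := x :* (g :+ z :* w) :+ (:- z) :* (w :* x)) ≈-refl (ι (+ G)) (ι (+ Z)) (w (vec b)) x)
            (+-cong h (*-congʳ (sym (ι-neg _))))
        t-small : t ≡ 0 ⊎ (∃ λ s → ℤ.∣ π x s ∣ ≡ t) → t ℕ.≤ 2 ℕ.* suc N₁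
        t-small (inj₁ refl) = z≤n
        t-small (inj₂ (s , e)) = ℕ.*-cancelˡ-≤ G (ℕ.+-cancelʳ-≤ (G ℕ.* t) _ _ (begin
          G ℕ.* t ℕ.+ G ℕ.* t ≤⟨ ℕ.+-mono-≤ est est ⟩
          (G ℕ.* N₁ ℕ.+ Z ℕ.* (Y ℕ.* M) ℕ.+ Z ℕ.* (K ℕ.* (Y ℕ.* M) ℕ.* t)) ℕ.+ (G ℕ.* N₁ ℕ.+ Z ℕ.* (Y ℕ.* M) ℕ.+ Z ℕ.* (K ℕ.* (Y ℕ.* M) ℕ.* t))
            ≤⟨ ℕ.+-mono-≤ (ℕ.+-monoˡ-≤ _ (ℕ.+-monoʳ-≤ (G ℕ.* N₁) (ℕ.<⇒≤ Z·Y·M≤G))) (ℕ.+-monoˡ-≤ _ (ℕ.+-monoʳ-≤ (G ℕ.* N₁) (ℕ.<⇒≤ Z·Y·M≤G))) ⟩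
          (G ℕ.* N₁ ℕ.+ G ℕ.+ Z ℕ.* (K ℕ.* (Y ℕ.* M) ℕ.* t)) ℕ.+ (G ℕ.* N₁ ℕ.+ G ℕ.+ Z ℕ.* (K ℕ.* (Y ℕ.* M) ℕ.* t))
            ≡⟨ lem G N₁ Z K (Y ℕ.* M) t ⟩
          G ℕ.* (2 ℕ.* suc N₁) ℕ.+ Z ℕ.* (2 ℕ.* K ℕ.* (Y ℕ.* M)) ℕ.* t
            ≤⟨ ℕ.+-monoʳ-≤ (G ℕ.* (2 ℕ.* suc N₁)) (ℕ.*-monoˡ-≤ t (ℕ.m≤n⇒m≤1+n (ℕ.*-monoʳ-≤ Z (ℕ.m≤n+m _ (Y ℕ.* M))))) ⟩
          G ℕ.* (2 ℕ.* suc N₁) ℕ.+ G ℕ.* t ∎))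
          where
          open ℕ.≤-Reasoning
          est : G ℕ.* t ℕ.≤ (G ℕ.* N₁ ℕ.+ Z ℕ.* (Y ℕ.* M)) ℕ.+ Z ℕ.* (K ℕ.* (Y ℕ.* M) ℕ.* t)
          est = subst (λ r → G ℕ.* r ℕ.≤ _) e (estimate s)
          lem : ∀ G n Z K y t → (G ℕ.* n ℕ.+ G ℕ.+ Z ℕ.* (K ℕ.* y ℕ.* t)) ℕ.+ (G ℕ.* n ℕ.+ G ℕ.+ Z ℕ.* (K ℕ.* y ℕ.* t))
            ≡ G ℕ.* (2 ℕ.* suc n) ℕ.+ Z ℕ.* (2 ℕ.* K ℕ.* y) ℕ.* t
          lem = ℕ-solve-∀

      -- Divide all the units by one of them: the quotients are distinct, and by `bounded-quotient`
      -- they lie in a fixed box.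
      few-units : ∀ as → Unique as → All (λ a → a ∈ box d Y × Unit (γ a)) as → length as ℕ.≤ units
      few-units [] _ _ = z≤n
      few-units as@(b ∷ _) u ok@((b∈ , v , vb) ∷ _) = count-bounded (λ a → γ a * v) (2 ℕ.* suc N₁) u
        (λ {a} a∈ → bounded-quotient {x = γ a * v} (proj₁ (All.lookup ok a∈)) b∈ (back a))
        λ {a} {a′} _ _ h → γ-injective (trans (sym (back a)) (trans (*-congʳ h) (back a′)))
        where
        back : ∀ a → γ a * v * γ b ≈ γ a
        back a = trans (*-assoc _ _ _) (trans (*-congˡ (trans (*-comm v (γ b)) vb)) (*-identityʳ _))

      -- A prime q ≤ z divides Z = z!, so `γ a` is 1 modulo q.
      prime-large : ∀ {q a} → Prime q → ¬ Invertible q (γ a) → z ℕ.< q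
      prime-large {q} {a} pq ni = ℕ.≰⇒> λ q≤z → invert q≤z (∣ᵤ⇒∣ {+ q} {+ Z} (∣! z (prime≥1 pq) q≤z))
        where
        invert : q ℕ.≤ z → ¬ (q ∣ᶻ + Z)
        invert _ (divides k e) = ni (1# , ι k * (ι (+ T) + w (vec a)) , trans (*-identityʳ _)
          (trans (+-cong (trans (ι-cong (≡.trans (ℤ.pos-+ 1 (Z ℕ.* T)) (cong (λ z → 1ℤ ℤ.+ z) (ℤ.pos-* Z T)))) (trans (ι-+ _ _) (+-cong ι-1 (ι-* _ _)))) ≈-refl)
          (trans (+-cong (+-congˡ (*-congʳ Zkq)) (*-congʳ Zkq))
          (solve 5 (λ o k q t w → (o :+ k :* q :* t) :+ k :* q :* w := o :+ q :* (k :* (t :+ w))) ≈-refl 1# (ι k) (ι (+ q)) (ι (+ T)) (w (vec a))))))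
          where
          Zkq : ι (+ Z) ≈ ι k * ι (+ q)
          Zkq = trans (ι-cong e) (ι-* k (+ q))

      -- An ideal is only a predicate, without a number for its index. That the index over q is at
      -- least `E q` is expressed by what it implies for the size of the nonzero elements of the
      -- ideal.
      module _ (E : ℕ → ℕ) {q : ℕ} (pq : Prime q)
        (index≥E : ∀ {I : Carrier → Set} → IsIdeal I → I (ι (+ q)) → ¬ I 1# → ∀ {ξ b} → I ξ → ¬ (ξ ≈ 0#) → Bounded ξ b → E q ℕ.≤ suc (c ℕ.* b) ℕ.^ d)
        where

        E-bound : ∀ {a} → a ∈ box d Y → ¬ Invertible q (γ a) → E q ℕ.≤ suc (c ℕ.* (G ℕ.* N₁ ℕ.+ Z ℕ.* (Y ℕ.* M))) ℕ.^ d
        E-bound {a} a∈ ni = index≥E {λ x → ∃₂ λ u v → x ≈ γ a * u + ι (+ q) * v}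
          (record
            { ≈-closed = λ e (u , v , h) → u , v , trans (sym e) h
            ; +-closed = λ (u , v , h) (u′ , v′ , h′) → u + u′ , v + v′ , trans (+-cong h h′)
                (solve 6 (λ g q u v u′ v′ → (g :* u :+ q :* v) :+ (g :* u′ :+ q :* v′) := g :* (u :+ u′) :+ q :* (v :+ v′)) ≈-refl (γ a) (ι (+ q)) u v u′ v′)
            ; *-closed = λ x (u , v , h) → x * u , x * v , trans (*-congˡ h)
                (solve 5 (λ g q u v x → x :* (g :* u :+ q :* v) := g :* (x :* u) :+ q :* (x :* v)) ≈-refl (γ a) (ι (+ q)) u v x) })
          (0# , 1# , sym (trans (+-cong (zeroʳ _) (*-identityʳ _)) (+-identityˡ _)))
          (λ (u , v , h) → ni (u , - v , trans (solve 3 (λ g q v → g := (g :+ q :* v) :+ q :* (:- v)) ≈-refl (γ a * u) (ι (+ q)) v) (+-congʳ (sym h))))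
          {γ a} (1# , 0# , sym (trans (+-cong (*-identityʳ _) (zeroʳ _)) (+-identityʳ _))) (γ≉0 a∈) (bounded-γ a∈)

        -- Two nonunits modulo q lying in the same small cube are comaximal, as their difference is too short for a common maximal ideal.
        few-in-cube : ∀ s .{{_ : NonZero s}} → suc (c ℕ.* (s ℕ.* M)) ℕ.^ d ℕ.< E q → suc (c ℕ.* N₁) ℕ.^ d ℕ.< q → z ℕ.< q →
          ∀ as → Unique as → All (λ a → ¬ Invertible q (γ a)) as → (∀ {a b} → a ∈ as → b ∈ as → ∀ i → lookup a i ℕ./ s ≡ lookup b i ℕ./ s) → length as ℕ.≤ d
        few-in-cube s s-small q-large z<q as u nis same = decidable-stable (length as ℕ.≤? d) λ many →
          ¬¬-AllPairs {R = λ a b → Comaximal q (γ a) (γ b)} (comax as u (λ a∈ → a∈)) λ cm →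
          many (subst (ℕ._≤ d) (length-map γ as) (few-comaximal pq (map γ as) (All.map⁺ nis) (AllPairs.map⁺ cm) q-large))
          where
          pair : ∀ {a b} → a ∈ as → b ∈ as → a ≢ b → ¬ ¬ Comaximal q (γ a) (γ b)
          pair {a} {b} a∈ b∈ a≢b nc = ℕ.<⇒≱ s-small (index≥E {I} ideal (0# , 0# , 1# , q∈) proper ξ∈ ξ≉0 bξ)
            where
            I : Carrier → Set
            I x = ∃ λ u → ∃₂ λ v t → x ≈ γ a * u + γ b * v + ι (+ q) * t
            ideal : IsIdeal I
            ideal = record
              { ≈-closed = λ e (u , v , t , h) → u , v , t , trans (sym e) h
              ; +-closed = λ (u , v , t , h) (u′ , v′ , t′ , h′) → u + u′ , v + v′ , t + t′ , trans (+-cong h h′)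
                  (solve 9 (λ g h q u v t u′ v′ t′ → (g :* u :+ h :* v :+ q :* t) :+ (g :* u′ :+ h :* v′ :+ q :* t′) := g :* (u :+ u′) :+ h :* (v :+ v′) :+ q :* (t :+ t′)) ≈-refl (γ a) (γ b) (ι (+ q)) u v t u′ v′ t′)
              ; *-closed = λ x (u , v , t , h) → x * u , x * v , x * t , trans (*-congˡ h)
                  (solve 7 (λ g h q u v t x → x :* (g :* u :+ h :* v :+ q :* t) := g :* (x :* u) :+ h :* (x :* v) :+ q :* (x :* t)) ≈-refl (γ a) (γ b) (ι (+ q)) u v t x) }
            q∈ : ι (+ q) ≈ γ a * 0# + γ b * 0# + ι (+ q) * 1#
            q∈ = sym (trans (+-cong (trans (+-cong (zeroʳ _) (zeroʳ _)) (+-identityˡ _)) (*-identityʳ _)) (+-identityˡ _))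
            proper : ¬ I 1#
            proper (u , v , t , h) = nc (u , - v , - t , trans (solve 5 (λ x h v q t → x := (x :+ h :* v :+ q :* t) :+ h :* (:- v) :+ q :* (:- t)) ≈-refl (γ a * u) (γ b) v (ι (+ q)) t)
              (+-congʳ (+-congʳ (sym h))))
            ξ = w (vec a) - w (vec b)
            ξ≉0 : ¬ (ξ ≈ 0#)
            ξ≉0 h = a≢b (vec-injective (w-injective (-‿≈0 h)))
            bξ : Bounded ξ (s ℕ.* M)
            bξ = bounded-cong (sym (w-sub (vec a) (vec b))) (bounded-w λ i → same-block s (lookup a i) (lookup b i) (same a∈ b∈ i))
            -- γ a - γ b = Z ξ, and Z = z! is invertible modulo q because z < q.
            ξ∈ : I ξ
            ξ∈ = member (inverse-mod pq (prime-∤! pq z z<q))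
              where
              member : (∃ λ y → q ∣ᶻ + Z ℤ.* y ℤ.- 1ℤ) → I ξ
              member (y , divides k e) = ι y , - ι y , - (ι k * ξ) , trans (sym (trans (*-congʳ one) (*-identityˡ ξ)))
                (solve 7 (λ g z y k q v v′ → (z :* y :- k :* q) :* (v :- v′) := (g :+ z :* v) :* y :+ (g :+ z :* v′) :* (:- y) :+ q :* (:- (k :* (v :- v′)))) ≈-refl
                  (ι (+ G)) (ι (+ Z)) (ι y) (ι k) (ι (+ q)) (w (vec a)) (w (vec b)))
                where
                lem : ∀ x → x ℤ.+ ℤ.- (x ℤ.- 1ℤ) ≡ 1ℤ
                lem = ℤ-solve-∀
                one : ι (+ Z) * ι y - ι k * ι (+ q) ≈ 1#
                one = trans (+-cong (sym (ι-* _ _)) (-‿cong (trans (sym (ι-* _ _)) (ι-cong (≡.sym e))))) (trans (+-congˡ (sym (ι-neg _))) (trans (sym (ι-+ _ _)) (trans (ι-cong (lem (+ Z ℤ.* y))) ι-1)))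
          comax : ∀ bs → Unique bs → (∀ {x} → x ∈ bs → x ∈ as) → AllPairs (λ a b → ¬ ¬ Comaximal q (γ a) (γ b)) bs
          comax [] _ _ = []
          comax (b ∷ bs) (b∉ ∷ v) sub = All.tabulate (λ {x} x∈ → pair (sub (here refl)) (sub (there x∈)) (All.lookup b∉ x∈)) ∷ comax bs v (sub ∘ there)

-- Divergence of the sum of 1/index

module DivergentReciprocals where

  open Counting
  open Q using (Σ[_]; fromℕ; inv)
  open Orders
  open Congruences
  open Ideals
  open Sieving
  open import Data.Nat using (_!)
  open import Data.Nat.Primality using (¬prime[0])
  open import Data.Integer using (+_)
  open import Data.Vec using (lookup)
  open import Data.List using (map; concatMap)
  open import Data.List.Properties using (length-map; length-upTo)
  open import Data.List.Relation.Unary.All as All using (All; []; _∷_)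
  import Data.List.Relation.Unary.All.Properties as All
  open import Data.List.Relation.Unary.AllPairs as AllPairs using (AllPairs; []; _∷_)
  import Data.List.Relation.Unary.AllPairs.Properties as AllPairs
  open import Data.Product.Properties using (≡-dec)
  open import Relation.Binary.PropositionalEquality as ≡ using (_≡_; refl; cong; cong₂; subst; sym; trans)

  all-to-list : {A : Set} {P : A → Set} {xs : List A} → All P xs → ∃ λ (ys : List (∃ P)) → map proj₁ ys ≡ xs
  all-to-list [] = [] , refl
  all-to-list {xs = x ∷ _} (p ∷ ps) with all-to-list ps
  ... | ys , e = (x , p) ∷ ys , cong (x ∷_) e

  fromℕ-length : {A : Set} (xs : List A) → fromℕ (length xs) ≡ Σ[ (λ _ → Q.1#) ] xs
  fromℕ-length xs = sym (trans (Q.Σ-const Q.1# xs) (Q.*-identityʳ _))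

  fromℕ-length-concatMap : {A B : Set} (f : A → List B) (xs : List A) → fromℕ (length (concatMap f xs)) ≡ Σ[ (λ x → fromℕ (length (f x))) ] xs
  fromℕ-length-concatMap f xs = trans (fromℕ-length (concatMap f xs)) (trans (Q.Σ-concatMap _ f xs) (Q.Σ-cong xs λ x → sym (fromℕ-length (f x))))

  x*inv[4x] : ∀ {x} → 1 ℕ.≤ x → fromℕ x Q.* inv (4 ℕ.* x) ≡ inv 4
  x*inv[4x] {x} 1≤x = trans (cong (fromℕ x Q.*_) (trans (cong inv (ℕ.*-comm 4 x)) (Q.inv-* x 4)))
    (trans (sym (Q.*-assoc (fromℕ x) (inv x) (inv 4))) (trans (cong (Q._* inv 4) (Q.fromℕ*inv 1≤x)) (Q.*-identityˡ _)))

  module _ (O : Order) (1≉0 : ¬ (Order._≈_ O (Order.1# O) (Order.0# O))) where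
    open Order O using (Carrier; d; K; M; 1≤M; ι; 1#; 0#; Bounded; vec) renaming (_≈_ to _≈ᴼ_)
    open PrimeIdeals O 1≉0
    open Divergence O 1≉0

    -- k bounds the number of elements with a common label: units, or nonunits in one small cube. A
    -- and B are the losses in `cube-count`, and D collects the factors of the main term. Primes
    -- above z-min are large enough for `few-comaximal` and admit cubes of positive side.
    units′ k c′ A B D z-min : ℕ
    units′ = suc (2 ℕ.* (2 ℕ.* suc N₁)) ℕ.^ d
    k = units′ ℕ.+ d
    c′ = c ℕ.* M
    A = 2 ℕ.^ d
    B = (3 ℕ.* c′) ℕ.^ d
    D = k ℕ.* A ℕ.* B
    z-min = suc (c ℕ.* N₁) ℕ.^ d ℕ.+ suc (c′ ℕ.* 1) ℕ.^ d

    1≤c′ : 1 ℕ.≤ c′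
    1≤c′ = ℕ.*-mono-≤ {1} {c} (s≤s z≤n) 1≤M

    1≤k : 1 ℕ.≤ k
    1≤k = ℕ.≤-trans 1≤d (ℕ.m≤n+m d units′)

    1≤A : 1 ℕ.≤ A
    1≤A = ℕ.m^n>0 2 d

    1≤D : 1 ℕ.≤ D
    1≤D = ℕ.*-mono-≤ (ℕ.*-mono-≤ 1≤k 1≤A) (ℕ.m^n>0 (3 ℕ.* c′) {{ℕ.>-nonZero (ℕ.*-mono-≤ {1} {3} (s≤s z≤n) 1≤c′)}} d)

    -- The side s of the cubes has s^d of order E, so the box meets O(Y^d / E + 1) of them. The 1 is
    -- the cost of primes with E beyond Y^d; how many of these occur is the subject of `few-primes`.
    cube-count : ∀ {E σ} Y → E ℕ.≤ suc (c′ ℕ.* suc (suc σ)) ℕ.^ d → 1 ℕ.≤ E →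
      fromℕ (suc (Y ℕ./ suc σ) ℕ.^ d) Q.≤ fromℕ A Q.* (fromℕ B Q.* fromℕ (Y ℕ.^ d) Q.* inv E Q.+ Q.1#)
    cube-count {E} {σ} Y E≤ 1≤E = begin
      fromℕ (suc y ℕ.^ d) ≤⟨ Q.fromℕ-mono (split y) ⟩
      fromℕ (A ℕ.* (y ℕ.^ d ℕ.+ 1)) ≡⟨ trans (Q.fromℕ-* A (y ℕ.^ d ℕ.+ 1)) (cong (fromℕ A Q.*_) (trans (Q.fromℕ-+ (y ℕ.^ d) 1) (cong (fromℕ (y ℕ.^ d) Q.+_) Q.fromℕ-1))) ⟩
      fromℕ A Q.* (fromℕ (y ℕ.^ d) Q.+ Q.1#) ≤⟨ Q.*-mono-≤ Q.≤-refl (Q.+-mono-≤ main Q.≤-refl) ⟩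
      fromℕ A Q.* (fromℕ B Q.* fromℕ (Y ℕ.^ d) Q.* inv E Q.+ Q.1#) ∎
      where
      open Q.≤-Reasoning
      s = suc σ
      y = Y ℕ./ s
      split : ∀ y → suc y ℕ.^ d ℕ.≤ A ℕ.* (y ℕ.^ d ℕ.+ 1)
      split zero = ℕ.≤-trans (ℕ.≤-reflexive (ℕ.^-zeroˡ d)) (ℕ.*-mono-≤ 1≤A (ℕ.m≤n+m 1 (0 ℕ.^ d)))
      split (suc y) = ℕ.≤-trans (ℕ.^-monoˡ-≤ d (ℕ.≤-trans (ℕ.+-monoˡ-≤ (suc y) {1} {suc y} (s≤s z≤n)) (ℕ.≤-reflexive (cong (suc y ℕ.+_) (sym (ℕ.+-identityʳ (suc y)))))))
        (ℕ.≤-trans (ℕ.≤-reflexive (^-distribʳ-* d 2 (suc y))) (ℕ.*-monoʳ-≤ A (ℕ.m≤m+n _ 1)))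
      E≤′ : E ℕ.≤ B ℕ.* s ℕ.^ d
      E≤′ = ℕ.≤-trans E≤ (ℕ.≤-trans (ℕ.^-monoˡ-≤ d (ℕ.≤-trans (ℕ.+-mono-≤ {1} {c′ ℕ.* s} (ℕ.*-mono-≤ 1≤c′ (s≤s z≤n))
          (ℕ.≤-trans (ℕ.≤-reflexive (ℕ.*-suc c′ s)) (ℕ.+-monoˡ-≤ (c′ ℕ.* s) (ℕ.≤-trans (ℕ.≤-reflexive (sym (ℕ.*-identityʳ c′))) (ℕ.*-monoʳ-≤ c′ {1} {s} (s≤s z≤n))))))
          (ℕ.≤-reflexive (lem c′ s)))) (ℕ.≤-reflexive (^-distribʳ-* d (3 ℕ.* c′) s)))
        where
        lem : ∀ c s → c ℕ.* s ℕ.+ (c ℕ.* s ℕ.+ c ℕ.* s) ≡ 3 ℕ.* c ℕ.* s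
        lem = ℕ-solve-∀
      main : fromℕ (y ℕ.^ d) Q.≤ fromℕ B Q.* fromℕ (Y ℕ.^ d) Q.* inv E
      main = Q.≤-from-*fromℕ {n = E} 1≤E (begin
        fromℕ (y ℕ.^ d) Q.* fromℕ E ≡⟨ sym (Q.fromℕ-* (y ℕ.^ d) E) ⟩
        fromℕ (y ℕ.^ d ℕ.* E) ≤⟨ Q.fromℕ-mono (ℕ.≤-trans (ℕ.*-monoʳ-≤ (y ℕ.^ d) E≤′) (ℕ.≤-trans (ℕ.≤-reflexive (lem (y ℕ.^ d) B (s ℕ.^ d)))
            (ℕ.*-monoʳ-≤ B (ℕ.≤-trans (ℕ.≤-reflexive (sym (^-distribʳ-* d y s))) (ℕ.^-monoˡ-≤ d (ℕ.m/n*n≤m Y s)))))) ⟩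
        fromℕ (B ℕ.* Y ℕ.^ d) ≡⟨ trans (Q.fromℕ-* B (Y ℕ.^ d)) (sym (trans (Q.*-assoc (fromℕ B Q.* fromℕ (Y ℕ.^ d)) (inv E) (fromℕ E)) (trans (cong (fromℕ B Q.* fromℕ (Y ℕ.^ d) Q.*_) (Q.inv*fromℕ 1≤E)) (Q.*-identityʳ _)))) ⟩
        fromℕ B Q.* fromℕ (Y ℕ.^ d) Q.* inv E Q.* fromℕ E ∎)
        where
        lem : ∀ y b s → y ℕ.* (b ℕ.* s) ≡ b ℕ.* (y ℕ.* s)
        lem = ℕ-solve-∀

    module _ (E : ℕ → ℕ) (z₀ : ℕ) (q≤E : ∀ {q} → Prime q → q ℕ.≤ E q)
      (index≥E : ∀ {q} → Prime q → z₀ ℕ.< q → ∀ {I : Carrier → Set} → IsIdeal I → I (ι (+ q)) → ¬ I 1# →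
        ∀ {ξ b} → I ξ → ¬ (ξ ≈ᴼ 0#) → Bounded ξ b → E q ℕ.≤ suc (c ℕ.* b) ℕ.^ d)
      where

      Tail : ℕ → ℕ → Set
      Tail z n = ∀ qs → Unique qs → All (λ q → (Prime q × z₀ ℕ.< q) × z ℕ.< q) qs → Σ[ inv ∘ E ] qs Q.≤ inv n

      module Count (z Y : ℕ) (1≤Y : 1 ℕ.≤ Y) (z₀≤z : z₀ ℕ.≤ z) (z-min≤z : z-min ℕ.≤ z) where
        open Sieve z Y 1≤Y

        top : ℕ
        top = suc (c ℕ.* (G ℕ.* N₁ ℕ.+ Z ℕ.* (Y ℕ.* M))) ℕ.^ d

        Class : Vec ℕ d → Set
        Class a = a ∈ box d Y × (Unit (γ a) ⊎ ∃ λ q → Prime q × ¬ Invertible q (γ a))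

        Small : ℕ → Set
        Small q = Prime q × z ℕ.< q × E q ℕ.≤ top

        small? : ∀ q → Dec (Small q)
        small? q = prime? q ×-dec (z ℕ.<? q) ×-dec (E q ℕ.≤? top)

        qs : List ℕ
        qs = filter small? (upTo (suc top))

        qs-unique : Unique qs
        qs-unique = Unique.filter⁺ small? (Unique.upTo⁺ (suc top))

        qs-small : ∀ {q} → q ∈ qs → Small q
        qs-small m = proj₂ (∈-filter⁻ small? {xs = upTo (suc top)} m)

        -- `suc σ` is the largest side for which `few-in-cube` applies (c′ contains the factor M);
        -- the second inequality makes its d-th power comparable to `E q`.
        Side : ℕ → ℕ → Set
        Side q σ = suc (c′ ℕ.* suc σ) ℕ.^ d ℕ.< E q × E q ℕ.≤ suc (c′ ℕ.* suc (suc σ)) ℕ.^ d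

        side-exists : ∀ {q} → Prime q → z ℕ.< q → ∃ (Side q)
        side-exists {q} pq z<q with root-bracket c′ d {E q} 1≤c′ 1≤d (ℕ.≤-trans (prime≥2 pq) (q≤E pq))
        ... | zero , _ , hi = contradiction hi (ℕ.<⇒≱ (ℕ.<-≤-trans (ℕ.≤-<-trans (ℕ.≤-trans (ℕ.m≤n+m _ _) z-min≤z) z<q) (q≤E pq)))
        ... | suc σ , lo , hi = σ , lo , hi

        side : ℕ → ℕ
        side q with prime? q ×-dec (z ℕ.<? q)
        ... | yes (pq , z<q) = proj₁ (side-exists pq z<q)
        ... | no _ = 0

        side-spec : ∀ {q} → Prime q → z ℕ.< q → Side q (side q)
        side-spec {q} pq z<q with prime? q ×-dec (z ℕ.<? q)
        ... | yes (pq , z<q) = proj₂ (side-exists pq z<q)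
        ... | no n = contradiction (pq , z<q) n

        Label : Set
        Label = ℕ × Vec ℕ d

        -- Units receive the first component 0, which no prime uses. A nonunit receives a prime
        -- modulo which it is not invertible, and the cube in which its parameter lies.
        label : ∃ Class → Label
        label (a , _ , inj₁ _) = 0 , Vec.replicate d 0
        label (a , _ , inj₂ (q , _)) = q , Vec.map (ℕ._/ suc (side q)) a

        cubes : ℕ → List Label
        cubes q = map (q ,_) (box d (suc (Y ℕ./ suc (side q))))

        labels : List Label
        labels = (0 , Vec.replicate d 0) ∷ concatMap cubes qs

        ∈-concatMap : ∀ {A B : Set} {f : A → List B} {xs x y} → x ∈ xs → y ∈ f x → y ∈ concatMap f xs
        ∈-concatMap {f = f} {x ∷ xs} (here refl) m = ∈-++⁺ˡ m
        ∈-concatMap {f = f} {x ∷ xs} (there x∈) m = ∈-++⁺ʳ (f x) (∈-concatMap x∈ m)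

        label-∈ : ∀ x → label x ∈ labels
        label-∈ (a , _ , inj₁ _) = here refl
        label-∈ (a , a∈ , inj₂ (q , pq , ni)) = there (∈-concatMap q∈ (∈-map⁺ (q ,_) (∈-box⁺ λ i →
            s≤s (subst (ℕ._≤ _) (sym (Vec.lookup-map i _ a)) (ℕ./-monoˡ-≤ (suc (side q)) (ℕ.<⇒≤ (∈-box⁻ a∈ i)))))))
          where
          z<q : z ℕ.< q
          z<q = prime-large {q} {a} pq ni
          E≤top : E q ℕ.≤ top
          E≤top = E-bound E pq (index≥E pq (ℕ.≤-<-trans z₀≤z z<q)) a∈ ni
          q∈ : q ∈ qs
          q∈ = ∈-filter⁺ small? (∈-upTo⁺ (s≤s (ℕ.≤-trans (q≤E pq) E≤top))) (pq , z<q , E≤top)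

        _≟ᴸ_ : (x y : Label) → Dec (x ≡ y)
        _≟ᴸ_ = ≡-dec ℕ._≟_ (Vec.≡-dec ℕ._≟_)

        fibre : ∀ (F : List (∃ Class)) → Unique (map proj₁ F) → ∀ y → (∀ {x} → x ∈ F → label x ≡ y) → length F ℕ.≤ k
        fibre [] _ _ _ = z≤n
        fibre F@((a , a∈ , inj₁ ua) ∷ _) u y same = ℕ.≤-trans (ℕ.≤-reflexive (sym (length-map proj₁ F)))
          (ℕ.≤-trans (few-units (map proj₁ F) u (All.map⁺ (All.tabulate unit))) (ℕ.m≤m+n units′ d))
          where
          unit : ∀ {x} → x ∈ F → proj₁ x ∈ box d Y × Unit (γ (proj₁ x))
          unit {b , b∈ , inj₁ ub} _ = b∈ , ub
          unit {b , b∈ , inj₂ (q , pq , _)} m = contradiction (subst Prime (cong proj₁ (trans (same m) (sym (same (here refl))))) pq) ¬prime[0]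
        fibre F@((a , a∈ , inj₂ (q , pq , ni)) ∷ _) u y same = ℕ.≤-trans (ℕ.≤-reflexive (sym (length-map proj₁ F)))
          (ℕ.≤-trans (few-in-cube E pq (index≥E pq (ℕ.≤-<-trans z₀≤z z<q)) (suc (side q))
              (subst (λ r → suc r ℕ.^ d ℕ.< E q) (lem c M (suc (side q))) (proj₁ (side-spec pq z<q)))
              (ℕ.≤-<-trans (ℕ.≤-trans (ℕ.m≤m+n _ _) z-min≤z) z<q) z<q
              (map proj₁ F) u (All.map⁺ (All.tabulate nonunit)) block) (ℕ.m≤n+m d units′))
          where
          z<q : z ℕ.< q
          z<q = prime-large {q} {a} pq ni
          lem : ∀ c M s → c ℕ.* M ℕ.* s ≡ c ℕ.* (s ℕ.* M)
          lem = ℕ-solve-∀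
          nonunit : ∀ {x} → x ∈ F → ¬ Invertible q (γ (proj₁ x))
          nonunit {b , b∈ , inj₁ ub} m = contradiction (subst Prime (cong proj₁ (trans (same (here refl)) (sym (same m)))) pq) ¬prime[0]
          nonunit {b , b∈ , inj₂ (q′ , pq′ , ni′)} m = subst (λ r → ¬ Invertible r (γ b)) (cong proj₁ (trans (same m) (sym (same (here refl))))) ni′
          blocks : ∀ {x} → x ∈ F → Vec.map (ℕ._/ suc (side q)) (proj₁ x) ≡ Vec.map (ℕ._/ suc (side q)) a
          blocks {b , b∈ , inj₁ ub} m = contradiction (subst Prime (cong proj₁ (trans (same (here refl)) (sym (same m)))) pq) ¬prime[0]
          blocks {b , b∈ , inj₂ (q′ , _)} m with trans (same m) (sym (same (here refl)))
          ... | e = trans (cong (λ r → Vec.map (ℕ._/ suc (side r)) b) (sym (cong proj₁ e))) (cong proj₂ e)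
          block : ∀ {b b′} → b ∈ map proj₁ F → b′ ∈ map proj₁ F → ∀ i → lookup b i ℕ./ suc (side q) ≡ lookup b′ i ℕ./ suc (side q)
          block m m′ i with ∈-map⁻ proj₁ m | ∈-map⁻ proj₁ m′
          ... | x , x∈ , refl | x′ , x′∈ , refl = trans (sym (Vec.lookup-map i _ (proj₁ x))) (trans (cong (λ v → lookup v i) (trans (blocks x∈) (sym (blocks x′∈)))) (Vec.lookup-map i _ (proj₁ x′)))

        count : ¬ ¬ (Y ℕ.^ d ℕ.≤ k ℕ.* length labels)
        count absurd = ¬¬-All {P = Class} {xs = box d Y} (All.tabulate λ {a} a∈ n → unit-or-prime (γ≉0 a∈) λ cl → n (a∈ , cl)) λ classes →
          let (xs , e) = all-to-list classes
              u = subst Unique (sym e) (grid-unique (Vec.replicate d Y))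
          in absurd (subst (ℕ._≤ k ℕ.* length labels) (trans (sym (length-map proj₁ xs)) (trans (cong length e) (length-box d Y)))
               (pigeonhole-fibres _≟ᴸ_ label k xs labels (λ {x} _ → label-∈ x) λ y →
                 fibre (filter (λ x → label x ≟ᴸ y) xs) (AllPairs.map⁺ (AllPairs.filter⁺ (λ x → label x ≟ᴸ y) (AllPairs.map⁻ u))) y
                   (λ m → proj₂ (∈-filter⁻ (λ x → label x ≟ᴸ y) {xs = xs} m))))

        labels-bound : fromℕ (length labels) Q.≤ Q.1# Q.+ Σ[ (λ q → fromℕ A Q.* (fromℕ B Q.* fromℕ (Y ℕ.^ d) Q.* inv (E q) Q.+ Q.1#)) ] qs
        labels-bound = Q.+-mono-≤ Q.≤-refl (Q.≤-trans (Q.≤-reflexive (fromℕ-length-concatMap cubes qs)) (Q.Σ-mono qs λ {q} q∈ →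
          let (pq , z<q , _) = qs-small q∈ in
          Q.≤-trans (Q.≤-reflexive (cong fromℕ (trans (length-map (q ,_) (box d (suc (Y ℕ./ suc (side q))))) (length-box d (suc (Y ℕ./ suc (side q)))))))
            (cube-count Y (proj₂ (side-spec pq z<q)) (ℕ.≤-trans (prime≥1 pq) (q≤E pq)))))

        -- Up to z′ all integers are counted. Beyond z′ a prime with E q ≤ top counts at most top /
        -- E q, and the tail bound applies.
        few-primes : ∀ z′ n → z ℕ.≤ z′ → Tail z′ n → fromℕ (length qs) Q.≤ fromℕ (suc z′) Q.+ fromℕ top Q.* inv n
        few-primes z′ n z≤z′ tail = begin
          fromℕ (length qs) ≡⟨ cong fromℕ (length-filter-split _ (ℕ._≤? z′) qs) ⟩
          fromℕ (length (filter (ℕ._≤? z′) qs) ℕ.+ length large) ≡⟨ Q.fromℕ-+ (length (filter (ℕ._≤? z′) qs)) (length large) ⟩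
          fromℕ (length (filter (ℕ._≤? z′) qs)) Q.+ fromℕ (length large) ≤⟨ Q.+-mono-≤
              (Q.fromℕ-mono (subst (length (filter (ℕ._≤? z′) qs) ℕ.≤_) (length-upTo (suc z′)) (unique⊆⇒length≤ (Unique.filter⁺ (ℕ._≤? z′) qs-unique)
                λ m → ∈-upTo⁺ (s≤s (proj₂ (∈-filter⁻ (ℕ._≤? z′) {xs = qs} m))))))
              (Q.≤-trans (Q.≤-reflexive (fromℕ-length large)) (Q.Σ-mono large weight)) ⟩
          fromℕ (suc z′) Q.+ Σ[ (λ q → fromℕ top Q.* inv (E q)) ] large ≡⟨ cong (fromℕ (suc z′) Q.+_) (Q.Σ-scale (fromℕ top) (inv ∘ E) large) ⟩
          fromℕ (suc z′) Q.+ fromℕ top Q.* Σ[ inv ∘ E ] large ≤⟨ Q.+-mono-≤ Q.≤-refl (Q.*-mono-≤ Q.≤-refl (tail large (Unique.filter⁺ large? qs-unique)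
              (All.tabulate λ m → let (q∈ , big) = ∈-filter⁻ large? {xs = qs} m ; (pq , z<q , _) = qs-small q∈ in (pq , ℕ.≤-<-trans z₀≤z z<q) , ℕ.≰⇒> big))) ⟩
          fromℕ (suc z′) Q.+ fromℕ top Q.* inv n ∎
          where
          open Q.≤-Reasoning
          large? : ∀ q → Dec (¬ q ℕ.≤ z′)
          large? q = ¬? (q ℕ.≤? z′)
          large = filter large? qs
          weight : ∀ {q} → q ∈ large → Q.1# Q.≤ fromℕ top Q.* inv (E q)
          weight {q} m = let (pq , _ , E≤) = qs-small (proj₁ (∈-filter⁻ large? {xs = qs} m)) in
            Q.≤-trans (Q.≤-reflexive (sym (Q.fromℕ*inv (ℕ.≤-trans (prime≥1 pq) (q≤E pq))))) (Q.*-mono-≤ (Q.fromℕ-mono E≤) Q.≤-refl)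

      module _ (C : ℕ) (bounded : ∀ qs → Unique qs → All (λ q → Prime q × z₀ ℕ.< q) qs → Σ[ inv ∘ E ] qs Q.≤ fromℕ C) where

        -- With V = Y^d the count has three parts, each made at most V/4. First z makes the main
        -- term small. Then z′, which depends on z through `top ≤ C₆ z * V`, makes the contribution
        -- of the additive 1 per prime beyond z′ small. Finally Y = 4 W makes the constant W small,
        -- so V ≤ 3V/4.
        diverges : ⊥
        diverges =
          small-tail (λ q → Prime q × z₀ ℕ.< q) (inv ∘ E) C bounded (4 ℕ.* D) (ℕ.*-mono-≤ {1} {4} (s≤s z≤n) 1≤D) (z₀ ℕ.+ z-min) λ (z , z-large , tail) →
          small-tail (λ q → Prime q × z₀ ℕ.< q) (inv ∘ E) C bounded (4 ℕ.* (k ℕ.* A ℕ.* C₆ z)) (1≤n z) z λ (z′ , z≤z′ , tail′) →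
          finish z (ℕ.≤-trans (ℕ.m≤m+n z₀ z-min) z-large) (ℕ.≤-trans (ℕ.m≤n+m z-min z₀) z-large) tail z′ z≤z′ tail′
          where
          C₅ C₆ : ℕ → ℕ
          C₅ z = (1 ℕ.+ z ! ℕ.* (suc (2 ℕ.* K) ℕ.* M)) ℕ.* N₁ ℕ.+ z ! ℕ.* M
          C₆ z = suc (c ℕ.* C₅ z) ℕ.^ d
          1≤x : ∀ z → 1 ℕ.≤ k ℕ.* A ℕ.* C₆ z
          1≤x z = ℕ.*-mono-≤ (ℕ.*-mono-≤ 1≤k 1≤A) (ℕ.m^n>0 (suc (c ℕ.* C₅ z)) d)
          1≤n : ∀ z → 1 ℕ.≤ 4 ℕ.* (k ℕ.* A ℕ.* C₆ z)
          1≤n z = ℕ.*-mono-≤ {1} {4} (s≤s z≤n) (1≤x z)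
          finish : ∀ z → z₀ ℕ.≤ z → z-min ℕ.≤ z → Tail z (4 ℕ.* D) → ∀ z′ → z ℕ.≤ z′ → Tail z′ (4 ℕ.* (k ℕ.* A ℕ.* C₆ z)) → ⊥
          finish z z₀≤z z-min≤z tail z′ z≤z′ tail′ = count λ le → ℕ.<⇒≱ (ℕ.*-monoˡ-< V {{ℕ.>-nonZero 1≤V}} (ℕ.n<1+n 3)) (Q.fromℕ-cancel (total le))
            where
            W Y V : ℕ
            W = k ℕ.+ k ℕ.* A ℕ.* suc z′
            Y = 4 ℕ.* W
            1≤Y : 1 ℕ.≤ Y
            1≤Y = ℕ.*-mono-≤ {1} {4} (s≤s z≤n) (ℕ.≤-trans 1≤k (ℕ.m≤m+n k _))
            V = Y ℕ.^ d
            open Count z Y 1≤Y z₀≤z z-min≤z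
            open Sieve z Y 1≤Y using (Z; G)
            Y≤V : Y ℕ.≤ V
            Y≤V = ℕ.≤-trans (ℕ.≤-reflexive (sym (ℕ.^-identityʳ Y))) (ℕ.^-monoʳ-≤ Y {{ℕ.>-nonZero 1≤Y}} 1≤d)
            1≤V : 1 ℕ.≤ V
            1≤V = ℕ.≤-trans 1≤Y Y≤V
            top≤ : top ℕ.≤ C₆ z ℕ.* V
            top≤ = ℕ.≤-trans (ℕ.^-monoˡ-≤ d (ℕ.≤-trans (s≤s (ℕ.*-monoʳ-≤ c size)) (ℕ.≤-trans (ℕ.+-monoˡ-≤ (c ℕ.* (C₅ z ℕ.* Y)) 1≤Y) (ℕ.≤-reflexive (lem c (C₅ z) Y)))))
              (ℕ.≤-reflexive (^-distribʳ-* d (suc (c ℕ.* C₅ z)) Y))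
              where
              lem : ∀ c C Y → Y ℕ.+ c ℕ.* (C ℕ.* Y) ≡ suc (c ℕ.* C) ℕ.* Y
              lem = ℕ-solve-∀
              lem₂ : ∀ Z κ Y M N → (Y ℕ.+ Z ℕ.* (κ ℕ.* (Y ℕ.* M))) ℕ.* N ℕ.+ Z ℕ.* (Y ℕ.* M) ≡ ((1 ℕ.+ Z ℕ.* (κ ℕ.* M)) ℕ.* N ℕ.+ Z ℕ.* M) ℕ.* Y
              lem₂ = ℕ-solve-∀
              size : G ℕ.* N₁ ℕ.+ Z ℕ.* (Y ℕ.* M) ℕ.≤ C₅ z ℕ.* Y
              size = ℕ.≤-trans (ℕ.+-monoˡ-≤ _ (ℕ.*-monoˡ-≤ N₁ (ℕ.+-monoˡ-≤ (Z ℕ.* (suc (2 ℕ.* K) ℕ.* (Y ℕ.* M))) 1≤Y))) (ℕ.≤-reflexive (lem₂ Z (suc (2 ℕ.* K)) Y M N₁))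
            v = fromℕ V
            n′ = 4 ℕ.* (k ℕ.* A ℕ.* C₆ z)
            open Q.≤-Reasoning
            open Q using (_:+_; _:*_; _:=_; con)
            bound : V ℕ.≤ k ℕ.* length labels → v Q.≤ inv 4 Q.* v Q.+ inv 4 Q.* v Q.+ inv 4 Q.* v
            bound le = begin
              v ≤⟨ Q.fromℕ-mono le ⟩
              fromℕ (k ℕ.* length labels) ≡⟨ Q.fromℕ-* k (length labels) ⟩
              fromℕ k Q.* fromℕ (length labels) ≤⟨ Q.*-mono-≤ Q.≤-refl labels-bound ⟩
              fromℕ k Q.* (Q.1# Q.+ Σ[ (λ q → fromℕ A Q.* (fromℕ B Q.* v Q.* inv (E q) Q.+ Q.1#)) ] qs)
                ≡⟨ cong (λ s → fromℕ k Q.* (Q.1# Q.+ s)) (trans (Q.Σ-scale (fromℕ A) _ qs) (cong (fromℕ A Q.*_) (trans (Q.Σ-+ _ _ qs) (cong₂ Q._+_ (Q.Σ-scale (fromℕ B Q.* v) (inv ∘ E) qs) (sym (fromℕ-length qs)))))) ⟩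
              fromℕ k Q.* (Q.1# Q.+ fromℕ A Q.* (fromℕ B Q.* v Q.* Σ[ inv ∘ E ] qs Q.+ fromℕ (length qs)))
                ≤⟨ Q.*-mono-≤ Q.≤-refl (Q.+-mono-≤ Q.≤-refl (Q.*-mono-≤ Q.≤-refl (Q.+-mono-≤ (Q.*-mono-≤ Q.≤-refl
                     (tail qs qs-unique (All.tabulate λ m → let (pq , z<q , _) = qs-small m in (pq , ℕ.≤-<-trans z₀≤z z<q) , z<q)))
                     (Q.≤-trans (few-primes z′ n′ z≤z′ tail′) (Q.+-mono-≤ Q.≤-refl (Q.*-mono-≤ (Q.≤-trans (Q.fromℕ-mono top≤) (Q.≤-reflexive (Q.fromℕ-* (C₆ z) V))) Q.≤-refl)))))) ⟩
              fromℕ k Q.* (Q.1# Q.+ fromℕ A Q.* (fromℕ B Q.* v Q.* inv (4 ℕ.* D) Q.+ (fromℕ (suc z′) Q.+ fromℕ (C₆ z) Q.* v Q.* inv n′)))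
                ≡⟨ Q.solve 8 (λ k a b v i z c j → k :* (con 1 :+ a :* (b :* v :* i :+ (z :+ c :* v :* j))) := (k :+ k :* a :* z) :+ (k :* a :* b :* i) :* v :+ (k :* a :* c :* j) :* v) refl
                     (fromℕ k) (fromℕ A) (fromℕ B) v (inv (4 ℕ.* D)) (fromℕ (suc z′)) (fromℕ (C₆ z)) (inv n′) ⟩
              (fromℕ k Q.+ fromℕ k Q.* fromℕ A Q.* fromℕ (suc z′)) Q.+ (fromℕ k Q.* fromℕ A Q.* fromℕ B Q.* inv (4 ℕ.* D)) Q.* v Q.+ (fromℕ k Q.* fromℕ A Q.* fromℕ (C₆ z) Q.* inv n′) Q.* v
                ≡⟨ cong₂ (λ x y → x Q.+ y Q.* v) (cong₂ (λ x y → x Q.+ y Q.* v) (sym W-value) (quarter B 1≤D)) (quarter (C₆ z) (1≤x z)) ⟩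
              fromℕ W Q.+ inv 4 Q.* v Q.+ inv 4 Q.* v
                ≤⟨ Q.+-mono-≤ (Q.+-mono-≤ W≤ Q.≤-refl) Q.≤-refl ⟩
              inv 4 Q.* v Q.+ inv 4 Q.* v Q.+ inv 4 Q.* v ∎
              where
              W-value : fromℕ W ≡ fromℕ k Q.+ fromℕ k Q.* fromℕ A Q.* fromℕ (suc z′)
              W-value = trans (Q.fromℕ-+ k _) (cong (fromℕ k Q.+_) (trans (Q.fromℕ-* (k ℕ.* A) (suc z′)) (cong (Q._* fromℕ (suc z′)) (Q.fromℕ-* k A))))
              quarter : ∀ x → 1 ℕ.≤ k ℕ.* A ℕ.* x → fromℕ k Q.* fromℕ A Q.* fromℕ x Q.* inv (4 ℕ.* (k ℕ.* A ℕ.* x)) ≡ inv 4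
              quarter x 1≤ = trans (cong (Q._* inv (4 ℕ.* (k ℕ.* A ℕ.* x))) (sym (trans (Q.fromℕ-* (k ℕ.* A) x) (cong (Q._* fromℕ x) (Q.fromℕ-* k A))))) (x*inv[4x] 1≤)
              W≤ : fromℕ W Q.≤ inv 4 Q.* v
              W≤ = Q.≤-trans (Q.≤-reflexive (sym (trans (cong (inv 4 Q.*_) (Q.fromℕ-* 4 W)) (trans (sym (Q.*-assoc (inv 4) (fromℕ 4) (fromℕ W)))
                  (trans (cong (Q._* fromℕ W) (Q.inv*fromℕ {4} (s≤s z≤n))) (Q.*-identityˡ _)))))) (Q.*-mono-≤ Q.≤-refl (Q.fromℕ-mono Y≤V))
            total : V ℕ.≤ k ℕ.* length labels → fromℕ (4 ℕ.* V) Q.≤ fromℕ (3 ℕ.* V)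
            total le = begin
              fromℕ (4 ℕ.* V) ≡⟨ Q.fromℕ-* 4 V ⟩
              fromℕ 4 Q.* v ≤⟨ Q.*-mono-≤ Q.≤-refl (bound le) ⟩
              fromℕ 4 Q.* (inv 4 Q.* v Q.+ inv 4 Q.* v Q.+ inv 4 Q.* v)
                ≡⟨ Q.solve 3 (λ f i v → f :* (i :* v :+ i :* v :+ i :* v) := (f :* i) :* (v :+ v :+ v)) refl (fromℕ 4) (inv 4) v ⟩
              fromℕ 4 Q.* inv 4 Q.* (v Q.+ v Q.+ v) ≡⟨ trans (cong (Q._* (v Q.+ v Q.+ v)) (Q.fromℕ*inv {4} (s≤s z≤n))) (Q.*-identityˡ _) ⟩
              v Q.+ v Q.+ v ≡⟨ sym (trans (cong fromℕ (lem V)) (trans (Q.fromℕ-+ (V ℕ.+ V) V) (cong (Q._+ v) (Q.fromℕ-+ V V)))) ⟩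
              fromℕ (3 ℕ.* V) ∎
              where
              lem : ∀ V → 3 ℕ.* V ≡ V ℕ.+ V ℕ.+ V
              lem = ℕ-solve-∀

-- Lower bound for ζ and comparison of Euler products

module EulerComparison where

  open Q
  open Estimates
  open Congruences using (prime≥1; prime≥2)
  open EulerProducts using (choices; Σ-choices; mass; ζ-weight; height; Π-weight)
  open import Data.Nat.Primality.Factorisation using (factorise; PrimeFactorisation)
  open import Data.List using (_++_; map; concatMap; applyUpTo; foldr)
  open import Data.List.Properties using (length-map; length-upTo; map-upTo)
  open import Data.List.Relation.Unary.All as All using (All; []; _∷_)
  open import Data.List.Relation.Unary.AllPairs using ([]; _∷_)
  open import Relation.Binary.PropositionalEquality hiding ([_])

  module Ratio (N : ℕ) (1≤N : 1 ℕ.≤ N) where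
    -- This is 1 - 1/N, whose geometric series is at most N.
    ρ : ℚ⁺
    ρ = fromℕ (ℕ.pred N) * inv N

    ρ+inv : ρ + inv N ≡ 1#
    ρ+inv = trans (solve 2 (λ a i → a :* i :+ i := (con 1 :+ a) :* i) refl (fromℕ (ℕ.pred N)) (inv N))
      (trans (cong (λ m → fromℕ m * inv N) (ℕ.suc-pred N {{ℕ.>-nonZero 1≤N}})) (fromℕ*inv 1≤N))

    ρ≤1 : ρ ≤ 1#
    ρ≤1 = ≤-trans (a≤a+b ρ (inv N)) (≤-reflexive ρ+inv)

    geometric : ∀ n → Σ[ (λ k → ρ ^ k) ] (upTo n) ≤ fromℕ N
    geometric zero = 0≤ _
    geometric (suc n) = begin
      1# + Σ[ (λ k → ρ ^ k) ] (applyUpTo suc n) ≡⟨ cong (1# +_) (trans (cong Σ[ (λ k → ρ ^ k) ] (sym (map-upTo suc n)))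
          (trans (Σ-map (λ k → ρ ^ k) suc (upTo n)) (Σ-scale ρ (λ k → ρ ^ k) (upTo n)))) ⟩
      1# + ρ * Σ[ (λ k → ρ ^ k) ] (upTo n) ≤⟨ +-mono-≤ ≤-refl (*-mono-≤ ≤-refl (geometric n)) ⟩
      1# + ρ * fromℕ N ≡⟨ cong (1# +_) (trans (*-assoc (fromℕ (ℕ.pred N)) (inv N) (fromℕ N)) (trans (cong (fromℕ (ℕ.pred N) *_) (inv*fromℕ 1≤N)) (*-identityʳ _))) ⟩
      fromℕ (suc (ℕ.pred N)) ≡⟨ cong fromℕ (ℕ.suc-pred N {{ℕ.>-nonZero 1≤N}}) ⟩
      fromℕ N ∎
      where open ≤-Reasoning

    bernoulli : ∀ j → 1# ≤ ρ ^ j + fromℕ j * inv N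
    bernoulli zero = a≤a+b 1# _
    bernoulli (suc j) = begin
      1# ≡⟨ sym ρ+inv ⟩
      ρ + inv N ≡⟨ cong (_+ inv N) (sym (*-identityʳ ρ)) ⟩
      ρ * 1# + inv N ≤⟨ +-mono-≤ (*-mono-≤ ≤-refl (bernoulli j)) ≤-refl ⟩
      ρ * (ρ ^ j + fromℕ j * inv N) + inv N ≡⟨ solve 4 (λ r x j i → r :* (x :+ j :* i) :+ i := r :* x :+ (r :* j :* i :+ i)) refl ρ (ρ ^ j) (fromℕ j) (inv N) ⟩
      ρ * ρ ^ j + (ρ * fromℕ j * inv N + inv N) ≤⟨ +-mono-≤ ≤-refl (+-mono-≤ (*-mono-≤ (*-mono-≤ ρ≤1 ≤-refl) ≤-refl) ≤-refl) ⟩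
      ρ * ρ ^ j + (1# * fromℕ j * inv N + inv N) ≡⟨ solve 3 (λ x j i → x :+ (con 1 :* j :* i :+ i) := x :+ (con 1 :+ j) :* i) refl (ρ * ρ ^ j) (fromℕ j) (inv N) ⟩
      ρ * ρ ^ j + (1# + fromℕ j) * inv N ∎
      where open ≤-Reasoning

  half : ∀ {n} → 1 ℕ.≤ n → fromℕ n * inv (2 ℕ.* n) ≡ inv 2
  half {n} 1≤n = trans (cong (fromℕ n *_) (trans (cong inv (ℕ.*-comm 2 n)) (inv-* n 2)))
    (trans (sym (*-assoc (fromℕ n) (inv n) (inv 2))) (trans (cong (_* inv 2) (fromℕ*inv 1≤n)) (*-identityˡ _)))

  ½+½ : inv 2 + inv 2 ≡ 1#
  ½+½ = trans (solve 1 (λ x → x :+ x := x :* (con 1 :+ (con 1 :+ con 0))) refl (inv 2)) (inv*fromℕ {2} (s≤s z≤n))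

  half≤ρ^ : ∀ {n} (1≤n : 1 ℕ.≤ n) {j} → j ℕ.≤ n → inv 2 ≤ Ratio.ρ (2 ℕ.* n) (ℕ.*-mono-≤ {1} {2} (s≤s z≤n) 1≤n) ^ j
  half≤ρ^ {n} 1≤n {j} j≤n = +-cancelʳ-≤ (inv 2) (≤-trans (≤-reflexive ½+½) (≤-trans (bernoulli j)
     (+-mono-≤ ≤-refl (≤-trans (*-mono-≤ (fromℕ-mono j≤n) ≤-refl) (≤-reflexive (half 1≤n))))))
    where open Ratio (2 ℕ.* n) (ℕ.*-mono-≤ {1} {2} (s≤s z≤n) 1≤n)

  -- One dummy root for each prime, so that `choices single` enumerates squarefree integers.
  single : ℕ → List ℕ
  single _ = 0 ∷ []

  private
    ∈-choices⁺ : ∀ {q qs pt} → pt ∈ choices single qs → ((q , 0) ∷ pt) ∈ choices single (q ∷ qs)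
    ∈-choices⁺ {q} {qs} m = ∈-++⁺ʳ (choices single qs) (∈-++⁺ˡ (∈-map⁺ ((q , 0) ∷_) m))

    -- q is added to the squarefree number or, when already present, removed from it; in the second
    -- case a factor q² passes to the square part.
    toggle : ∀ {q} qs {pt} → q ∈ qs → pt ∈ choices single qs →
      (∃ λ pt′ → pt′ ∈ choices single qs × (mass pt′ ≡ q ℕ.* mass pt ⊎ mass pt ≡ q ℕ.* mass pt′))
    toggle (q ∷ qs) q∈ m with ∈-++⁻ (choices single qs) m
    toggle (q ∷ qs) {pt} (here refl) m | inj₁ m′ = (q , 0) ∷ pt , ∈-choices⁺ {qs = qs} m′ , inj₁ refl
    toggle (r ∷ qs) (there q∈) m | inj₁ m′ = let (pt′ , m″ , e) = toggle qs q∈ m′ in pt′ , ∈-++⁺ˡ m″ , e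
    ... | inj₂ m′ with ∈-++⁻ (map ((q , 0) ∷_) (choices single qs)) m′
    ...   | inj₁ m″ with ∈-map⁻ ((q , 0) ∷_) m″
    toggle (q ∷ qs) (here refl) m | inj₂ _ | inj₁ _ | pt , pt∈ , refl = pt , ∈-++⁺ˡ pt∈ , inj₂ refl
    toggle {q} (r ∷ qs) (there q∈) m | inj₂ _ | inj₁ _ | pt , pt∈ , refl with toggle qs q∈ pt∈
    ... | pt′ , m′ , inj₁ e = (r , 0) ∷ pt′ , ∈-choices⁺ {qs = qs} m′ , inj₁ (trans (cong (r ℕ.*_) e) (lem r q (mass pt)))
      where
      lem : ∀ r q m → r ℕ.* (q ℕ.* m) ≡ q ℕ.* (r ℕ.* m)
      lem = ℕ-solve-∀
    ... | pt′ , m′ , inj₂ e = (r , 0) ∷ pt′ , ∈-choices⁺ {qs = qs} m′ , inj₂ (trans (cong (r ℕ.*_) e) (lem r q (mass pt′)))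
      where
      lem : ∀ r q m → r ℕ.* (q ℕ.* m) ≡ q ℕ.* (r ℕ.* m)
      lem = ℕ-solve-∀

    empty-∈ : ∀ qs → [] ∈ choices single qs
    empty-∈ [] = here refl
    empty-∈ (q ∷ qs) = ∈-++⁺ˡ (empty-∈ qs)

  squarefree-part : ∀ qs fs → All (_∈ qs) fs → ∃₂ λ pt r → pt ∈ choices single qs × foldr ℕ._*_ 1 fs ≡ mass pt ℕ.* (r ℕ.* r)
  squarefree-part qs [] [] = [] , 1 , empty-∈ qs , refl
  squarefree-part qs (q ∷ fs) (q∈ ∷ ok) with squarefree-part qs fs ok
  ... | pt , r , pt∈ , e with toggle qs q∈ pt∈
  ...   | pt′ , pt′∈ , inj₁ e′ = pt′ , r , pt′∈ , trans (cong (q ℕ.*_) e) (trans (sym (ℕ.*-assoc q (mass pt) (r ℕ.* r))) (cong (ℕ._* (r ℕ.* r)) (sym e′)))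
  ...   | pt′ , pt′∈ , inj₂ e′ = pt′ , q ℕ.* r , pt′∈ , trans (cong (q ℕ.*_) (trans e (cong (ℕ._* (r ℕ.* r)) e′))) (lem q (mass pt′) r)
    where
    lem : ∀ q m r → q ℕ.* (q ℕ.* m ℕ.* (r ℕ.* r)) ≡ m ℕ.* ((q ℕ.* r) ℕ.* (q ℕ.* r))
    lem = ℕ-solve-∀

  dyadic : ℕ → List ℕ
  dyadic zero = []
  dyadic (suc j) = dyadic j ++ map (2 ℕ.^ j ℕ.+_) (upTo (2 ℕ.^ j))

  ∈-dyadic : ∀ j {m} → m ∈ dyadic j → 1 ℕ.≤ m × m ℕ.< 2 ℕ.^ j
  ∈-dyadic (suc j) {m} m∈ with ∈-++⁻ (dyadic j) m∈
  ... | inj₁ p = let (a , b) = ∈-dyadic j p in a , ℕ.<-≤-trans b (ℕ.m≤m+n _ _)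
  ... | inj₂ p with ∈-map⁻ (2 ℕ.^ j ℕ.+_) p
  ...   | i , i∈ , refl = ℕ.≤-trans (ℕ.m^n>0 2 j) (ℕ.m≤m+n _ i) , ℕ.<-≤-trans (ℕ.+-monoʳ-< (2 ℕ.^ j) (∈-upTo⁻ i∈)) (ℕ.≤-reflexive (cong (2 ℕ.^ j ℕ.+_) (sym (ℕ.+-identityʳ _))))

  dyadic-unique : ∀ j → Unique (dyadic j)
  dyadic-unique zero = []
  dyadic-unique (suc j) = Unique.++⁺ (dyadic-unique j) (Unique.map⁺ (ℕ.+-cancelˡ-≡ (2 ℕ.^ j) _ _) (Unique.upTo⁺ _)) λ (p , q) →
    let (i , i∈ , e) = ∈-map⁻ (2 ℕ.^ j ℕ.+_) q in ℕ.<⇒≱ (proj₂ (∈-dyadic j p)) (ℕ.≤-trans (ℕ.m≤m+n _ i) (ℕ.≤-reflexive (sym e)))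

  -- With N = 2 n the power ρ^j is at least 1/2 for all j ≤ n, so integers below 2^n weigh the same
  -- as at s = 1 up to a factor 2.
  module ZetaLowerBound {n : ℕ} (1≤n : 1 ℕ.≤ n) where
    open Ratio (2 ℕ.* n) (ℕ.*-mono-≤ {1} {2} (s≤s z≤n) 1≤n) public

    g : ℕ → ℚ⁺
    g = ζ-weight ρ

    -- Each of the 2^j members has logarithm at most j and reciprocal at least 2^-(j+1), and ρ^j ≥
    -- 1/2.
    block-bound : ∀ j → j ℕ.≤ n → inv 4 ≤ Σ[ g ] (map (2 ℕ.^ j ℕ.+_) (upTo (2 ℕ.^ j)))
    block-bound j j≤n = begin
      inv 4 ≡⟨ inv-* 2 2 ⟩
      inv 2 * inv 2 ≤⟨ *-mono-≤ (half≤ρ^ 1≤n j≤n) ≤-refl ⟩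
      ρ ^ j * inv 2 ≡⟨ cong (ρ ^ j *_) (sym (half (ℕ.m^n>0 2 j))) ⟩
      ρ ^ j * (fromℕ (2 ℕ.^ j) * inv (2 ℕ.^ suc j)) ≡⟨ solve 3 (λ a b c → a :* (b :* c) := b :* (a :* c)) refl (ρ ^ j) (fromℕ (2 ℕ.^ j)) (inv (2 ℕ.^ suc j)) ⟩
      fromℕ (2 ℕ.^ j) * (ρ ^ j * inv (2 ℕ.^ suc j)) ≡⟨ cong (λ l → fromℕ l * (ρ ^ j * inv (2 ℕ.^ suc j))) (sym (trans (length-map (2 ℕ.^ j ℕ.+_) (upTo (2 ℕ.^ j))) (length-upTo (2 ℕ.^ j)))) ⟩
      fromℕ (length block) * (ρ ^ j * inv (2 ℕ.^ suc j)) ≡⟨ sym (Σ-const _ block) ⟩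
      Σ[ (λ _ → ρ ^ j * inv (2 ℕ.^ suc j)) ] block ≤⟨ Σ-mono block term ⟩
      Σ[ g ] block ∎
      where
      open ≤-Reasoning
      block = map (2 ℕ.^ j ℕ.+_) (upTo (2 ℕ.^ j))
      term : ∀ {m} → m ∈ block → ρ ^ j * inv (2 ℕ.^ suc j) ≤ g m
      term {m} m∈ = let (1≤m , m<) = ∈-dyadic (suc j) (∈-++⁺ʳ (dyadic j) m∈) in
        *-mono-≤ (^-antitone ρ≤1 (^-cancelʳ-≤ 2 {λ₂ m} {j} ℕ.≤-refl (ℕ.≤-<-trans (2^λ₂≤ 1≤m) m<))) (inv-antitone 1≤m (ℕ.<⇒≤ m<))

    dyadic-bound : ∀ j → j ℕ.≤ suc n → fromℕ j * inv 4 ≤ Σ[ g ] (dyadic j)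
    dyadic-bound zero _ = ≤-reflexive (*-zeroˡ _)
    dyadic-bound (suc j) (s≤s j≤n) = begin
      fromℕ (suc j) * inv 4 ≡⟨ solve 2 (λ j i → (con 1 :+ j) :* i := j :* i :+ i) refl (fromℕ j) (inv 4) ⟩
      fromℕ j * inv 4 + inv 4 ≤⟨ +-mono-≤ (dyadic-bound j (ℕ.m≤n⇒m≤1+n j≤n)) (block-bound j j≤n) ⟩
      Σ[ g ] (dyadic j) + Σ[ g ] (map (2 ℕ.^ j ℕ.+_) (upTo (2 ℕ.^ j))) ≡⟨ sym (Σ-++ g (dyadic j) _) ⟩
      Σ[ g ] (dyadic (suc j)) ∎
      where open ≤-Reasoning

    2^height≤mass : ∀ {pt} → All (λ (q , t) → 1 ℕ.≤ q) pt → 2 ℕ.^ height ρ pt ℕ.≤ mass pt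
    2^height≤mass [] = ℕ.≤-refl
    2^height≤mass {(q , t) ∷ pt} (p ∷ ps) = ℕ.≤-trans (ℕ.≤-reflexive (ℕ.^-distribˡ-+-* 2 (λ₂ q) (height ρ pt))) (ℕ.*-mono-≤ (2^λ₂≤ p) (2^height≤mass ps))

    -- Each m < 2^n is a squarefree number times r². As `λ₂` is superadditive, its weight is at most
    -- the product of the weights of the primes of the squarefree part times 1/r². So the sum over m
    -- is at most the Euler product times the sum of the 1/r², which is at most 2.
    zeta-lower-bound : ∀ qs → All (λ q → 1 ℕ.≤ q) qs → (∀ {q} → Prime q → q ℕ.≤ 2 ℕ.^ n → q ∈ qs) →
      fromℕ n * inv 4 ≤ fromℕ 2 * Π[ (λ q → 1# + g q) ] qs
    zeta-lower-bound qs qs≥1 complete = begin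
      fromℕ n * inv 4 ≤⟨ dyadic-bound n (ℕ.n≤1+n n) ⟩
      Σ[ g ] (dyadic n) ≤⟨ Σ-⊆ (dyadic-unique n) cover ⟩
      Σ[ g ] (concatMap (λ pt → map (λ r → mass pt ℕ.* (r ℕ.* r)) rs) pts) ≡⟨ trans (Σ-concatMap g _ pts) (Σ-cong pts λ pt → Σ-map g _ rs) ⟩
      Σ[ (λ pt → Σ[ (λ r → g (mass pt ℕ.* (r ℕ.* r))) ] rs) ] pts ≤⟨ Σ-mono pts (λ {pt} pt∈ → Σ-mono rs (λ {r} r∈ → term (choices≥1 qs qs≥1 pt∈) (rs≥1 r∈))) ⟩
      Σ[ (λ pt → Σ[ (λ r → Π[ g ∘ proj₁ ] pt * inv-square r) ] rs) ] pts ≡⟨ Σ-cong pts (λ pt → trans (Σ-scale (Π[ g ∘ proj₁ ] pt) inv-square rs) (*-comm _ _)) ⟩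
      Σ[ (λ pt → Σ[ inv-square ] rs * Π[ g ∘ proj₁ ] pt) ] pts ≡⟨ Σ-scale (Σ[ inv-square ] rs) Π[ g ∘ proj₁ ] pts ⟩
      Σ[ inv-square ] rs * Σ[ Π[ g ∘ proj₁ ] ] pts ≤⟨ *-mono-≤ squares (≤-reflexive (trans (Σ-choices single (g ∘ proj₁) qs) (Π-cong qs))) ⟩
      fromℕ 2 * Π[ (λ q → 1# + g q) ] qs ∎
      where
      open ≤-Reasoning
      pts = choices single qs
      bound = 2 ℕ.^ n
      rs = 1 ∷ countdown bound
      Π-cong : ∀ qs → Π[ (λ q → 1# + Σ[ (λ t → g q) ] (single q)) ] qs ≡ Π[ (λ q → 1# + g q) ] qs
      Π-cong [] = refl
      Π-cong (q ∷ qs) = cong₂ (λ x y → (1# + x) * y) (+-identityʳ (g q)) (Π-cong qs)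
      squares : Σ[ inv-square ] rs ≤ fromℕ 2
      squares = begin
        inv (1 ℕ.* 1) + Σ[ inv-square ] (countdown bound) ≡⟨ cong (_+ Σ[ inv-square ] (countdown bound)) inv-1 ⟩
        1# + Σ[ inv-square ] (countdown bound) ≤⟨ 1+Σ≤Π (countdown bound) ⟩
        Π[ (λ q → 1# + inv-square q) ] (countdown bound) ≤⟨ Π-1+inv-square≤2 (countdown-unique bound) (countdown≥2 bound) ⟩
        fromℕ 2 ∎
        where
        countdown≤ : ∀ n {q} → q ∈ countdown n → q ℕ.≤ suc n
        countdown≤ (suc n) (here refl) = ℕ.≤-refl
        countdown≤ (suc n) (there m) = ℕ.m≤n⇒m≤1+n (countdown≤ n m)
        countdown-unique : ∀ n → Unique (countdown n)
        countdown-unique zero = []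
        countdown-unique (suc n) = All.tabulate (λ m e → ℕ.<⇒≱ (s≤s (countdown≤ n m)) (ℕ.≤-reflexive e)) ∷ countdown-unique n
        countdown≥2 : ∀ n {q} → q ∈ countdown n → 2 ℕ.≤ q
        countdown≥2 (suc n) (here refl) = s≤s (s≤s z≤n)
        countdown≥2 (suc n) (there m) = countdown≥2 n m
      rs≥1 : ∀ {r} → r ∈ rs → 1 ℕ.≤ r
      rs≥1 (here refl) = ℕ.≤-refl
      rs≥1 (there m) = go bound m
        where
        go : ∀ n {q} → q ∈ countdown n → 1 ℕ.≤ q
        go (suc n) (here refl) = s≤s z≤n
        go (suc n) (there m) = go n m
      choices≥1 : ∀ qs → All (λ q → 1 ℕ.≤ q) qs → ∀ {pt} → pt ∈ choices single qs → All (λ (q , t) → 1 ℕ.≤ q) pt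
      choices≥1 [] [] (here refl) = []
      choices≥1 (q ∷ qs) (p ∷ ps) m with ∈-++⁻ (choices single qs) m
      ... | inj₁ m′ = choices≥1 qs ps m′
      ... | inj₂ m′ with ∈-++⁻ (map ((q , 0) ∷_) (choices single qs)) m′
      ...   | inj₁ m″ with ∈-map⁻ ((q , 0) ∷_) m″
      ...     | pt , pt∈ , refl = p ∷ choices≥1 qs ps pt∈
      term : ∀ {pt r} → All (λ (q , t) → 1 ℕ.≤ q) pt → 1 ℕ.≤ r → g (mass pt ℕ.* (r ℕ.* r)) ≤ Π[ g ∘ proj₁ ] pt * inv-square r
      term {pt} {r} ok 1≤r = begin
        ρ ^ λ₂ (mass pt ℕ.* (r ℕ.* r)) * inv (mass pt ℕ.* (r ℕ.* r)) ≤⟨ *-mono-≤ (^-antitone ρ≤1 higher) (≤-reflexive (inv-* (mass pt) (r ℕ.* r))) ⟩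
        ρ ^ height ρ pt * (inv (mass pt) * inv-square r) ≡⟨ trans (sym (*-assoc _ _ _)) (cong (_* inv-square r) (sym (Π-weight ρ pt))) ⟩
        Π[ g ∘ proj₁ ] pt * inv-square r ∎
        where
        higher : height ρ pt ℕ.≤ λ₂ (mass pt ℕ.* (r ℕ.* r))
        higher = ^-cancelʳ-≤ 2 ℕ.≤-refl (ℕ.≤-<-trans (ℕ.≤-trans (2^height≤mass ok) (ℕ.≤-trans (ℕ.≤-reflexive (sym (ℕ.*-identityʳ _))) (ℕ.*-monoʳ-≤ (mass pt) (ℕ.*-mono-≤ 1≤r 1≤r)))) (<2^1+λ₂ _))
      ∈-concatMap : ∀ {A B : Set} {f : A → List B} {xs x y} → x ∈ xs → y ∈ f x → y ∈ concatMap f xs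
      ∈-concatMap {f = f} {x ∷ xs} (here refl) m = ∈-++⁺ˡ m
      ∈-concatMap {f = f} {x ∷ xs} (there x∈) m = ∈-++⁺ʳ (f x) (∈-concatMap x∈ m)
      cover : ∀ {m} → m ∈ dyadic n → m ∈ Data.List.concatMap (λ pt → map (λ r → mass pt ℕ.* (r ℕ.* r)) rs) pts
      cover {m} m∈ = covered (squarefree-part qs factors (All.tabulate λ {q} q∈ → complete (All.lookup factorsPrime q∈)
          (ℕ.≤-trans (factor≤ factors factorsPrime q∈) (ℕ.≤-trans (ℕ.≤-reflexive (sym isFactorisation)) (ℕ.<⇒≤ m<)))))
        where
        1≤m = proj₁ (∈-dyadic n m∈)
        m< = proj₂ (∈-dyadic n m∈)
        open PrimeFactorisation (factorise m {{ℕ.>-nonZero 1≤m}})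
        product≥1 : ∀ fs → All Prime fs → 1 ℕ.≤ foldr ℕ._*_ 1 fs
        product≥1 [] [] = ℕ.≤-refl
        product≥1 (f ∷ fs) (p ∷ ps) = ℕ.*-mono-≤ (prime≥1 p) (product≥1 fs ps)
        factor≤ : ∀ fs → All Prime fs → ∀ {q} → q ∈ fs → q ℕ.≤ foldr ℕ._*_ 1 fs
        factor≤ (f ∷ fs) (p ∷ ps) (here refl) = ℕ.≤-trans (ℕ.≤-reflexive (sym (ℕ.*-identityʳ f))) (ℕ.*-monoʳ-≤ f (product≥1 fs ps))
        factor≤ (f ∷ fs) (p ∷ ps) (there q∈) = ℕ.≤-trans (factor≤ fs ps q∈) (ℕ.≤-trans (ℕ.≤-reflexive (sym (ℕ.*-identityˡ _))) (ℕ.*-monoˡ-≤ _ (prime≥1 p)))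
        covered : (∃₂ λ pt r → pt ∈ pts × foldr ℕ._*_ 1 factors ≡ mass pt ℕ.* (r ℕ.* r)) → _
        covered (pt , r , pt∈ , e) = subst (_∈ _) (sym e′) (∈-concatMap pt∈ (∈-map⁺ (λ r → mass pt ℕ.* (r ℕ.* r)) r∈))
          where
          e′ : m ≡ mass pt ℕ.* (r ℕ.* r)
          e′ = trans isFactorisation e
          1≤r : 1 ℕ.≤ r
          1≤r = ℕ.n≢0⇒n>0 λ { refl → ℕ.<⇒≢ 1≤m (sym (trans e′ (ℕ.*-zeroʳ (mass pt)))) }
          r≤m : r ℕ.≤ m
          r≤m = ℕ.∣⇒≤ {{ℕ.>-nonZero 1≤m}} (ℕ.divides (mass pt ℕ.* r) (trans e′ (sym (ℕ.*-assoc (mass pt) r r))))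
          r∈ : r ∈ rs
          r∈ with r ℕ.≟ 1
          ... | yes refl = here refl
          ... | no r≢1 = there (∈-countdown bound (ℕ.≤∧≢⇒< 1≤r (r≢1 ∘ sym)) (ℕ.m≤n⇒m≤1+n (ℕ.≤-trans r≤m (ℕ.<⇒≤ m<))))

  ^-expansion : ∀ W → ∃ λ c → ∀ {z} → z ≤ 1# → (1# + z) ^ W ≤ 1# + fromℕ W * z + fromℕ c * (z * z)
  ^-expansion zero = 0 , λ {z} _ → ≤-trans (a≤a+b 1# (0# * z)) (a≤a+b _ _)
  ^-expansion (suc W) with ^-expansion W
  ... | c , h = W ℕ.+ 2 ℕ.* c , λ {z} z≤1 → begin
      (1# + z) * (1# + z) ^ W ≤⟨ *-mono-≤ ≤-refl (h z≤1) ⟩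
      (1# + z) * (1# + fromℕ W * z + fromℕ c * (z * z))
        ≡⟨ solve 3 (λ z w c → (con 1 :+ z) :* (con 1 :+ w :* z :+ c :* (z :* z)) := con 1 :+ (con 1 :+ w) :* z :+ (w :* (z :* z) :+ c :* (z :* z) :+ z :* (c :* (z :* z)))) refl z (fromℕ W) (fromℕ c) ⟩
      1# + (1# + fromℕ W) * z + (fromℕ W * (z * z) + fromℕ c * (z * z) + z * (fromℕ c * (z * z)))
        ≤⟨ +-mono-≤ ≤-refl (+-mono-≤ ≤-refl (*-mono-≤ z≤1 ≤-refl)) ⟩
      1# + (1# + fromℕ W) * z + (fromℕ W * (z * z) + fromℕ c * (z * z) + 1# * (fromℕ c * (z * z)))
        ≡⟨ cong (1# + (1# + fromℕ W) * z +_) (trans (solve 3 (λ w c x → w :* x :+ c :* x :+ con 1 :* (c :* x) := (w :+ (con 1 :+ (con 1 :+ con 0)) :* c) :* x) refl (fromℕ W) (fromℕ c) (z * z))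
             (cong (_* (z * z)) (sym (trans (fromℕ-+ W (2 ℕ.* c)) (cong (fromℕ W +_) (fromℕ-* 2 c)))))) ⟩
      1# + fromℕ (suc W) * z + fromℕ (W ℕ.+ 2 ℕ.* c) * (z * z) ∎
    where open ≤-Reasoning

  1+c*x≤ : ∀ c x → 1# + fromℕ c * x ≤ (1# + x) ^ c
  1+c*x≤ zero x = ≤-reflexive (trans (cong (1# +_) (*-zeroˡ x)) (+-identityʳ 1#))
  1+c*x≤ (suc c) x = begin
    1# + (1# + fromℕ c) * x ≤⟨ a≤a+b _ (x * (fromℕ c * x)) ⟩
    1# + (1# + fromℕ c) * x + x * (fromℕ c * x) ≡⟨ solve 2 (λ c x → con 1 :+ (con 1 :+ c) :* x :+ x :* (c :* x) := (con 1 :+ x) :* (con 1 :+ c :* x)) refl (fromℕ c) x ⟩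
    (1# + x) * (1# + fromℕ c * x) ≤⟨ *-mono-≤ ≤-refl (1+c*x≤ c x) ⟩
    (1# + x) * (1# + x) ^ c ∎
    where open ≤-Reasoning

  -- Comparison of Euler products: if each of W products ∏(1 + rᵢ(q) z_q) is at most of the order of ζ,
  -- and Σᵢ rᵢ(q) ≥ W, then Σᵢ rᵢ(q) > W can only happen on a set of primes with convergent reciprocal sum.
  module Comparison {I : Set} (is : List I) (r : I → ℕ → ℕ) (z₀ : ℕ) (C : I → ℕ)
    (upper : ∀ {i} → i ∈ is → ∀ N (1≤N : 1 ℕ.≤ N) qs → Unique qs → All (λ q → Prime q × z₀ ℕ.< q) qs →
       Π[ (λ q → 1# + fromℕ (r i q) * ζ-weight (Ratio.ρ N 1≤N) q) ] qs ≤ fromℕ (C i) * fromℕ N)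
    (P : ℕ → Set) (P? : ∀ q → Dec (P q))
    (pointwise : ∀ {q} → Prime q → z₀ ℕ.< q → fromℕ (length is) + indicator (P? q) ≤ Σ[ (λ i → fromℕ (r i q)) ] is)
    where

    W : ℕ
    W = length is

    -- Serves both exponents that occur in `factor`: W where P fails and W + 1 where it holds.
    c : ℕ
    c = proj₁ (^-expansion W) ℕ.+ proj₁ (^-expansion (suc W))

    -- C₀ compares N = 2 n with the Euler product over `qs`: n/4 ≤ 2 ∏ gives the factor 16, and
    -- 2^(z₀+1) pays for the primes up to z₀.
    ΠC C₀ C₁ : ℚ⁺
    ΠC = Π[ fromℕ ∘ C ] is
    C₀ = fromℕ 8 * (fromℕ 2 * fromℕ 2 ^ suc z₀)
    C₁ = ΠC * C₀ ^ W * fromℕ 2 ^ c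

    module _ {n : ℕ} (1≤n : 1 ℕ.≤ n) where
      open ZetaLowerBound 1≤n

      good? : ∀ q → Dec (Prime q × z₀ ℕ.< q)
      good? q = prime? q ×-dec (z₀ ℕ.<? q)

      bad? : ∀ q → Dec (Prime q × q ℕ.≤ z₀)
      bad? q = prime? q ×-dec (q ℕ.≤? z₀)

      qs : List ℕ
      qs = filter good? (upTo (suc (2 ℕ.^ n)))

      qs-good : ∀ {q} → q ∈ qs → Prime q × z₀ ℕ.< q
      qs-good m = proj₂ (∈-filter⁻ good? {xs = upTo (suc (2 ℕ.^ n))} m)

      qs-unique : Unique qs
      qs-unique = Unique.filter⁺ good? (Unique.upTo⁺ (suc (2 ℕ.^ n)))

      ε : ℕ → ℚ⁺
      ε q = indicator (P? q)

      g≤1 : ∀ q → g q ≤ 1#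
      g≤1 q = ≤-trans (*-mono-≤ (^-antitone {n = λ₂ q} ρ≤1 z≤n) (inv≤1 q)) (≤-reflexive (*-identityˡ 1#))

      g²≤ : ∀ q → g q * g q ≤ inv-square q
      g²≤ q = ≤-trans (*-mono-≤ g≤inv g≤inv) (≤-reflexive (sym (inv-* q q)))
        where
        g≤inv : g q ≤ inv q
        g≤inv = ≤-trans (*-mono-≤ (^-antitone {n = λ₂ q} ρ≤1 z≤n) ≤-refl) (≤-reflexive (*-identityˡ _))

      ζ : ℚ⁺
      ζ = Π[ (λ q → 1# + g q) ] qs

      upper-product : Π[ (λ q → 1# + (fromℕ W + ε q) * g q) ] qs ≤ ΠC * fromℕ (2 ℕ.* n) ^ W
      upper-product = begin
        Π[ (λ q → 1# + (fromℕ W + ε q) * g q) ] qs ≤⟨ Π-mono qs (λ {q} m → ≤-trans (+-mono-≤ ≤-refl (*-mono-≤ (let (pq , z<q) = qs-good m in pointwise pq z<q) ≤-refl))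
            (≤-trans (+-mono-≤ ≤-refl (≤-reflexive (trans (*-comm _ _) (trans (sym (Σ-scale (g q) _ is)) (Σ-cong is λ i → *-comm (g q) (fromℕ (r i q))))))) (1+Σ≤Π is))) ⟩
        Π[ (λ q → Π[ (λ i → 1# + fromℕ (r i q) * g q) ] is) ] qs ≡⟨ Π-swap _ qs is ⟩
        Π[ (λ i → Π[ (λ q → 1# + fromℕ (r i q) * g q) ] qs) ] is ≤⟨ Π-mono is (λ i∈ → upper i∈ (2 ℕ.* n) (ℕ.*-mono-≤ {1} {2} (s≤s z≤n) 1≤n) qs qs-unique (All.tabulate qs-good)) ⟩
        Π[ (λ i → fromℕ (C i) * fromℕ (2 ℕ.* n)) ] is ≡⟨ trans (Π-* _ _ is) (cong (ΠC *_) (constant is)) ⟩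
        ΠC * fromℕ (2 ℕ.* n) ^ W ∎
        where
        open ≤-Reasoning
        constant : ∀ (js : List I) → Π[ (λ _ → fromℕ (2 ℕ.* n)) ] js ≡ fromℕ (2 ℕ.* n) ^ length js
        constant [] = refl
        constant (_ ∷ js) = cong (fromℕ (2 ℕ.* n) *_) (constant js)

      N≤ζ : fromℕ (2 ℕ.* n) ≤ C₀ * ζ
      N≤ζ = begin
        fromℕ (2 ℕ.* n) ≡⟨ fromℕ-* 2 n ⟩
        fromℕ 2 * fromℕ n ≡⟨ cong (fromℕ 2 *_) (sym (trans (*-assoc (fromℕ n) (inv 4) (fromℕ 4)) (trans (cong (fromℕ n *_) (inv*fromℕ {4} (s≤s z≤n))) (*-identityʳ _)))) ⟩
        fromℕ 2 * (fromℕ n * inv 4 * fromℕ 4) ≤⟨ *-mono-≤ ≤-refl (*-mono-≤ (zeta-lower-bound (qs ++ bad) positive complete) ≤-refl) ⟩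
        fromℕ 2 * (fromℕ 2 * Π[ (λ q → 1# + g q) ] (qs ++ bad) * fromℕ 4)
          ≤⟨ *-mono-≤ ≤-refl (*-mono-≤ (*-mono-≤ ≤-refl (≤-trans (≤-reflexive (Π-++ (λ q → 1# + g q) qs bad)) (*-mono-≤ ≤-refl bad-bound))) ≤-refl) ⟩
        fromℕ 2 * (fromℕ 2 * (ζ * fromℕ 2 ^ suc z₀) * fromℕ 4)
          ≡⟨ solve 4 (λ t f z x → t :* (t :* (z :* x) :* f) := (t :* f) :* (t :* x) :* z) refl (fromℕ 2) (fromℕ 4) ζ (fromℕ 2 ^ suc z₀) ⟩
        fromℕ 2 * fromℕ 4 * (fromℕ 2 * fromℕ 2 ^ suc z₀) * ζ ≡⟨ cong (λ x → x * (fromℕ 2 * fromℕ 2 ^ suc z₀) * ζ) (sym (fromℕ-* 2 4)) ⟩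
        C₀ * ζ ∎
        where
        open ≤-Reasoning
        bad = filter bad? (upTo (suc z₀))
        positive : All (λ q → 1 ℕ.≤ q) (qs ++ bad)
        positive = All.tabulate λ m → prime≥1 (prime-in m)
          where
          prime-in : ∀ {q} → q ∈ qs ++ bad → Prime q
          prime-in m with ∈-++⁻ qs m
          ... | inj₁ p = proj₁ (qs-good p)
          ... | inj₂ p = proj₁ (proj₂ (∈-filter⁻ bad? {xs = upTo (suc z₀)} p))
        complete : ∀ {q} → Prime q → q ℕ.≤ 2 ℕ.^ n → q ∈ qs ++ bad
        complete {q} pq q≤ with q ℕ.≤? z₀
        ... | yes le = ∈-++⁺ʳ qs (∈-filter⁺ bad? (∈-upTo⁺ (s≤s le)) (pq , le))
        ... | no nle = ∈-++⁺ˡ (∈-filter⁺ good? (∈-upTo⁺ (s≤s q≤)) (pq , ℕ.≰⇒> nle))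
        two : ∀ (xs : List ℕ) → Π[ (λ q → 1# + g q) ] xs ≤ fromℕ 2 ^ length xs
        two [] = ≤-refl
        two (x ∷ xs) = *-mono-≤ (+-mono-≤ ≤-refl (≤-trans (g≤1 x) (≤-reflexive (sym fromℕ-1)))) (two xs)
        bad-bound : Π[ (λ q → 1# + g q) ] bad ≤ fromℕ 2 ^ suc z₀
        bad-bound = ≤-trans (Π-⊆ (λ q → a≤a+b 1# _) (Unique.filter⁺ bad? (Unique.upTo⁺ (suc z₀))) (λ m → proj₁ (∈-filter⁻ bad? {xs = upTo (suc z₀)} m)))
          (≤-trans (two (upTo (suc z₀))) (≤-reflexive (cong (fromℕ 2 ^_) (length-upTo (suc z₀)))))

      -- With z the weight of q, both sides are 1 + (W + ε) z to first order; the rest is O(z²),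
      -- hence O(1/q²), and the product of the corrections converges.
      factor : ∀ q → (1# + g q) ^ W * (1# + ε q * g q) ≤ (1# + (fromℕ W + ε q) * g q) * (1# + fromℕ c * inv-square q)
      factor q with P? q
      ... | yes _ = begin
        (1# + z) ^ W * (1# + 1# * z) ≡⟨ trans (*-comm _ _) (cong (λ x → (1# + x) * (1# + z) ^ W) (*-identityˡ z)) ⟩
        (1# + z) ^ suc W ≤⟨ proj₂ (^-expansion (suc W)) (g≤1 q) ⟩
        1# + fromℕ (suc W) * z + fromℕ (proj₁ (^-expansion (suc W))) * (z * z) ≤⟨ +-mono-≤ (+-mono-≤ ≤-refl (*-mono-≤ (≤-reflexive (+-comm 1# (fromℕ W))) ≤-refl)) (*-mono-≤ (fromℕ-mono (ℕ.m≤n+m _ (proj₁ (^-expansion W)))) (g²≤ q)) ⟩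
        1# + (fromℕ W + 1#) * z + fromℕ c * inv-square q ≤⟨ expand ((fromℕ W + 1#) * z) (fromℕ c * inv-square q) ⟩
        (1# + (fromℕ W + 1#) * z) * (1# + fromℕ c * inv-square q) ∎
        where
        open ≤-Reasoning
        z = g q
        expand : ∀ a b → 1# + a + b ≤ (1# + a) * (1# + b)
        expand a b = ≤-trans (a≤a+b _ (a * b)) (≤-reflexive (solve 2 (λ a b → con 1 :+ a :+ b :+ a :* b := (con 1 :+ a) :* (con 1 :+ b)) refl a b))
      ... | no _ = begin
        (1# + z) ^ W * (1# + 0# * z) ≡⟨ trans (cong (λ x → (1# + z) ^ W * (1# + x)) (*-zeroˡ z)) (trans (cong ((1# + z) ^ W *_) (+-identityʳ 1#)) (*-identityʳ _)) ⟩
        (1# + z) ^ W ≤⟨ proj₂ (^-expansion W) (g≤1 q) ⟩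
        1# + fromℕ W * z + fromℕ (proj₁ (^-expansion W)) * (z * z) ≤⟨ +-mono-≤ (+-mono-≤ ≤-refl (*-mono-≤ (≤-reflexive (sym (+-identityʳ (fromℕ W)))) ≤-refl)) (*-mono-≤ (fromℕ-mono (ℕ.m≤m+n (proj₁ (^-expansion W)) (proj₁ (^-expansion (suc W))))) (g²≤ q)) ⟩
        1# + (fromℕ W + 0#) * z + fromℕ c * inv-square q ≤⟨ expand ((fromℕ W + 0#) * z) (fromℕ c * inv-square q) ⟩
        (1# + (fromℕ W + 0#) * z) * (1# + fromℕ c * inv-square q) ∎
        where
        open ≤-Reasoning
        z = g q
        expand : ∀ a b → 1# + a + b ≤ (1# + a) * (1# + b)
        expand a b = ≤-trans (a≤a+b _ (a * b)) (≤-reflexive (solve 2 (λ a b → con 1 :+ a :+ b :+ a :* b := (con 1 :+ a) :* (con 1 :+ b)) refl a b))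

      -- ζ^W times the excess is, up to constants, at most the product of the W given Euler
      -- products, hence at most N^W, hence at most ζ^W. Cancelling ζ^W leaves a bound that does not
      -- depend on n.
      excess-bound : Π[ (λ q → 1# + ε q * g q) ] qs ≤ C₁
      excess-bound = *-cancelʳ-≤ (ζ ^ W) (^-≥1 W (Π-≥1 qs λ q → a≤a+b 1# (g q))) (begin
        Π[ (λ q → 1# + ε q * g q) ] qs * ζ ^ W ≡⟨ trans (*-comm _ _) (trans (cong (_* Π[ (λ q → 1# + ε q * g q) ] qs) (sym (Π-^ (λ q → 1# + g q) W qs))) (sym (Π-* _ _ qs))) ⟩
        Π[ (λ q → (1# + g q) ^ W * (1# + ε q * g q)) ] qs ≤⟨ Π-mono qs (λ {q} _ → factor q) ⟩
        Π[ (λ q → (1# + (fromℕ W + ε q) * g q) * (1# + fromℕ c * inv-square q)) ] qs ≡⟨ Π-* _ _ qs ⟩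
        Π[ (λ q → 1# + (fromℕ W + ε q) * g q) ] qs * Π[ (λ q → 1# + fromℕ c * inv-square q) ] qs
          ≤⟨ *-mono-≤ (≤-trans upper-product (*-mono-≤ ≤-refl (^-mono W N≤ζ))) (≤-trans (Π-mono qs (λ {q} _ → 1+c*x≤ c (inv-square q)))
               (≤-trans (≤-reflexive (Π-^ (λ q → 1# + inv-square q) c qs)) (^-mono c (Π-1+inv-square≤2 qs-unique (λ m → prime≥2 (proj₁ (qs-good m))))))) ⟩
        ΠC * (C₀ * ζ) ^ W * fromℕ 2 ^ c ≡⟨ cong (λ x → ΠC * x * fromℕ 2 ^ c) (*-^ C₀ ζ W) ⟩
        ΠC * (C₀ ^ W * ζ ^ W) * fromℕ 2 ^ c ≡⟨ solve 4 (λ a b z d → a :* (b :* z) :* d := a :* b :* d :* z) refl ΠC (C₀ ^ W) (ζ ^ W) (fromℕ 2 ^ c) ⟩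
        C₁ * ζ ^ W ∎)
        where open ≤-Reasoning

    -- The passage to the limit s = 1: n exceeds every q of the given list, so ρ^(λ₂ q) ≥ 1/2 and
    -- 1/q is at most twice the weight of q.
    bounded-reciprocals : ∀ qs → Unique qs → All (λ q → (Prime q × z₀ ℕ.< q) × P q) qs → Σ[ inv ] qs ≤ fromℕ 2 * C₁
    bounded-reciprocals rs u ok = begin
      Σ[ inv ] rs ≡⟨ sym (*-identityˡ _) ⟩
      1# * Σ[ inv ] rs ≡⟨ cong (_* Σ[ inv ] rs) (sym (fromℕ*inv {2} (s≤s z≤n))) ⟩
      fromℕ 2 * inv 2 * Σ[ inv ] rs ≡⟨ trans (*-assoc _ _ _) (cong (fromℕ 2 *_) (sym (Σ-scale (inv 2) inv rs))) ⟩
      fromℕ 2 * Σ[ (λ q → inv 2 * inv q) ] rs ≤⟨ *-mono-≤ ≤-refl (Σ-mono rs λ {q} m → *-mono-≤ (half≤ρ^ 1≤n (ℕ.≤-trans (λ₂≤ (prime≥1 (proj₁ (proj₁ (All.lookup ok m))))) (q≤n m))) ≤-refl) ⟩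
      fromℕ 2 * Σ[ g ] rs ≤⟨ *-mono-≤ ≤-refl (≤-trans (Σ-mono rs λ {q} m → ≤-reflexive (sym (trans (cong (_* g q) (indicator-true (P? q) (proj₂ (All.lookup ok m)))) (*-identityˡ _))))
          (Σ-⊆ {f = λ q → ε 1≤n q * g q} u λ {q} m → ∈-filter⁺ (good? 1≤n) (∈-upTo⁺ (s≤s (ℕ.≤-trans (q≤n m) (n≤2^n n)))) (proj₁ (All.lookup ok m)))) ⟩
      fromℕ 2 * Σ[ (λ q → ε 1≤n q * g q) ] (qs 1≤n) ≤⟨ *-mono-≤ ≤-refl (≤-trans (b≤a+b 1# _) (≤-trans (1+Σ≤Π (qs 1≤n)) (excess-bound 1≤n))) ⟩
      fromℕ 2 * C₁ ∎
      where
      open ≤-Reasoning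
      n = suc (proj₁ (list-bound id rs))
      1≤n : 1 ℕ.≤ n
      1≤n = s≤s z≤n
      q≤n : ∀ {q} → q ∈ rs → q ℕ.≤ n
      q≤n m = ℕ.m≤n⇒m≤1+n (proj₂ (list-bound id rs) m)
      n≤2^n : ∀ k → k ℕ.≤ 2 ℕ.^ k
      n≤2^n zero = z≤n
      n≤2^n (suc k) = ℕ.≤-trans (ℕ.+-mono-≤ (ℕ.m^n>0 2 k) (n≤2^n k)) (ℕ.≤-reflexive (cong (2 ℕ.^ k ℕ.+_) (sym (ℕ.+-identityʳ _))))
      open ZetaLowerBound 1≤n

-- Roots of polynomials and p-th power residues modulo q

module Roots where

  open import Defs using (eval)
  open Counting
  open Congruences
  open import Data.Nat.Coprimality using (Coprime; coprime-Bézout; prime⇒coprime)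
  open import Data.Nat.GCD using (module Bézout)
  open import Data.Integer using (+_; _+_; _*_; _-_; -_; _^_)
  open import Data.Integer.Tactic.RingSolver using (solve-∀)
  open import Data.List using (_++_; map; replicate; cartesianProduct)
  open import Data.List.Properties using (length-map; length-upTo; length-++)
  open import Data.List.Relation.Unary.Any using (any?)
  open import Data.List.Relation.Unary.All as All using (All; []; _∷_)
  open import Data.List.Relation.Unary.AllPairs using ([]; _∷_)
  open import Relation.Nullary.Decidable using (map′)
  open import Relation.Binary.Definitions using (tri<; tri≈; tri>)
  open import Relation.Binary.PropositionalEquality

  *-^ : ∀ x y n → (x * y) ^ n ≡ x ^ n * y ^ n
  *-^ x y zero = refl
  *-^ x y (suc n) = trans (cong (x * y *_) (*-^ x y n)) (lem x y (x ^ n) (y ^ n))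
    where
    lem : ∀ a b c d → a * b * (c * d) ≡ a * c * (b * d)
    lem = solve-∀

  -- Synthetic division: (f - f(r)) / (X - r).
  quotient : ℤ → List ℤ → List ℤ
  quotient r [] = []
  quotient r (a ∷ []) = []
  quotient r (a ∷ f@(_ ∷ _)) = eval f r ∷ quotient r f

  eval-quotient : ∀ r f x → eval f x - eval f r ≡ (x - r) * eval (quotient r f) x
  eval-quotient r [] x = sym (ℤ.*-zeroʳ (x - r))
  eval-quotient r (a ∷ []) x = lem a x r
    where
    lem : ∀ a x r → (a + x * 0ℤ) - (a + r * 0ℤ) ≡ (x - r) * 0ℤ
    lem = solve-∀
  eval-quotient r (a ∷ f@(_ ∷ _)) x = trans (lem a x r (eval f x) (eval f r)) (trans (cong (λ z → (x - r) * eval f r + x * z) (eval-quotient r f x))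
      (lem₂ (x - r) (eval f r) x (eval (quotient r f) x)))
    where
    lem : ∀ a x r u v → (a + x * u) - (a + r * v) ≡ (x - r) * v + x * (u - v)
    lem = solve-∀
    lem₂ : ∀ d v x y → d * v + x * (d * y) ≡ d * (v + x * y)
    lem₂ = solve-∀

  data Degree (q : ℕ) : List ℤ → ℕ → Set where
    leading : ∀ {a} → ¬ (q ∣ᶻ a) → Degree q (a ∷ []) 0
    lower : ∀ {a f n} → Degree q f n → Degree q (a ∷ f) (suc n)

  degree-quotient : ∀ {q} r {f n} → Degree q f (suc n) → Degree q (quotient r f) n
  degree-quotient {q} r (lower (leading {a} na)) = leading λ h → na (∣ᶻ-≡ (trans (cong (λ z → a + z) (ℤ.*-zeroʳ r)) (ℤ.+-identityʳ a)) h)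
  degree-quotient r (lower (lower d)) = lower (degree-quotient r (lower d))

  lagrange : ∀ {q} → Prime q → ∀ {n f} → Degree q f n → ∀ {xs} → Unique xs → All (λ x → x ℕ.< q × q ∣ᶻ eval f (+ x)) xs → length xs ℕ.≤ n
  lagrange pq d [] [] = z≤n
  lagrange pq {f = a ∷ []} (leading na) {x ∷ xs} _ ((_ , h) ∷ _) = contradiction (∣ᶻ-≡ (trans (cong (λ z → a + z) (ℤ.*-zeroʳ (+ x))) (ℤ.+-identityʳ a)) h) na
  lagrange {q} pq {suc n} {f} d@(lower _) {r ∷ xs} (r∉ ∷ u) ((r< , hr) ∷ hs) =
    s≤s (lagrange pq (degree-quotient (+ r) d) u (All.tabulate λ {x} x∈ → let (x< , hx) = All.lookup hs x∈ in
      x< , euclidˡ {a = + x - + r} pq (λ h → All.lookup r∉ x∈ (sym (∣ᶻ-difference⇒≡ x< r< h))) (∣ᶻ-≡ (eval-quotient (+ r) f (+ x)) (∣ᶻ-- hx hr))))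

  monomial : ℕ → ℤ → List ℤ
  monomial k u = replicate k 0ℤ ++ (u ∷ [])

  eval-monomial : ∀ k u x → eval (monomial k u) x ≡ u * x ^ k
  eval-monomial zero u x = lem u x
    where
    lem : ∀ u x → u + x * 0ℤ ≡ u * 1ℤ
    lem = solve-∀
  eval-monomial (suc k) u x = trans (cong (λ z → 0ℤ + x * z) (eval-monomial k u x)) (lem x u (x ^ k))
    where
    lem : ∀ x u y → 0ℤ + x * (u * y) ≡ u * (x * y)
    lem = solve-∀

  degree-monomial : ∀ {q} k u → ¬ (q ∣ᶻ u) → Degree q (monomial k u) k
  degree-monomial zero u n = leading n
  degree-monomial (suc k) u n = lower (degree-monomial k u n)

  ∃-mod? : ∀ {q} → 1 ℕ.≤ q → (f : ℤ → ℤ) → (∀ a b → q ∣ᶻ a - b → q ∣ᶻ f a - f b) → Dec (∃ λ x → q ∣ᶻ f x)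
  ∃-mod? {q} 1≤q f f-cong = map′ (λ a → let (x , h) = Any.satisfied a in + x , h)
    (λ (x , h) → Any.map (λ { refl → ∣ᶻ-cong (f (+ residue q x)) (f x) (∣ᶻ-sym (f x) (f (+ residue q x)) (f-cong x (+ residue q x) (residue-≡ 1≤q x))) h }) (∈-upTo⁺ (residue-< 1≤q x)))
    (any? (λ x → q ∣ᶻ? f (+ x)) (upTo q))

  roots : ℕ → ℕ → ℤ → List ℕ
  roots p q b = filter (λ t → q ∣ᶻ? (+ t) ^ p - b) (upTo q)

  module PowerResidues (p : ℕ) (pp : Prime p) {q : ℕ} (pq : Prime q) where

    private
      1≤q = prime≥1 pq

    Power : ℤ → Set
    Power a = ∃ λ y → q ∣ᶻ y ^ p - a

    abstract
      power? : ∀ a → Dec (Power a)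
      power? a = ∃-mod? 1≤q (λ y → y ^ p - a) λ x y h → ∣ᶻ-≡ (lem (x ^ p) (y ^ p) a) (∣ᶻ-cong-^ x y p h)
        where
        lem : ∀ x y a → x - y ≡ (x - a) - (y - a)
        lem = solve-∀

    power-^ : ∀ a → Power (a ^ p)
    power-^ a = a , ∣ᶻ-self- (a ^ p)

    power-≡ : ∀ {a b} → a ≡ b → Power a → Power b
    power-≡ refl h = h

    power-* : ∀ {a b} → Power a → Power b → Power (a * b)
    power-* {a} {b} (x , h) (y , k) = x * y , ∣ᶻ-≡ (cong (_- a * b) (sym (*-^ x y p))) (∣ᶻ-cong-* (x ^ p) a (y ^ p) b h k)

    power-1 : Power 1ℤ
    power-1 = power-≡ (ℤ.^-zeroˡ p) (power-^ 1ℤ)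

    power-^ⁿ : ∀ {a} n → Power a → Power (a ^ n)
    power-^ⁿ zero h = power-1
    power-^ⁿ (suc n) h = power-* h (power-^ⁿ n h)

    unit-inverse : ∀ {a} → ¬ (q ∣ᶻ a) → ∃ λ b → q ∣ᶻ a * b - 1ℤ × ¬ (q ∣ᶻ b)
    unit-inverse {a} na with inverse-mod pq na
    ... | b , h = b , h , λ q∣b → ∤1 pq (∣ᶻ-≡ (lem (a * b)) (∣ᶻ-- (∣ᶻ-*ˡ a q∣b) h))
      where
      lem : ∀ x → x - (x - 1ℤ) ≡ 1ℤ
      lem = solve-∀

    power-unit : ∀ {a y} → ¬ (q ∣ᶻ a) → q ∣ᶻ y ^ p - a → ¬ (q ∣ᶻ y)
    power-unit {a} {y} na h q∣y = na (∣ᶻ-≡ (lem (y ^ p) a) (∣ᶻ-- (y^p∣ p (prime≥1 pp)) h))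
      where
      lem : ∀ x a → x - (x - a) ≡ a
      lem = solve-∀
      y^p∣ : ∀ n → 1 ℕ.≤ n → q ∣ᶻ y ^ n
      y^p∣ (suc n) _ = ∣ᶻ-*ʳ (y ^ n) q∣y

    power-cancel : ∀ {a b} → ¬ (q ∣ᶻ b) → Power b → Power (a * b) → Power a
    power-cancel {a} {b} nb (y , hy) (x , hx) = x * v , ∣ᶻ-≡ (cong (_- a) (sym (*-^ x v p))) (∣ᶻ-≡ (lem (x ^ p) (v ^ p) a b (y ^ p)) (∣ᶻ-+ step₁ step₂))
      where
      v = proj₁ (unit-inverse (power-unit nb hy))
      hv : q ∣ᶻ (y * v) ^ p - 1ℤ
      hv = ∣ᶻ-≡ (cong (λ w → (y * v) ^ p - w) (ℤ.^-zeroˡ p)) (∣ᶻ-cong-^ (y * v) 1ℤ p (proj₁ (proj₂ (unit-inverse (power-unit nb hy)))))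
      step₁ : q ∣ᶻ (x ^ p - a * b) * v ^ p + (- (a * v ^ p)) * (y ^ p - b)
      step₁ = ∣ᶻ-+ (∣ᶻ-*ʳ (v ^ p) hx) (∣ᶻ-*ˡ (- (a * v ^ p)) hy)
      step₂ : q ∣ᶻ a * (y ^ p * v ^ p - 1ℤ)
      step₂ = ∣ᶻ-*ˡ a (∣ᶻ-≡ (cong (_- 1ℤ) (*-^ y v p)) hv)
      lem : ∀ X V a b Y → ((X - a * b) * V + (- (a * V)) * (Y - b)) + a * (Y * V - 1ℤ) ≡ X * V - a
      lem = solve-∀

    power-root : ∀ {a} k → ¬ (q ∣ᶻ a) → Coprime k p → Power (a ^ k) → Power a
    power-root {a} k na cop h with coprime-Bézout cop
    ... | Bézout.+- x y eq = power-cancel (∤-^ pq y (∤-^ pq p na)) (power-^ⁿ y (power-^ a)) (power-≡ (trans (ℤ.^-*-assoc a k x)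
          (trans (cong (a ^_) (trans (ℕ.*-comm k x) (trans (sym eq) (cong (1 ℕ.+_) (ℕ.*-comm y p))))) (cong (a *_) (sym (ℤ.^-*-assoc a p y))))) (power-^ⁿ x h))
    ... | Bézout.-+ x y eq = power-cancel (∤-^ pq x (∤-^ pq k na)) (power-^ⁿ x h) (power-≡ (trans (ℤ.^-*-assoc a p y)
          (trans (cong (a ^_) (trans (ℕ.*-comm p y) (trans (sym eq) (cong (1 ℕ.+_) (ℕ.*-comm x k))))) (cong (a *_) (sym (ℤ.^-*-assoc a k x))))) (power-^ⁿ y (power-^ a)))

    units : List ℕ
    units = map suc (upTo (ℕ.pred q))

    units-unique : Unique units
    units-unique = Unique.map⁺ ℕ.suc-injective (Unique.upTo⁺ (ℕ.pred q))

    length-units : length units ≡ ℕ.pred q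
    length-units = trans (length-map suc (upTo (ℕ.pred q))) (length-upTo (ℕ.pred q))

    suc-pred-q : suc (ℕ.pred q) ≡ q
    suc-pred-q = ℕ.suc-pred q {{ℕ.>-nonZero 1≤q}}

    ∈-units⁻ : ∀ {x} → x ∈ units → 1 ℕ.≤ x × x ℕ.< q
    ∈-units⁻ m with ∈-map⁻ suc m
    ... | i , i∈ , refl = s≤s z≤n , subst (suc (suc i) ℕ.≤_) suc-pred-q (s≤s (∈-upTo⁻ i∈))

    ∈-units⁺ : ∀ {x} → 1 ℕ.≤ x → x ℕ.< q → x ∈ units
    ∈-units⁺ {suc x} _ x<q = ∈-map⁺ suc (∈-upTo⁺ (ℕ.≤-pred (subst (suc (suc x) ℕ.≤_) (sym suc-pred-q) x<q)))

    units-∤ : ∀ {x} → x ∈ units → ¬ (q ∣ᶻ + x)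
    units-∤ m = let (a , b) = ∈-units⁻ m in ∤-small a b

    residue-unit : ∀ {a} → ¬ (q ∣ᶻ a) → residue q a ∈ units
    residue-unit {a} na = ∈-units⁺ (ℕ.n≢0⇒n>0 λ e → na (∣ᶻ-cong a (+ residue q a) (residue-≡ 1≤q a) (subst (λ r → q ∣ᶻ + r) (sym e) ∣ᶻ-0))) (residue-< 1≤q a)

    -- The p-th powers have index at most p in the group of units modulo q.
    power-index : ∀ (is : List ℕ) → Unique is → (u : ℕ → ℤ) → (∀ {i} → i ∈ is → ¬ (q ∣ᶻ u i)) → p ℕ.< length is →
      ¬ (∀ {i j} → i ∈ is → j ∈ is → i ≢ j → ∀ x y → ¬ (q ∣ᶻ x) → ¬ (q ∣ᶻ y) → ¬ (q ∣ᶻ u i * x ^ p - u j * y ^ p))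
    power-index is uis u nu many separate = ℕ.<⇒≱ many (ℕ.*-cancelʳ-≤ (length is) p (ℕ.pred q) {{ℕ.>-nonZero (ℕ.≤-pred (subst (2 ℕ.≤_) (sym suc-pred-q) (prime≥2 pq)))}} (begin
        length is ℕ.* ℕ.pred q ≡⟨ cong (length is ℕ.*_) (sym length-units) ⟩
        length is ℕ.* length units ≡⟨ sym (length-cartesian is units) ⟩
        -- The pair (i, x) is labelled by u i * x^p. By `separate` a fibre has a single i, and by
        -- Lagrange's theorem it has at most p values of x.
        length pairs ≤⟨ pigeonhole-fibres ℕ._≟_ label p pairs units (λ {x} m → let (a , b) = ∈-cartesianProduct⁻ is units m in residue-unit (∤-* pq (nu a) (∤-^ pq p (units-∤ b)))) fibre ⟩
        p ℕ.* length units ≡⟨ cong (p ℕ.*_) length-units ⟩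
        p ℕ.* ℕ.pred q ∎))
      where
      open ℕ.≤-Reasoning
      pairs : List (ℕ × ℕ)
      pairs = cartesianProduct is units
      length-cartesian : ∀ (xs ys : List ℕ) → length (cartesianProduct xs ys) ≡ length xs ℕ.* length ys
      length-cartesian [] ys = refl
      length-cartesian (x ∷ xs) ys = trans (length-++ (map (x ,_) ys)) (cong₂ ℕ._+_ (length-map (x ,_) ys) (length-cartesian xs ys))
      label : ℕ × ℕ → ℕ
      label (i , x) = residue q (u i * (+ x) ^ p)
      fibre : ∀ y → length (filter (λ x → label x ℕ.≟ y) pairs) ℕ.≤ p
      fibre y = bound (filter (λ x → label x ℕ.≟ y) pairs) (Unique.filter⁺ (λ x → label x ℕ.≟ y) (Unique.cartesianProduct⁺ uis units-unique))
        (All.tabulate λ m → let (m′ , e) = ∈-filter⁻ (λ x → label x ℕ.≟ y) {xs = pairs} m ; (a , b) = ∈-cartesianProduct⁻ is units m′ in a , b , e)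
        where
        bound : ∀ F → Unique F → All (λ x → proj₁ x ∈ is × proj₂ x ∈ units × label x ≡ y) F → length F ℕ.≤ p
        bound [] _ _ = z≤n
        bound F@((i , x) ∷ _) uF ok@((i∈ , x∈ , e) ∷ _) = subst (ℕ._≤ p) (length-map proj₂ F)
          (subst (length (map proj₂ F) ℕ.≤_) (ℕ.suc-pred p {{ℕ.>-nonZero (prime≥1 pp)}})
            (lagrange pq {f = - (+ y) ∷ monomial (ℕ.pred p) (u i)} (lower (degree-monomial (ℕ.pred p) (u i) (nu i∈)))
              (unique-map proj₂ uF (λ {a} {b} a∈ b∈ eq → cong₂ _,_ (trans (same a∈) (sym (same b∈))) eq))
              (All.tabulate root)))
          where
          same : ∀ {a} → a ∈ F → proj₁ a ≡ i
          same {j , z} a∈ = let (j∈ , z∈ , e′) = All.lookup ok a∈ in decidable-stable (j ℕ.≟ i) λ j≢i →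
            separate j∈ i∈ j≢i (+ z) (+ x) (units-∤ z∈) (units-∤ x∈) (residue-injective (u j * (+ z) ^ p) (u i * (+ x) ^ p) 1≤q (trans e′ (sym e)))
          root : ∀ {z} → z ∈ map proj₂ F → z ℕ.< q × q ∣ᶻ eval (- (+ y) ∷ monomial (ℕ.pred p) (u i)) (+ z)
          root m with ∈-map⁻ proj₂ m
          ... | (j , z) , a∈ , refl with same a∈ | All.lookup ok a∈
          ...   | refl | (_ , z∈ , e′) = proj₂ (∈-units⁻ z∈) , ∣ᶻ-≡ (trans (lem (u i) (+ z) ((+ z) ^ ℕ.pred p) (+ y))
                (cong (λ w → - (+ y) + + z * w) (sym (eval-monomial (ℕ.pred p) (u i) (+ z)))))
                (∣ᶻ-≡ (cong (λ k → u i * (+ z) ^ k - + y) (sym (ℕ.suc-pred p {{ℕ.>-nonZero (prime≥1 pp)}}))) (subst (λ r → q ∣ᶻ u i * (+ z) ^ p - + r) e′ (residue-≡ 1≤q (u i * (+ z) ^ p))))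
            where
            lem : ∀ u z w y → u * (z * w) - y ≡ - y + z * (u * w)
            lem = solve-∀

    RootOfUnity : Set
    RootOfUnity = ∃ λ z → q ∣ᶻ z ^ p - 1ℤ × ¬ (q ∣ᶻ z - 1ℤ)

    root-∈ : ∀ {b} y → q ∣ᶻ y ^ p - b → residue q y ∈ roots p q b
    root-∈ {b} y h = ∈-filter⁺ (λ t → q ∣ᶻ? (+ t) ^ p - b) (∈-upTo⁺ (residue-< 1≤q y))
      (∣ᶻ-trans ((+ residue q y) ^ p) (y ^ p) b (∣ᶻ-cong-^ (+ residue q y) y p (∣ᶻ-sym y (+ residue q y) (residue-≡ 1≤q y))) h)

    power⇒root : ∀ {b} → Power b → 1 ℕ.≤ length (roots p q b)
    power⇒root {b} (y , h) with roots p q b | root-∈ {b} y h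
    ... | _ ∷ _ | _ = s≤s z≤n

    -- z has order exactly p: a coincidence gives z^k = 1 with 0 < k < p, and Bézout for p and k
    -- then gives z = 1.
    z^-injective : ∀ {z} → q ∣ᶻ z ^ p - 1ℤ → ¬ (q ∣ᶻ z - 1ℤ) → ∀ {i j} → i ℕ.< j → j ℕ.< p → ¬ (q ∣ᶻ z ^ i - z ^ j)
    z^-injective {z} zp z≢1 {i} {j} i<j j<p h = z≢1 (collapse (coprime-Bézout cop))
      where
      k = j ℕ.∸ i
      instance
        k≢0 : ℕ.NonZero k
        k≢0 = ℕ.>-nonZero (ℕ.m<n⇒0<n∸m i<j)
      cop : Coprime p k
      cop = prime⇒coprime pp (ℕ.≤-<-trans (ℕ.m∸n≤m j i) j<p)
      nz : ¬ (q ∣ᶻ z)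
      nz = power-unit (∤1 pq) zp
      zk : q ∣ᶻ z ^ k - 1ℤ
      zk = euclidˡ {a = z ^ i} pq (∤-^ pq i nz) (∣ᶻ-≡ (trans (cong (λ n → z ^ n - z ^ i) (sym (ℕ.m+[n∸m]≡n (ℕ.<⇒≤ i<j)))) (trans (cong (_- z ^ i) (ℤ.^-distribˡ-+-* z i k)) (lem (z ^ i) (z ^ k))))
        (∣ᶻ-sym (z ^ i) (z ^ j) h))
        where
        lem : ∀ a b → a * b - a ≡ a * (b - 1ℤ)
        lem = solve-∀
      multiple : ∀ m n → q ∣ᶻ z ^ m - 1ℤ → q ∣ᶻ z ^ (n ℕ.* m) - 1ℤ
      multiple m n hm = ∣ᶻ-≡ (cong₂ _-_ (trans (ℤ.^-*-assoc z m n) (cong (z ^_) (ℕ.*-comm m n))) (ℤ.^-zeroˡ n)) (∣ᶻ-cong-^ (z ^ m) 1ℤ n hm)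
      ratio : ∀ m n → suc m ≡ n → q ∣ᶻ z ^ m - 1ℤ → q ∣ᶻ z ^ n - 1ℤ → q ∣ᶻ z - 1ℤ
      ratio m n refl hm hn = ∣ᶻ-≡ (lem z (z ^ m)) (∣ᶻ-- hn (∣ᶻ-*ˡ z hm))
        where
        lem : ∀ z x → (z * x - 1ℤ) - z * (x - 1ℤ) ≡ z - 1ℤ
        lem = solve-∀
      collapse : Bézout.Identity 1 p k → q ∣ᶻ z - 1ℤ
      collapse (Bézout.+- x y eq) = ratio (y ℕ.* k) (x ℕ.* p) eq (multiple k y zk) (multiple p x zp)
      collapse (Bézout.-+ x y eq) = ratio (x ℕ.* p) (y ℕ.* k) eq (multiple p x zp) (multiple k y zk)

    power⇒p-roots : RootOfUnity → ∀ {b} → ¬ (q ∣ᶻ b) → Power b → p ℕ.≤ length (roots p q b)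
    power⇒p-roots (z , zp , z≢1) {b} nb (y , h) = subst (ℕ._≤ length (roots p q b)) (length-upTo p)
      (injection⇒length≤ (λ k → residue q (y * z ^ k)) (Unique.upTo⁺ p) inj (λ {k} _ → root-∈ (y * z ^ k) (root k)))
      where
      root : ∀ k → q ∣ᶻ (y * z ^ k) ^ p - b
      root k = ∣ᶻ-≡ (trans (lem (y ^ p) ((z ^ k) ^ p) b) (cong (_- b) (sym (*-^ y (z ^ k) p))))
        (∣ᶻ-+ (∣ᶻ-*ˡ (y ^ p) (∣ᶻ-≡ (cong₂ _-_ (trans (ℤ.^-*-assoc z p k) (trans (cong (z ^_) (ℕ.*-comm p k)) (sym (ℤ.^-*-assoc z k p)))) (ℤ.^-zeroˡ k)) (∣ᶻ-cong-^ (z ^ p) 1ℤ k zp))) h)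
        where
        lem : ∀ a c b → a * (c - 1ℤ) + (a - b) ≡ a * c - b
        lem = solve-∀
      cancel-y : ∀ i j → residue q (y * z ^ i) ≡ residue q (y * z ^ j) → q ∣ᶻ z ^ i - z ^ j
      cancel-y i j e = euclidˡ {a = y} pq (power-unit nb h) (∣ᶻ-≡ (lem y (z ^ i) (z ^ j)) (residue-injective (y * z ^ i) (y * z ^ j) 1≤q e))
        where
        lem : ∀ y a b → y * a - y * b ≡ y * (a - b)
        lem = solve-∀
      inj : ∀ {i j} → i ∈ upTo p → j ∈ upTo p → residue q (y * z ^ i) ≡ residue q (y * z ^ j) → i ≡ j
      inj {i} {j} i∈ j∈ e with ℕ.<-cmp i j
      ... | tri≈ _ eq _ = eq
      ... | tri< lt _ _ = contradiction (cancel-y i j e) (z^-injective zp z≢1 lt (∈-upTo⁻ j∈))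
      ... | tri> _ _ gt = contradiction (cancel-y j i (sym e)) (z^-injective zp z≢1 gt (∈-upTo⁻ i∈))

    -- Without nontrivial p-th roots of unity x ↦ x^p is injective on the q - 1 units, so a value b
    -- missed by it would be one unit too many.
    all-powers : ¬ RootOfUnity → ∀ {b} → ¬ (q ∣ᶻ b) → Power b
    all-powers none {b} nb = decidable-stable (power? b) λ np → ℕ.<-irrefl refl (ℕ.≤-trans
        (s≤s (ℕ.≤-reflexive (sym (length-map label units))))
        (unique⊆⇒length≤ {xs = residue q b ∷ map label units} (All.tabulate (fresh np) ∷ unique-map label units-unique inj)
          λ { (here refl) → residue-unit nb ; (there m) → label-∈ m }))
      where
      label : ℕ → ℕ
      label x = residue q ((+ x) ^ p)
      label-∈ : ∀ {y} → y ∈ map label units → y ∈ units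
      label-∈ m with ∈-map⁻ label m
      ... | x , x∈ , refl = residue-unit (∤-^ pq p (units-∤ x∈))
      fresh : ¬ Power b → ∀ {y} → y ∈ map label units → residue q b ≢ y
      fresh np m e with ∈-map⁻ label m
      ... | x , x∈ , refl = np (+ x , residue-injective ((+ x) ^ p) b 1≤q (sym e))
      inj : ∀ {x y} → x ∈ units → y ∈ units → label x ≡ label y → x ≡ y
      inj {x} {y} x∈ y∈ e = ∣ᶻ-difference⇒≡ (proj₂ (∈-units⁻ x∈)) (proj₂ (∈-units⁻ y∈)) (ratio (unit-inverse (units-∤ y∈)))
        where
        ratio : (∃ λ v → q ∣ᶻ + y * v - 1ℤ × ¬ (q ∣ᶻ v)) → q ∣ᶻ + x - + y
        ratio (v , hv , nv) = decidable-stable (q ∣ᶻ? + x - + y) λ x≢y → none (+ x * v ,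
            ∣ᶻ-trans ((+ x * v) ^ p) ((+ y * v) ^ p) 1ℤ
              (∣ᶻ-≡ (cong₂ _-_ (sym (*-^ (+ x) v p)) (sym (*-^ (+ y) v p))) (∣ᶻ-cong-* ((+ x) ^ p) ((+ y) ^ p) (v ^ p) (v ^ p) (residue-injective ((+ x) ^ p) ((+ y) ^ p) 1≤q e) (∣ᶻ-self- (v ^ p))))
              (∣ᶻ-≡ (cong (λ w → (+ y * v) ^ p - w) (ℤ.^-zeroˡ p)) (∣ᶻ-cong-^ (+ y * v) 1ℤ p hv)) ,
            λ h → x≢y (euclidˡ {a = v} pq nv (∣ᶻ-≡ (lem v (+ x) (+ y)) (∣ᶻ-- h hv))))
          where
          lem : ∀ v x y → (x * v - 1ℤ) - (y * v - 1ℤ) ≡ v * (x - y)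
          lem = solve-∀

    -- `power-index` is applied to the p + 1 elements b⁻¹, 1, c, ..., c^(p-1). Two powers of c
    -- cannot agree up to p-th powers, because p is prime and c is not a p-th power; so b⁻¹ agrees
    -- with some c^k.
    power-in-coset : ∀ {c} → ¬ (q ∣ᶻ c) → ¬ Power c → ∀ {b} → ¬ (q ∣ᶻ b) → ¬ ¬ (∃ λ k → k ℕ.< p × Power (b * c ^ k))
    power-in-coset {c} nc npc {b} nb none = power-index (upTo (suc p)) (Unique.upTo⁺ (suc p)) u (λ {i} _ → u-unit i)
        (subst (p ℕ.<_) (sym (length-upTo (suc p))) (ℕ.n<1+n p)) λ {i} {j} i∈ j∈ i≢j x y nx ny h → cases i j (∈-upTo⁻ i∈) (∈-upTo⁻ j∈) i≢j x y nx ny h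
      where
      b⁻¹ = proj₁ (unit-inverse nb)
      u : ℕ → ℤ
      u zero = b⁻¹
      u (suc k) = c ^ k
      u-unit : ∀ i → ¬ (q ∣ᶻ u i)
      u-unit zero = proj₂ (proj₂ (unit-inverse nb))
      u-unit (suc k) = ∤-^ pq k nc
      -- b⁻¹ xᵖ ≡ cᵏ yᵖ makes b cᵏ a p-th power.
      with-b : ∀ k → k ℕ.< p → ∀ x y → ¬ (q ∣ᶻ y) → ¬ (q ∣ᶻ b⁻¹ * x ^ p - c ^ k * y ^ p)
      with-b k k<p x y ny h = none (k , k<p , power-cancel {b * c ^ k} {y ^ p} (∤-^ pq p ny) (power-^ y)
        (x , ∣ᶻ-≡ (lem b b⁻¹ (x ^ p) (c ^ k) (y ^ p)) (∣ᶻ-- (∣ᶻ-*ˡ b h) (∣ᶻ-*ʳ (x ^ p) (proj₁ (proj₂ (unit-inverse nb)))))))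
        where
        lem : ∀ b i X C Y → b * (i * X - C * Y) - (b * i - 1ℤ) * X ≡ X - b * C * Y
        lem = solve-∀
      without-b : ∀ i k → 1 ℕ.≤ k → k ℕ.< p → ∀ x y → ¬ (q ∣ᶻ y) → ¬ (q ∣ᶻ c ^ i * x ^ p - c ^ (i ℕ.+ k) * y ^ p)
      without-b i k@(suc _) 1≤k k<p x y ny h = npc (power-root k nc (λ (a , b) → prime⇒coprime pp k<p (b , a)) (power-cancel {c ^ k} {y ^ p} (∤-^ pq p ny) (power-^ y)
        (x , euclidˡ {a = c ^ i} pq (∤-^ pq i nc) (∣ᶻ-≡ (trans (cong (λ w → c ^ i * x ^ p - w * y ^ p) (ℤ.^-distribˡ-+-* c i k)) (lem (c ^ i) (x ^ p) (c ^ k) (y ^ p))) h))))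
        where
        lem : ∀ C X D Y → C * X - C * D * Y ≡ C * (X - D * Y)
        lem = solve-∀
      cases : ∀ i j → i ℕ.< suc p → j ℕ.< suc p → i ≢ j → ∀ x y → ¬ (q ∣ᶻ x) → ¬ (q ∣ᶻ y) → ¬ (q ∣ᶻ u i * x ^ p - u j * y ^ p)
      cases zero zero _ _ ne = contradiction refl ne
      cases zero (suc k) _ (s≤s k<) _ x y nx ny h = with-b k k< x y ny h
      cases (suc k) zero (s≤s k<) _ _ x y nx ny h = with-b k k< y x nx (∣ᶻ-sym (c ^ k * x ^ p) (b⁻¹ * y ^ p) h)
      cases (suc i) (suc j) (s≤s i<) (s≤s j<) ne x y nx ny h with ℕ.<-cmp i j
      ... | tri≈ _ eq _ = ne (cong suc eq)
      ... | tri< lt _ _ = without-b i (j ℕ.∸ i) (ℕ.m<n⇒0<n∸m lt) (ℕ.≤-<-trans (ℕ.m∸n≤m j i) j<) x y ny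
              (subst (λ m → q ∣ᶻ c ^ i * x ^ p - c ^ m * y ^ p) (sym (ℕ.m+[n∸m]≡n (ℕ.<⇒≤ lt))) h)
      ... | tri> _ _ gt = without-b j (i ℕ.∸ j) (ℕ.m<n⇒0<n∸m gt) (ℕ.≤-<-trans (ℕ.m∸n≤m i j) i<) y x nx
              (subst (λ m → q ∣ᶻ c ^ j * y ^ p - c ^ m * x ^ p) (sym (ℕ.m+[n∸m]≡n (ℕ.<⇒≤ gt))) (∣ᶻ-sym (c ^ i * x ^ p) (c ^ j * y ^ p) h))

-- The family b_a and its roots modulo q

module SplitPrimes where

  open Counting hiding (product)
  open Q using (ℚ⁺; Σ[_]; fromℕ; indicator)
  open Congruences
  open Roots
  open import Data.Integer using (+_; _+_; _*_; _-_; -_; _^_)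
  open import Data.Integer.Tactic.RingSolver using (solve-∀)
  open import Data.Vec.Relation.Unary.All as VecAll using (All; []; _∷_)
  open import Data.Vec.Relation.Unary.AllPairs using (AllPairs; []; _∷_)
  open import Data.List using (cartesianProductWith; map)
  open import Data.List.Properties using (length-upTo)
  open import Data.List.Membership.Propositional.Properties using (∈-upTo⁺)
  open import Relation.Binary.PropositionalEquality

  Σ-cartesianProductWith : {A B C : Set} (φ : C → ℚ⁺) (f : A → B → C) (xs : List A) (ys : List B) →
    Σ[ φ ] (cartesianProductWith f xs ys) ≡ Σ[ (λ x → Σ[ (λ y → φ (f x y)) ] ys) ] xs
  Σ-cartesianProductWith φ f [] ys = refl
  Σ-cartesianProductWith φ f (x ∷ xs) ys = trans (Q.Σ-++ φ (map (f x) ys) _) (cong₂ Q._+_ (Q.Σ-map φ (f x) ys) (Σ-cartesianProductWith φ f xs ys))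

  monomials : ∀ {m} → Vec ℕ m → Vec ℕ m → ℕ
  monomials [] [] = 1
  monomials (c ∷ cs) (a ∷ as) = c ℕ.^ a ℕ.* monomials cs as

  record ExactPrime (p b : ℕ) : Set where
    field
      l a r : ℕ
      l-prime : Prime l
      l∤r : ¬ (l ∣ᶻ + r)
      0<a : 1 ℕ.≤ a
      a<p : a ℕ.< p
      b≡ : b ≡ l ℕ.^ a ℕ.* r

  ∤-ℕ* : ∀ {l m n} → Prime l → ¬ (l ∣ᶻ + m) → ¬ (l ∣ᶻ + n) → ¬ (l ∣ᶻ + (m ℕ.* n))
  ∤-ℕ* {m = m} {n} pl nm nn h = ∤-* pl nm nn (∣ᶻ-≡ (ℤ.pos-* m n) h)

  ∤-ℕ^ : ∀ {l m} → Prime l → ∀ k → ¬ (l ∣ᶻ + m) → ¬ (l ∣ᶻ + (m ℕ.^ k))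
  ∤-ℕ^ pl zero nm = ∤1 pl
  ∤-ℕ^ {m = m} pl (suc k) nm = ∤-ℕ* {m = m} pl nm (∤-ℕ^ pl k nm)

  pos-^ : ∀ m k → + (m ℕ.^ k) ≡ (+ m) ^ k
  pos-^ m zero = refl
  pos-^ m (suc k) = trans (ℤ.pos-* m (m ℕ.^ k)) (cong (+ m *_) (pos-^ m k))

  inverse-exponent : ∀ {p a} → Prime p → 1 ℕ.≤ a → a ℕ.< p → ∃₂ λ k x → a ℕ.* k ≡ suc (x ℕ.* p)
  inverse-exponent {p} {a} pp 0<a a<p with inverse-mod pp (∤-small 0<a a<p)
  ... | b , h = exponent (a ℕ.* residue p b) refl (∣ᶻ-≡ (trans (lem (+ a) b (+ residue p b)) (cong (_- 1ℤ) (sym (ℤ.pos-* a (residue p b))))) (∣ᶻ-- h (∣ᶻ-*ˡ (+ a) (residue-≡ (prime≥1 pp) b))))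
    where
    lem : ∀ a b r → (a * b - 1ℤ) - a * (b - r) ≡ a * r - 1ℤ
    lem = solve-∀
    exponent : ∀ n → n ≡ a ℕ.* residue p b → p ∣ᶻ + n - 1ℤ → ∃₂ λ k x → a ℕ.* k ≡ suc (x ℕ.* p)
    exponent zero _ h = contradiction (∣ᶻ-≡ {b = 1ℤ} refl (∣ᶻ-*ˡ (- 1ℤ) h)) (∤1 pp)
    exponent (suc n) e h with ∣⇒∣ᵤ h
    ... | ℕ.divides x eq = residue p b , x , trans (sym e) (cong suc eq)

  -- If b = lᵃ r and a k ≡ 1 modulo p, then bᵏ is l rᵏ up to p-th powers, so that Xᵖ - l rᵏ is Eisenstein at l.
  record Reduction (p b : ℕ) : Set where
    field
      l u : ℕ
      l-prime : Prime l
      l∤u : ¬ (l ∣ᶻ + u)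
      transfer : ∀ (pp : Prime p) {q} (pq : Prime q) → ¬ (q ∣ᶻ + l) → PowerResidues.Power p pp pq (+ b) → PowerResidues.Power p pp pq (+ (l ℕ.* u))

  reduction : ∀ {p b} → Prime p → ExactPrime p b → Reduction p b
  reduction {p} {b} pp e with inverse-exponent pp (ExactPrime.0<a e) (ExactPrime.a<p e)
  ... | k , x , ak≡ = record
    { l = l ; u = r ℕ.^ k ; l-prime = l-prime ; l∤u = ∤-ℕ^ l-prime k l∤r
    ; transfer = λ pp {q} pq q∤l h → let open PowerResidues p pp pq in
        power-cancel {+ (l ℕ.* r ℕ.^ k)} {((+ l) ^ x) ^ p} (∤-^ pq p (∤-^ pq x q∤l)) (power-^ ((+ l) ^ x)) (power-≡ b^k (power-^ⁿ k h)) }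
    where
    open ExactPrime e
    b^k : (+ b) ^ k ≡ + (l ℕ.* r ℕ.^ k) * ((+ l) ^ x) ^ p
    b^k = trans (sym (pos-^ b k)) (trans (cong +_ (begin
      b ℕ.^ k ≡⟨ cong (ℕ._^ k) b≡ ⟩
      (l ℕ.^ a ℕ.* r) ℕ.^ k ≡⟨ ^-distribʳ-* k (l ℕ.^ a) r ⟩
      (l ℕ.^ a) ℕ.^ k ℕ.* r ℕ.^ k ≡⟨ cong (ℕ._* r ℕ.^ k) (trans (ℕ.^-*-assoc l a k) (cong (l ℕ.^_) ak≡)) ⟩
      l ℕ.* l ℕ.^ (x ℕ.* p) ℕ.* r ℕ.^ k ≡⟨ lem l (l ℕ.^ (x ℕ.* p)) (r ℕ.^ k) ⟩
      (l ℕ.* r ℕ.^ k) ℕ.* l ℕ.^ (x ℕ.* p) ≡⟨ cong ((l ℕ.* r ℕ.^ k) ℕ.*_) (sym (ℕ.^-*-assoc l x p)) ⟩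
      (l ℕ.* r ℕ.^ k) ℕ.* (l ℕ.^ x) ℕ.^ p ∎)) (trans (ℤ.pos-* (l ℕ.* r ℕ.^ k) ((l ℕ.^ x) ℕ.^ p)) (cong (+ (l ℕ.* r ℕ.^ k) *_) (trans (pos-^ (l ℕ.^ x) p) (cong (_^ p) (pos-^ l x))))))
      where
      open ≡-Reasoning
      lem : ∀ l y z → l ℕ.* y ℕ.* z ≡ (l ℕ.* z) ℕ.* y
      lem = ℕ-solve-∀

  module Family (p : ℕ) (pp : Prime p) (l₁ : ℕ) (pl₁ : Prime l₁) where

    -- l / l₁ multiplied by the p-th power of l₁: an integer in the same class modulo p-th powers.
    twist : ℕ → ℕ
    twist l = l ℕ.* l₁ ℕ.^ ℕ.pred p

    twists : ∀ {m} → Vec ℕ m → Vec ℕ m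
    twists [] = []
    twists (l ∷ ls) = twist l ∷ twists ls

    member : ∀ {m} → Vec ℕ m → Vec ℕ m → ℕ
    member ls a = l₁ ℕ.* monomials (twists ls) a

    twist-∤ : ∀ {l l′} → Prime l → Prime l′ → l ≢ l₁ → l ≢ l′ → ¬ (l ∣ᶻ + twist l′)
    twist-∤ {l′ = l′} pl pl′ ne ne′ = ∤-ℕ* {m = l′} pl (prime∤prime pl pl′ ne′) (∤-ℕ^ pl (ℕ.pred p) (prime∤prime pl pl₁ ne))

    monomials-∤ : ∀ {l} → Prime l → l ≢ l₁ → ∀ {m} (ls a : Vec ℕ m) → All Prime ls → All (l ≢_) ls → ¬ (l ∣ᶻ + monomials (twists ls) a)
    monomials-∤ pl ne [] [] _ _ = ∤1 pl
    monomials-∤ pl ne (l′ ∷ ls) (a ∷ as) (p′ ∷ ps) (n ∷ ns) = ∤-ℕ* {m = twist l′ ℕ.^ a} pl (∤-ℕ^ pl a (twist-∤ pl p′ ne n)) (monomials-∤ pl ne ls as ps ns)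

    -- The first nonzero exponent supplies l. The prime l₁ is excluded, as its exponent in b_a may
    -- be divisible by p; only when all exponents vanish, and b_a = l₁, does `exact-prime` use l₁
    -- itself.
    exact-monomials : ∀ {m} (ls a : Vec ℕ m) → All Prime ls → AllPairs _≢_ ls → All (_≢ l₁) ls → All (ℕ._< p) a →
      monomials (twists ls) a ≡ 1 ⊎ (∃₂ λ l k → ∃ λ r → Prime l × l ≢ l₁ × ¬ (l ∣ᶻ + r) × 1 ℕ.≤ k × k ℕ.< p × monomials (twists ls) a ≡ l ℕ.^ k ℕ.* r)
    exact-monomials [] [] _ _ _ _ = inj₁ refl
    exact-monomials (l ∷ ls) (suc k ∷ as) (pl ∷ ps) (u ∷ us) (n ∷ ns) (k< ∷ _) = inj₂ (l , suc k , (l₁ ℕ.^ ℕ.pred p) ℕ.^ suc k ℕ.* monomials (twists ls) as , pl , n ,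
      ∤-ℕ* {m = (l₁ ℕ.^ ℕ.pred p) ℕ.^ suc k} pl (∤-ℕ^ pl (suc k) (∤-ℕ^ pl (ℕ.pred p) (prime∤prime pl pl₁ n))) (monomials-∤ pl n ls as ps u) , s≤s z≤n , k< ,
      trans (cong (ℕ._* monomials (twists ls) as) (^-distribʳ-* (suc k) l (l₁ ℕ.^ ℕ.pred p))) (ℕ.*-assoc (l ℕ.^ suc k) _ _))
    exact-monomials (l ∷ ls) (zero ∷ as) (pl ∷ ps) (u ∷ us) (n ∷ ns) (_ ∷ as<) with exact-monomials ls as ps us ns as<
    ... | inj₁ e = inj₁ (trans (ℕ.*-identityˡ _) e)
    ... | inj₂ (l′ , k , r , pl′ , n′ , nd , 0<k , k<p , e) = inj₂ (l′ , k , r , pl′ , n′ , nd , 0<k , k<p , trans (ℕ.*-identityˡ _) e)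

    exact-prime : ∀ {m} (ls a : Vec ℕ m) → All Prime ls → AllPairs _≢_ ls → All (_≢ l₁) ls → All (ℕ._< p) a → ExactPrime p (member ls a)
    exact-prime ls a ps us ns as< with exact-monomials ls a ps us ns as<
    ... | inj₁ e = record { l = l₁ ; a = 1 ; r = 1 ; l-prime = pl₁ ; l∤r = ∤1 pl₁ ; 0<a = ℕ.≤-refl ; a<p = prime≥2 pp
                          ; b≡ = trans (cong (l₁ ℕ.*_) e) (cong (ℕ._* 1) (sym (ℕ.^-identityʳ l₁))) }
    ... | inj₂ (l , k , r , pl , ne , nd , 0<k , k<p , e) = record { l = l ; a = k ; r = l₁ ℕ.* r ; l-prime = pl ; l∤r = ∤-ℕ* {m = l₁} pl (prime∤prime pl pl₁ ne) nd
                          ; 0<a = 0<k ; a<p = k<p ; b≡ = trans (cong (l₁ ℕ.*_) e) (lem l₁ (l ℕ.^ k) r) }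
      where
      lem : ∀ l x r → l ℕ.* (x ℕ.* r) ≡ x ℕ.* (l ℕ.* r)
      lem = ℕ-solve-∀

    module AtPrime {q : ℕ} (pq : Prime q) where
      open PowerResidues p pp pq

      Powers : ∀ {m} → Vec ℕ m → Set
      Powers = All (λ c → Power (+ c))

      power-count : ∀ {m} → Vec ℕ m → ℤ → ℚ⁺
      power-count {m} cs b = Σ[ (λ a → indicator (power? (b * + monomials cs a))) ] (box m p)

      shift-power : ∀ {m} (cs : Vec ℕ m) b c k a → b * + (c ℕ.^ k ℕ.* monomials cs a) ≡ (b * (+ c) ^ k) * + monomials cs a
      shift-power cs b c k a = trans (cong (b *_) (trans (ℤ.pos-* (c ℕ.^ k) _) (cong (_* + monomials cs a) (pos-^ c k)))) (sym (ℤ.*-assoc b _ _))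

      power-count-∷ : ∀ {m} c (cs : Vec ℕ m) b → power-count (c ∷ cs) b ≡ Σ[ (λ k → power-count cs (b * (+ c) ^ k)) ] (upTo p)
      power-count-∷ {m} c cs b = trans (Σ-cartesianProductWith (λ a → indicator (power? (b * + monomials (c ∷ cs) a))) _∷_ (upTo p) (box m p))
        (Q.Σ-cong (upTo p) λ k → Q.Σ-cong (box m p) λ a → cong (λ x → indicator (power? x)) (shift-power cs b c k a))

      fromℕ-box : ∀ m → Σ[ (λ _ → Q.1#) ] (box m p) ≡ fromℕ (p ℕ.^ m)
      fromℕ-box m = trans (Q.Σ-const Q.1# (box m p)) (trans (Q.*-identityʳ _) (cong fromℕ (length-box m p)))

      -- If some c is not a p-th power, exactly one of the p cosets b cᵏ consists of p-th powers.
      power-count-bound : ∀ {m} (cs : Vec ℕ m) → All (λ c → ¬ (q ∣ᶻ + c)) cs → ¬ Powers cs → ∀ b → ¬ (q ∣ᶻ b) →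
        fromℕ (p ℕ.^ m) Q.≤ fromℕ p Q.* power-count cs b
      power-count-bound [] _ np b nb = contradiction [] np
      power-count-bound {suc m} (c ∷ cs) (nc ∷ ncs) np b nb with VecAll.all? (λ c → power? (+ c)) cs
      -- Some later element is not a p-th power, so the induction hypothesis applies to each of the
      -- p shifts b cᵏ.
      ... | no np′ = begin
        fromℕ (p ℕ.* p ℕ.^ m) ≡⟨ Q.fromℕ-* p (p ℕ.^ m) ⟩
        fromℕ p Q.* fromℕ (p ℕ.^ m) ≡⟨ trans (cong (λ k → fromℕ k Q.* fromℕ (p ℕ.^ m)) (sym (length-upTo p))) (sym (Q.Σ-const (fromℕ (p ℕ.^ m)) (upTo p))) ⟩
        Σ[ (λ k → fromℕ (p ℕ.^ m)) ] (upTo p) ≤⟨ Q.Σ-mono (upTo p) (λ {k} _ → power-count-bound cs ncs np′ (b * (+ c) ^ k) (∤-* pq nb (∤-^ pq k nc))) ⟩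
        Σ[ (λ k → fromℕ p Q.* power-count cs (b * (+ c) ^ k)) ] (upTo p) ≡⟨ Q.Σ-scale (fromℕ p) _ (upTo p) ⟩
        fromℕ p Q.* Σ[ (λ k → power-count cs (b * (+ c) ^ k)) ] (upTo p) ≡⟨ cong (fromℕ p Q.*_) (sym (power-count-∷ c cs b)) ⟩
        fromℕ p Q.* power-count (c ∷ cs) b ∎
        where open Q.≤-Reasoning
      ... | yes ps = begin
        fromℕ (p ℕ.* p ℕ.^ m) ≡⟨ Q.fromℕ-* p (p ℕ.^ m) ⟩
        fromℕ p Q.* fromℕ (p ℕ.^ m) ≡⟨ cong (fromℕ p Q.*_) (sym (fromℕ-box m)) ⟩
        fromℕ p Q.* Σ[ (λ _ → Q.1#) ] (box m p) ≤⟨ Q.*-mono-≤ Q.≤-refl (Q.Σ-mono (box m p) (λ {a} _ → one a)) ⟩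
        fromℕ p Q.* Σ[ (λ a → Σ[ (λ k → indicator (power? (b * (+ c) ^ k * + monomials cs a))) ] (upTo p)) ] (box m p)
          ≡⟨ cong (fromℕ p Q.*_) (trans (Q.Σ-swap _ (box m p) (upTo p)) (sym (power-count-∷ c cs b))) ⟩
        fromℕ p Q.* power-count (c ∷ cs) b ∎
        where
        open Q.≤-Reasoning
        npc : ¬ Power (+ c)
        npc pc = np (pc ∷ ps)
        monomials-unit : ∀ {m} (cs a : Vec ℕ m) → All (λ c → ¬ (q ∣ᶻ + c)) cs → ¬ (q ∣ᶻ + monomials cs a)
        monomials-unit [] [] [] = ∤1 pq
        monomials-unit (c ∷ cs) (a ∷ as) (n ∷ ns) = ∤-ℕ* {m = c ℕ.^ a} pq (∤-ℕ^ pq a n) (monomials-unit cs as ns)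
        one : ∀ a → Q.1# Q.≤ Σ[ (λ k → indicator (power? (b * (+ c) ^ k * + monomials cs a))) ] (upTo p)
        one a = decidable-stable (_ Q.≤? _) λ small → power-in-coset nc npc {b * + monomials cs a} (∤-* pq nb (monomials-unit cs a ncs)) λ (k , k<p , h) →
          small (Q.≤-trans (Q.≤-reflexive (sym (Q.indicator-true (power? (b * (+ c) ^ k * + monomials cs a)) (power-≡ (lem b (+ monomials cs a) ((+ c) ^ k)) h))))
            (Q.Σ-∈ {f = λ k → indicator (power? (b * (+ c) ^ k * + monomials cs a))} {x = k} (∈-upTo⁺ k<p)))
          where
          lem : ∀ b m k → b * m * k ≡ b * k * m
          lem = solve-∀

      geometric-sum : ℕ → ℤ → ℤ
      geometric-sum zero z = 0ℤ
      geometric-sum (suc j) z = geometric-sum j z + z ^ j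

      geometric-* : ∀ j z → (z - 1ℤ) * geometric-sum j z ≡ z ^ j - 1ℤ
      geometric-* zero z = ℤ.*-zeroʳ (z - 1ℤ)
      geometric-* (suc j) z = trans (lem z (geometric-sum j z) (z ^ j)) (trans (cong (_+ (z - 1ℤ) * z ^ j) (geometric-* j z)) (lem₂ z (z ^ j)))
        where
        lem : ∀ z g x → (z - 1ℤ) * (g + x) ≡ (z - 1ℤ) * g + (z - 1ℤ) * x
        lem = solve-∀
        lem₂ : ∀ z x → (x - 1ℤ) + (z - 1ℤ) * x ≡ z * x - 1ℤ
        lem₂ = solve-∀

      geometric-near-1 : ∀ j z → q ∣ᶻ z - 1ℤ → q ∣ᶻ geometric-sum j z - + j
      geometric-near-1 zero z h = ∣ᶻ-0
      geometric-near-1 (suc j) z h = ∣ᶻ-≡ (trans (lem (geometric-sum j z) (z ^ j) (+ j)) (cong (λ w → geometric-sum (suc j) z - w) (sym (ℤ.pos-+ 1 j))))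
        (∣ᶻ-+ (geometric-near-1 j z h) (∣ᶻ-≡ (cong (λ w → z ^ j - w) (ℤ.^-zeroˡ j)) (∣ᶻ-cong-^ z 1ℤ j h)))
        where
        lem : ∀ g x j → (g - j) + (x - 1ℤ) ≡ g + x - (1ℤ + j)
        lem = solve-∀

      -- q splits completely in the field generated by a p-th root of unity and p-th roots of the cs.
      Split : ∀ {m} → Vec ℕ m → Set
      Split cs = (∃ λ z → q ∣ᶻ geometric-sum p z) × Powers cs

      geometric-sum-cong : ∀ j a b → q ∣ᶻ a - b → q ∣ᶻ geometric-sum j a - geometric-sum j b
      geometric-sum-cong zero a b h = ∣ᶻ-0
      geometric-sum-cong (suc j) a b h = ∣ᶻ-≡ (lem (geometric-sum j a) (geometric-sum j b) (a ^ j) (b ^ j)) (∣ᶻ-+ (geometric-sum-cong j a b h) (∣ᶻ-cong-^ a b j h))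
        where
        lem : ∀ x y z w → (x - y) + (z - w) ≡ (x + z) - (y + w)
        lem = solve-∀

      -- If z were 1 modulo q, the sum would be p, which is not 0 modulo q > p.
      split⇒root-of-unity : p ℕ.< q → (∃ λ z → q ∣ᶻ geometric-sum p z) → RootOfUnity
      split⇒root-of-unity p<q (z , h) = z , ∣ᶻ-≡ (geometric-* p z) (∣ᶻ-*ˡ (z - 1ℤ) h) ,
        λ z≡1 → ∤-small (prime≥1 pp) p<q (∣ᶻ-≡ (lem (geometric-sum p z) (+ p)) (∣ᶻ-- h (geometric-near-1 p z z≡1)))
        where
        lem : ∀ g j → g - (g - j) ≡ j
        lem = solve-∀

      root-of-unity? : Dec RootOfUnity
      root-of-unity? with Any.any? (λ t → (q ∣ᶻ? (+ t) ^ p - 1ℤ) ×-dec ¬? (q ∣ᶻ? + t - 1ℤ)) (upTo q)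
      ... | yes a = let (t , h , n) = Any.satisfied a in yes (+ t , h , n)
      ... | no none = no λ (z , h , n) → none (Any.map (λ { refl → ∣ᶻ-trans ((+ residue q z) ^ p) (z ^ p) 1ℤ (∣ᶻ-cong-^ (+ residue q z) z p (near z)) h ,
            λ k → n (∣ᶻ-trans z (+ residue q z) 1ℤ (residue-≡ (prime≥1 pq) z) k) }) (∈-upTo⁺ (residue-< (prime≥1 pq) z)))
        where
        near : ∀ z → q ∣ᶻ + residue q z - z
        near z = ∣ᶻ-sym z (+ residue q z) (residue-≡ (prime≥1 pq) z)

      abstract
        split? : ∀ {m} (cs : Vec ℕ m) → Dec (Split cs)
        split? cs = ∃-mod? (prime≥1 pq) (geometric-sum p) (geometric-sum-cong p) ×-dec (VecAll.all? (λ c → power? (+ c)) cs)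

      -- Without p-th roots of unity every unit is a p-th power, so each polynomial has a root, and
      -- q is not split. With roots of unity and all `cs` powers, every b_a is a power with at least
      -- p ≥ 2 roots, which leaves room for the indicator. Otherwise at least the fraction 1/p of
      -- the b_a are powers, each with at least p roots.
      pointwise : ∀ {m} (cs : Vec ℕ m) → p ℕ.< q → All (λ c → ¬ (q ∣ᶻ + c)) cs → ¬ (q ∣ᶻ + l₁) → (Powers cs → Power (+ l₁)) →
        (b′ : Vec ℕ m → ℕ) → (∀ {a} → a ∈ box m p → ¬ (q ∣ᶻ + b′ a) × (Power (+ (l₁ ℕ.* monomials cs a)) → Power (+ b′ a))) →
        fromℕ (length (box m p)) Q.+ indicator (split? cs) Q.≤ Σ[ (λ a → fromℕ (length (roots p q (+ b′ a)))) ] (box m p)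
      pointwise {m} cs p<q ncs nl₁ propagate b′ ok with root-of-unity? | VecAll.all? (λ c → power? (+ c)) cs
      ... | no none | _ = begin
        fromℕ (length (box m p)) Q.+ indicator (split? cs) ≡⟨ trans (cong (fromℕ (length (box m p)) Q.+_) (indicator-false (split? cs) (λ (z , _) → none (split⇒root-of-unity p<q z)))) (Q.+-identityʳ _) ⟩
        fromℕ (length (box m p)) ≡⟨ sym (trans (Q.Σ-const Q.1# (box m p)) (Q.*-identityʳ _)) ⟩
        Σ[ (λ _ → Q.1#) ] (box m p) ≤⟨ Q.Σ-mono (box m p) (λ a∈ → Q.1≤fromℕ (power⇒root (all-powers none (proj₁ (ok a∈))))) ⟩
        Σ[ (λ a → fromℕ (length (roots p q (+ b′ a)))) ] (box m p) ∎
        where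
        open Q.≤-Reasoning
        indicator-false : {P : Set} (d : Dec P) → ¬ P → indicator d ≡ Q.0#
        indicator-false (yes h) n = contradiction h n
        indicator-false (no _) n = refl
      ... | yes ζ | yes ps = begin
        fromℕ (length (box m p)) Q.+ indicator (split? cs) ≤⟨ Q.+-mono-≤ Q.≤-refl (Q.≤-trans (indicator≤1 (split? cs)) (Q.1≤fromℕ (subst (1 ℕ.≤_) (sym (length-box m p)) (ℕ.m^n>0 p {{ℕ.>-nonZero (prime≥1 pp)}} m)))) ⟩
        fromℕ (length (box m p)) Q.+ fromℕ (length (box m p)) ≡⟨ double (fromℕ (length (box m p))) ⟩
        fromℕ (length (box m p)) Q.* fromℕ 2 ≡⟨ sym (Q.Σ-const (fromℕ 2) (box m p)) ⟩
        Σ[ (λ _ → fromℕ 2) ] (box m p) ≤⟨ Q.Σ-mono (box m p) (λ {a} a∈ → Q.fromℕ-mono (ℕ.≤-trans (prime≥2 pp) (power⇒p-roots ζ (proj₁ (ok a∈)) (proj₂ (ok a∈) (power-≡ (sym (ℤ.pos-* l₁ (monomials cs a))) (power-* (propagate ps) (powers-monomials cs ps a))))))) ⟩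
        Σ[ (λ a → fromℕ (length (roots p q (+ b′ a)))) ] (box m p) ∎
        where
        open Q.≤-Reasoning
        indicator≤1 : {P : Set} (d : Dec P) → indicator d Q.≤ Q.1#
        indicator≤1 (yes _) = Q.≤-refl
        indicator≤1 (no _) = Q.0≤ _
        double : ∀ x → x Q.+ x ≡ x Q.* fromℕ 2
        double x = Q.solve 1 (λ x → x Q.:+ x Q.:= x Q.:* (Q.con 1 Q.:+ (Q.con 1 Q.:+ Q.con 0))) refl x
        powers-monomials : ∀ {m} (cs : Vec ℕ m) → Powers cs → ∀ a → Power (+ monomials cs a)
        powers-monomials [] [] [] = power-1
        powers-monomials (c ∷ cs) (h ∷ hs) (a ∷ as) = power-≡ (trans (cong (_* + monomials cs as) (sym (pos-^ c a))) (sym (ℤ.pos-* (c ℕ.^ a) _))) (power-* (power-^ⁿ a h) (powers-monomials cs hs as))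
      ... | yes ζ | no np = begin
        fromℕ (length (box m p)) Q.+ indicator (split? cs) ≡⟨ trans (cong (fromℕ (length (box m p)) Q.+_) (indicator-false (split? cs) (λ (_ , ps) → np ps))) (Q.+-identityʳ _) ⟩
        fromℕ (length (box m p)) ≡⟨ cong fromℕ (length-box m p) ⟩
        fromℕ (p ℕ.^ m) ≤⟨ power-count-bound cs ncs np (+ l₁) nl₁ ⟩
        fromℕ p Q.* power-count cs (+ l₁) ≡⟨ sym (Q.Σ-scale (fromℕ p) _ (box m p)) ⟩
        Σ[ (λ a → fromℕ p Q.* indicator (power? (+ l₁ * + monomials cs a))) ] (box m p) ≤⟨ Q.Σ-mono (box m p) (λ {a} a∈ → Q.*indicator-≤ (power? (+ l₁ * + monomials cs a)) λ h →
            Q.fromℕ-mono (power⇒p-roots ζ (proj₁ (ok a∈)) (proj₂ (ok a∈) (power-≡ (sym (ℤ.pos-* l₁ (monomials cs a))) h)))) ⟩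
        Σ[ (λ a → fromℕ (length (roots p q (+ b′ a)))) ] (box m p) ∎
        where
        open Q.≤-Reasoning
        indicator-false : {P : Set} (d : Dec P) → ¬ P → indicator d ≡ Q.0#
        indicator-false (yes h) n = contradiction h n
        indicator-false (no _) n = refl

-- The polynomial `fL` and exceptionality for |L| ≥ p

module Sufficiency where

  open import Defs
  open Estimates using (list-bound)
  open Congruences
  open Roots
  open import Data.Nat using (_≤?_)
  open import Data.Nat.Primality using (¬prime[0])
  open import Data.Nat.Induction using (<-rec)
  open import Data.Nat.ListAction using (product)
  open import Data.Integer using (+_; _+_; _*_; _-_; -_; _^_)
  open import Data.Integer.Tactic.RingSolver using (solve-∀)
  open import Data.List using (_++_; map; foldr; replicate; [_])
  open import Data.List.Membership.Propositional using (lose; find)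
  open import Data.List.Relation.Unary.Any using (any?)
  open import Data.List.Relation.Unary.All as All using (All; []; _∷_)
  open import Data.List.Relation.Unary.AllPairs using ([]; _∷_)
  open import Data.Bool using (if_then_else_)
  open import Relation.Nullary using (⌊_⌋)
  open import Relation.Binary.Definitions using (tri<; tri≈; tri>)
  open import Relation.Binary.PropositionalEquality hiding ([_])

  eval-+P : ∀ f g x → eval (f +P g) x ≡ eval f x + eval g x
  eval-+P [] g x = sym (ℤ.+-identityˡ _)
  eval-+P (a ∷ f) [] x = sym (ℤ.+-identityʳ _)
  eval-+P (a ∷ f) (b ∷ g) x = trans (cong (λ z → (a + b) + x * z) (eval-+P f g x)) (lem a b x (eval f x) (eval g x))
    where
    lem : ∀ a b x u v → (a + b) + x * (u + v) ≡ (a + x * u) + (b + x * v)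
    lem = solve-∀

  eval-scale : ∀ a g x → eval (map (a *_) g) x ≡ a * eval g x
  eval-scale a [] x = sym (ℤ.*-zeroʳ a)
  eval-scale a (b ∷ g) x = trans (cong (λ z → a * b + x * z) (eval-scale a g x)) (lem a b x (eval g x))
    where
    lem : ∀ a b x y → a * b + x * (a * y) ≡ a * (b + x * y)
    lem = solve-∀

  eval-*P : ∀ f g x → eval (f *P g) x ≡ eval f x * eval g x
  eval-*P [] g x = sym (ℤ.*-zeroˡ (eval g x))
  eval-*P (a ∷ f) g x = trans (eval-+P (map (a *_) g) (0ℤ ∷ (f *P g)) x) (trans (cong₂ (λ u v → u + (0ℤ + x * v)) (eval-scale a g x) (eval-*P f g x))
    (lem a x (eval f x) (eval g x)))
    where
    lem : ∀ a x u v → a * v + (0ℤ + x * (u * v)) ≡ (a + x * u) * v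
    lem = solve-∀

  eval-XpMinus : ∀ p b x → 1 ℕ.≤ p → eval (XpMinus p b) x ≡ x ^ p - + b
  eval-XpMinus (suc p) b x _ = trans (cong (λ z → - (+ b) + x * z) (eval-monomial p 1ℤ x)) (lem (+ b) x (x ^ p))
    where
    lem : ∀ b x y → - b + x * (1ℤ * y) ≡ x * y - b
    lem = solve-∀

  eval-cong : ∀ {q} f a b → q ∣ᶻ a - b → q ∣ᶻ eval f a - eval f b
  eval-cong f a b h = ∣ᶻ-≡ (sym (eval-quotient b f a)) (∣ᶻ-*ʳ _ h)

  ∏XpMinus : ℕ → List ℕ → Poly
  ∏XpMinus p bs = foldr (λ b acc → XpMinus p b *P acc) oneP bs

  root⇒factor : ∀ {q} → Prime q → ∀ p bs x → 1 ℕ.≤ p → q ∣ᶻ eval (∏XpMinus p bs) x → ∃ λ b → b ∈ bs × q ∣ᶻ x ^ p - + b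
  root⇒factor pq p [] x _ h = contradiction (∣ᶻ-≡ (lem x) h) (∤1 pq)
    where
    lem : ∀ x → 1ℤ + x * 0ℤ ≡ 1ℤ
    lem = solve-∀
  root⇒factor {q} pq p (b ∷ bs) x 1≤p h = choose (euclid pq (eval (XpMinus p b) x) (eval (∏XpMinus p bs) x) (∣ᶻ-≡ (eval-*P (XpMinus p b) (∏XpMinus p bs) x) h))
    where
    choose : (q ∣ᶻ eval (XpMinus p b) x) ⊎ (q ∣ᶻ eval (∏XpMinus p bs) x) → ∃ λ c → c ∈ b ∷ bs × q ∣ᶻ x ^ p - + c
    choose (inj₁ h′) = b , here refl , ∣ᶻ-≡ (eval-XpMinus p b x 1≤p) h′
    choose (inj₂ h′) = let (b′ , b∈ , k) = root⇒factor pq p bs x 1≤p h′ in b′ , there b∈ , k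

  factor⇒root : ∀ {q} p bs x {b} → 1 ℕ.≤ p → b ∈ bs → q ∣ᶻ x ^ p - + b → q ∣ᶻ eval (∏XpMinus p bs) x
  factor⇒root p (b ∷ bs) x 1≤p (here refl) h = ∣ᶻ-≡ (sym (eval-*P (XpMinus p b) (∏XpMinus p bs) x)) (∣ᶻ-*ʳ _ (∣ᶻ-≡ (sym (eval-XpMinus p b x 1≤p)) h))
  factor⇒root p (b ∷ bs) x 1≤p (there m) h = ∣ᶻ-≡ (sym (eval-*P (XpMinus p b) (∏XpMinus p bs) x)) (∣ᶻ-*ˡ (eval (XpMinus p b) x) (factor⇒root p bs x 1≤p m h))

  zero⇒factor : ∀ p bs x → 1 ℕ.≤ p → eval (∏XpMinus p bs) x ≡ 0ℤ → ∃ λ b → b ∈ bs × x ^ p ≡ + b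
  zero⇒factor p [] x _ h with () ← trans (sym (trans (cong (λ z → 1ℤ + z) (ℤ.*-zeroʳ x)) refl)) h
  zero⇒factor p (b ∷ bs) x 1≤p h = choose (ℤ.i*j≡0⇒i≡0∨j≡0 (eval (XpMinus p b) x) (trans (sym (eval-*P (XpMinus p b) (∏XpMinus p bs) x)) h))
    where
    choose : eval (XpMinus p b) x ≡ 0ℤ ⊎ eval (∏XpMinus p bs) x ≡ 0ℤ → ∃ λ c → c ∈ b ∷ bs × x ^ p ≡ + c
    choose (inj₁ z) = b , here refl , ℤ.i-j≡0⇒i≡j (x ^ p) (+ b) (trans (sym (eval-XpMinus p b x 1≤p)) z)
    choose (inj₂ z) = let (b′ , b∈ , k) = zero⇒factor p bs x 1≤p z in b′ , there b∈ , k

  record MonicForm (f : Poly) : Set where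
    constructor monic
    field
      lower-part : Poly
      form : f ≡ lower-part ++ [ 1ℤ ]

  private
    dominated : ∀ f h → length f ℕ.≤ length h → ∃ λ k → f +P (h ++ [ 1ℤ ]) ≡ k ++ [ 1ℤ ]
    dominated [] h _ = h , refl
    dominated (a ∷ f) (b ∷ h) (s≤s le) = let (k , e) = dominated f h le in (a + b) ∷ k , cong ((a + b) ∷_) e

    -- The inequality of lengths is carried along so that in the next step the scaled summand does
    -- not reach the leading 1 of the shifted product.
    *P-monic : ∀ f g → ∃ λ h → (f ++ [ 1ℤ ]) *P (g ++ [ 1ℤ ]) ≡ h ++ [ 1ℤ ] × length g ℕ.≤ length h
    *P-monic [] g = g′ g
      where
      one : ∀ g → map (1ℤ *_) g ≡ g
      one [] = refl
      one (a ∷ g) = cong₂ _∷_ (ℤ.*-identityˡ a) (one g)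
      g′ : ∀ g → ∃ λ h → map (1ℤ *_) (g ++ [ 1ℤ ]) +P (0ℤ ∷ []) ≡ h ++ [ 1ℤ ] × length g ℕ.≤ length h
      g′ [] = [] , refl , z≤n
      g′ (a ∷ g) = a ∷ g , cong₂ _∷_ (trans (ℤ.+-identityʳ _) (ℤ.*-identityˡ a)) (trans (right-identity (map (1ℤ *_) (g ++ [ 1ℤ ]))) (one (g ++ [ 1ℤ ]))) , ℕ.≤-refl
        where
        right-identity : ∀ f → f +P [] ≡ f
        right-identity [] = refl
        right-identity (a ∷ f) = refl
    *P-monic (a ∷ f) g with *P-monic f g
    ... | h , e , le with dominated (map (a *_) (g ++ [ 1ℤ ])) (0ℤ ∷ h) (ℕ.≤-trans (ℕ.≤-reflexive (len a g)) (s≤s le))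
      where
      len : ∀ a (g : Poly) → length (map (a *_) (g ++ [ 1ℤ ])) ≡ suc (length g)
      len a [] = refl
      len a (b ∷ g) = cong suc (len a g)
    ...   | k , e′ = k , trans (cong (λ z → map (a *_) (g ++ [ 1ℤ ]) +P (0ℤ ∷ z)) e) e′ , longer
      where
      length-snoc : ∀ (xs : Poly) → length (xs ++ [ 1ℤ ]) ≡ suc (length xs)
      length-snoc [] = refl
      length-snoc (x ∷ xs) = cong suc (length-snoc xs)
      ≤length-+P : ∀ f h → length h ℕ.≤ length (f +P h)
      ≤length-+P [] h = ℕ.≤-refl
      ≤length-+P (a ∷ f) [] = z≤n
      ≤length-+P (a ∷ f) (b ∷ h) = s≤s (≤length-+P f h)
      longer : length g ℕ.≤ length k
      longer = ℕ.≤-pred (subst (suc (length g) ℕ.≤_) (trans (cong length e′) (length-snoc k))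
        (ℕ.≤-trans (s≤s le) (ℕ.≤-trans (ℕ.n≤1+n _) (ℕ.≤-trans (ℕ.≤-reflexive (cong suc (sym (length-snoc h)))) (≤length-+P (map (a *_) (g ++ [ 1ℤ ])) (0ℤ ∷ (h ++ [ 1ℤ ])))))))

  ∏XpMinus-monic : ∀ p bs → ∃ λ h → ∏XpMinus p bs ≡ h ++ [ 1ℤ ]
  ∏XpMinus-monic p [] = [] , refl
  ∏XpMinus-monic p (b ∷ bs) with ∏XpMinus-monic p bs
  ... | g , e with *P-monic (- (+ b) ∷ replicate (p ℕ.∸ 1) 0ℤ) g
  ...   | h , e′ , _ = h , trans (cong (XpMinus p b *P_) e) e′

  fL-monic : ∀ p L → Monic (fL p L)
  fL-monic p L = let (h , e) = ∏XpMinus-monic p (B L) in h , 0 , e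

  B⁺ : ∀ L {a b} → a ∈ L → b ∈ L → a ℕ.≤ b → product (segment L a b) ∈ B L
  B⁺ L {a} {b} a∈ b∈ a≤b = ∈-deduplicate⁺ ℕ._≟_ (∈-concatMap⁺ _ (lose a∈ (∈-concatMap⁺ _ (lose b∈ chosen))))
    where
    chosen : product (segment L a b) ∈ (if ⌊ a ≤? b ⌋ then [ product (segment L a b) ] else [])
    chosen with a ≤? b
    ... | yes _ = here refl
    ... | no n = contradiction a≤b n

  B⁻ : ∀ L {c} → c ∈ B L → ∃₂ λ a b → a ∈ L × b ∈ L × a ℕ.≤ b × c ≡ product (segment L a b)
  B⁻ L {c} c∈ with find (∈-concatMap⁻ _ {xs = L} (∈-deduplicate⁻ ℕ._≟_ _ c∈))
  ... | a , a∈ , m with find (∈-concatMap⁻ _ {xs = L} m)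
  ...   | b , b∈ , m′ with a ≤? b | m′
  ...     | yes le | here e = a , b , a∈ , b∈ , le , e
  ...     | no _ | ()

  between? : ∀ a b x → Dec (a ℕ.≤ x × x ℕ.≤ b)
  between? a b x = (a ≤? x) ×-dec (x ≤? b)

  ∤-product : ∀ {q} → Prime q → ∀ xs → All (λ x → ¬ (q ∣ᶻ + x)) xs → ¬ (q ∣ᶻ + product xs)
  ∤-product pq [] [] = ∤1 pq
  ∤-product pq (x ∷ xs) (n ∷ ns) h = ∤-* pq n (∤-product pq xs ns) (∣ᶻ-≡ (ℤ.pos-* x (product xs)) h)

  -- l occurs exactly once in the product, but it divides x, and p ≥ 2 makes l² divide x^p.
  product-of-primes-not-power : ∀ {p l} → 2 ℕ.≤ p → ∀ xs → Unique xs → All Prime xs → l ∈ xs → ∀ x → ¬ (x ^ p ≡ + product xs)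
  product-of-primes-not-power {suc (suc p)} {l} (s≤s (s≤s _)) xs u ps l∈ x e with ∈-∃++ l∈
  ... | as , bs , refl = contradiction (square∣ (l∣x (suc (suc p)) (∣ᶻ-≡ (sym (trans e factor)) (∣ᶻ-*ʳ _ ∣ᶻ-refl)))) (∤-product pl (as ++ bs) others)
    where
    pl = All.lookup ps (∈-++⁺ʳ as (here refl))
    product-++ : ∀ as bs → product (as ++ l ∷ bs) ≡ l ℕ.* product (as ++ bs)
    product-++ [] bs = refl
    product-++ (a ∷ as) bs = trans (cong (a ℕ.*_) (product-++ as bs)) (lem a l (product (as ++ bs)))
      where
      open import Data.Nat.Tactic.RingSolver using () renaming (solve-∀ to ℕ-solve-∀)
      lem : ∀ a l m → a ℕ.* (l ℕ.* m) ≡ l ℕ.* (a ℕ.* m)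
      lem = ℕ-solve-∀
    factor : + product (as ++ l ∷ bs) ≡ + l * + product (as ++ bs)
    factor = trans (cong +_ (product-++ as bs)) (ℤ.pos-* l (product (as ++ bs)))
    l∣x : ∀ n → l ∣ᶻ x ^ n → l ∣ᶻ x
    l∣x zero h = contradiction h (∤1 pl)
    l∣x (suc n) h with euclid pl x (x ^ n) h
    ... | inj₁ a = a
    ... | inj₂ b = l∣x n b
    square∣ : l ∣ᶻ x → l ∣ᶻ + product (as ++ bs)
    square∣ (divides k refl) = divides (k * k * (k * + l) ^ p) (ℤ.*-cancelˡ-≡ (+ l) _ _ {{ℕ.>-nonZero (prime≥1 pl)}}
      (trans (sym factor) (trans (sym e) (lem k (+ l) ((k * + l) ^ p)))))
      where
      lem : ∀ k l y → k * l * (k * l * y) ≡ l * (k * k * y * l)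
      lem = solve-∀
    distinct : ∀ as → Unique (as ++ l ∷ bs) → ∀ {y} → y ∈ as ++ bs → l ≢ y
    distinct [] (n ∷ _) y∈ = All.lookup n y∈
    distinct (a ∷ as) (n ∷ v) (here refl) = λ l≡a → All.lookup n (∈-++⁺ʳ as (here refl)) (sym l≡a)
    distinct (a ∷ as) (n ∷ v) (there y∈) = distinct as v y∈
    prime-of : ∀ {y} → y ∈ as ++ bs → Prime y
    prime-of y∈ with ∈-++⁻ as y∈
    ... | inj₁ p = All.lookup ps (∈-++⁺ˡ p)
    ... | inj₂ p = All.lookup ps (∈-++⁺ʳ as (there p))
    others : All (λ y → ¬ (l ∣ᶻ + y)) (as ++ bs)
    others = All.tabulate λ y∈ → prime∤prime pl (prime-of y∈) (distinct as u y∈)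

  segment-∈ : ∀ {L a b} → a ∈ L → a ℕ.≤ b → a ∈ segment L a b
  segment-∈ {L} {a} {b} a∈ a≤b = ∈-filter⁺ (between? a b) a∈ (ℕ.≤-refl , a≤b)

  no-integer-root : ∀ {p} → Prime p → ∀ L → All Prime L → Unique L → ¬ HasIntegerRoot (fL p L)
  no-integer-root {p} pp L ps u (x , h) with zero⇒factor p (B L) x (prime≥1 pp) h
  ... | c , c∈ , e with B⁻ L c∈
  ...   | a , b , a∈ , b∈ , a≤b , refl = product-of-primes-not-power (prime≥2 pp) (segment L a b) (Unique.filter⁺ (between? a b) u)
          (All.tabulate λ m → All.lookup ps (proj₁ (∈-filter⁻ (between? a b) {xs = L} m))) (segment-∈ a∈ a≤b) x e

  product-filter-split : {P Q R : ℕ → Set} (P? : ∀ x → Dec (P x)) (Q? : ∀ x → Dec (Q x)) (R? : ∀ x → Dec (R x)) → ∀ L →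
    All (λ x → (R x → P x ⊎ Q x) × (P x → R x) × (Q x → R x) × ¬ (P x × Q x)) L →
    product (filter R? L) ≡ product (filter P? L) ℕ.* product (filter Q? L)
  product-filter-split P? Q? R? [] [] = refl
  product-filter-split P? Q? R? (x ∷ L) ((f , g , h , d) ∷ rest) with R? x | P? x | Q? x
  ... | yes r | yes p | yes q = contradiction (p , q) d
  ... | yes r | yes p | no nq = trans (cong (x ℕ.*_) (product-filter-split P? Q? R? L rest)) (sym (ℕ.*-assoc x _ _))
  ... | yes r | no np | yes q = trans (cong (x ℕ.*_) (product-filter-split P? Q? R? L rest)) (lem x (product (filter P? L)) (product (filter Q? L)))
    where
    open import Data.Nat.Tactic.RingSolver using () renaming (solve-∀ to ℕ-solve-∀)
    lem : ∀ x p q → x ℕ.* (p ℕ.* q) ≡ p ℕ.* (x ℕ.* q)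
    lem = ℕ-solve-∀
  ... | yes r | no np | no nq with f r
  ...   | inj₁ p = contradiction p np
  ...   | inj₂ q = contradiction q nq
  product-filter-split P? Q? R? (x ∷ L) ((f , g , h , d) ∷ rest) | no nr | yes p | _ = contradiction (g p) nr
  product-filter-split P? Q? R? (x ∷ L) ((f , g , h , d) ∷ rest) | no nr | no np | yes q = contradiction (h q) nr
  product-filter-split P? Q? R? (x ∷ L) ((f , g , h , d) ∷ rest) | no nr | no np | no nq = product-filter-split P? Q? R? L rest

  -- L need not be sorted, so the left end of a segment is found by descent as the least element
  -- above i.
  successor : ∀ L i j → j ∈ L → i ℕ.< j → ∃ λ a → a ∈ L × i ℕ.< a × a ℕ.≤ j × (∀ {x} → x ∈ L → i ℕ.< x → a ℕ.≤ x)
  successor L i = <-rec (λ j → j ∈ L → i ℕ.< j → ∃ λ a → a ∈ L × i ℕ.< a × a ℕ.≤ j × (∀ {x} → x ∈ L → i ℕ.< x → a ℕ.≤ x)) step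
    where
    step : ∀ j → (∀ {k} → k ℕ.< j → k ∈ L → i ℕ.< k → ∃ λ a → a ∈ L × i ℕ.< a × a ℕ.≤ k × (∀ {x} → x ∈ L → i ℕ.< x → a ℕ.≤ x)) →
      j ∈ L → i ℕ.< j → ∃ λ a → a ∈ L × i ℕ.< a × a ℕ.≤ j × (∀ {x} → x ∈ L → i ℕ.< x → a ℕ.≤ x)
    step j rec j∈ i<j with any? (λ x → (i ℕ.<? x) ×-dec (x ℕ.<? j)) L
    ... | yes a = let (k , k∈ , i<k , k<j) = find a ; (b , b∈ , i<b , b≤k , least) = rec k<j k∈ i<k in b , b∈ , i<b , ℕ.≤-trans b≤k (ℕ.<⇒≤ k<j) , least
    ... | no none = j , j∈ , i<j , ℕ.≤-refl , λ {x} x∈ i<x → ℕ.≮⇒≥ λ x<j → none (lose x∈ (i<x , x<j))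

  -- Among the p + 1 partial products of the increasing sequence of primes two agree modulo p-th powers;
  -- their quotient is a product of consecutive primes.
  many-primes⇒exceptional : ∀ {p} → Prime p → ∀ L → All Prime L → Unique L → p ℕ.≤ length L → Exceptional (fL p L)
  many-primes⇒exceptional {p} pp L ps u p≤ = fL-monic p L , no-integer-root pp L ps u , suc (proj₁ (list-bound id L)) , has-root
    where
    has-root : ∀ q → Prime q → suc (proj₁ (list-bound id L)) ℕ.≤ q → HasRootMod q (fL p L)
    has-root q pq q-large = let (x , h) = decidable-stable (∃-mod? (prime≥1 pq) (eval (fL p L)) (eval-cong (fL p L))) root in x , ∣⇒∣ᵤ h
      where
      open PowerResidues p pp pq
      partial : ℕ → ℕ
      partial t = product (filter (_≤? t) L)
      unit : ∀ {l} → l ∈ L → ¬ (q ∣ᶻ + l)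
      unit l∈ = ∤-small (prime≥1 (All.lookup ps l∈)) (ℕ.<-≤-trans (s≤s (proj₂ (list-bound id L) l∈)) q-large)
      partial-unit : ∀ t → ¬ (q ∣ᶻ + partial t)
      partial-unit t = ∤-product pq (filter (_≤? t) L) (All.tabulate λ m → unit (proj₁ (∈-filter⁻ (_≤? t) {xs = L} m)))
      root : ¬ ¬ (∃ λ x → q ∣ᶻ eval (fL p L) x)
      -- Partial products are indexed by thresholds: the members of L, and 0 for the empty product.
      -- This makes more than p of them.
      root none = power-index (0 ∷ L) (All.tabulate (λ { m refl → ¬prime[0] (All.lookup ps m) }) ∷ u) (λ t → + partial t) (λ {t} _ → partial-unit t) (s≤s p≤) separate
        where
        ordered : ∀ {i j} → j ∈ L → i ℕ.< j → ∀ x y → ¬ (q ∣ᶻ y) → ¬ (q ∣ᶻ + partial i * x ^ p - + partial j * y ^ p)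
        ordered {i} {j} j∈ i<j x y ny h with successor L i j j∈ i<j
        ... | a , a∈ , i<a , a≤j , least = none (proj₁ pw , factor⇒root p (B L) (proj₁ pw) (prime≥1 pp) (B⁺ L a∈ j∈ a≤j) (proj₂ pw))
          where
          s = product (segment L a j)
          -- With a the successor of i in L, the elements in (i, j] are those in [a, j], so the
          -- quotient is a member of `B L`.
          split : partial j ≡ partial i ℕ.* s
          split = product-filter-split (_≤? i) (between? a j) (_≤? j) L (All.tabulate λ {z} z∈ →
            (λ z≤j → Sum.map₂ (λ i<z → least z∈ i<z , z≤j) (ℕ.≤-<-connex z i)) , (λ z≤i → ℕ.≤-trans z≤i (ℕ.<⇒≤ i<j)) , proj₂ ,
            λ (z≤i , a≤z , _) → ℕ.<⇒≱ (ℕ.<-≤-trans i<a a≤z) z≤i)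
          pw : Power (+ s)
          pw = power-cancel {+ s} {y ^ p} (∤-^ pq p ny) (power-^ y) (x , euclidˡ {a = + partial i} pq (partial-unit i)
            (∣ᶻ-≡ (trans (cong (λ w → + partial i * x ^ p - w * y ^ p) (trans (cong +_ split) (ℤ.pos-* (partial i) s))) (lem (+ partial i) (x ^ p) (+ s) (y ^ p))) h))
            where
            lem : ∀ u x s y → u * x - u * s * y ≡ u * (x - s * y)
            lem = solve-∀
        below : ∀ {i j} → j ∈ 0 ∷ L → i ℕ.< j → j ∈ L
        below (here refl) ()
        below (there m) _ = m
        separate : ∀ {i j} → i ∈ 0 ∷ L → j ∈ 0 ∷ L → i ≢ j → ∀ x y → ¬ (q ∣ᶻ x) → ¬ (q ∣ᶻ y) → ¬ (q ∣ᶻ + partial i * x ^ p - + partial j * y ^ p)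
        separate {i} {j} i∈ j∈ i≢j x y nx ny h with ℕ.<-cmp i j
        ... | tri≈ _ e _ = i≢j e
        ... | tri< lt _ _ = ordered (below j∈ lt) lt x y ny h
        ... | tri> _ _ gt = ordered (below i∈ gt) gt y x nx (∣ᶻ-sym (+ partial i * x ^ p) (+ partial j * y ^ p) h)

-- No exceptional `fL` for |L| < p

module Necessity where

  open import Defs
  open Counting hiding (product)
  open Q using (ℚ⁺; Σ[_]; Π[_]; fromℕ; inv; indicator)
  open Orders
  open Estimates using (list-bound; inv-square; Π-1+inv-square≤2)
  open Congruences
  open EulerProducts using (module UpperBound; ζ-weight)
  open SequenceOperators
  open PureRoots using (module Eisenstein)
  open RadicalRings using (module Radical; ¬¬-∀Fin; Null)
  open Ideals using (module PrimeIdeals)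
  open Sieving using (∣!; 1≤!)
  open DivergentReciprocals using (diverges)
  open EulerComparison using (module Ratio; module Comparison)
  open Roots
  open SplitPrimes
  open Sufficiency
  open import Data.Nat using (_!)
  open import Data.Nat.Coprimality using (Coprime; prime⇒coprime)
  open import Data.Nat.Primality.Factorisation using (factorise; PrimeFactorisation)
  open import Data.Nat.ListAction using (product)
  open import Data.Integer using (+_; -1ℤ; _+_; _*_; _-_; -_; _^_)
  open import Data.Integer.Tactic.RingSolver using (solve-∀)
  open import Data.Vec using (lookup)
  import Data.Vec.Relation.Unary.All as VecAll
  import Data.Vec.Relation.Unary.AllPairs as VecAllPairs
  open import Data.List.Properties using (length-filter)
  open import Data.List.Relation.Unary.All as All using (All; []; _∷_)
  import Data.List.Relation.Unary.All.Properties as All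
  open import Data.List.Relation.Unary.AllPairs using (AllPairs; []; _∷_)
  open import Relation.Binary.PropositionalEquality

  fromList-All : {P : ℕ → Set} {xs : List ℕ} → All P xs → VecAll.All P (Vec.fromList xs)
  fromList-All [] = VecAll.[]
  fromList-All (p ∷ ps) = p VecAll.∷ fromList-All ps

  fromList-AllPairs : {R : ℕ → ℕ → Set} {xs : List ℕ} → AllPairs R xs → VecAllPairs.AllPairs R (Vec.fromList xs)
  fromList-AllPairs [] = VecAllPairs.[]
  fromList-AllPairs (p ∷ ps) = fromList-All p VecAllPairs.∷ fromList-AllPairs ps

  all-lookup : ∀ {m n} (a : Vec ℕ m) → (∀ i → lookup a i ℕ.< n) → VecAll.All (ℕ._< n) a
  all-lookup [] h = VecAll.[]
  all-lookup (x ∷ a) h = h zero VecAll.∷ all-lookup a (h ∘ suc)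

  prime-above : ∀ N → ∃ λ q → Prime q × N ℕ.≤ q
  prime-above N = first factors refl
    where
    open PrimeFactorisation (factorise (suc (N !)))
    first : ∀ fs → fs ≡ factors → ∃ λ q → Prime q × N ℕ.≤ q
    first [] e = contradiction (trans isFactorisation (cong (product) (sym e))) λ h → ℕ.<⇒≢ (s≤s (1≤! N)) (sym h)
    first (q ∷ fs) e = q , pq , ℕ.<⇒≤ (ℕ.≰⇒> λ q≤N → ∤1 pq (∣ᶻ-≡ (lem (+ (N !))) (∣ᶻ-- (∣ᶻ-≡ (ℤ.pos-+ 1 (N !)) q∣) (∣ᵤ⇒∣ {+ q} {+ (N !)} (∣! N (prime≥1 pq) q≤N)))))
      where
      pq : Prime q
      pq = All.lookup factorsPrime (subst (q ∈_) e (here refl))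
      q∣ : q ∣ᶻ + suc (N !)
      q∣ = ∣ᵤ⇒∣ {+ q} {+ suc (N !)} (subst (q ℕ.∣_) (sym (trans isFactorisation (cong (product) (sym e)))) (ℕ.m∣m*n (product fs)))
      lem : ∀ x → (1ℤ + x) - x ≡ 1ℤ
      lem = solve-∀

  -- The divergence theorem asks for a bound in ℕ. It is assembled along the expression for the
  -- rational constant `C₁`.
  record Majorised (x : ℚ⁺) : Set where
    constructor majorised
    field
      bound : ℕ
      below : x Q.≤ fromℕ bound

  majorised-ℕ : ∀ n → Majorised (fromℕ n)
  majorised-ℕ n = majorised n Q.≤-refl

  majorised-1 : Majorised Q.1#
  majorised-1 = majorised 1 (Q.≤-reflexive (sym Q.fromℕ-1))

  majorised-* : ∀ {x y} → Majorised x → Majorised y → Majorised (x Q.* y)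
  majorised-* (majorised m p) (majorised n r) = majorised (m ℕ.* n) (Q.≤-trans (Q.*-mono-≤ p r) (Q.≤-reflexive (sym (Q.fromℕ-* m n))))

  majorised-+ : ∀ {x y} → Majorised x → Majorised y → Majorised (x Q.+ y)
  majorised-+ (majorised m p) (majorised n r) = majorised (m ℕ.+ n) (Q.≤-trans (Q.+-mono-≤ p r) (Q.≤-reflexive (sym (Q.fromℕ-+ m n))))

  majorised-^ : ∀ {x} n → Majorised x → Majorised (x Q.^ n)
  majorised-^ zero h = majorised-1
  majorised-^ (suc n) h = majorised-* h (majorised-^ n h)

  majorised-Π : {A : Set} (f : A → ℕ) (xs : List A) → Majorised (Π[ fromℕ ∘ f ] xs)
  majorised-Π f [] = majorised-1
  majorised-Π f (x ∷ xs) = majorised-* (majorised-ℕ (f x)) (majorised-Π f xs)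

  module FewPrimes (p : ℕ) (pp : Prime p) (l₁ : ℕ) (ls : List ℕ) (pl₁ : Prime l₁) (pls : All Prime ls)
    (l₁∉ : All (l₁ ≢_) ls) (uls : Unique ls) (few : length (l₁ ∷ ls) ℕ.< p)
    (N : ℕ) (has-root : ∀ q → Prime q → N ℕ.≤ q → HasRootMod q (fL p (l₁ ∷ ls))) where

    open Family p pp l₁ pl₁
    L = l₁ ∷ ls
    m = length ls
    lsᵛ : Vec ℕ m
    lsᵛ = Vec.fromList ls
    cs : Vec ℕ m
    cs = twists lsᵛ

    2≤p = prime≥2 pp

    exact : ∀ a → VecAll.All (ℕ._< p) a → ExactPrime p (member lsᵛ a)
    exact a = exact-prime lsᵛ a (fromList-All pls) (fromList-AllPairs uls) (VecAll.map (λ n e → n (sym e)) (fromList-All l₁∉))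

    zeros-< : VecAll.All (ℕ._< p) (Vec.replicate m 0)
    zeros-< = all-lookup (Vec.replicate m 0) λ i → subst (ℕ._< p) (sym (Vec.lookup-replicate i 0)) (ℕ.<⇒≤ 2≤p)

    -- Defined for every a, with b_0 as default outside the box, because `Comparison` takes its
    -- functions on the whole index type.
    reduced : ∀ a → ∃ λ b → Reduction p b × (VecAll.All (ℕ._< p) a → b ≡ member lsᵛ a)
    reduced a with VecAll.all? (ℕ._<? p) a
    ... | yes a< = member lsᵛ a , reduction pp (exact a a<) , λ _ → refl
    ... | no n = member lsᵛ (Vec.replicate m 0) , reduction pp (exact (Vec.replicate m 0) zeros-<) , λ a< → contradiction a< n

    open Reduction using (l-prime; l∤u; transfer)

    red : ∀ a → Reduction p (proj₁ (reduced a))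
    red a = proj₁ (proj₂ (reduced a))

    l u b′ : Vec ℕ m → ℕ
    l a = Reduction.l (red a)
    u a = Reduction.u (red a)
    b′ a = l a ℕ.* u a

    z₀ : ℕ
    z₀ = N ℕ.+ p ℕ.+ proj₁ (list-bound id L) ℕ.+ proj₁ (list-bound (λ a → l a ℕ.+ b′ a) (box m p))

    module _ {q : ℕ} (pq : Prime q) (z₀<q : z₀ ℕ.< q) where
      open PowerResidues p pp pq
      open AtPrime pq

      N≤q : N ℕ.≤ q
      N≤q = ℕ.≤-trans (ℕ.m≤m+n N p) (ℕ.≤-trans (ℕ.m≤m+n (N ℕ.+ p) _) (ℕ.≤-trans (ℕ.m≤m+n _ _) (ℕ.<⇒≤ z₀<q)))

      p<q : p ℕ.< q
      p<q = ℕ.≤-<-trans (ℕ.≤-trans (ℕ.m≤n+m p N) (ℕ.≤-trans (ℕ.m≤m+n (N ℕ.+ p) _) (ℕ.m≤m+n _ _))) z₀<q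

      L-unit : ∀ {x} → x ∈ L → ¬ (q ∣ᶻ + x)
      L-unit {x} x∈ = ∤-small (prime≥1 (All.lookup (pl₁ ∷ pls) x∈)) (ℕ.≤-<-trans (ℕ.≤-trans (proj₂ (list-bound id L) x∈) (ℕ.≤-trans (ℕ.m≤n+m _ (N ℕ.+ p)) (ℕ.m≤m+n _ _))) z₀<q)

      l+b′<q : ∀ {a} → a ∈ box m p → l a ℕ.+ b′ a ℕ.< q
      l+b′<q a∈ = ℕ.≤-<-trans (ℕ.≤-trans (proj₂ (list-bound (λ a → l a ℕ.+ b′ a) (box m p)) a∈) (ℕ.m≤n+m _ (N ℕ.+ p ℕ.+ proj₁ (list-bound id L)))) z₀<q

      l-unit : ∀ {a} → a ∈ box m p → ¬ (q ∣ᶻ + l a)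
      l-unit {a} a∈ = ∤-small (prime≥1 (l-prime (red a))) (ℕ.≤-<-trans (ℕ.m≤m+n (l a) (b′ a)) (l+b′<q a∈))

      b′-unit : ∀ {a} → a ∈ box m p → ¬ (q ∣ᶻ + b′ a)
      b′-unit {a} a∈ = ∤-small (ℕ.*-mono-≤ (prime≥1 (l-prime (red a))) (ℕ.n≢0⇒n>0 λ e → l∤u (red a) (subst (λ w → l a ∣ᶻ + w) (sym e) ∣ᶻ-0)))
        (ℕ.≤-<-trans (ℕ.m≤n+m (b′ a) (l a)) (l+b′<q a∈))

      twists-unit : ∀ {n} (xs : Vec ℕ n) → VecAll.All (λ x → ¬ (q ∣ᶻ + x)) xs → VecAll.All (λ c → ¬ (q ∣ᶻ + c)) (twists xs)
      twists-unit [] VecAll.[] = VecAll.[]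
      twists-unit (x ∷ xs) (h VecAll.∷ hs) = ∤-ℕ* {m = x} pq h (∤-ℕ^ pq (ℕ.pred p) (L-unit (here refl))) VecAll.∷ twists-unit xs hs

      cs-unit : VecAll.All (λ c → ¬ (q ∣ᶻ + c)) cs
      cs-unit = twists-unit lsᵛ (fromList-All (All.tabulate λ x∈ → L-unit (there x∈)))

      -- If all elements of L lie in the same class modulo p-th powers, the given root forces this class to be trivial.
      propagate : Powers cs → Power (+ l₁)
      propagate ps = finish (root⇒factor pq p (B L) (proj₁ r) (prime≥1 pp) (∣ᵤ⇒∣ (proj₂ r)))
        where
        r = has-root q pq N≤q
        twists-power : ∀ xs → Powers (twists (Vec.fromList xs)) → All (λ x → Power (+ (x ℕ.* l₁ ℕ.^ ℕ.pred p))) xs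
        twists-power [] VecAll.[] = []
        twists-power (x ∷ xs) (h VecAll.∷ hs) = h ∷ twists-power xs hs
        L-power : ∀ {x} → x ∈ L → Power (+ x * (+ l₁) ^ ℕ.pred p)
        L-power (here refl) = power-≡ (cong ((+ l₁) ^_) (sym (ℕ.suc-pred p {{ℕ.>-nonZero (prime≥1 pp)}}))) (power-^ (+ l₁))
        L-power {x} (there x∈) = power-≡ (trans (ℤ.pos-* x (l₁ ℕ.^ ℕ.pred p)) (cong (+ x *_) (pos-^ l₁ (ℕ.pred p)))) (All.lookup (twists-power ls ps) x∈)
        product-power : ∀ xs → All (_∈ L) xs → Power (+ product xs * ((+ l₁) ^ ℕ.pred p) ^ length xs)
        product-power [] [] = power-≡ refl power-1
        product-power (x ∷ xs) (x∈ ∷ xs∈) = power-≡ (trans (lem (+ x) ((+ l₁) ^ ℕ.pred p) (+ product xs) (((+ l₁) ^ ℕ.pred p) ^ length xs))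
            (cong (_* (((+ l₁) ^ ℕ.pred p) ^ suc (length xs))) (sym (ℤ.pos-* x (product xs))))) (power-* (L-power x∈) (product-power xs xs∈))
          where
          lem : ∀ a b c d → (a * b) * (c * d) ≡ (a * c) * (b * d)
          lem = solve-∀
        finish : (∃ λ b → b ∈ B L × q ∣ᶻ proj₁ r ^ p - + b) → Power (+ l₁)
        finish (b , b∈ , h) with B⁻ L b∈
        ... | x , y , x∈ , y∈ , x≤y , refl = power-root k (L-unit (here refl)) coprime l₁^k
          where
          seg = segment L x y
          k = length seg
          seg∈ : All (_∈ L) seg
          seg∈ = All.tabulate λ m → proj₁ (∈-filter⁻ (between? x y) {xs = L} m)
          1≤k : 1 ℕ.≤ k
          1≤k with seg | segment-∈ {L} {x} {y} x∈ x≤y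
          ... | _ ∷ _ | _ = s≤s z≤n
          k<p : k ℕ.< p
          k<p = ℕ.≤-<-trans (length-filter (between? x y) L) few
          coprime : Coprime k p
          coprime (d∣k , d∣p) = prime⇒coprime pp {{ℕ.>-nonZero 1≤k}} k<p (d∣p , d∣k)
          -- Both the product of the segment and its multiple by `A` are p-th powers, so `A` is one.
          -- Since l₁^k times `A` is (l₁^k)^p, so is l₁^k, and 0 < k < p is prime to p.
          A = ((+ l₁) ^ ℕ.pred p) ^ k
          A-power : Power A
          A-power = power-cancel {A} {+ product seg} (∤-product pq seg (All.map L-unit seg∈)) (proj₁ r , h) (power-≡ (ℤ.*-comm (+ product seg) A) (product-power seg seg∈))
          l₁^k : Power ((+ l₁) ^ k)
          l₁^k = power-cancel {(+ l₁) ^ k} {A} (∤-^ pq k (∤-^ pq (ℕ.pred p) (L-unit (here refl)))) A-power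
            (power-≡ (trans (ℤ.^-*-assoc (+ l₁) k p) (trans (cong ((+ l₁) ^_) (trans (ℕ.*-comm k p) (cong (ℕ._* k) (sym (ℕ.suc-pred p {{ℕ.>-nonZero (prime≥1 pp)}})))))
              (trans (ℤ.^-distribˡ-+-* (+ l₁) k (ℕ.pred p ℕ.* k)) (cong ((+ l₁) ^ k *_) (sym (ℤ.^-*-assoc (+ l₁) (ℕ.pred p) k)))))) (power-^ ((+ l₁) ^ k)))

    module At (a : Vec ℕ m) where
      module Ei = Eisenstein p 2≤p (l a) (u a) (l-prime (red a)) (l∤u (red a))
      module U = UpperBound Ei.order Ei.evaluation (ℕ.<⇒≤ 2≤p)
      C : ℕ
      C = U.constant ℕ.* (U.base ℕ.* U.base ℕ.* U.base)

    upper : ∀ {a} → a ∈ box m p → ∀ n (1≤n : 1 ℕ.≤ n) qs → Unique qs → All (λ q → Prime q × z₀ ℕ.< q) qs →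
      Π[ (λ q → Q.1# Q.+ fromℕ (length (roots p q (+ b′ a))) Q.* ζ-weight (Ratio.ρ n 1≤n) q) ] qs Q.≤ fromℕ (At.C a) Q.* fromℕ n
    upper {a} a∈ n 1≤n qs uqs ok = At.U.upper-bound-at a (λ q → roots p q (+ b′ a)) qs uqs (All.map proj₁ ok) lists (Ratio.ρ n 1≤n) n (Ratio.ρ≤1 n 1≤n) (Ratio.geometric n 1≤n)
      where
      lists : At.U.RootLists a (λ q → roots p q (+ b′ a)) qs
      lists {q} q∈ = Unique.filter⁺ (λ t → q ∣ᶻ? (+ t) ^ p - + b′ a) (Unique.upTo⁺ q) , λ {t} t∈ →
        let (t∈′ , root) = ∈-filter⁻ (λ t → q ∣ᶻ? (+ t) ^ p - + b′ a) {xs = upTo q} t∈ ; (pq , z₀<q) = All.lookup ok q∈ in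
        ∈-upTo⁻ t∈′ , λ x h → At.Ei.valid a t pq (b′-unit pq z₀<q a∈) root x h

    P : ℕ → Set
    P q = Σ (Prime q) λ pq → AtPrime.Split pq cs

    P? : ∀ q → Dec (P q)
    P? q with prime? q
    ... | no n = no λ (pq , _) → n pq
    ... | yes pq with AtPrime.split? pq cs
    ...   | yes s = yes (pq , s)
    ...   | no n = no λ (_ , s) → n s

    indicator-mono : {A B : Set} (d : Dec A) (e : Dec B) → (A → B) → indicator d Q.≤ indicator e
    indicator-mono (no _) e f = Q.0≤ _
    indicator-mono (yes a) (yes _) f = Q.≤-refl
    indicator-mono (yes a) (no n) f = contradiction (f a) n

    pointwise-bound : ∀ {q} → Prime q → z₀ ℕ.< q →
      fromℕ (length (box m p)) Q.+ indicator (P? q) Q.≤ Σ[ (λ a → fromℕ (length (roots p q (+ b′ a)))) ] (box m p)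
    pointwise-bound {q} pq z₀<q = Q.≤-trans (Q.+-mono-≤ Q.≤-refl (indicator-mono (P? q) (AtPrime.split? pq cs) proj₂))
      (AtPrime.pointwise pq cs (p<q pq z₀<q) (cs-unit pq z₀<q) (L-unit pq z₀<q (here refl)) (propagate pq z₀<q) b′ λ {a} a∈ →
        b′-unit pq z₀<q a∈ , λ h → transfer (red a) pp pq (l-unit pq z₀<q a∈)
          (subst (λ b → PowerResidues.Power p pp pq (+ b)) (sym (proj₂ (proj₂ (reduced a)) (all-lookup a λ i → ∈-box⁻ a∈ i))) h))

    open Comparison (box m p) (λ a q → length (roots p q (+ b′ a))) z₀ At.C upper P P? pointwise-bound using (C₁; W; bounded-reciprocals) renaming (c to excess)

    -- A lower bound for the index of proper ideals containing q: only a split q can have residue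
    -- ring of q elements.
    index : (q : ℕ) → Dec (P q) → ℕ
    index q (yes _) = q
    index q (no _) = q ℕ.* q

    E : ℕ → ℕ
    E q = index q (P? q)

    q≤E : ∀ {q} → Prime q → q ℕ.≤ E q
    q≤E {q} pq with P? q
    ... | yes _ = ℕ.≤-refl
    ... | no _ = ℕ.≤-trans (ℕ.≤-reflexive (sym (ℕ.*-identityʳ q))) (ℕ.*-monoʳ-≤ q (prime≥1 pq))

    E-bounded : ∃ λ C → ∀ qs → Unique qs → All (λ q → Prime q × z₀ ℕ.< q) qs → Σ[ inv ∘ E ] qs Q.≤ fromℕ C
    E-bounded = Majorised.bound M , λ qs uqs ok → Q.≤-trans (bound qs uqs ok) (Majorised.below M)
      where
      M : Majorised (fromℕ 2 Q.* C₁ Q.+ fromℕ 2)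
      M = majorised-+ (majorised-* (majorised-ℕ 2) (majorised-* (majorised-* (majorised-Π At.C (box m p))
            (majorised-^ W (majorised-* (majorised-ℕ 8) (majorised-* (majorised-ℕ 2) (majorised-^ (suc z₀) (majorised-ℕ 2)))))) (majorised-^ excess (majorised-ℕ 2)))) (majorised-ℕ 2)
      weight : ∀ q → inv (E q) Q.≤ indicator (P? q) Q.* inv q Q.+ inv-square q
      weight q with P? q
      ... | yes _ = Q.≤-trans (Q.≤-reflexive (sym (Q.*-identityˡ _))) (Q.a≤a+b _ _)
      ... | no _ = Q.b≤a+b _ _
      bound : ∀ qs → Unique qs → All (λ q → Prime q × z₀ ℕ.< q) qs → Σ[ inv ∘ E ] qs Q.≤ fromℕ 2 Q.* C₁ Q.+ fromℕ 2
      bound qs uqs ok = begin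
        Σ[ inv ∘ E ] qs ≤⟨ Q.Σ-mono qs (λ {q} _ → weight q) ⟩
        Σ[ (λ q → indicator (P? q) Q.* inv q Q.+ inv-square q) ] qs ≡⟨ Q.Σ-+ _ _ qs ⟩
        Σ[ (λ q → indicator (P? q) Q.* inv q) ] qs Q.+ Σ[ inv-square ] qs ≤⟨ Q.+-mono-≤
            (Q.≤-trans (Q.≤-reflexive (sym (Q.Σ-filter P? inv qs))) (bounded-reciprocals (filter P? qs) (Unique.filter⁺ P? uqs)
              (All.tabulate λ m → let (m′ , h) = ∈-filter⁻ P? {xs = qs} m in All.lookup ok m′ , h)))
            (Q.≤-trans (Q.b≤a+b Q.1# _) (Q.≤-trans (Q.1+Σ≤Π qs) (Π-1+inv-square≤2 uqs λ m → prime≥2 (proj₁ (All.lookup ok m))))) ⟩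
        fromℕ 2 Q.* C₁ Q.+ fromℕ 2 ∎
        where open Q.≤-Reasoning

    csᶻ : Vec ℤ m
    csᶻ = Vec.map +_ cs

    module Rad = Radical p 2≤p csᶻ

    powers : ∀ {q} (pq : Prime q) {n} (xs : Vec ℕ n) → (∀ i → PowerResidues.Power p pp pq (+ lookup xs i)) → AtPrime.Powers pq xs
    powers pq [] h = VecAll.[]
    powers pq (x ∷ xs) h = h zero VecAll.∷ powers pq xs (h ∘ suc)

    module Quotient (e : Op (suc m)) (nonnull : ¬ Null (act e Rad.ρ)) (F : Frame (act e Rad.ρ)) where
      σ = act e Rad.ρ
      O : Order
      O = toOrder σ F
      module O = Order O

      1≉0 : ¬ (O._≈_ O.1# O.0#)
      1≉0 h = nonnull λ a → trans (sym (ℤ.*-identityˡ (σ a))) (trans (h a) (ℤ.*-zeroˡ (σ a)))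

      open PrimeIdeals O 1≉0

      module _ {q : ℕ} (pq : Prime q) (z₀<q : z₀ ℕ.< q) {I : Op (suc m) → Set} (ideal : IsIdeal I) (q∈I : I (con (+ q))) (proper : ¬ I (con 1ℤ)) where
        open IsIdeal ideal
        open AtPrime pq

        -- An ideal modulo which all generators are integers defines a homomorphism to 𝔽_q.
        value-≡ : ∀ (v : Fin (suc m) → ℤ) → (∀ i → I (var i O.- con (v i))) → ∀ f → I (f O.- con (value v f))
        value-≡ v h (con c) = ≈-closed (λ a → lem c (σ a)) (*-closed (con 0ℤ) q∈I)
          where
          lem : ∀ c s → 0ℤ * (+ q * s) ≡ c * s + -1ℤ * (c * s)
          lem = λ c s → sym (trans (cong (λ w → c * s + w) (ℤ.-1*i≡-i (c * s))) (trans (ℤ.+-inverseʳ (c * s)) (sym (ℤ.*-zeroˡ (+ q * s)))))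
        value-≡ v h (var i) = h i
        value-≡ v h (f ⊕ g) = ≈-closed (λ a → lem (act f σ a) (act g σ a) (value v f) (value v g) (σ a)) (+-closed (value-≡ v h f) (value-≡ v h g))
          where
          lem : ∀ x y b c s → (x + -1ℤ * (b * s)) + (y + -1ℤ * (c * s)) ≡ (x + y) + -1ℤ * ((b + c) * s)
          lem = solve-∀
        value-≡ v h (f ⊗ g) = ≈-closed {f ⊗ g O.- con (value v f) ⊗ con (value v g)} {f ⊗ g O.- con (value v f * value v g)}
            (λ a → cong (λ z → act f (act g σ) a + -1ℤ * z) (sym (ℤ.*-assoc (value v f) (value v g) (σ a))))
          (≈-closed {f ⊗ (g O.- con (value v g)) ⊕ con (value v g) ⊗ (f O.- con (value v f))} {f ⊗ g O.- con (value v f) ⊗ con (value v g)}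
            (O.solve 4 (λ f g b c → f O.:* (g O.:- c) O.:+ c O.:* (f O.:- b) O.:= f O.:* g O.:- b O.:* c) (λ _ → refl) f g (con (value v f)) (con (value v g)))
          (+-closed (*-closed f (value-≡ v h g)) (*-closed (con (value v g)) (value-≡ v h f))))

        value-^ : ∀ (v : Fin (suc m) → ℤ) i j → value v (var i ^ᴼ j) ≡ v i ^ j
        value-^ v i zero = refl
        value-^ v i (suc j) = cong (v i *_) (value-^ v i j)

        value-Φ : ∀ (v : Fin (suc m) → ℤ) j → value v (Rad.Φ j) ≡ geometric-sum j (v zero)
        value-Φ v zero = refl
        value-Φ v (suc j) = cong₂ _+_ (value-Φ v j) (value-^ v zero j)

        -- Under the homomorphism given by v the relations of the ring, the cyclotomic one and x^p =
        -- c, become congruences modulo q.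
        split : ∀ (v : Fin (suc m) → ℤ) → (∀ i → I (var i O.- con (v i))) → Split cs
        split v h = (v zero , ∣ᶻ-≡ (value-Φ v p) (integer-in-ideal ideal pq q∈I proper (value v (Rad.Φ p)) Φ∈)) , powers pq cs (λ i → v (suc i) , root i)
          where
          Φ∈ : I (con (value v (Rad.Φ p)))
          Φ∈ = ≈-closed (λ a → trans (cong (λ x → -1ℤ * (x + -1ℤ * (value v (Rad.Φ p) * σ a))) (Rad.Φ-relation e a)) (lem (value v (Rad.Φ p) * σ a)))
            (*-closed (con -1ℤ) (value-≡ v h (Rad.Φ p)))
            where
            lem : ∀ x → -1ℤ * (0ℤ + -1ℤ * x) ≡ x
            lem = solve-∀
          root : ∀ i → q ∣ᶻ v (suc i) ^ p - + lookup cs i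
          root i = integer-in-ideal ideal pq q∈I proper _ (≈-closed (λ a → trans (cong₂ (λ x y → -1ℤ * (x + -1ℤ * (y * σ a))) (Rad.root-relation e i a) (value-^ v (suc i) p))
              (trans (lem (lookup csᶻ i) (v (suc i) ^ p) (σ a)) (cong (λ c → (v (suc i) ^ p - c) * σ a) (Vec.lookup-map i +_ cs))))
            (*-closed (con -1ℤ) (value-≡ v h (var (suc i) ^ᴼ p))))
            where
            lem : ∀ c x s → -1ℤ * (c * s + -1ℤ * (x * s)) ≡ (x - c) * s
            lem = solve-∀

      -- If q is not split, some generator is not congruent to an integer modulo the ideal, as
      -- otherwise `split` would apply; this generator is the x of `index≥q²`.
      index≥E : ∀ {q} → Prime q → z₀ ℕ.< q → ∀ {I} → IsIdeal I → I (con (+ q)) → ¬ I (con 1ℤ) →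
        ∀ {ξ b} → I ξ → ¬ (ξ O.≈ con 0ℤ) → O.Bounded ξ b → E q ℕ.≤ suc (c ℕ.* b) ℕ.^ O.d
      index≥E {q} pq z₀<q ideal q∈I proper {b = b} ξ∈I ξ≉0 bξ = index≥ (P? q)
        where
        index≥ : (split? : Dec (P q)) → index q split? ℕ.≤ suc (c ℕ.* b) ℕ.^ O.d
        index≥ (yes _) = index≥q ideal pq q∈I proper ξ∈I ξ≉0 bξ
        index≥ (no inert) = decidable-stable (q ℕ.* q ℕ.≤? _) λ small →
          ¬¬-∀Fin (λ i nonint → small (index≥q² ideal pq q∈I proper (var i) (λ a h → nonint (a , h)) ξ∈I ξ≉0 bξ)) λ h →
          inert (pq , split pq z₀<q ideal q∈I proper (proj₁ ∘ h) (proj₂ ∘ h))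

      absurd : ⊥
      absurd = diverges O 1≉0 E z₀ q≤E index≥E (proj₁ E-bounded) (proj₂ E-bounded)

    absurd : ⊥
    absurd = Rad.exists-quotient λ (e , nonnull , F) → Quotient.absurd e nonnull F

  exceptional⇒many-primes : ∀ {p} → Prime p → ∀ L → All Prime L → Unique L → Exceptional (fL p L) → p ℕ.≤ length L
  exceptional⇒many-primes {p} pp L pL uL (_ , _ , N , has-root) = ℕ.≮⇒≥ λ few → impossible L pL uL few has-root
    where
    impossible : ∀ L → All Prime L → Unique L → length L ℕ.< p → ¬ (∀ q → Prime q → N ℕ.≤ q → HasRootMod q (fL p L))
    impossible [] _ _ _ roots = let (q , pq , N≤q) = prime-above N ; (x , h) = roots q pq N≤q in
      ∤1 pq (∣ᶻ-≡ (lem x) (∣ᵤ⇒∣ h))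
      where
      lem : ∀ x → 1ℤ + x * 0ℤ ≡ 1ℤ
      lem = solve-∀
    impossible (l ∷ ls) (pl ∷ pls) (l∉ ∷ uls) few roots = FewPrimes.absurd p pp l ls pl pls l∉ uls few N roots

open import Defs
open import Data.Nat using (ℕ; _≤_)
open import Data.Nat.Primality using (Prime)
open import Data.List using (List; length)
open import Data.List.Relation.Unary.All using (All)
open import Data.List.Relation.Unary.Unique.Propositional using (Unique)
open import Function.Bundles using (_⇔_)

theorem3p7 : (p : ℕ) → (L : List ℕ) → Prime p → All Prime L → Unique L →
    (Exceptional (fL p L) ⇔ p ≤ length L)
theorem3p7 p L pp pL uL = mk⇔ (Necessity.exceptional⇒many-primes pp L pL uL) (Sufficiency.many-primes⇒exceptional pp L pL uL)
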